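{- Let $q$ be a prime power with $q\equiv1\pmod 4$ such that $2$ is a square in $\mathbb F_q$, and let $\mathcal U_3,\mathcal X^+,\Delta^+,\Omega,\mathcal G_1,\mathcal G_2,\mathfrak H$ and the points "of Case (III)" be as in the context. Then the following are equivalent: (a) there exist an $\mathfrak H$-orbit $\mathcal M_1$ on $\mathcal G_1$ and an $\mathfrak H$-orbit $\mathcal M_2$ on $\mathcal G_2$ such that, with $\mathcal M=\mathcal M_1\cup\mathcal M_2$, every point $P$ of Case (III) satisfies Condition (B), i.e. the number of generators of $\mathcal M$ through $P$ equals $\frac12 n_P$; (b) the number $N_q$ of $\mathbb F_q$-rational points (including the point at infinity) of the elliptic curve $Y^2=X^3-X$ equals $q-1$ or $q+3$.
   Context: In $\mathrm{PG}(3,q^2)$ with coordinates $(X_0,X_1,X_2,X_3)$ (points as column vectors, matrices acting by $x\mapsto Ax$), $\mathcal U_3$ is $X_1^{q+1}+2X_2^{q+1}=X_3^qX_0+X_3X_0^q$; a generator is a line of $\mathrm{PG}(3,q^2)$ contained in $\mathcal U_3$. $\mathcal X^+$ is the non-singular model of the plane curve $y^qz-yz^q=x^{(q+1)/2}$ under $(x,y,z)\mapsto(z^2,xz,yz,y^2)$, a degree-$(q+1)$ $\mathbb F_{q^2}$-maximal curve on $\mathcal U_3$. $\pi$ is the plane $X_1=0$, $\Omega=\mathcal X^+\cap\pi=\{(1,0,y,y^2):y\in\mathbb F_q\}\cup\{(0,0,0,1)\}$, $\Delta^+=\mathcal X^+(\mathbb F_{q^2})\setminus\Omega$. $\mathcal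 G_1$ (resp. $\mathcal G_2$) is the set of generators meeting $\Delta^+$ (resp. $\Omega$). $\mathfrak G\le\mathrm{PGU}(4,q)$ is generated by the collineations with matrices $\mathbf T_\alpha=\begin{pmatrix}1&0&0&0\\0&1&0&0\\ \alpha&0&1&0\\ \alpha^2&0&2\alpha&1\end{pmatrix}$ ($\alpha\in\mathbb F_q$), $\mathbf M_\rho=\mathrm{diag}(\rho^{ -1},1,1,\rho)$ ($\rho$ non-zero square in $\mathbb F_q$), $\mathbf L_\lambda=\mathrm{diag}(1,\lambda,1,1)$ ($\lambda^{(q+1)/2}=1$), $\mathbf N_\sigma=\begin{pmatrix}0&0&0&1\\0&\sigma&0&0\\0&0&1&0\\1&0&0&0\end{pmatrix}$ ($\sigma^{(q+1)/2}=-1$), $\mathbf R_\mu=\begin{pmatrix}0&0&0&\mu^{ -1}\\0&1&0&0\\0&0&1&0\\ \mu&0&0&0\end{pmatrix}$ ($\mu$ non-square in $\mathbb F_q$); $\mathfrak H$ is the subgroup of $\mathfrak G$ generated by its elements of $p$-power order ($p$ the characteristic) and the $\mathbf L_\lambda$. Identify $\pi$ with $\mathrm{PG}(2,q^2)$ via $(X_0,X_2,X_3)$; let $\mathcal C$ be the conic $X_0X_3=X_2^2$. The projection of $P\ne(0,1,0,0)$ from $X_\infty=(0,1,0,0)$ onto $\pi$ is $P'=(x_0,x_2,x_3)$. A point $P\in\mathcal U_3$ with coordinates in $\mathbb F_{q^2}$ is of Case (III) if $P'\notin\mathrm{PG}(2,q)$ and $P'$ lies on a line of $\mathrm{PG}(2,q)$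 that is tangent to $\mathcal C$ at a point of $\Omega$. For such $P$ (which is not on $\mathcal X^+$), $n_P$ is the number of generators through $P$ containing a point of $\mathcal X^+(\mathbb F_{q^2})$. -}

module Defs where

open import Level using (0ℓ)
open import Data.Nat using (ℕ; zero; suc; _^_; _/_; _∸_) renaming (_+_ to _+ℕ_; _*_ to _*ℕ_)
open import Data.Fin using (Fin; zero; suc)
open import Data.List using (List; length)
open import Data.List.Membership.Propositional using (_∈_)
open import Data.List.Relation.Unary.All using (All)
open import Data.List.Relation.Unary.Any using (Any)
open import Data.List.Relation.Unary.AllPairs using (AllPairs)
open import Data.List.Relation.Unary.Unique.Propositional using (Unique)
open import Data.Product using (Σ; ∃; ∃-syntax; _×_; _,_)
open import Data.Sum using (_⊎_)
open import Relation.Nullary using (¬_)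
open import Relation.Binary.PropositionalEquality using (_≡_; _≢_)
open import Algebra.Structures using (IsCommutativeRing)

CardUpTo : {X : Set} → (X → X → Set) → (X → Set) → ℕ → Set
CardUpTo {X} _≈_ S n =
  Σ (List X) λ xs → length xs ≡ n × All S xs
    × AllPairs (λ a b → ¬ (a ≈ b)) xs × (∀ x → S x → Any (x ≈_) xs)

record FiniteField : Set₁ where
  field
    Carrier : Set
    _⊕_ _⊗_ : Carrier → Carrier → Carrier
    ⊖_ : Carrier → Carrier
  infixl 6 _⊕_
  infixl 7 _⊗_
  infix 8 ⊖_
  field
    𝟘 𝟙 : Carrier
    inv : Carrier → Carrier
    isCommutativeRing : IsCommutativeRing _≡_ _⊕_ _⊗_ ⊖_ 𝟘 𝟙
    𝟘≢𝟙 : 𝟘 ≢ 𝟙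
    inverseʳ : ∀ x → x ≢ 𝟘 → x ⊗ inv x ≡ 𝟙
    elements : List Carrier
    complete : ∀ x → x ∈ elements
    unique : Unique elements

-- Everything below is relative to a finite field F (playing the role of
-- F_{q^2}), a natural number q (conjugation x ↦ x^q, F_q = fixed field)
-- and the characteristic p.

module Geometry (F : FiniteField) (p q : ℕ) where
  open FiniteField F renaming (Carrier to A)

  pow : A → ℕ → A
  pow x zero = 𝟙
  pow x (suc n) = x ⊗ pow x n

  conj : A → A
  conj x = pow x q

  InFq : A → Set
  InFq x = conj x ≡ x

  𝟚 : A
  𝟚 = 𝟙 ⊕ 𝟙

  h : ℕ
  h = (q +ℕ 1) / 2

  V : Set
  V = Fin 4 → A

  Mat : Set
  Mat = Fin 4 → Fin 4 → A

  v4 : A → A → A → A → V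
  v4 a b c d zero = a
  v4 a b c d (suc zero) = b
  v4 a b c d (suc (suc zero)) = c
  v4 a b c d (suc (suc (suc zero))) = d

  rows : V → V → V → V → Mat
  rows r0 r1 r2 r3 i j = v4 (r0 j) (r1 j) (r2 j) (r3 j) i

  sum4 : V → A
  sum4 f = f zero ⊕ f (suc zero) ⊕ f (suc (suc zero)) ⊕ f (suc (suc (suc zero)))

  apply : Mat → V → V
  apply M v i = sum4 (λ j → M i j ⊗ v j)

  _·_ : Mat → Mat → Mat
  (M · N) i j = sum4 (λ k → M i k ⊗ N k j)

  I : Mat
  I = rows (v4 𝟙 𝟘 𝟘 𝟘) (v4 𝟘 𝟙 𝟘 𝟘) (v4 𝟘 𝟘 𝟙 𝟘) (v4 𝟘 𝟘 𝟘 𝟙)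

  mpow : Mat → ℕ → Mat
  mpow M zero = I
  mpow M (suc n) = M · mpow M n

  -- Projective points: nonzero vectors up to a nonzero scalar.
  -- "v represents the same point as w":  v = c w with c ≠ 0.

  _∼_ : V → V → Set
  v ∼ w = Σ A λ c → c ≢ 𝟘 × (∀ i → v i ≡ c ⊗ w i)

  NonZero : V → Set
  NonZero v = ¬ (∀ i → v i ≡ 𝟘)

  X0 X1 X2 X3 : V → A
  X0 v = v zero
  X1 v = v (suc zero)
  X2 v = v (suc (suc zero))
  X3 v = v (suc (suc (suc zero)))

  U3 : V → Set
  U3 v = pow (X1 v) (q +ℕ 1) ⊕ 𝟚 ⊗ pow (X2 v) (q +ℕ 1)
         ≡ pow (X3 v) q ⊗ X0 v ⊕ X3 v ⊗ pow (X0 v) q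

  -- F_{q^2}-rational points of X⁺: images (1,x,y,y^2) of the affine points
  -- of y^q - y = x^{(q+1)/2}, together with the image (0,0,0,1) of the
  -- unique point at infinity.
  XPlus : V → Set
  XPlus v = (Σ A λ x → Σ A λ y → (pow y q ⊕ ⊖ y ≡ pow x h)
               × v ∼ v4 𝟙 x y (y ⊗ y))
            ⊎ v ∼ v4 𝟘 𝟘 𝟘 𝟙

  -- Ω = X⁺ ∩ π
  Ω : V → Set
  Ω v = (Σ A λ y → InFq y × v ∼ v4 𝟙 𝟘 y (y ⊗ y)) ⊎ v ∼ v4 𝟘 𝟘 𝟘 𝟙

  Δ⁺ : V → Set
  Δ⁺ v = XPlus v × ¬ Ω v

  record Line : Set where
    constructor line
    field
      u w : V

  Independent : Line → Set
  Independent (line u w) = ∀ a b → (∀ i → a ⊗ u i ⊕ b ⊗ w i ≡ 𝟘) → (a ≡ 𝟘 × b ≡ 𝟘)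

  OnLine : V → Line → Set
  OnLine v (line u w) = Σ A λ a → Σ A λ b → ∀ i → v i ≡ a ⊗ u i ⊕ b ⊗ w i

  _≈L_ : Line → Line → Set
  ℓ ≈L m = (OnLine (Line.u ℓ) m × OnLine (Line.w ℓ) m)
         × (OnLine (Line.u m) ℓ × OnLine (Line.w m) ℓ)

  Generator : Line → Set
  Generator ℓ = Independent ℓ × (∀ v → OnLine v ℓ → U3 v)

  Contains : (V → Set) → Line → Set
  Contains S ℓ = Σ V λ v → S v × OnLine v ℓ

  𝒢₁ 𝒢₂ : Line → Set
  𝒢₁ ℓ = Generator ℓ × Contains Δ⁺ ℓ
  𝒢₂ ℓ = Generator ℓ × Contains Ω ℓ

  𝐓 : A → Mat
  𝐓 α = rows (v4 𝟙 𝟘 𝟘 𝟘) (v4 𝟘 𝟙 𝟘 𝟘) (v4 α 𝟘 𝟙 𝟘) (v4 (α ⊗ α) 𝟘 (𝟚 ⊗ α) 𝟙)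

  𝐌 : A → Mat
  𝐌 ρ = rows (v4 (inv ρ) 𝟘 𝟘 𝟘) (v4 𝟘 𝟙 𝟘 𝟘) (v4 𝟘 𝟘 𝟙 𝟘) (v4 𝟘 𝟘 𝟘 ρ)

  𝐋 : A → Mat
  𝐋 λ' = rows (v4 𝟙 𝟘 𝟘 𝟘) (v4 𝟘 λ' 𝟘 𝟘) (v4 𝟘 𝟘 𝟙 𝟘) (v4 𝟘 𝟘 𝟘 𝟙)

  𝐍 : A → Mat
  𝐍 σ = rows (v4 𝟘 𝟘 𝟘 𝟙) (v4 𝟘 σ 𝟘 𝟘) (v4 𝟘 𝟘 𝟙 𝟘) (v4 𝟙 𝟘 𝟘 𝟘)

  𝐑 : A → Mat
  𝐑 μ = rows (v4 𝟘 𝟘 𝟘 (inv μ)) (v4 𝟘 𝟙 𝟘 𝟘) (v4 𝟘 𝟘 𝟙 𝟘) (v4 μ 𝟘 𝟘 𝟘)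

  SquareInFq : A → Set
  SquareInFq x = Σ A λ s → InFq s × x ≡ s ⊗ s

  data GenG : Mat → Set where
    genT : ∀ α → InFq α → GenG (𝐓 α)
    genM : ∀ ρ → InFq ρ → ρ ≢ 𝟘 → SquareInFq ρ → GenG (𝐌 ρ)
    genL : ∀ λ' → pow λ' h ≡ 𝟙 → GenG (𝐋 λ')
    genN : ∀ σ → pow σ h ≡ ⊖ 𝟙 → GenG (𝐍 σ)
    genR : ∀ μ → InFq μ → ¬ SquareInFq μ → GenG (𝐑 μ)

  -- matrices representing elements of 𝔊: finite products of generators
  -- (the generating set is closed under inverses, so this is the group)
  data In𝔊 : Mat → Set where
    one : In𝔊 I
    step : ∀ {g M} → GenG g → In𝔊 M → In𝔊 (g · M)

  _≈P_ : Mat → Mat → Set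
  M ≈P N = Σ A λ c → c ≢ 𝟘 × (∀ i j → M i j ≡ c ⊗ N i j)

  pPowerOrder : Mat → Set
  pPowerOrder M = Σ ℕ λ k → mpow M (p ^ k) ≈P I

  data Gen𝔥 : Mat → Set where
    fromP : ∀ {M} → In𝔊 M → pPowerOrder M → Gen𝔥 M
    fromL : ∀ λ' → pow λ' h ≡ 𝟙 → Gen𝔥 (𝐋 λ')

  -- matrices representing elements of 𝔥 (finite products of its
  -- generators; closed under inverses since 𝔊 is finite)
  data In𝔥 : Mat → Set where
    one : In𝔥 I
    step : ∀ {g M} → Gen𝔥 g → In𝔥 M → In𝔥 (g · M)

  actL : Mat → Line → Line
  actL M (line u w) = line (apply M u) (apply M w)

  Orbit𝔥 : Line → Line → Set
  Orbit𝔥 ℓ₀ ℓ = Σ Mat λ M → In𝔥 M × ℓ ≈L actL M ℓ₀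

  proj : V → (Fin 3 → A)
  proj v zero = X0 v
  proj v (suc zero) = X2 v
  proj v (suc (suc zero)) = X3 v

  InPG2q : (Fin 3 → A) → Set
  InPG2q x = Σ A λ c → c ≢ 𝟘 × (∀ i → InFq (c ⊗ x i))

  -- Ω as a subset of π in coordinates (X0,X2,X3)
  Ωπ : (Fin 3 → A) → Set
  Ωπ x = Σ A λ c → c ≢ 𝟘 × (Σ A λ y → InFq y × x zero ≡ c ⊗ 𝟙
                                 × x (suc zero) ≡ c ⊗ y × x (suc (suc zero)) ≡ c ⊗ (y ⊗ y))
       ⊎ Σ A λ c → c ≢ 𝟘 × (x zero ≡ 𝟘 × x (suc zero) ≡ 𝟘 × x (suc (suc zero)) ≡ c)

  -- the tangent line to C : X0 X3 = X2^2 at the point Q ∈ C is the line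
  -- Q3 X0 - 2 Q2 X2 + Q0 X3 = 0 (given by the gradient of the form at Q)
  OnTangentAt : (Fin 3 → A) → (Fin 3 → A) → Set
  OnTangentAt Q x = Q (suc (suc zero)) ⊗ x zero ⊕ ⊖ (𝟚 ⊗ Q (suc zero) ⊗ x (suc zero))
                    ⊕ Q zero ⊗ x (suc (suc zero)) ≡ 𝟘

  CaseIII : V → Set
  CaseIII P = NonZero P × U3 P × ¬ InPG2q (proj P)
              × (Σ (Fin 3 → A) λ Q → Ωπ Q × OnTangentAt Q (proj P))

  GensThroughPMeetingX : V → Line → Set
  GensThroughPMeetingX P ℓ = Generator ℓ × OnLine P ℓ × Contains XPlus ℓ

  ConditionB : (Line → Set) → V → Set
  ConditionB 𝓜 P = Σ ℕ λ m →
      CardUpTo _≈L_ (λ ℓ → 𝓜 ℓ × Generator ℓ × OnLine P ℓ) m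
    × CardUpTo _≈L_ (GensThroughPMeetingX P) (2 *ℕ m)

  StatementA : Set
  StatementA = Σ Line λ ℓ₁ → Σ Line λ ℓ₂ → 𝒢₁ ℓ₁ × 𝒢₂ ℓ₂ ×
    (∀ P → CaseIII P → ConditionB (λ ℓ → Orbit𝔥 ℓ₁ ℓ ⊎ Orbit𝔥 ℓ₂ ℓ) P)

  EllAff : A × A → Set
  EllAff (x , y) = InFq x × InFq y × y ⊗ y ≡ x ⊗ x ⊗ x ⊕ ⊖ x

  StatementB : Set
  StatementB = Σ ℕ λ n → CardUpTo _≡_ EllAff n
    × ((n +ℕ 1 ≡ q ∸ 1) ⊎ (n +ℕ 1 ≡ q +ℕ 3))

{-# OPTIONS --safe #-}
-- A generator through (1,x,y,y²) ∈ Δ⁺ is projected from X_∞ onto a line meeting the conic C again at a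
-- point of parameter z, and t = (z - y)/(z - y^q) always has norm 2.  Hence
-- s = t^((q+1)/2) (y^q - y)^((q-1)/2) is a square root of -2, and an element of 𝔊 inducing y ↦ (Ay+B)/(Cy+D)
-- multiplies s by the quadratic character of AD - BC.  There is a similar invariant on 𝒢₂.  Elements of
-- p-power order cannot change these signs, and SL(2,q) together with the L_λ acts transitively on the
-- generators of a given sign, so each of 𝒢₁, 𝒢₂ splits into two 𝔥-orbits, told apart by s.
--
-- An element of 𝔥 moves a point of Case (III) to P = (0,a,1,b) with a^(q+1) = -2 and b ∉ F_q.  One
-- generator of 𝒢₂ passes through P; those of 𝒢₁ through P are parametrised by the φ with φ^((q+1)/2) = -1,
-- and the sign of the generator belonging to φ is -a^((q+1)/2) ψ(φ + φ^q), with ψ the quadratic character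
-- of F_q.  So Condition (B) holds, for a suitable choice of orbits, at one point of Case (III) or at all of
-- them exactly when ∑ ψ(φ + φ^q) = ±1.  Counting the φ with a given trace T shows that this sum equals
-- -½ ∑ ψ(T³ - 4T) = -½ ∑ ψ(x³ - x) = (q + 1 - N_q)/2.

module Submission where

open import Defs
open import Algebra.Bundles using (CommutativeRing; RawRing)
open import Data.Empty using (⊥; ⊥-elim)
open import Data.Fin using (Fin; zero; suc; toℕ; fromℕ; inject₁)
import Data.Fin.Properties as Fin
open import Data.Integer as ℤ using (ℤ; +_; -[1+_])
import Data.Integer.Properties as ℤ
open import Data.Integer.Tactic.RingSolver using (solve-∀)
open import Data.List using (List; []; _∷_; _++_; map; foldr; length; filter; lookup; cartesianProduct)
open import Data.List.Membership.Propositional using (_∈_; find; lose)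
open import Data.List.Membership.Propositional.Properties using (∈-map⁺; ∈-map⁻; ∈-filter⁺; ∈-filter⁻; ∈-∃++; ∈-cartesianProduct⁺; ∈-cartesianProduct⁻)
open import Data.List.Membership.Propositional.Properties.WithK using (unique∧set⇒bag)
open import Data.List.Properties using (length-map)
open import Data.List.Relation.Binary.BagAndSetEquality using (∼bag⇒↭)
open import Data.List.Relation.Binary.Permutation.Propositional as Perm using (_↭_; ↭-sym; ↭-trans)
open import Data.List.Relation.Binary.Permutation.Propositional.Properties using (shift; ↭-length; drop-∷; map⁺)
import Data.List.Relation.Binary.Permutation.Setoid.Properties as PermSetoid
open import Data.List.Relation.Unary.All as All using (All; []; _∷_)
import Data.List.Relation.Unary.All.Properties as All
open import Data.List.Relation.Unary.AllPairs using (AllPairs; []; _∷_)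
open import Data.List.Relation.Unary.Any as Any using (Any; here; there; index; any?)
import Data.List.Relation.Unary.Any.Properties as Any
open import Data.List.Relation.Unary.Unique.Propositional using (Unique)
open import Data.List.Relation.Unary.Unique.Propositional.Properties using () renaming (filter⁺ to filter-unique; cartesianProduct⁺ to cartesianProduct-unique)
import Data.Maybe as Maybe
open import Data.Nat as ℕ using (ℕ; zero; suc; _^_; _*_; _%_; _≤_; z≤n; s≤s)
import Data.Nat.DivMod as ℕ
import Data.Nat.Properties as ℕ
open import Data.Nat.Combinatorics using (nC1≡n; nCn≡1; nCk+nC[k+1]≡[n+1]C[k+1]) renaming (_C_ to _choose_)
open import Data.Nat.Divisibility using (_∣_; divides; ∣⇒≤)
open import Data.Nat.Primality using (Prime; euclidsLemma; prime⇒nonZero; prime⇒nonTrivial)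
open import Data.Nat.Tactic.RingSolver using () renaming (solve-∀ to solve-∀ℕ)
open import Data.Product using (Σ; _×_; _,_; proj₁; proj₂)
open import Data.Sum using (_⊎_; inj₁; inj₂; [_,_]′)
open import Data.Unit using (⊤; tt)
open import Data.Vec as Vec using (Vec; []; _∷_)
open import Data.Vec.N-ary using (N-ary; _$ⁿ_)
open import Function using (_∘_)
open import Function.Bundles using (_⇔_; mk⇔)
open import Relation.Binary.Definitions using (tri<; tri≈; tri>)
open import Relation.Binary.PropositionalEquality using (_≡_; _≢_; refl; sym; trans; cong; cong₂; subst; subst₂; setoid; module ≡-Reasoning)
open import Relation.Nullary using (¬_; Dec; yes; no)
open import Relation.Nullary.Decidable using (dec⇒maybe)
open import Relation.Unary using (Decidable)

-- Signs enter because 2h = q + 1 for h = (q+1)/2, so an h-th power is a square root of a norm. As q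
-- ≡ 1 mod 4, h is odd: negating `a` then negates a^h, -1 is a square, and F_q contains ι with ι² =
-- -1. That 2 is a square makes ι a square as well. The group 𝔥 is given through all elements of
-- p-power order of 𝔊. So its orbits are bounded from above by invariants that any such element must
-- fix, and filled from below by explicit unipotent matrices. The parameter φ arises as follows. The
-- points of the curve orthogonal to P = (0,a,1,b) correspond to x, and in the coordinate U = a^q x
-- / (b - b^q) the curve equation reads 1 + U + U^q = -κ′ U^h with κ′² = 2. Its square is a conic in
-- U and U^q, rationalised by U = (η - 1)²/(2η) with η of norm ι; the lost square root prescribes
-- η^h. Since h is odd, η² and η^h determine η, and φ = ι η² is the only parameter left. The point P
-- enters the sign only through a^((q+1)/2), which is why one numerical criterion serves all points
-- of Case (III).

-- Lists without repetition and integer-valued sums over them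

module _ {B C : Set} {g : B → C} where

  map-unique : ∀ {xs} → (∀ {x y} → x ∈ xs → y ∈ xs → g x ≡ g y → x ≡ y) → Unique xs → Unique (map g xs)
  map-unique {[]} inj [] = []
  map-unique {x ∷ xs} inj (x∉ ∷ u) =
    All.map⁺ (All.tabulate λ y∈ e → All.lookup x∉ y∈ (inj (here refl) (there y∈) e))
    ∷ map-unique (λ a b → inj (there a) (there b)) u

  -- Two repetition-free lists with the same members are permutations of each other. The maps need
  -- to be inverse only on members, so partial changes of variables are allowed.
  bijection⇒↭ : ∀ {xs ys} → Unique xs → Unique ys → (g′ : C → B) →
    (∀ {x} → x ∈ xs → g x ∈ ys × g′ (g x) ≡ x) → (∀ {y} → y ∈ ys → g′ y ∈ xs × g (g′ y) ≡ y) → map g xs ↭ ys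
  bijection⇒↭ {xs} {ys} ux uy g′ to from = ∼bag⇒↭ (unique∧set⇒bag
    (map-unique (λ a b e → trans (sym (proj₂ (to a))) (trans (cong g′ e) (proj₂ (to b)))) ux) uy
    (mk⇔ (λ y∈ → let (x , x∈ , e) = ∈-map⁻ g y∈ in subst (_∈ ys) (sym e) (proj₁ (to x∈)))
         (λ y∈ → subst (_∈ map g xs) (proj₂ (from y∈)) (∈-map⁺ g (proj₁ (from y∈))))))

  bijection⇒length : ∀ {xs ys} → Unique xs → Unique ys → (g′ : C → B) →
    (∀ {x} → x ∈ xs → g x ∈ ys × g′ (g x) ≡ x) → (∀ {y} → y ∈ ys → g′ y ∈ xs × g (g′ y) ≡ y) → length xs ≡ length ys
  bijection⇒length {xs} ux uy g′ to from = trans (sym (length-map g xs)) (↭-length (bijection⇒↭ ux uy g′ to from))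

∑ : {B : Set} → List B → (B → ℤ) → ℤ
∑ [] f = + 0
∑ (x ∷ xs) f = f x ℤ.+ ∑ xs f

indicator : {P : Set} → Dec P → ℤ
indicator (yes _) = + 1
indicator (no _) = + 0

indicator-yes : ∀ {P : Set} (d : Dec P) → P → indicator d ≡ + 1
indicator-yes (yes _) _ = refl
indicator-yes (no n) x = ⊥-elim (n x)

indicator-no : ∀ {P : Set} (d : Dec P) → ¬ P → indicator d ≡ + 0
indicator-no (yes x) n = ⊥-elim (n x)
indicator-no (no _) _ = refl

module _ {B : Set} where

  ∑-cong : ∀ {f g : B → ℤ} xs → (∀ {x} → x ∈ xs → f x ≡ g x) → ∑ xs f ≡ ∑ xs g
  ∑-cong [] e = refl
  ∑-cong (x ∷ xs) e = cong₂ ℤ._+_ (e (here refl)) (∑-cong xs (e ∘ there))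

  ∑-+ : ∀ (f g : B → ℤ) xs → ∑ xs (λ x → f x ℤ.+ g x) ≡ ∑ xs f ℤ.+ ∑ xs g
  ∑-+ f g [] = refl
  ∑-+ f g (x ∷ xs) rewrite ∑-+ f g xs = lemma (f x) (g x) (∑ xs f) (∑ xs g)
    where
    lemma : ∀ a b c d → (a ℤ.+ b) ℤ.+ (c ℤ.+ d) ≡ (a ℤ.+ c) ℤ.+ (b ℤ.+ d)
    lemma = solve-∀

  ∑-* : ∀ c (f : B → ℤ) xs → ∑ xs (λ x → c ℤ.* f x) ≡ c ℤ.* ∑ xs f
  ∑-* c f [] = sym (ℤ.*-zeroʳ c)
  ∑-* c f (x ∷ xs) rewrite ∑-* c f xs = sym (ℤ.*-distribˡ-+ c (f x) (∑ xs f))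

  ∑-one : ∀ (xs : List B) → ∑ xs (λ _ → + 1) ≡ + length xs
  ∑-one [] = refl
  ∑-one (x ∷ xs) rewrite ∑-one xs = refl

  ∑-zero : ∀ {f : B → ℤ} xs → (∀ {x} → x ∈ xs → f x ≡ + 0) → ∑ xs f ≡ + 0
  ∑-zero [] e = refl
  ∑-zero (x ∷ xs) e rewrite e (here refl) | ∑-zero xs (e ∘ there) = refl

  ∑-↭ : ∀ (f : B → ℤ) {xs ys} → xs ↭ ys → ∑ xs f ≡ ∑ ys f
  ∑-↭ f Perm.refl = refl
  ∑-↭ f (Perm.prep x p) = cong (λ z → f x ℤ.+ z) (∑-↭ f p)
  ∑-↭ f (Perm.swap {ys = ys} x y p) rewrite ∑-↭ f p = lemma (f x) (f y) (∑ ys f)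
    where
    lemma : ∀ a b c → a ℤ.+ (b ℤ.+ c) ≡ b ℤ.+ (a ℤ.+ c)
    lemma = solve-∀
  ∑-↭ f (Perm.trans p q) = trans (∑-↭ f p) (∑-↭ f q)

  ∑-filter : ∀ {P : B → Set} (P? : Decidable P) (f : B → ℤ) xs →
    ∑ (filter P? xs) f ≡ ∑ xs (λ x → indicator (P? x) ℤ.* f x)
  ∑-filter P? f [] = refl
  ∑-filter P? f (x ∷ xs) with P? x
  ... | yes _ = cong₂ ℤ._+_ (sym (ℤ.*-identityˡ (f x))) (∑-filter P? f xs)
  ... | no _ = trans (∑-filter P? f xs) (sym (ℤ.+-identityˡ _))

  length-filter : ∀ {P : B → Set} (P? : Decidable P) xs → + length (filter P? xs) ≡ ∑ xs (λ x → indicator (P? x))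
  length-filter P? xs = trans (sym (∑-one (filter P? xs)))
    (trans (∑-filter P? (λ _ → + 1) xs) (∑-cong xs (λ _ → ℤ.*-identityʳ _)))

  ∑-single : ∀ {f : B → ℤ} {xs y} → Unique xs → y ∈ xs → (∀ {x} → x ∈ xs → x ≢ y → f x ≡ + 0) → ∑ xs f ≡ f y
  ∑-single {f} {x ∷ xs} (x∉ ∷ u) (here refl) z =
    trans (cong (λ z → f x ℤ.+ z) (∑-zero xs (λ y∈ → z (there y∈) (λ e → All.lookup x∉ y∈ (sym e))))) (ℤ.+-identityʳ (f x))
  ∑-single {f} {x ∷ xs} (x∉ ∷ u) (there y∈) z =
    trans (cong₂ ℤ._+_ (z (here refl) (λ e → All.lookup x∉ y∈ e)) (∑-single u y∈ (z ∘ there))) (ℤ.+-identityˡ _)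

  ∑-mono : ∀ {f g : B → ℤ} xs → (∀ {x} → x ∈ xs → f x ℤ.≤ g x) → ∑ xs f ℤ.≤ ∑ xs g
  ∑-mono [] le = ℤ.≤-refl
  ∑-mono (x ∷ xs) le = ℤ.+-mono-≤ (le (here refl)) (∑-mono xs (le ∘ there))

  -- Turns upper bounds for individual fibres together with one global count into exact values; a
  -- single strict inequality would make the totals differ.
  ∑-tight : ∀ {f g : B → ℤ} xs → (∀ {x} → x ∈ xs → f x ℤ.≤ g x) → ∑ xs f ≡ ∑ xs g → ∀ {x} → x ∈ xs → f x ≡ g x
  ∑-tight {f} {g} (x ∷ xs) le e (here refl) with f x ℤ.≟ g x
  ... | yes eq = eq
  ... | no ne = ⊥-elim (ℤ.<-irrefl e (ℤ.+-mono-<-≤ (ℤ.≤∧≢⇒< (le (here refl)) ne) (∑-mono xs (le ∘ there))))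
  ∑-tight {f} {g} (x ∷ xs) le e (there y∈) with ∑ xs f ℤ.≟ ∑ xs g
  ... | yes eq = ∑-tight xs (le ∘ there) eq y∈
  ... | no ne = ⊥-elim (ℤ.<-irrefl e (ℤ.+-mono-≤-< (le (here refl)) (ℤ.≤∧≢⇒< (∑-mono xs (le ∘ there)) ne)))

∑-map : ∀ {B C : Set} (g : B → C) (f : C → ℤ) xs → ∑ (map g xs) f ≡ ∑ xs (f ∘ g)
∑-map g f [] = refl
∑-map g f (x ∷ xs) = cong (λ z → f (g x) ℤ.+ z) (∑-map g f xs)

∑-bijection : ∀ {B C : Set} {g : B → C} {xs ys} → Unique xs → Unique ys → (g′ : C → B) →
  (∀ {x} → x ∈ xs → g x ∈ ys × g′ (g x) ≡ x) → (∀ {y} → y ∈ ys → g′ y ∈ xs × g (g′ y) ≡ y) →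
  ∀ f → ∑ xs (f ∘ g) ≡ ∑ ys f
∑-bijection {g = g} {xs} ux uy g′ to from f =
  trans (sym (∑-map g f xs)) (∑-↭ f (bijection⇒↭ ux uy g′ to from))

∑-swap : ∀ {B C : Set} (f : B → C → ℤ) xs ys → ∑ xs (λ x → ∑ ys (f x)) ≡ ∑ ys (λ y → ∑ xs (λ x → f x y))
∑-swap f [] ys = sym (∑-zero ys (λ _ → refl))
∑-swap f (x ∷ xs) ys = trans (cong (λ z → ∑ ys (f x) ℤ.+ z) (∑-swap f xs ys)) (sym (∑-+ (f x) (λ y → ∑ xs (λ x → f x y)) ys))

∑-++ : ∀ {B : Set} (f : B → ℤ) xs ys → ∑ (xs ++ ys) f ≡ ∑ xs f ℤ.+ ∑ ys f
∑-++ f [] ys = sym (ℤ.+-identityˡ _)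
∑-++ f (x ∷ xs) ys = trans (cong (λ z → f x ℤ.+ z) (∑-++ f xs ys)) (sym (ℤ.+-assoc (f x) _ _))

∑-cartesianProduct : ∀ {B C : Set} (f : B × C → ℤ) xs ys → ∑ (cartesianProduct xs ys) f ≡ ∑ xs (λ x → ∑ ys (λ y → f (x , y)))
∑-cartesianProduct f [] ys = refl
∑-cartesianProduct f (x ∷ xs) ys = trans (∑-++ f (map (x ,_) ys) _)
  (cong₂ ℤ._+_ (∑-map (x ,_) f ys) (∑-cartesianProduct f xs ys))

unique-resp-↭ : {B : Set} {xs ys : List B} → xs ↭ ys → Unique xs → Unique ys
unique-resp-↭ {B} p = PermSetoid.Unique-resp-↭ (setoid B) (Perm.↭⇒↭ₛ p)

-- Binomial coefficients modulo a prime

-- Pascal's rule on both sides carries the induction. The identity exhibits the upper index as a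
-- factor, so that Euclid's lemma applies when that index is prime.
absorption : ∀ n k → suc k ℕ.* (suc n choose suc k) ≡ suc n ℕ.* (n choose k)
absorption zero zero = refl
absorption zero (suc k) = ℕ.*-zeroʳ (suc (suc k))
absorption (suc n) zero = trans (ℕ.*-identityˡ _) (trans (nC1≡n (suc (suc n))) (sym (ℕ.*-identityʳ _)))
absorption (suc n) (suc k) = begin
  suc (suc k) ℕ.* (suc (suc n) choose suc (suc k))
    ≡⟨ cong (suc (suc k) ℕ.*_) (sym (nCk+nC[k+1]≡[n+1]C[k+1] (suc n) (suc k))) ⟩
  suc (suc k) ℕ.* ((suc n choose suc k) ℕ.+ (suc n choose suc (suc k)))
    ≡⟨ split k (suc n choose suc k) (suc n choose suc (suc k)) ⟩
  (suc n choose suc k) ℕ.+ (suc k ℕ.* (suc n choose suc k) ℕ.+ suc (suc k) ℕ.* (suc n choose suc (suc k)))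
    ≡⟨ cong₂ (λ a b → (suc n choose suc k) ℕ.+ (a ℕ.+ b)) (absorption n k) (absorption n (suc k)) ⟩
  (suc n choose suc k) ℕ.+ (suc n ℕ.* (n choose k) ℕ.+ suc n ℕ.* (n choose suc k))
    ≡⟨ cong ((suc n choose suc k) ℕ.+_) (sym (ℕ.*-distribˡ-+ (suc n) (n choose k) (n choose suc k))) ⟩
  (suc n choose suc k) ℕ.+ suc n ℕ.* ((n choose k) ℕ.+ (n choose suc k))
    ≡⟨ cong (λ z → (suc n choose suc k) ℕ.+ suc n ℕ.* z) (nCk+nC[k+1]≡[n+1]C[k+1] n k) ⟩
  suc (suc n) ℕ.* (suc n choose suc k) ∎
  where
  open ≡-Reasoning
  split : ∀ k a b → suc (suc k) ℕ.* (a ℕ.+ b) ≡ a ℕ.+ (suc k ℕ.* a ℕ.+ suc (suc k) ℕ.* b)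
  split = solve-∀ℕ

-- By `absorption` the prime divides k times the binomial coefficient, and it is too large to divide
-- k.
prime∣binomial : ∀ {p k} → Prime p → 0 ℕ.< k → k ℕ.< p → p ∣ p choose k
prime∣binomial {suc p} {suc k} pr _ k<p with euclidsLemma (suc k) (suc p choose suc k) pr
    (divides (p choose k) (trans (absorption p k) (ℕ.*-comm (suc p) (p choose k))))
... | inj₁ d = ⊥-elim (ℕ.<⇒≱ k<p (∣⇒≤ d))
... | inj₂ d = d

-- Counting by cases and counting up to a relation

length-partition : ∀ {B : Set} {P R : B → Set} (P? : Decidable P) (R? : Decidable R) xs → (∀ {x} → x ∈ xs → P x ⊎ R x) → (∀ {x} → P x → R x → ⊥) →
  length xs ≡ length (filter P? xs) ℕ.+ length (filter R? xs)
length-partition P? R? [] either both = refl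
length-partition P? R? (x ∷ xs) either both with P? x | R? x
... | yes a | yes b = ⊥-elim (both a b)
... | yes a | no b = cong suc (length-partition P? R? xs (λ m → either (there m)) both)
... | no a | yes b = trans (cong suc (length-partition P? R? xs (λ m → either (there m)) both)) (sym (ℕ.+-suc _ _))
... | no a | no b = ⊥-elim ([ a , b ]′ (either (here refl)))

module _ {B : Set} {_≈_ : B → B → Set} (join : ∀ {x x′ y} → x ≈ y → x′ ≈ y → x ≈ x′) where

  private
    remove : ∀ {P : B → Set} {ys} → Any P ys → List B
    remove {ys = y ∷ ys} (here _) = ys
    remove {ys = y ∷ ys} (there p) = y ∷ remove p

    length-remove : ∀ {P : B → Set} {ys} (p : Any P ys) → length ys ≡ suc (length (remove p))
    length-remove (here _) = refl
    length-remove (there p) = cong suc (length-remove p)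

    any-remove : ∀ {P R : B → Set} {ys} → (∀ {y} → P y → R y → ⊥) → (p : Any P ys) → Any R ys → Any R (remove p)
    any-remove n (here a) (here b) = ⊥-elim (n a b)
    any-remove n (here _) (there r) = r
    any-remove n (there p) (here b) = here b
    any-remove n (there p) (there r) = there (any-remove n p r)

  -- Pigeonhole: by `join`, two elements related to the same y are related to each other, so
  -- unrelated elements occupy different places of `ys` and the place of the head may be removed.
  covered⇒≤ : ∀ {xs ys} → AllPairs (λ a b → ¬ (a ≈ b)) xs → All (λ x → Any (x ≈_) ys) xs → length xs ≤ length ys
  covered⇒≤ [] [] = z≤n
  covered⇒≤ (n ∷ ap) (c ∷ cs) = subst (_ ≤_) (sym (length-remove c))
    (s≤s (covered⇒≤ ap (All.map (λ { (ne , c′) → any-remove (λ a b → ne (join a b)) c c′ }) (All.zip (n , cs)))))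

  -- Makes the numbers inside `ConditionB` and `StatementB` comparable with those of any other
  -- listing of the same set.
  CardUpTo-unique : ∀ {S : B → Set} {m n} → CardUpTo _≈_ S m → CardUpTo _≈_ S n → m ≡ n
  CardUpTo-unique (xs , lx , sx , px , cx) (ys , ly , sy , py , cy) = subst₂ _≡_ lx ly
    (ℕ.≤-antisym (covered⇒≤ px (All.map (cy _) sx)) (covered⇒≤ py (All.map (cx _) sy)))

allPairs-map : ∀ {B C : Set} {R : C → C → Set} {S : B → Set} (f : B → C) {xs : List B} → (∀ {x y} → S x → S y → x ≢ y → R (f x) (f y)) →
  All S xs → Unique xs → AllPairs R (map f xs)
allPairs-map f r [] [] = []
allPairs-map f r (s ∷ ss) (n ∷ u) = All.map⁺ (All.map (λ { (sy , ne) → r s sy ne }) (All.zip (ss , n))) ∷ allPairs-map f r ss u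

-- Polynomial identities and linear consequences of equations

module FieldSolver (F : FiniteField) where
  open FiniteField F renaming (Carrier to A)

  commutativeRing : CommutativeRing _ _
  commutativeRing = record { isCommutativeRing = isCommutativeRing }

  open CommutativeRing commutativeRing public
    using (+-assoc; +-comm; +-identityˡ; +-identityʳ; -‿inverseʳ; *-assoc; *-comm; *-identityˡ; *-identityʳ; zeroˡ; zeroʳ; semiring; ring; +-monoid; commutativeSemiring)
  open import Algebra.Properties.Semiring.Mult.TCOptimised semiring using (×-homo-+; ×1-homo-*; 1+×) renaming (_×_ to _⋆_)
  open import Algebra.Properties.Ring ring using (-‿distribˡ-*; -‿distribʳ-*; -0#≈0#; -‿involutive; -‿+-comm)
  open import Algebra.Solver.Ring.AlmostCommutativeRing using (fromCommutativeRing; _-Raw-AlmostCommutative⟶_)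

  open ≡-Reasoning

  -- The solver takes integer coefficients because their equality is decided by evaluation, whereas
  -- the elements of `F` are opaque.
  fromℤ : ℤ → A
  fromℤ (+ n) = n ⋆ 𝟙
  fromℤ -[1+ n ] = ⊖ (suc n ⋆ 𝟙)

  private
    cancel : ∀ a b c → (c ⊕ a) ⊕ ⊖ (c ⊕ b) ≡ a ⊕ ⊖ b
    cancel a b c = begin
      (c ⊕ a) ⊕ ⊖ (c ⊕ b)       ≡⟨ cong₂ _⊕_ (+-comm c a) (sym (-‿+-comm c b)) ⟩
      (a ⊕ c) ⊕ (⊖ c ⊕ ⊖ b)     ≡⟨ +-assoc a c _ ⟩
      a ⊕ (c ⊕ (⊖ c ⊕ ⊖ b))     ≡⟨ cong (a ⊕_) (sym (+-assoc c (⊖ c) _)) ⟩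
      a ⊕ ((c ⊕ ⊖ c) ⊕ ⊖ b)     ≡⟨ cong (λ z → a ⊕ (z ⊕ ⊖ b)) (-‿inverseʳ c) ⟩
      a ⊕ (𝟘 ⊕ ⊖ b)             ≡⟨ cong (a ⊕_) (+-identityˡ _) ⟩
      a ⊕ ⊖ b                   ∎

  fromℤ-⊖ : ∀ m n → fromℤ (m ℤ.⊖ n) ≡ m ⋆ 𝟙 ⊕ ⊖ (n ⋆ 𝟙)
  fromℤ-⊖ m zero = sym (trans (cong (m ⋆ 𝟙 ⊕_) -0#≈0#) (+-identityʳ _))
  fromℤ-⊖ zero (suc n) = sym (+-identityˡ _)
  fromℤ-⊖ (suc m) (suc n) = begin
    fromℤ (suc m ℤ.⊖ suc n)               ≡⟨ cong fromℤ (ℤ.[1+m]⊖[1+n]≡m⊖n m n) ⟩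
    fromℤ (m ℤ.⊖ n)                       ≡⟨ fromℤ-⊖ m n ⟩
    m ⋆ 𝟙 ⊕ ⊖ (n ⋆ 𝟙)                     ≡⟨ sym (cancel _ _ 𝟙) ⟩
    (𝟙 ⊕ m ⋆ 𝟙) ⊕ ⊖ (𝟙 ⊕ n ⋆ 𝟙)           ≡⟨ sym (cong₂ (λ a b → a ⊕ ⊖ b) (1+× m 𝟙) (1+× n 𝟙)) ⟩
    suc m ⋆ 𝟙 ⊕ ⊖ (suc n ⋆ 𝟙)             ∎

  fromℤ-neg : ∀ m → fromℤ (ℤ.- m) ≡ ⊖ fromℤ m
  fromℤ-neg (+ zero) = sym -0#≈0#
  fromℤ-neg (+ suc n) = refl
  fromℤ-neg -[1+ n ] = sym (-‿involutive _)

  fromℤ-+ : ∀ m n → fromℤ (m ℤ.+ n) ≡ fromℤ m ⊕ fromℤ n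
  fromℤ-+ (+ m) (+ n) = ×-homo-+ 𝟙 m n
  fromℤ-+ (+ m) -[1+ n ] = fromℤ-⊖ m (suc n)
  fromℤ-+ -[1+ m ] (+ n) = trans (fromℤ-⊖ n (suc m)) (+-comm _ _)
  fromℤ-+ -[1+ m ] -[1+ n ] = begin
    ⊖ (suc (suc (m ℕ.+ n)) ⋆ 𝟙)            ≡⟨ cong (λ k → ⊖ (k ⋆ 𝟙)) (sym (cong suc (ℕ.+-suc m n))) ⟩
    ⊖ ((suc m ℕ.+ suc n) ⋆ 𝟙)              ≡⟨ cong ⊖_ (×-homo-+ 𝟙 (suc m) (suc n)) ⟩
    ⊖ (suc m ⋆ 𝟙 ⊕ suc n ⋆ 𝟙)              ≡⟨ sym (-‿+-comm _ _) ⟩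
    ⊖ (suc m ⋆ 𝟙) ⊕ ⊖ (suc n ⋆ 𝟙)          ∎

  fromℤ-*ℕ : ∀ m n → fromℤ (+ m ℤ.* + n) ≡ m ⋆ 𝟙 ⊗ n ⋆ 𝟙
  fromℤ-*ℕ m n = trans (cong fromℤ (sym (ℤ.pos-* m n))) (×1-homo-* m n)

  fromℤ-* : ∀ m n → fromℤ (m ℤ.* n) ≡ fromℤ m ⊗ fromℤ n
  fromℤ-* (+ m) (+ n) = fromℤ-*ℕ m n
  fromℤ-* (+ m) -[1+ n ] = begin
    fromℤ (+ m ℤ.* -[1+ n ])        ≡⟨ cong fromℤ (sym (ℤ.neg-distribʳ-* (+ m) (+ suc n))) ⟩
    fromℤ (ℤ.- (+ m ℤ.* + suc n))   ≡⟨ fromℤ-neg (+ m ℤ.* + suc n) ⟩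
    ⊖ fromℤ (+ m ℤ.* + suc n)       ≡⟨ cong ⊖_ (fromℤ-*ℕ m (suc n)) ⟩
    ⊖ (m ⋆ 𝟙 ⊗ suc n ⋆ 𝟙)           ≡⟨ -‿distribʳ-* _ _ ⟩
    m ⋆ 𝟙 ⊗ ⊖ (suc n ⋆ 𝟙)           ∎
  fromℤ-* -[1+ m ] (+ n) = begin
    fromℤ (-[1+ m ] ℤ.* + n)        ≡⟨ cong fromℤ (sym (ℤ.neg-distribˡ-* (+ suc m) (+ n))) ⟩
    fromℤ (ℤ.- (+ suc m ℤ.* + n))   ≡⟨ fromℤ-neg (+ suc m ℤ.* + n) ⟩
    ⊖ fromℤ (+ suc m ℤ.* + n)       ≡⟨ cong ⊖_ (fromℤ-*ℕ (suc m) n) ⟩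
    ⊖ (suc m ⋆ 𝟙 ⊗ n ⋆ 𝟙)           ≡⟨ -‿distribˡ-* _ _ ⟩
    ⊖ (suc m ⋆ 𝟙) ⊗ n ⋆ 𝟙           ∎
  fromℤ-* -[1+ m ] -[1+ n ] = begin
    (suc m ℕ.* suc n) ⋆ 𝟙                ≡⟨ ×1-homo-* (suc m) (suc n) ⟩
    suc m ⋆ 𝟙 ⊗ suc n ⋆ 𝟙              ≡⟨ sym (-‿involutive _) ⟩
    ⊖ ⊖ (suc m ⋆ 𝟙 ⊗ suc n ⋆ 𝟙)        ≡⟨ cong ⊖_ (-‿distribʳ-* _ _) ⟩
    ⊖ (suc m ⋆ 𝟙 ⊗ ⊖ (suc n ⋆ 𝟙))      ≡⟨ -‿distribˡ-* _ _ ⟩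
    ⊖ (suc m ⋆ 𝟙) ⊗ ⊖ (suc n ⋆ 𝟙)      ∎

  ℤ-rawRing : RawRing _ _
  ℤ-rawRing = record
    { Carrier = ℤ ; _≈_ = _≡_ ; _+_ = ℤ._+_ ; _*_ = ℤ._*_ ; -_ = ℤ.-_ ; 0# = + 0 ; 1# = + 1 }

  fromℤ-homomorphism : ℤ-rawRing -Raw-AlmostCommutative⟶ fromCommutativeRing commutativeRing
  fromℤ-homomorphism = record
    { ⟦_⟧ = fromℤ ; +-homo = fromℤ-+ ; *-homo = fromℤ-* ; -‿homo = fromℤ-neg ; 0-homo = refl ; 1-homo = refl }

  open import Algebra.Solver.Ring ℤ-rawRing (fromCommutativeRing commutativeRing) fromℤ-homomorphism
    (λ m n → Maybe.map (cong fromℤ) (dec⇒maybe (m ℤ.≟ n)))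
    public using (solve; prove; normalise; ⟦_⟧; ⟦_⟧N; Polynomial; var; _:+_; _:*_; _:-_; :-_; con; _:=_)

  infix 9 #_
  #_ : ∀ {n} → ℕ → Polynomial n
  # n = con (+ n)

  private
    by : ∀ {a b c l r} → l ≡ r → a ⊕ c ⊗ r ≡ b ⊕ c ⊗ l → a ≡ b
    by {a} {b} {c} {l} refl e = begin
      a                           ≡⟨ solve 2 (λ a x → a := a :+ x :+ :- x) refl a (c ⊗ l) ⟩
      a ⊕ c ⊗ l ⊕ ⊖ (c ⊗ l)       ≡⟨ cong (_⊕ ⊖ (c ⊗ l)) e ⟩
      b ⊕ c ⊗ l ⊕ ⊖ (c ⊗ l)       ≡⟨ solve 2 (λ b x → b :+ x :+ :- x := b) refl b (c ⊗ l) ⟩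
      b                           ∎

  Equation : ℕ → Set
  Equation n = Polynomial n × Polynomial n

  infix 2 _⊣_
  infixr 3 _⊞_
  infix 3.5 _∙_

  _⊣_ : ∀ {n} → Equation n → List (Polynomial n × Equation n) → Equation n × List (Polynomial n × Equation n)
  _⊣_ = _,_

  _⊞_ : ∀ {n} → Polynomial n × Equation n → List (Polynomial n × Equation n) → List (Polynomial n × Equation n)
  _⊞_ = _∷_

  _∙_ : ∀ {n} → Polynomial n → Equation n → Polynomial n × Equation n
  _∙_ = _,_

  Hypotheses : ∀ {n} → Vec A n → List (Polynomial n × Equation n) → Set
  Hypotheses ρ [] = ⊤
  Hypotheses ρ ((c , l , r) ∷ hs) = ⟦ l ⟧ ρ ≡ ⟦ r ⟧ ρ × Hypotheses ρ hs

  -- Each hypothesis l = r enters crosswise, c r on the left and c l on the right; what remains is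
  -- an identity free of hypotheses, to be decided by normalisation.
  combine : ∀ {n} → Equation n → List (Polynomial n × Equation n) → Equation n
  combine g [] = g
  combine (a , b) ((c , l , r) ∷ hs) = combine (a :+ c :* r , b :+ c :* l) hs

  combine-sound : ∀ {n} (ρ : Vec A n) g hs → Hypotheses ρ hs → ⟦ proj₁ (combine g hs) ⟧ ρ ≡ ⟦ proj₂ (combine g hs) ⟧ ρ → ⟦ proj₁ g ⟧ ρ ≡ ⟦ proj₂ g ⟧ ρ
  combine-sound ρ g [] _ e = e
  combine-sound ρ (a , b) ((c , l , r) ∷ hs) (h , p) e = by {c = ⟦ c ⟧ ρ} h (combine-sound ρ (a :+ c :* r , b :+ c :* l) hs p e)

  -- linear (x ∷ …) (λ x … → L := R ⊣ c₁ ∙ l₁ := r₁ ⊞ c₂ ∙ l₂ := r₂ ⊞ []) (h₁ , h₂ , tt) refl proves L ≡ R from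
  -- h₁ : l₁ ≡ r₁ and h₂ : l₂ ≡ r₂; the certificate is the identity L - R = c₁ (l₁ - r₁) + c₂ (l₂ - r₂).
  linear : ∀ {n} (ρ : Vec A n) (f : N-ary n (Polynomial n) (Equation n × List (Polynomial n × Equation n))) →
    let (g , hs) = f $ⁿ Vec.map var (Vec.allFin n) in Hypotheses ρ hs →
    normalise (proj₁ (combine g hs)) ≡ normalise (proj₂ (combine g hs)) → ⟦ proj₁ g ⟧ ρ ≡ ⟦ proj₂ g ⟧ ρ
  linear {n} ρ f p e = combine-sound ρ (proj₁ system) (proj₂ system) p
    (prove ρ (proj₁ (combine (proj₁ system) (proj₂ system))) (proj₂ (combine (proj₁ system) (proj₂ system))) (cong (λ s → ⟦ s ⟧N ρ) e))
    where
    system : Equation n × List (Polynomial n × Equation n)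
    system = f $ⁿ Vec.map var (Vec.allFin n)

-- Finite fields: roots of polynomials, Fermat, Frobenius

module FieldTheory (F : FiniteField) (p q : ℕ) where
  open FiniteField F renaming (Carrier to A)
  open FieldSolver F
  open Geometry F p q using (pow)

  infix 4 _≟_
  _≟_ : (x y : A) → Dec (x ≡ y)
  x ≟ y with index (complete x) Fin.≟ index (complete y)
  ... | yes e = yes (trans (sym (lookup-index′ x)) (trans (cong (lookup elements) e) (lookup-index′ y)))
    where
    lookup-index′ : ∀ x → lookup elements (index (complete x)) ≡ x
    lookup-index′ x = sym (Any.lookup-index (complete x))
  ... | no ne = no λ { refl → ne refl }

  inverseˡ : ∀ x → x ≢ 𝟘 → inv x ⊗ x ≡ 𝟙
  inverseˡ x x≢ = trans (*-comm _ _) (inverseʳ x x≢)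

  ⊗-cancelˡ : ∀ {x y z} → x ≢ 𝟘 → x ⊗ y ≡ x ⊗ z → y ≡ z
  ⊗-cancelˡ {x} {y} {z} x≢ e = linear (x ∷ y ∷ z ∷ inv x ∷ []) (λ x y z w → y := z ⊣ w ∙ x :* y := x :* z ⊞ :- y :+ z ∙ x :* w := # 1 ⊞ []) (e , inverseʳ x x≢ , tt) refl

  integral : ∀ {x y} → x ⊗ y ≡ 𝟘 → x ≢ 𝟘 → y ≡ 𝟘
  integral {x} e x≢ = ⊗-cancelˡ x≢ (trans e (sym (zeroʳ x)))

  ⊗-nonzero : ∀ {x y} → x ≢ 𝟘 → y ≢ 𝟘 → x ⊗ y ≢ 𝟘
  ⊗-nonzero x≢ y≢ e = y≢ (integral e x≢)

  factorˡ : ∀ {x y} → x ⊗ y ≢ 𝟘 → x ≢ 𝟘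
  factorˡ {_} {y} n refl = n (zeroˡ y)

  factorʳ : ∀ {x y} → x ⊗ y ≢ 𝟘 → y ≢ 𝟘
  factorʳ {x} n refl = n (zeroʳ x)

  inv-nonzero : ∀ {x} → x ≢ 𝟘 → inv x ≢ 𝟘
  inv-nonzero {x} x≢ = factorʳ {x} λ e → 𝟘≢𝟙 (trans (sym e) (inverseʳ x x≢))

  difference-zero : ∀ {x y} → x ⊕ ⊖ y ≡ 𝟘 → x ≡ y
  difference-zero {x} {y} e = linear (x ∷ y ∷ []) (λ x y → x := y ⊣ # 1 ∙ x :- y := # 0 ⊞ []) (e , tt) refl

  equal⇒difference-zero : ∀ {x y} → x ≡ y → x ⊕ ⊖ y ≡ 𝟘
  equal⇒difference-zero refl = -‿inverseʳ _

  difference-nonzero : ∀ {x y} → x ≢ y → x ⊕ ⊖ y ≢ 𝟘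
  difference-nonzero n e = n (difference-zero e)

  pow-⊗ : ∀ x y n → pow (x ⊗ y) n ≡ pow x n ⊗ pow y n
  pow-⊗ x y zero = sym (*-identityˡ 𝟙)
  pow-⊗ x y (suc n) = linear (x ∷ y ∷ pow x n ∷ pow y n ∷ pow (x ⊗ y) n ∷ []) (λ x y a b c → x :* y :* c := x :* a :* (y :* b) ⊣ x :* y ∙ c := a :* b ⊞ []) (pow-⊗ x y n , tt) refl

  pow-+ : ∀ x m n → pow x (m ℕ.+ n) ≡ pow x m ⊗ pow x n
  pow-+ x zero n = sym (*-identityˡ _)
  pow-+ x (suc m) n = trans (cong (x ⊗_) (pow-+ x m n)) (sym (*-assoc x _ _))

  pow-𝟙 : ∀ n → pow 𝟙 n ≡ 𝟙
  pow-𝟙 zero = refl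
  pow-𝟙 (suc n) = trans (*-identityˡ _) (pow-𝟙 n)

  pow-* : ∀ x m n → pow x (m ℕ.* n) ≡ pow (pow x m) n
  pow-* x zero n = sym (pow-𝟙 n)
  pow-* x (suc m) n = trans (pow-+ x n (m ℕ.* n)) (trans (cong (pow x n ⊗_) (pow-* x m n)) (sym (pow-⊗ x (pow x m) n)))

  pow-nonzero : ∀ {x} n → x ≢ 𝟘 → pow x n ≢ 𝟘
  pow-nonzero zero x≢ e = 𝟘≢𝟙 (sym e)
  pow-nonzero (suc n) x≢ = ⊗-nonzero x≢ (pow-nonzero n x≢)

  pow-𝟘 : ∀ n → pow 𝟘 (suc n) ≡ 𝟘
  pow-𝟘 n = zeroˡ _

  pow-1 : ∀ x → pow x 1 ≡ x
  pow-1 = *-identityʳ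

  -- Horner form of a monic polynomial of degree n, kept as a property of the function that it
  -- induces.
  Monic : ℕ → (A → A) → Set
  Monic zero f = ∀ x → f x ≡ 𝟙
  Monic (suc n) f = Σ (A → A) λ g → Σ A λ c → Monic n g × (∀ x → f x ≡ x ⊗ g x ⊕ c)

  -- Synthetic division by x - a: the coefficients of the quotient are the values at a of the
  -- successive Horner stages.
  factor-root : ∀ n {f} → Monic (suc n) f → ∀ a → Σ (A → A) λ g → Monic n g × (∀ x → f x ≡ (x ⊕ ⊖ a) ⊗ g x ⊕ f a)
  factor-root zero {f} (g , c , m , e) a = (λ _ → 𝟙) , (λ _ → refl) , λ x →
    linear (x ∷ a ∷ c ∷ f x ∷ f a ∷ g x ∷ g a ∷ []) (λ x a c fx fa gx ga → fx := (x :- a) :* # 1 :+ fa ⊣ # 1 ∙ fx := x :* gx :+ c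
        ⊞ :- # 1 ∙ fa := a :* ga :+ c ⊞ x ∙ gx := # 1 ⊞ :- a ∙ ga := # 1 ⊞ []) (e x , e a , m x , m a , tt) refl
  factor-root (suc n) {f} (g , c , m , e) a with factor-root n m a
  ... | k , mk , ek = (λ x → x ⊗ k x ⊕ g a) , (k , g a , mk , λ _ → refl) , λ x →
    linear (x ∷ a ∷ c ∷ f x ∷ f a ∷ g x ∷ g a ∷ k x ∷ []) (λ x a c fx fa gx ga kx → fx := (x :- a) :* (x :* kx :+ ga) :+ fa ⊣ # 1 ∙ fx := x :* gx :+ c
        ⊞ :- # 1 ∙ fa := a :* ga :+ c ⊞ x ∙ gx := (x :- a) :* kx :+ ga ⊞ []) (e x , e a , ek x , tt) refl

  monic-roots : ∀ n {f} → Monic n f → ∀ {xs} → Unique xs → All (λ x → f x ≡ 𝟘) xs → length xs ≤ n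
  monic-roots n m {[]} u r = z≤n
  monic-roots zero m {x ∷ xs} u (r ∷ _) = ⊥-elim (𝟘≢𝟙 (trans (sym r) (m x)))
  monic-roots (suc n) {f} m {a ∷ xs} (a∉ ∷ u) (r ∷ rs) with factor-root n m a
  ... | g , mg , e = s≤s (monic-roots n mg u (All.map (λ { (ne , rx) → root ne rx }) (All.zip (a∉ , rs))))
    where
    root : ∀ {x} → a ≢ x → f x ≡ 𝟘 → g x ≡ 𝟘
    root {x} ne rx = integral (linear (x ∷ a ∷ f x ∷ f a ∷ g x ∷ []) (λ x a fx fa gx → (x :- a) :* gx := # 0 ⊣ :- # 1 ∙ fx := (x :- a) :* gx :+ fa
        ⊞ :- # 1 ∙ fa := # 0 ⊞ # 1 ∙ fx := # 0 ⊞ []) (e x , r , rx , tt) refl) (difference-nonzero (ne ∘ sym))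

  pow-monic : ∀ n → Monic n (λ x → pow x n)
  pow-monic zero x = refl
  pow-monic (suc n) = (λ x → pow x n) , 𝟘 , pow-monic n , λ x → sym (+-identityʳ _)

  pow-minus-one-monic : ∀ n → Monic (suc n) (λ x → pow x (suc n) ⊕ ⊖ 𝟙)
  pow-minus-one-monic n = (λ x → pow x n) , ⊖ 𝟙 , pow-monic n , λ x → refl

  open import Algebra.Properties.Semiring.Mult semiring using (×-homo-+; ×1-homo-*; ×-assoc-*)
    renaming (_×_ to _·ℕ_)
  open import Algebra.Properties.CommutativeSemiring.Binomial commutativeSemiring using (theorem; binomialTerm)
  open import Algebra.Properties.Semiring.Exp semiring using () renaming (_^_ to _^ˢ_)
  open import Algebra.Properties.Monoid.Sum +-monoid using (sum-init-last; sum-cong-≋; sum-replicate-zero; sum)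

  private
    foldr-↭ : (_∙_ : A → A → A) (ε : A) → (∀ x y z → x ∙ (y ∙ z) ≡ y ∙ (x ∙ z)) → ∀ {xs ys} → xs ↭ ys → foldr _∙_ ε xs ≡ foldr _∙_ ε ys
    foldr-↭ _∙_ ε c Perm.refl = refl
    foldr-↭ _∙_ ε c (Perm.prep x p) = cong (x ∙_) (foldr-↭ _∙_ ε c p)
    foldr-↭ _∙_ ε c (Perm.swap x y p) = trans (c x y _) (cong (λ z → y ∙ (x ∙ z)) (foldr-↭ _∙_ ε c p))
    foldr-↭ _∙_ ε c (Perm.trans p r) = trans (foldr-↭ _∙_ ε c p) (foldr-↭ _∙_ ε c r)

    ∑-translate : ∀ xs → foldr _⊕_ 𝟘 (map (𝟙 ⊕_) xs) ≡ length xs ·ℕ 𝟙 ⊕ foldr _⊕_ 𝟘 xs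
    ∑-translate [] = sym (+-identityˡ 𝟘)
    ∑-translate (x ∷ xs) = linear (x ∷ length xs ·ℕ 𝟙 ∷ foldr _⊕_ 𝟘 xs ∷ foldr _⊕_ 𝟘 (map (𝟙 ⊕_) xs) ∷ []) (λ x a s t → # 1 :+ x :+ t := # 1 :+ a :+ (x :+ s) ⊣ # 1 ∙ t := a :+ s ⊞ []) (∑-translate xs , tt) refl

    ∏-scale : ∀ c xs → foldr _⊗_ 𝟙 (map (c ⊗_) xs) ≡ pow c (length xs) ⊗ foldr _⊗_ 𝟙 xs
    ∏-scale c [] = sym (*-identityˡ 𝟙)
    ∏-scale c (x ∷ xs) = linear (c ∷ x ∷ pow c (length xs) ∷ foldr _⊗_ 𝟙 xs ∷ foldr _⊗_ 𝟙 (map (c ⊗_) xs) ∷ []) (λ c x a s t → c :* x :* t := c :* a :* (x :* s) ⊣ c :* x ∙ t := a :* s ⊞ []) (∏-scale c xs , tt) refl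

    ∏-nonzero : ∀ {xs} → All (_≢ 𝟘) xs → foldr _⊗_ 𝟙 xs ≢ 𝟘
    ∏-nonzero [] e = 𝟘≢𝟙 (sym e)
    ∏-nonzero (n ∷ ns) = ⊗-nonzero n (∏-nonzero ns)

  -- Translation by 1 permutes the field, so the sum of all elements is unchanged when the order of
  -- the field times 1 is added to it.
  order·𝟙 : length elements ·ℕ 𝟙 ≡ 𝟘
  order·𝟙 = linear (length elements ·ℕ 𝟙 ∷ foldr _⊕_ 𝟘 elements ∷ foldr _⊕_ 𝟘 (map (𝟙 ⊕_) elements) ∷ []) (λ a s t → a := # 0 ⊣ :- # 1 ∙ t := a :+ s
      ⊞ # 1 ∙ t := s ⊞ []) (∑-translate elements , foldr-↭ _⊕_ 𝟘 (solve 3 (λ x y z → x :+ (y :+ z) := y :+ (x :+ z)) refl) translated , tt) refl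
    where
    translated : map (𝟙 ⊕_) elements ↭ elements
    translated = bijection⇒↭ unique unique (⊖ 𝟙 ⊕_)
      (λ {x} _ → complete _ , solve 1 (λ x → :- # 1 :+ (# 1 :+ x) := x) refl x) (λ {x} _ → complete _ , solve 1 (λ x → # 1 :+ (:- # 1 :+ x) := x) refl x)

  nonzero-elements : Σ (List A) λ ys → elements ↭ 𝟘 ∷ ys × All (_≢ 𝟘) ys × Unique ys
  nonzero-elements with ∈-∃++ (complete 𝟘)
  ... | as , bs , eq with unique-resp-↭ perm unique
    where
    perm : elements ↭ 𝟘 ∷ as ++ bs
    perm = subst (_↭ 𝟘 ∷ as ++ bs) (sym eq) (shift 𝟘 as bs)
  ... | n ∷ u = as ++ bs , subst (_↭ 𝟘 ∷ as ++ bs) (sym eq) (shift 𝟘 as bs) , All.map (λ ne e → ne (sym e)) n , u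

  -- For x ≠ 0, multiplication by x permutes the nonzero elements; comparing their products gives
  -- x^(order - 1) = 1.
  fermat : ∀ x → pow x (length elements) ≡ x
  fermat x = go
    where
    ys = proj₁ nonzero-elements
    el = proj₁ (proj₂ nonzero-elements)
    nonzero = proj₁ (proj₂ (proj₂ nonzero-elements))
    go : pow x (length elements) ≡ x
    go with x ≟ 𝟘
    ... | yes refl = trans (cong (pow 𝟘) (↭-length el)) (pow-𝟘 (length ys))
    ... | no x≢ = trans (cong (pow x) (↭-length el)) (trans (cong (x ⊗_) one) (*-identityʳ x))
      where
      scaled : map (x ⊗_) elements ↭ elements
      scaled = bijection⇒↭ unique unique (inv x ⊗_)
        (λ {y} _ → complete _ , linear (x ∷ y ∷ inv x ∷ []) (λ x y w → w :* (x :* y) := y ⊣ y ∙ x :* w := # 1 ⊞ []) (inverseʳ x x≢ , tt) refl)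
        (λ {y} _ → complete _ , linear (x ∷ y ∷ inv x ∷ []) (λ x y w → x :* (w :* y) := y ⊣ y ∙ x :* w := # 1 ⊞ []) (inverseʳ x x≢ , tt) refl)
      -- Multiplication by x fixes 0, so 0 can be cancelled from both sides of the permutation of
      -- the whole field.
      scaled-nonzero : map (x ⊗_) ys ↭ ys
      scaled-nonzero = drop-∷ (subst (λ z → z ∷ map (x ⊗_) ys ↭ 𝟘 ∷ ys) (zeroʳ x)
        (↭-trans (↭-sym (map⁺ (x ⊗_) el)) (↭-trans scaled el)))
      one : pow x (length ys) ≡ 𝟙
      one = ⊗-cancelˡ (∏-nonzero nonzero) (linear (pow x (length ys) ∷ foldr _⊗_ 𝟙 ys ∷ foldr _⊗_ 𝟙 (map (x ⊗_) ys) ∷ []) (λ a s t → s :* a := s :* # 1 ⊣ :- # 1 ∙ t := a :* s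
          ⊞ # 1 ∙ t := s ⊞ []) (∏-scale x ys , foldr-↭ _⊗_ 𝟙 (solve 3 (λ x y z → x :* (y :* z) := y :* (x :* z)) refl) scaled-nonzero , tt) refl)

  ·ℕ-pow : ∀ n k → (n ℕ.^ k) ·ℕ 𝟙 ≡ pow (n ·ℕ 𝟙) k
  ·ℕ-pow n zero = +-identityʳ 𝟙
  ·ℕ-pow n (suc k) = trans (×1-homo-* n (n ℕ.^ k)) (cong (n ·ℕ 𝟙 ⊗_) (·ℕ-pow n k))

  ^-pow : ∀ x n → x ^ˢ n ≡ pow x n
  ^-pow x zero = refl
  ^-pow x (suc n) = cong (x ⊗_) (^-pow x n)

  module Characteristic (p-prime : Prime p) (char : p ·ℕ 𝟙 ≡ 𝟘) where

    multiple-zero : ∀ {n} → p ∣ n → ∀ x → n ·ℕ x ≡ 𝟘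
    multiple-zero (divides m refl) x = begin
      (m ℕ.* p) ·ℕ x            ≡⟨ cong ((m ℕ.* p) ·ℕ_) (sym (*-identityˡ x)) ⟩
      (m ℕ.* p) ·ℕ (𝟙 ⊗ x)      ≡⟨ sym (×-assoc-* (m ℕ.* p) 𝟙 x) ⟩
      (m ℕ.* p) ·ℕ 𝟙 ⊗ x        ≡⟨ cong (_⊗ x) (trans (×1-homo-* m p) (trans (cong (m ·ℕ 𝟙 ⊗_) char) (zeroʳ _))) ⟩
      𝟘 ⊗ x                     ≡⟨ zeroˡ x ⟩
      𝟘                         ∎
      where open ≡-Reasoning

    -- In the binomial expansion every middle coefficient is a multiple of p. The exponent has the
    -- shape `suc n` so that both the first and the last term can be split off the sum.
    frobenius-suc : ∀ n → p ≡ suc n → ∀ x y → pow (x ⊕ y) (suc n) ≡ pow x (suc n) ⊕ pow y (suc n)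
    frobenius-suc n eq x y = begin
      pow (x ⊕ y) (suc n)                       ≡⟨ sym (^-pow (x ⊕ y) (suc n)) ⟩
      (x ⊕ y) ^ˢ suc n                          ≡⟨ theorem (suc n) x y ⟩
      sum t                                     ≡⟨ cong (t zero ⊕_) (sum-init-last (t ∘ suc)) ⟩
      t zero ⊕ (sum middle ⊕ t (suc (fromℕ n)))  ≡⟨ cong₂ (λ a b → t zero ⊕ (a ⊕ b)) middle-zero top ⟩
      t zero ⊕ (𝟘 ⊕ pow x (suc n))              ≡⟨ cong₂ (λ a b → a ⊕ b) bottom (+-identityˡ _) ⟩
      pow y (suc n) ⊕ pow x (suc n)             ≡⟨ +-comm _ _ ⟩
      pow x (suc n) ⊕ pow y (suc n)             ∎
      where
      open ≡-Reasoning
      t : Fin (suc (suc n)) → A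
      t = binomialTerm x y (suc n)
      middle : Fin n → A
      middle k = t (suc (inject₁ k))
      middle-zero : sum middle ≡ 𝟘
      middle-zero = trans (sum-cong-≋ {n} λ k → multiple-zero
        (subst (λ z → p ∣ z choose suc (toℕ (inject₁ k))) eq (prime∣binomial p-prime (s≤s z≤n)
          (subst (suc (toℕ (inject₁ k)) ℕ.<_) (sym eq) (s≤s (subst (ℕ._< n) (sym (Fin.toℕ-inject₁ k)) (Fin.toℕ<n k)))))) _)
        (sum-replicate-zero n)
      one· : ∀ z → 1 ·ℕ z ≡ z
      one· z = +-identityʳ z
      top : t (suc (fromℕ n)) ≡ pow x (suc n)
      top = begin
        (suc n choose suc (toℕ (fromℕ n))) ·ℕ (x ^ˢ suc (toℕ (fromℕ n)) ⊗ y ^ˢ (n ℕ.∸ toℕ (fromℕ n)))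
          ≡⟨ cong (λ k → (suc n choose suc k) ·ℕ (x ^ˢ suc k ⊗ y ^ˢ (n ℕ.∸ k))) (Fin.toℕ-fromℕ n) ⟩
        (suc n choose suc n) ·ℕ (x ^ˢ suc n ⊗ y ^ˢ (n ℕ.∸ n))
          ≡⟨ cong₂ (λ a b → a ·ℕ (x ^ˢ suc n ⊗ y ^ˢ b)) (nCn≡1 (suc n)) (ℕ.n∸n≡0 n) ⟩
        1 ·ℕ (x ^ˢ suc n ⊗ 𝟙)   ≡⟨ one· _ ⟩
        x ^ˢ suc n ⊗ 𝟙          ≡⟨ *-identityʳ _ ⟩
        x ^ˢ suc n              ≡⟨ ^-pow x (suc n) ⟩
        pow x (suc n)           ∎
      bottom : t zero ≡ pow y (suc n)
      bottom = begin
        (suc n choose 0) ·ℕ (𝟙 ⊗ y ^ˢ suc n)   ≡⟨ one· _ ⟩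
        𝟙 ⊗ y ^ˢ suc n                    ≡⟨ *-identityˡ _ ⟩
        y ^ˢ suc n                        ≡⟨ ^-pow y (suc n) ⟩
        pow y (suc n)                     ∎

    frobenius : ∀ x y → pow (x ⊕ y) p ≡ pow x p ⊕ pow y p
    frobenius x y = subst (λ k → pow (x ⊕ y) k ≡ pow x k ⊕ pow y k) (ℕ.suc-pred p {{prime⇒nonZero p-prime}})
      (frobenius-suc (ℕ.pred p) (sym (ℕ.suc-pred p {{prime⇒nonZero p-prime}})) x y)

    frobenius-iterate : ∀ k x y → pow (x ⊕ y) (p ℕ.^ k) ≡ pow x (p ℕ.^ k) ⊕ pow y (p ℕ.^ k)
    frobenius-iterate zero x y = trans (pow-1 _) (sym (cong₂ _⊕_ (pow-1 x) (pow-1 y)))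
    frobenius-iterate (suc k) x y = begin
      pow (x ⊕ y) (p ℕ.* p ℕ.^ k)                                 ≡⟨ pow-* (x ⊕ y) p (p ℕ.^ k) ⟩
      pow (pow (x ⊕ y) p) (p ℕ.^ k)                               ≡⟨ cong (λ z → pow z (p ℕ.^ k)) (frobenius x y) ⟩
      pow (pow x p ⊕ pow y p) (p ℕ.^ k)                           ≡⟨ frobenius-iterate k (pow x p) (pow y p) ⟩
      pow (pow x p) (p ℕ.^ k) ⊕ pow (pow y p) (p ℕ.^ k)           ≡⟨ sym (cong₂ _⊕_ (pow-* x p (p ℕ.^ k)) (pow-* y p (p ℕ.^ k))) ⟩
      pow x (p ℕ.* p ℕ.^ k) ⊕ pow y (p ℕ.* p ℕ.^ k)               ∎
      where open ≡-Reasoning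

-- The standing hypotheses and their first consequences

record Assumptions (F : FiniteField) (p q : ℕ) : Set where
  field
    exponent : ℕ
    p-prime : Prime p
    q≡ : q ≡ p ^ suc exponent
    q%4 : q % 4 ≡ 1
    order : length (FiniteField.elements F) ≡ q * q
    two-square : Geometry.SquareInFq F p q (Geometry.𝟚 F p q)

module Setting (F : FiniteField) (p q : ℕ) (assumptions : Assumptions F p q) where

  open Assumptions assumptions

  open FiniteField F renaming (Carrier to A) public
  open FieldSolver F public
  open FieldTheory F p q public
  open Geometry F p q public
  open import Algebra.Properties.Semiring.Mult semiring using () renaming (_×_ to _·ℕ_; ×-homo-+ to ·ℕ-+; ×1-homo-* to ·ℕ-*)

  -- Here q = 1 + 4k. The exponent j = (q - 1)/2 = 2k defines the quadratic character of F_q, and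
  -- the exponent h = (q + 1)/2 of the curve is j + 1 = 2k + 1.
  k j : ℕ
  k = q ℕ./ 4
  j = k ℕ.+ k

  q≡1+2j : q ≡ suc (j ℕ.+ j)
  q≡1+2j = trans (ℕ.m≡m%n+[m/n]*n q 4) (trans (cong (ℕ._+ k ℕ.* 4) q%4) (cong suc (four k)))
    where
    four : ∀ k → k ℕ.* 4 ≡ k ℕ.+ k ℕ.+ (k ℕ.+ k)
    four = solve-∀ℕ

  h≡1+j : h ≡ suc j
  h≡1+j = trans (cong (ℕ._/ 2) (trans (cong (ℕ._+ 1) q≡1+2j) (double j))) (ℕ.m*n/n≡m (suc j) 2)
    where
    double : ∀ j → suc (j ℕ.+ j) ℕ.+ 1 ≡ suc j ℕ.* 2
    double = solve-∀ℕ

  1<q : 1 ℕ.< q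
  1<q = subst (1 ℕ.<_) (sym q≡) (ℕ.<-≤-trans (ℕ.nonTrivial⇒n>1 p {{prime⇒nonTrivial p-prime}})
    (ℕ.m≤m*n p (p ℕ.^ exponent) {{ℕ.m^n≢0 p exponent {{ℕ.>-nonZero (ℕ.<-trans (s≤s z≤n) (ℕ.nonTrivial⇒n>1 p {{prime⇒nonTrivial p-prime}}))}}}}))

  j≢0 : j ≢ 0
  j≢0 j≡0 = ℕ.<-irrefl (sym (trans q≡1+2j (cong (λ z → suc (z ℕ.+ z)) j≡0))) 1<q

  q·𝟙 : q ·ℕ 𝟙 ≡ pow (p ·ℕ 𝟙) (suc exponent)
  q·𝟙 = trans (cong (_·ℕ 𝟙) q≡) (·ℕ-pow p (suc exponent))

  -- The order q² of the field annihilates 1, and q² times 1 is a power of p times 1; a field has no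
  -- nilpotent elements except 0.
  char : p ·ℕ 𝟙 ≡ 𝟘
  char with p ·ℕ 𝟙 ≟ 𝟘
  ... | yes z = z
  ... | no n = ⊥-elim (⊗-nonzero q·𝟙≢ q·𝟙≢ (trans (sym (·ℕ-* q q)) (trans (cong (_·ℕ 𝟙) (sym order)) order·𝟙)))
    where
    q·𝟙≢ : q ·ℕ 𝟙 ≢ 𝟘
    q·𝟙≢ z = pow-nonzero (suc exponent) n (trans (sym q·𝟙) z)

  open Characteristic p-prime char public

  -- q times 1 vanishes and q is odd, so 2 = 0 would give 1 = 0.
  𝟚≢𝟘 : 𝟚 ≢ 𝟘
  𝟚≢𝟘 z = 𝟘≢𝟙 (linear (j ·ℕ 𝟙 ∷ q ·ℕ 𝟙 ∷ p ·ℕ 𝟙 ∷ pow (p ·ℕ 𝟙) exponent ∷ 𝟚 ∷ []) (λ a b c d w → # 0 := # 1 ⊣ # 1 ∙ b := # 1 :+ w :* a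
      ⊞ :- # 1 ∙ b := c :* d ⊞ :- d ∙ c := # 0 ⊞ a ∙ w := # 0 ⊞ []) (odd , q·𝟙 , char , z , tt) refl)
    where
    odd : q ·ℕ 𝟙 ≡ 𝟙 ⊕ 𝟚 ⊗ (j ·ℕ 𝟙)
    odd = trans (cong (_·ℕ 𝟙) q≡1+2j) (trans (cong (𝟙 ⊕_) (·ℕ-+ 𝟙 j j)) (solve 1 (λ a → # 1 :+ (a :+ a) := # 1 :+ # 2 :* a) refl (j ·ℕ 𝟙)))

  half : A
  half = inv 𝟚

  2half : 𝟚 ⊗ half ≡ 𝟙
  2half = inverseʳ 𝟚 𝟚≢𝟘

  ⊖𝟙≢𝟙 : ⊖ 𝟙 ≢ 𝟙
  ⊖𝟙≢𝟙 eq = 𝟚≢𝟘 (linear (𝟙 ∷ []) (λ o → # 1 :+ # 1 := # 0 ⊣ :- # 1 ∙ :- # 1 := # 1 ⊞ []) (eq , tt) refl)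

  ⊖𝟙≢𝟘 : ⊖ 𝟙 ≢ 𝟘
  ⊖𝟙≢𝟘 eq = 𝟘≢𝟙 (linear (𝟙 ∷ []) (λ o → # 0 := # 1 ⊣ # 1 ∙ :- # 1 := # 0 ⊞ []) (eq , tt) refl)

  ⊖-nonzero : ∀ {x} → x ≢ 𝟘 → ⊖ x ≢ 𝟘
  ⊖-nonzero {x} n eq = n (linear (x ∷ []) (λ x → x := # 0 ⊣ :- # 1 ∙ :- x := # 0 ⊞ []) (eq , tt) refl)

  square-zero : ∀ {x} → x ⊗ x ≡ 𝟘 → x ≡ 𝟘
  square-zero {x} eq with x ≟ 𝟘
  ... | yes z = z
  ... | no n = integral eq n

  square-roots : ∀ {x y} → x ⊗ x ≡ y ⊗ y → x ≡ y ⊎ x ≡ ⊖ y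
  square-roots {x} {y} eq with x ≟ y
  ... | yes z = inj₁ z
  ... | no n = inj₂ (linear (x ∷ y ∷ []) (λ x y → x := :- y ⊣ # 1 ∙ x :+ y := # 0 ⊞ []) (integral (linear (x ∷ y ∷ []) (λ x y → (x :- y) :* (x :+ y) := # 0 ⊣ # 1 ∙ x :* x := y :* y ⊞ []) (eq , tt) refl) (difference-nonzero n) , tt) refl)

  pow-zero : ∀ {x n} → n ≢ 0 → x ≡ 𝟘 → pow x n ≡ 𝟘
  pow-zero {n = zero} n≢ _ = ⊥-elim (n≢ refl)
  pow-zero {n = suc n} _ refl = pow-𝟘 n

  -- Conjugation

  conj-⊕ : ∀ x y → conj (x ⊕ y) ≡ conj x ⊕ conj y
  conj-⊕ x y = subst (λ n → pow (x ⊕ y) n ≡ pow x n ⊕ pow y n) (sym q≡) (frobenius-iterate (suc exponent) x y)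

  conj-⊗ : ∀ x y → conj (x ⊗ y) ≡ conj x ⊗ conj y
  conj-⊗ x y = pow-⊗ x y q

  conj-𝟘 : conj 𝟘 ≡ 𝟘
  conj-𝟘 = pow-zero (λ z → ℕ.<⇒≱ 1<q (subst (_≤ 1) (sym z) z≤n)) refl

  conj-𝟙 : conj 𝟙 ≡ 𝟙
  conj-𝟙 = pow-𝟙 q

  conj-⊖ : ∀ x → conj (⊖ x) ≡ ⊖ conj x
  conj-⊖ x = linear (conj x ∷ conj (⊖ x) ∷ conj 𝟘 ∷ conj (x ⊕ ⊖ x) ∷ []) (λ a b z s → b := :- a ⊣ :- # 1 ∙ s := a :+ b ⊞ # 1 ∙ s := z ⊞ # 1 ∙ z := # 0 ⊞ []) (conj-⊕ x (⊖ x) , cong conj (-‿inverseʳ x) , conj-𝟘 , tt) refl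

  conj-conj : ∀ x → conj (conj x) ≡ x
  conj-conj x = trans (sym (pow-* x q q)) (trans (cong (pow x) (sym order)) (fermat x))

  conj-⊝ : ∀ x y → conj (x ⊕ ⊖ y) ≡ conj x ⊕ ⊖ conj y
  conj-⊝ x y = trans (conj-⊕ x (⊖ y)) (cong (conj x ⊕_) (conj-⊖ y))

  conj-pow : ∀ x n → conj (pow x n) ≡ pow (conj x) n
  conj-pow x n = trans (sym (pow-* x n q)) (trans (cong (pow x) (ℕ.*-comm n q)) (pow-* x q n))

  conj-nonzero : ∀ {x} → x ≢ 𝟘 → conj x ≢ 𝟘
  conj-nonzero = pow-nonzero q

  conj-inv : ∀ {x} → x ≢ 𝟘 → conj x ⊗ conj (inv x) ≡ 𝟙
  conj-inv {x} n = trans (sym (conj-⊗ x (inv x))) (trans (cong conj (inverseʳ x n)) conj-𝟙)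

  conj-injective : ∀ {x y} → conj x ≡ conj y → x ≡ y
  conj-injective {x} {y} eq = trans (sym (conj-conj x)) (trans (cong conj eq) (conj-conj y))

  pow-q : ∀ x → conj x ≡ x ⊗ (pow x j ⊗ pow x j)
  pow-q x = trans (cong (pow x) q≡1+2j) (cong (x ⊗_) (pow-+ x j j))

  pow-h : ∀ x → pow x h ≡ x ⊗ pow x j
  pow-h x = cong (pow x) h≡1+j

  -- Since 2h = q + 1, the h-th power is a square root of the norm; every sign below is the
  -- ambiguity of such a root.
  pow-h² : ∀ x → pow x h ⊗ pow x h ≡ x ⊗ conj x
  pow-h² x = linear (x ∷ pow x h ∷ pow x j ∷ conj x ∷ []) (λ x a b c → a :* a := x :* c ⊣ x :* b :+ a ∙ a := x :* b ⊞ :- x ∙ c := x :* (b :* b) ⊞ []) (pow-h x , pow-q x , tt) refl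

  pow-q+1 : ∀ x → pow x (q ℕ.+ 1) ≡ x ⊗ conj x
  pow-q+1 x = trans (cong (pow x) (ℕ.+-comm q 1)) refl

  -- The subfield F_q

  Fq-𝟘 : InFq 𝟘
  Fq-𝟘 = conj-𝟘

  Fq-𝟙 : InFq 𝟙
  Fq-𝟙 = conj-𝟙

  Fq-⊕ : ∀ {x y} → InFq x → InFq y → InFq (x ⊕ y)
  Fq-⊕ {x} {y} a b = trans (conj-⊕ x y) (cong₂ _⊕_ a b)

  Fq-⊗ : ∀ {x y} → InFq x → InFq y → InFq (x ⊗ y)
  Fq-⊗ {x} {y} a b = trans (conj-⊗ x y) (cong₂ _⊗_ a b)

  Fq-⊖ : ∀ {x} → InFq x → InFq (⊖ x)
  Fq-⊖ {x} a = trans (conj-⊖ x) (cong ⊖_ a)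

  conj-affine : ∀ {s t} → InFq s → InFq t → ∀ y → conj (s ⊗ y ⊕ t) ≡ s ⊗ conj y ⊕ t
  conj-affine {s} {t} is it y = trans (conj-⊕ (s ⊗ y) t) (cong₂ _⊕_ (trans (conj-⊗ s y) (cong (_⊗ conj y) is)) it)

  Fq-inv : ∀ {x} → x ≢ 𝟘 → InFq x → InFq (inv x)
  Fq-inv {x} n a = ⊗-cancelˡ n (linear (x ∷ inv x ∷ conj x ∷ conj (inv x) ∷ []) (λ x w cx cw → x :* cw := x :* w ⊣ :- cw ∙ cx := x
      ⊞ # 1 ∙ cx :* cw := # 1 ⊞ :- # 1 ∙ x :* w := # 1 ⊞ []) (a , conj-inv n , inverseʳ x n , tt) refl)

  Fq-pow : ∀ {x} n → InFq x → InFq (pow x n)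
  Fq-pow {x} n a = trans (conj-pow x n) (cong (λ z → pow z n) a)

  Fq-𝟚 : InFq 𝟚
  Fq-𝟚 = Fq-⊕ Fq-𝟙 Fq-𝟙

  Fq-half : InFq half
  Fq-half = Fq-inv 𝟚≢𝟘 Fq-𝟚

  Fq-norm : ∀ x → InFq (x ⊗ conj x)
  Fq-norm x = trans (conj-⊗ x (conj x)) (trans (cong (conj x ⊗_) (conj-conj x)) (*-comm _ _))

  Fq-trace : ∀ x → InFq (x ⊕ conj x)
  Fq-trace x = trans (conj-⊕ x (conj x)) (trans (cong (conj x ⊕_) (conj-conj x)) (+-comm _ _))

  -- On F_q, x ↦ pow x j is the quadratic character.

  character-square : ∀ {x} → InFq x → x ≢ 𝟘 → pow x j ⊗ pow x j ≡ 𝟙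
  character-square {x} a n = ⊗-cancelˡ n (trans (sym (pow-q x)) (trans a (sym (*-identityʳ x))))

  character-values : ∀ {x} → InFq x → x ≢ 𝟘 → pow x j ≡ 𝟙 ⊎ pow x j ≡ ⊖ 𝟙
  character-values a n = square-roots (trans (character-square a n) (sym (*-identityˡ 𝟙)))

  pow-square : ∀ x n → pow (x ⊗ x) n ≡ pow x (n ℕ.+ n)
  pow-square x n = trans (pow-⊗ x x n) (sym (pow-+ x n n))

  character-of-square : ∀ {x} → InFq x → x ≢ 𝟘 → pow (x ⊗ x) j ≡ 𝟙
  character-of-square {x} a n = trans (pow-⊗ x x j) (character-square a n)

  ⊖𝟙-square : ⊖ 𝟙 ⊗ ⊖ 𝟙 ≡ 𝟙
  ⊖𝟙-square = solve 1 (λ o → :- # 1 :* :- # 1 := # 1) refl 𝟙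

  -- The exponent j = k + k is even; this is the condition q ≡ 1 mod 4.
  character-⊖𝟙 : pow (⊖ 𝟙) j ≡ 𝟙
  character-⊖𝟙 = trans (sym (pow-square (⊖ 𝟙) k)) (trans (cong (λ z → pow z k) ⊖𝟙-square) (pow-𝟙 k))

  character-⊖ : ∀ x → pow (⊖ x) j ≡ pow x j
  character-⊖ x = linear (pow (⊖ 𝟙 ⊗ x) j ∷ pow x j ∷ pow (⊖ 𝟙) j ∷ pow (⊖ x) j ∷ []) (λ a b c d → d := b ⊣ # 1 ∙ a := c :* b ⊞ b ∙ c := # 1
      ⊞ :- # 1 ∙ a := d ⊞ []) (pow-⊗ (⊖ 𝟙) x j , character-⊖𝟙 , cong (λ z → pow z j) (solve 1 (λ x → :- # 1 :* x := :- x) refl x) , tt) refl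

  pow-h-⊖ : ∀ x → pow (⊖ x) h ≡ ⊖ pow x h
  pow-h-⊖ x = linear (x ∷ pow (⊖ x) h ∷ pow x h ∷ pow (⊖ x) j ∷ pow x j ∷ []) (λ x a b c d → a := :- b ⊣ # 1 ∙ a := :- x :* c ⊞ # 1 ∙ b := x :* d
      ⊞ :- x ∙ c := d ⊞ []) (pow-h (⊖ x) , pow-h x , character-⊖ x , tt) refl

  pow-h-𝟙 : pow 𝟙 h ≡ 𝟙
  pow-h-𝟙 = pow-𝟙 h

  √2 : A
  √2 = proj₁ two-square

  Fq-√2 : InFq √2
  Fq-√2 = proj₁ (proj₂ two-square)

  √2² : 𝟚 ≡ √2 ⊗ √2
  √2² = proj₂ (proj₂ two-square)

  √2≢𝟘 : √2 ≢ 𝟘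
  √2≢𝟘 = factorˡ (λ z → 𝟚≢𝟘 (trans √2² z))

  character-𝟚 : pow 𝟚 j ≡ 𝟙
  character-𝟚 = trans (cong (λ z → pow z j) √2²) (character-of-square Fq-√2 √2≢𝟘)

  pow-h-𝟚 : pow 𝟚 h ≡ 𝟚
  pow-h-𝟚 = trans (pow-h 𝟚) (trans (cong (𝟚 ⊗_) character-𝟚) (*-identityʳ 𝟚))

  -- A nonresidue of F_q and the constants ι and δ built from it

  norm-character : ∀ {x} → x ≢ 𝟘 → pow (x ⊗ conj x) j ≡ 𝟙 ⊎ pow (x ⊗ conj x) j ≡ ⊖ 𝟙
  norm-character {x} n = character-values (Fq-norm x) (⊗-nonzero n (conj-nonzero n))

  private
    -- This is (q² - 1)/2, so x^m₀ is the quadratic character of F_q at the norm of x.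
    m₀ : ℕ
    m₀ = suc q ℕ.* j

    pow-n : ∀ x → pow x m₀ ≡ pow (x ⊗ conj x) j
    pow-n x = pow-* x (suc q) j

    order≡ : length elements ≡ suc (m₀ ℕ.+ m₀)
    order≡ = trans order (trans (cong (λ z → z ℕ.* z) q≡1+2j) (trans (arith j) (cong (λ z → suc (suc z ℕ.* j ℕ.+ suc z ℕ.* j)) (sym q≡1+2j))))
      where
      arith : ∀ j → suc (j ℕ.+ j) ℕ.* suc (j ℕ.+ j) ≡ suc (suc (suc (j ℕ.+ j)) ℕ.* j ℕ.+ suc (suc (j ℕ.+ j)) ℕ.* j)
      arith = solve-∀ℕ

  -- Otherwise all 2 m₀ nonzero elements of the field would be roots of X^m₀ - 1.
  non-square-exists : Σ A λ ν → pow (ν ⊗ conj ν) j ≡ ⊖ 𝟙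
  non-square-exists with any? (λ x → pow (x ⊗ conj x) j ≟ ⊖ 𝟙) elements
  ... | yes a = let (x , _ , eq) = find a in x , eq
  ... | no none = ⊥-elim (absurd m₀ refl)
    where
    ys = proj₁ nonzero-elements
    roots : ∀ {m} → m₀ ≡ suc m → All (λ x → pow x (suc m) ⊕ ⊖ 𝟙 ≡ 𝟘) ys
    roots {m} eq = All.map root (proj₁ (proj₂ (proj₂ nonzero-elements)))
      where
      root : ∀ {x} → x ≢ 𝟘 → pow x (suc m) ⊕ ⊖ 𝟙 ≡ 𝟘
      root {x} x≢ = [ (λ pos → trans (cong (_⊕ ⊖ 𝟙) (trans (cong (pow x) (sym eq)) (trans (pow-n x) pos))) (-‿inverseʳ 𝟙))
        , (λ neg → ⊥-elim (none (lose (complete x) neg))) ]′ (norm-character x≢)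
    ys-length : length ys ≡ m₀ ℕ.+ m₀
    ys-length = ℕ.suc-injective (trans (sym (↭-length (proj₁ (proj₂ nonzero-elements)))) order≡)
    absurd : ∀ m → m₀ ≡ m → ⊥
    absurd zero eq = j≢0 (ℕ.n≤0⇒n≡0 (subst (j ≤_) eq (ℕ.m≤m+n j (q ℕ.* j))))
    absurd (suc m) eq = ℕ.<-irrefl refl (ℕ.≤-trans (ℕ.≤-trans (s≤s (ℕ.m≤n+m (suc m) m)) (ℕ.≤-reflexive (trans (cong (λ z → z ℕ.+ z) (sym eq)) (sym ys-length))))
      (monic-roots (suc m) (pow-minus-one-monic m) (proj₂ (proj₂ (proj₂ nonzero-elements))) (roots eq)))

  ν : A
  ν = proj₁ non-square-exists

  g : A
  g = ν ⊗ conj ν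

  Fq-g : InFq g
  Fq-g = Fq-norm ν

  character-g : pow g j ≡ ⊖ 𝟙
  character-g = proj₂ non-square-exists

  -- A square root of -1: squaring gives g^(2k) = g^j, and g is a nonresidue.
  ι : A
  ι = pow g k

  ι² : ι ⊗ ι ≡ ⊖ 𝟙
  ι² = trans (sym (pow-+ g k k)) character-g

  Fq-ι : InFq ι
  Fq-ι = Fq-pow k Fq-g

  -- A square root of the nonresidue g of F_q. Conjugation negates it, so 1 and δ form a basis over
  -- F_q.
  δ : A
  δ = pow ν h

  δ² : δ ⊗ δ ≡ g
  δ² = pow-h² ν

  conj-δ : conj δ ≡ ⊖ δ
  conj-δ = linear (δ ∷ conj δ ∷ pow δ j ∷ pow (δ ⊗ δ) j ∷ pow g j ∷ []) (λ d cd a b c → cd := :- d ⊣ # 1 ∙ cd := d :* (a :* a) ⊞ :- d ∙ b := a :* a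
      ⊞ d ∙ b := c ⊞ d ∙ c := :- # 1 ⊞ []) (pow-q δ , pow-⊗ δ δ j , cong (λ z → pow z j) δ² , character-g , tt) refl

  δ≢𝟘 : δ ≢ 𝟘
  δ≢𝟘 z = ⊖𝟙≢𝟘 (trans (sym character-g) (pow-zero j≢0 (trans (sym δ²) (trans (cong (_⊗ δ) z) (zeroˡ δ)))))

  g≢𝟘 : g ≢ 𝟘
  g≢𝟘 z = ⊗-nonzero δ≢𝟘 δ≢𝟘 (trans δ² z)

  ι≢𝟘 : ι ≢ 𝟘
  ι≢𝟘 z = ⊖𝟙≢𝟘 (trans (sym ι²) (trans (cong (_⊗ ι) z) (zeroˡ ι)))

  1+ι≢𝟘 : 𝟙 ⊕ ι ≢ 𝟘
  1+ι≢𝟘 z = 𝟚≢𝟘 (linear (ι ∷ []) (λ i → # 1 :+ # 1 := # 0 ⊣ :- i :+ # 1 ∙ # 1 :+ i := # 0 ⊞ # 1 ∙ i :* i := :- # 1 ⊞ []) (z , ι² , tt) refl)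

  1-ι≢𝟘 : 𝟙 ⊕ ⊖ ι ≢ 𝟘
  1-ι≢𝟘 z = 𝟚≢𝟘 (linear (ι ∷ []) (λ i → # 1 :+ # 1 := # 0 ⊣ i :+ # 1 ∙ # 1 :- i := # 0 ⊞ # 1 ∙ i :* i := :- # 1 ⊞ []) (z , ι² , tt) refl)

  -- From 2 = -ι (1 + ι)², where 2 and -1 are squares in F_q.
  character-ι : pow ι j ≡ 𝟙
  character-ι = linear (pow ι j ∷ pow ((𝟙 ⊕ ι) ⊗ (𝟙 ⊕ ι)) j ∷ pow (ι ⊗ ((𝟙 ⊕ ι) ⊗ (𝟙 ⊕ ι))) j ∷ pow 𝟚 j ∷ pow (⊖ 𝟚) j ∷ []) (λ a b c d e → a := # 1 ⊣ :- # 1 ∙ c := a :* b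
      ⊞ :- a ∙ b := # 1 ⊞ # 1 ∙ c := e ⊞ # 1 ∙ e := d ⊞ # 1 ∙ d := # 1 ⊞ []) (pow-⊗ ι ((𝟙 ⊕ ι) ⊗ (𝟙 ⊕ ι)) j , character-of-square (Fq-⊕ Fq-𝟙 Fq-ι) 1+ι≢𝟘 , cong (λ z → pow z j) (linear (ι ∷ []) (λ i → i :* ((# 1 :+ i) :* (# 1 :+ i)) := :- # 2 ⊣ i :+ # 2 ∙ i :* i := :- # 1 ⊞ []) (ι² , tt) refl) , character-⊖ 𝟚 , character-𝟚 , tt) refl

  Fq : List A
  Fq = filter (λ x → conj x ≟ x) elements

  Fq-unique : Unique Fq
  Fq-unique = filter-unique (λ x → conj x ≟ x) unique

  ∈Fq : ∀ {x} → InFq x → x ∈ Fq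
  ∈Fq {x} a = ∈-filter⁺ (λ x → conj x ≟ x) (complete x) a

  Fq∋ : ∀ {x} → x ∈ Fq → InFq x
  Fq∋ m = proj₂ (∈-filter⁻ (λ x → conj x ≟ x) {xs = elements} m)

  Fq-bijection : (f f′ : A → A) → (∀ {x} → InFq x → InFq (f x) × f′ (f x) ≡ x) → (∀ {x} → InFq x → InFq (f′ x) × f (f′ x) ≡ x) →
    ∀ w → ∑ Fq (w ∘ f) ≡ ∑ Fq w
  Fq-bijection f f′ to from = ∑-bijection Fq-unique Fq-unique f′
    (λ m → let (a , b) = to (Fq∋ m) in ∈Fq a , b) (λ m → let (a , b) = from (Fq∋ m) in ∈Fq a , b)

  conj-inv-δ : conj (inv δ) ≡ ⊖ inv δ
  conj-inv-δ = linear (inv δ ∷ δ ∷ conj δ ∷ conj (inv δ) ∷ []) (λ w d cd cw → cw := :- w ⊣ :- cw ∙ w :* d := # 1 ⊞ :- w ∙ cd :* cw := # 1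
      ⊞ w :* cw ∙ cd := :- d ⊞ []) (inverseˡ δ δ≢𝟘 , conj-inv δ≢𝟘 , conj-δ , tt) refl

  -- The element is the coefficient of δ when x is written in the basis 1, δ.
  Fq-imaginary : ∀ x → InFq (half ⊗ inv δ ⊗ (x ⊕ ⊖ conj x))
  Fq-imaginary x = trans (trans (conj-⊗ (half ⊗ inv δ) _) (cong₂ _⊗_ (trans (conj-⊗ half (inv δ)) (cong₂ _⊗_ Fq-half conj-inv-δ))
    (trans (conj-⊝ x (conj x)) (cong (λ z → conj x ⊕ ⊖ z) (conj-conj x)))))
    (solve 4 (λ x w c f → f :* :- w :* (c :- x) := f :* w :* (x :- c)) refl x (inv δ) (conj x) half)

  -- F = F_q ⊕ F_q δ.
  Fq-order : length Fq ≡ q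
  Fq-order = square-injective (ℤ.+-injective (begin
    + (length Fq ℕ.* length Fq)                         ≡⟨ ℤ.pos-* (length Fq) (length Fq) ⟩
    + length Fq ℤ.* + length Fq                         ≡⟨ cong (λ z → + length Fq ℤ.* z) (sym (∑-one Fq)) ⟩
    + length Fq ℤ.* ∑ Fq (λ _ → + 1)                    ≡⟨ sym (∑-* (+ length Fq) (λ _ → + 1) Fq) ⟩
    ∑ Fq (λ _ → + length Fq ℤ.* + 1)                    ≡⟨ ∑-cong Fq (λ _ → trans (ℤ.*-identityʳ _) (sym (∑-one Fq))) ⟩
    ∑ Fq (λ _ → ∑ Fq (λ _ → + 1))                       ≡⟨ sym (∑-cartesianProduct (λ _ → + 1) Fq Fq) ⟩
    ∑ (cartesianProduct Fq Fq) (λ _ → + 1)              ≡⟨ ∑-bijection (cartesianProduct-unique Fq-unique Fq-unique) unique split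
                                                             to from (λ _ → + 1) ⟩
    ∑ elements (λ _ → + 1)                              ≡⟨ ∑-one elements ⟩
    + length elements                                   ≡⟨ cong +_ order ⟩
    + (q ℕ.* q)                                         ∎))
    where
    open ≡-Reasoning
    square-injective : ∀ {m n} → m ℕ.* m ≡ n ℕ.* n → m ≡ n
    square-injective {m} {n} eq with ℕ.<-cmp m n
    ... | tri≈ _ b _ = b
    ... | tri< a _ _ = ⊥-elim (ℕ.<-irrefl eq (ℕ.*-mono-< a a))
    ... | tri> _ _ c = ⊥-elim (ℕ.<-irrefl (sym eq) (ℕ.*-mono-< c c))
    join : A × A → A
    join (r , s) = r ⊕ s ⊗ δ
    w = inv δ
    split : A → A × A
    split x = half ⊗ (x ⊕ conj x) , half ⊗ w ⊗ (x ⊕ ⊖ conj x)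
    wδ : w ⊗ δ ≡ 𝟙
    wδ = inverseˡ δ δ≢𝟘
    to : ∀ {x} → x ∈ cartesianProduct Fq Fq → join x ∈ elements × split (join x) ≡ x
    to {r , s} m with ∈-cartesianProduct⁻ Fq Fq m
    ... | mr , ms = complete _ , cong₂ _,_
        (linear (r ∷ s ∷ δ ∷ conj (r ⊕ s ⊗ δ) ∷ half ∷ []) (λ r s d c f → f :* (r :+ s :* d :+ c) := r ⊣ :- f :+ # 1 ∙ c := r :- s :* d
            ⊞ s :* d :+ c ∙ # 2 :* f := # 1 ⊞ []) (c-join , 2half , tt) refl)
        (linear (r ∷ s ∷ w ∷ δ ∷ conj (r ⊕ s ⊗ δ) ∷ half ∷ []) (λ r s w d c f → f :* w :* (r :+ s :* d :- c) := s ⊣ :- (w :* f) ∙ c := r :- s :* d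
            ⊞ s :* w :* d ∙ # 2 :* f := # 1 ⊞ s ∙ w :* d := # 1 ⊞ []) (c-join , 2half , wδ , tt) refl)
      where
      c-join : conj (r ⊕ s ⊗ δ) ≡ r ⊕ ⊖ (s ⊗ δ)
      c-join = trans (conj-⊕ r (s ⊗ δ)) (trans (cong₂ _⊕_ (Fq∋ mr) (trans (conj-⊗ s δ) (cong₂ _⊗_ (Fq∋ ms) conj-δ)))
        (solve 3 (λ r s d → r :+ s :* :- d := r :- s :* d) refl r s δ))
    from : ∀ {x} → x ∈ elements → split x ∈ cartesianProduct Fq Fq × join (split x) ≡ x
    from {x} _ = ∈-cartesianProduct⁺ (∈Fq (Fq-⊗ Fq-half (Fq-trace x))) (∈Fq (Fq-imaginary x))
      , linear (x ∷ w ∷ conj x ∷ δ ∷ half ∷ []) (λ x w c d f → f :* (x :+ c) :+ f :* w :* (x :- c) :* d := x ⊣ x ∙ # 2 :* f := # 1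
          ⊞ x :* f :- (c :* f) ∙ w :* d := # 1 ⊞ []) (2half , wδ , tt) refl

  -- The quadratic character of F_q, with integer values

  ψ : A → ℤ
  ψ c with c ≟ 𝟘
  ... | yes _ = + 0
  ... | no _ with pow c j ≟ 𝟙
  ...   | yes _ = + 1
  ...   | no _ = -[1+ 0 ]

  data CharacterView (c : A) : Set where
    is-zero : c ≡ 𝟘 → ψ c ≡ + 0 → CharacterView c
    is-residue : c ≢ 𝟘 → pow c j ≡ 𝟙 → ψ c ≡ + 1 → CharacterView c
    is-nonresidue : c ≢ 𝟘 → pow c j ≡ ⊖ 𝟙 → ψ c ≡ -[1+ 0 ] → CharacterView c

  ψ-zero : ∀ {c} → c ≡ 𝟘 → ψ c ≡ + 0
  ψ-zero {c} z with c ≟ 𝟘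
  ... | yes _ = refl
  ... | no n = ⊥-elim (n z)

  ψ-residue : ∀ {c} → pow c j ≡ 𝟙 → ψ c ≡ + 1
  ψ-residue {c} eq with c ≟ 𝟘
  ... | yes z = ⊥-elim (𝟘≢𝟙 (trans (sym (pow-zero j≢0 z)) eq))
  ... | no n with pow c j ≟ 𝟙
  ...   | yes _ = refl
  ...   | no m = ⊥-elim (m eq)

  ψ-nonresidue : ∀ {c} → pow c j ≡ ⊖ 𝟙 → ψ c ≡ -[1+ 0 ]
  ψ-nonresidue {c} eq with c ≟ 𝟘
  ... | yes z = ⊥-elim (⊖𝟙≢𝟘 (trans (sym eq) (pow-zero j≢0 z)))
  ... | no n with pow c j ≟ 𝟙
  ...   | yes m = ⊥-elim (⊖𝟙≢𝟙 (trans (sym eq) m))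
  ...   | no _ = refl

  character-view : ∀ {c} → InFq c → CharacterView c
  character-view {c} a = go (c ≟ 𝟘)
    where
    go : Dec (c ≡ 𝟘) → CharacterView c
    go (yes z) = is-zero z (ψ-zero z)
    go (no n) = [ (λ eq → is-residue n eq (ψ-residue eq)) , (λ eq → is-nonresidue n eq (ψ-nonresidue eq)) ]′ (character-values a n)

  ψ-⊗ : ∀ {c d} → InFq c → InFq d → ψ (c ⊗ d) ≡ ψ c ℤ.* ψ d
  ψ-⊗ {c} {d} a b with character-view a | character-view b
  ... | is-zero z e | _ rewrite e = ψ-zero (trans (cong (_⊗ d) z) (zeroˡ d))
  ... | is-residue _ x e | is-zero z e' rewrite e | e' = ψ-zero (trans (cong (c ⊗_) z) (zeroʳ c))
  ... | is-nonresidue _ x e | is-zero z e' rewrite e | e' = ψ-zero (trans (cong (c ⊗_) z) (zeroʳ c))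
  ... | is-residue _ x e | is-residue _ y e' rewrite e | e' =
        ψ-residue (trans (pow-⊗ c d j) (trans (cong₂ _⊗_ x y) (*-identityˡ 𝟙)))
  ... | is-residue _ x e | is-nonresidue _ y e' rewrite e | e' =
        ψ-nonresidue (trans (pow-⊗ c d j) (trans (cong₂ _⊗_ x y) (*-identityˡ (⊖ 𝟙))))
  ... | is-nonresidue _ x e | is-residue _ y e' rewrite e | e' =
        ψ-nonresidue (trans (pow-⊗ c d j) (trans (cong₂ _⊗_ x y) (*-identityʳ (⊖ 𝟙))))
  ... | is-nonresidue _ x e | is-nonresidue _ y e' rewrite e | e' =
        ψ-residue (trans (pow-⊗ c d j) (trans (cong₂ _⊗_ x y) ⊖𝟙-square))

  -- Multiplication by the nonresidue g permutes F_q and negates every value of ψ.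
  ∑ψ : ∑ Fq ψ ≡ + 0
  ∑ψ = self-negative (begin
    ∑ Fq ψ                          ≡⟨ sym (Fq-bijection (g ⊗_) (inv g ⊗_)
                                        (λ {x} a → Fq-⊗ Fq-g a , linear (x ∷ g ∷ inv g ∷ []) (λ x g w → w :* (g :* x) := x ⊣ x ∙ g :* w := # 1 ⊞ []) (inverseʳ g g≢𝟘 , tt) refl)
                                        (λ {x} a → Fq-⊗ (Fq-inv g≢𝟘 Fq-g) a , linear (x ∷ g ∷ inv g ∷ []) (λ x g w → g :* (w :* x) := x ⊣ x ∙ g :* w := # 1 ⊞ []) (inverseʳ g g≢𝟘 , tt) refl) ψ) ⟩
    ∑ Fq (λ x → ψ (g ⊗ x))          ≡⟨ ∑-cong Fq (λ {x} m → trans (ψ-⊗ Fq-g (Fq∋ m)) (cong (ℤ._* ψ x) (ψ-nonresidue character-g))) ⟩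
    ∑ Fq (λ x → -[1+ 0 ] ℤ.* ψ x)   ≡⟨ ∑-* -[1+ 0 ] ψ Fq ⟩
    -[1+ 0 ] ℤ.* ∑ Fq ψ             ∎)
    where
    open ≡-Reasoning
    self-negative : ∀ {s} → s ≡ -[1+ 0 ] ℤ.* s → s ≡ + 0
    self-negative {+ zero} eq = refl
    self-negative {+ suc n} ()
    self-negative { -[1+ n ]} ()

  -- Both sides sum to q over c ∈ F_q, and ≤ holds termwise.
  roots-count : ∀ {c} → InFq c → ∑ Fq (λ y → indicator (y ⊗ y ≟ c)) ≡ + 1 ℤ.+ ψ c
  roots-count a = ∑-tight Fq (λ m → bound (Fq∋ m)) total (∈Fq a)
    where
    open ≡-Reasoning
    total : ∑ Fq (λ c → ∑ Fq (λ y → indicator (y ⊗ y ≟ c))) ≡ ∑ Fq (λ c → + 1 ℤ.+ ψ c)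
    total = begin
      ∑ Fq (λ c → ∑ Fq (λ y → indicator (y ⊗ y ≟ c)))   ≡⟨ ∑-swap (λ c y → indicator (y ⊗ y ≟ c)) Fq Fq ⟩
      ∑ Fq (λ y → ∑ Fq (λ c → indicator (y ⊗ y ≟ c)))   ≡⟨ ∑-cong Fq (λ {y} m → trans (∑-single Fq-unique (∈Fq (Fq-⊗ (Fq∋ m) (Fq∋ m)))
                                                            (λ _ n → indicator-no (_ ≟ _) (n ∘ sym))) (indicator-yes (y ⊗ y ≟ y ⊗ y) refl)) ⟩
      ∑ Fq (λ _ → + 1)                                  ≡⟨ sym (ℤ.+-identityʳ _) ⟩
      ∑ Fq (λ _ → + 1) ℤ.+ + 0                          ≡⟨ cong (λ z → ∑ Fq (λ _ → + 1) ℤ.+ z) (sym ∑ψ) ⟩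
      ∑ Fq (λ _ → + 1) ℤ.+ ∑ Fq ψ                       ≡⟨ sym (∑-+ (λ _ → + 1) ψ Fq) ⟩
      ∑ Fq (λ c → + 1 ℤ.+ ψ c)                          ∎
    bound : ∀ {c} → InFq c → ∑ Fq (λ y → indicator (y ⊗ y ≟ c)) ℤ.≤ + 1 ℤ.+ ψ c
    bound {c} a with character-view a
    ... | is-zero refl e rewrite e = ℤ.≤-reflexive (trans (∑-single Fq-unique (∈Fq Fq-𝟘)
            (λ _ n → indicator-no (_ ≟ _) (n ∘ square-zero))) (indicator-yes (𝟘 ⊗ 𝟘 ≟ 𝟘) (zeroˡ 𝟘)))
    ... | is-nonresidue n x e rewrite e = ℤ.≤-reflexive (∑-zero Fq (λ {y} m → indicator-no (_ ≟ _) (λ eq →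
            ⊖𝟙≢𝟙 (trans (sym x) (trans (cong (λ z → pow z j) (sym eq)) (character-of-square (Fq∋ m) (λ z → n (trans (sym eq) (trans (cong (_⊗ y) z) (zeroˡ y))))))))))
    ... | is-residue n x e with any? (λ y → y ⊗ y ≟ c) Fq
    -- Only an upper bound is claimed here, so a residue without a root does no harm; the comparison
    -- of the totals excludes it afterwards.
    ...   | no none rewrite e = ℤ.≤-trans (ℤ.≤-reflexive (∑-zero Fq (λ m → indicator-no (_ ≟ _) (λ eq → none (lose m eq))))) (ℤ.+≤+ z≤n)
    ...   | yes some rewrite e with find some
    ...     | s , ms , eq = ℤ.≤-trans (∑-mono Fq two-roots) (ℤ.≤-reflexive (trans (∑-+ (λ y → indicator (y ≟ s)) (λ y → indicator (y ≟ ⊖ s)) Fq)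
                (cong₂ ℤ._+_ (delta ms) (delta (∈Fq (Fq-⊖ (Fq∋ ms)))))))
            where
            delta : ∀ {t} → t ∈ Fq → ∑ Fq (λ y → indicator (y ≟ t)) ≡ + 1
            delta {t} m = trans (∑-single Fq-unique m (λ _ n → indicator-no (_ ≟ _) n)) (indicator-yes (t ≟ t) refl)
            two-roots : ∀ {y} → y ∈ Fq → indicator (y ⊗ y ≟ c) ℤ.≤ indicator (y ≟ s) ℤ.+ indicator (y ≟ ⊖ s)
            two-roots {y} _ with y ⊗ y ≟ c | y ≟ s | y ≟ ⊖ s
            ... | no _ | yes _ | yes _ = ℤ.+≤+ z≤n
            ... | no _ | yes _ | no _ = ℤ.+≤+ z≤n
            ... | no _ | no _ | yes _ = ℤ.+≤+ z≤n
            ... | no _ | no _ | no _ = ℤ.+≤+ z≤n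
            ... | yes _ | yes _ | yes _ = ℤ.+≤+ (s≤s z≤n)
            ... | yes _ | yes _ | no _ = ℤ.≤-refl
            ... | yes _ | no _ | yes _ = ℤ.≤-refl
            ... | yes eq' | no n₁ | no n₂ = [ ⊥-elim ∘ n₁ , ⊥-elim ∘ n₂ ]′ (square-roots (trans eq' (sym eq)))

  -- By `roots-count` a residue has 1 + 1 roots, so the search through F_q cannot fail.
  residue⇒square : ∀ {c} → InFq c → pow c j ≡ 𝟙 → Σ A λ s → InFq s × s ⊗ s ≡ c
  residue⇒square {c} a x with any? (λ y → y ⊗ y ≟ c) Fq
  ... | yes some = let (s , m , eq) = find some in s , Fq∋ m , eq
  ... | no none = ⊥-elim (0≢2 (trans (sym (∑-zero Fq (λ {y} m → indicator-no (y ⊗ y ≟ c) (λ eq → none (lose m eq))))) (trans (roots-count a) (cong (λ z → + 1 ℤ.+ z) (ψ-residue x)))))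
    where
    0≢2 : + 0 ≢ + 2
    0≢2 ()

  -- Division with the convention 1/0 = 0, an involution.
  inv₀ : A → A
  inv₀ x with x ≟ 𝟘
  ... | yes _ = 𝟘
  ... | no _ = inv x

  inv₀-zero : ∀ {x} → x ≡ 𝟘 → inv₀ x ≡ 𝟘
  inv₀-zero {x} z with x ≟ 𝟘
  ... | yes _ = refl
  ... | no n = ⊥-elim (n z)

  inv₀-nonzero : ∀ {x} → x ≢ 𝟘 → x ⊗ inv₀ x ≡ 𝟙
  inv₀-nonzero {x} n with x ≟ 𝟘
  ... | yes z = ⊥-elim (n z)
  ... | no _ = inverseʳ x n

  Fq-inv₀ : ∀ {x} → InFq x → InFq (inv₀ x)
  Fq-inv₀ {x} a with x ≟ 𝟘
  ... | yes _ = Fq-𝟘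
  ... | no n = Fq-inv n a

  inv₀-involutive : ∀ x → inv₀ (inv₀ x) ≡ x
  inv₀-involutive x with x ≟ 𝟘
  ... | yes z = trans (inv₀-zero refl) (sym z)
  ... | no n = ⊗-cancelˡ {inv x} (inv-nonzero n) (trans (inv₀-nonzero (inv-nonzero n)) (sym (inverseˡ x n)))

  -- For x ≠ 0 one has x(x + c) = x²(1 + c/x), and with 1/0 = 0 the map x ↦ 1 + c/x permutes F_q.
  -- The full sum of ψ is 0; the term ψ(1) = 1 at x = 0 has to be taken away.
  ∑ψ-quadratic : ∀ {c} → InFq c → c ≢ 𝟘 → ∑ Fq (λ x → ψ (x ⊗ (x ⊕ c))) ≡ -[1+ 0 ]
  ∑ψ-quadratic {c} a n = begin
    ∑ Fq (λ x → ψ (x ⊗ (x ⊕ c)))                                        ≡⟨ ∑-cong Fq (λ m → pointwise (Fq∋ m)) ⟩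
    ∑ Fq (λ x → ψ (𝟙 ⊕ c ⊗ inv₀ x) ℤ.+ -[1+ 0 ] ℤ.* indicator (x ≟ 𝟘))  ≡⟨ ∑-+ _ _ Fq ⟩
    ∑ Fq (λ x → ψ (𝟙 ⊕ c ⊗ inv₀ x)) ℤ.+ ∑ Fq (λ x → -[1+ 0 ] ℤ.* indicator (x ≟ 𝟘))
      ≡⟨ cong₂ ℤ._+_ (trans (Fq-bijection (λ x → 𝟙 ⊕ c ⊗ inv₀ x) (λ y → inv₀ (inv c ⊗ (y ⊕ ⊖ 𝟙))) to from ψ) ∑ψ)
                     (trans (∑-* -[1+ 0 ] _ Fq) (cong (-[1+ 0 ] ℤ.*_) (trans (∑-single Fq-unique (∈Fq Fq-𝟘) (λ _ n → indicator-no (_ ≟ 𝟘) n)) (indicator-yes (𝟘 ≟ 𝟘) refl)))) ⟩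
    -[1+ 0 ] ∎
    where
    open ≡-Reasoning
    w = inv c
    to : ∀ {x} → InFq x → InFq (𝟙 ⊕ c ⊗ inv₀ x) × inv₀ (inv c ⊗ (𝟙 ⊕ c ⊗ inv₀ x ⊕ ⊖ 𝟙)) ≡ x
    to {x} b = Fq-⊕ Fq-𝟙 (Fq-⊗ a (Fq-inv₀ b)) ,
      trans (cong inv₀ (linear (c ∷ w ∷ inv₀ x ∷ []) (λ c w u → w :* (# 1 :+ c :* u :- # 1) := u ⊣ u ∙ c :* w := # 1 ⊞ []) (inverseʳ c n , tt) refl)) (inv₀-involutive x)
    from : ∀ {y} → InFq y → InFq (inv₀ (inv c ⊗ (y ⊕ ⊖ 𝟙))) × 𝟙 ⊕ c ⊗ inv₀ (inv₀ (inv c ⊗ (y ⊕ ⊖ 𝟙))) ≡ y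
    from {y} b = Fq-inv₀ (Fq-⊗ (Fq-inv n a) (Fq-⊕ b (Fq-⊖ Fq-𝟙))) ,
      trans (cong (λ z → 𝟙 ⊕ c ⊗ z) (inv₀-involutive _)) (linear (c ∷ w ∷ y ∷ []) (λ c w y → # 1 :+ c :* (w :* (y :- # 1)) := y ⊣ y :- # 1 ∙ c :* w := # 1 ⊞ []) (inverseʳ c n , tt) refl)
    pointwise : ∀ {x} → InFq x → ψ (x ⊗ (x ⊕ c)) ≡ ψ (𝟙 ⊕ c ⊗ inv₀ x) ℤ.+ -[1+ 0 ] ℤ.* indicator (x ≟ 𝟘)
    pointwise {x} b with x ≟ 𝟘
    ... | yes z = trans (ψ-zero (trans (cong (_⊗ (x ⊕ c)) z) (zeroˡ _)))
          (cong (λ t → t ℤ.+ -[1+ 0 ]) (sym (ψ-residue (trans (cong (λ t → pow t j) (trans (cong (𝟙 ⊕_) (zeroʳ c)) (+-identityʳ 𝟙))) (pow-𝟙 j)))))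
    ... | no x≢ = begin
          ψ (x ⊗ (x ⊕ c))                     ≡⟨ cong ψ (linear (x ∷ c ∷ inv x ∷ []) (λ x c u → x :* (x :+ c) := x :* x :* (# 1 :+ c :* u) ⊣ :- (x :* c) ∙ x :* u := # 1 ⊞ []) (inverseʳ x x≢ , tt) refl) ⟩
          ψ (x ⊗ x ⊗ (𝟙 ⊕ c ⊗ inv x))         ≡⟨ ψ-⊗ (Fq-⊗ b b) (Fq-⊕ Fq-𝟙 (Fq-⊗ a (Fq-inv x≢ b))) ⟩
          ψ (x ⊗ x) ℤ.* ψ (𝟙 ⊕ c ⊗ inv x)     ≡⟨ cong (ℤ._* ψ (𝟙 ⊕ c ⊗ inv x)) (ψ-residue (character-of-square b x≢)) ⟩
          + 1 ℤ.* ψ (𝟙 ⊕ c ⊗ inv x)           ≡⟨ ℤ.*-identityˡ _ ⟩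
          ψ (𝟙 ⊕ c ⊗ inv x)                   ≡⟨ sym (ℤ.+-identityʳ _) ⟩
          ψ (𝟙 ⊕ c ⊗ inv x) ℤ.+ + 0           ∎

  -- Φ consists of the non-squares of the group of elements of norm 1.
  Φ? : (φ : A) → Dec (pow φ h ≡ ⊖ 𝟙)
  Φ? φ = pow φ h ≟ ⊖ 𝟙

  Φ : List A
  Φ = filter Φ? elements

  Φ-unique : Unique Φ
  Φ-unique = filter-unique Φ? unique

  Φ∋ : ∀ {φ} → φ ∈ Φ → pow φ h ≡ ⊖ 𝟙
  Φ∋ m = proj₂ (∈-filter⁻ Φ? {xs = elements} m)

  ∈Φ : ∀ {φ} → pow φ h ≡ ⊖ 𝟙 → φ ∈ Φ
  ∈Φ = ∈-filter⁺ Φ? (complete _)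

  tr : A → A
  tr φ = φ ⊕ conj φ

  Φ-norm : ∀ {φ} → pow φ h ≡ ⊖ 𝟙 → φ ⊗ conj φ ≡ 𝟙
  Φ-norm {φ} eq = trans (sym (pow-h² φ)) (trans (cong₂ _⊗_ eq eq) ⊖𝟙-square)

  -- Since (1 + φ)² = φ (T + 2) and 1 + φ has norm T + 2, where T is the trace of φ.
  norm-one-character : ∀ {φ} → φ ⊗ conj φ ≡ 𝟙 → tr φ ⊕ 𝟚 ≢ 𝟘 → pow φ h ⊗ pow (tr φ ⊕ 𝟚) j ≡ 𝟙
  norm-one-character {φ} nm n = ⊗-cancelˡ n (linear (φ ∷ conj φ ∷ pow φ h ∷ pow (𝟙 ⊕ φ) h ∷ pow ((𝟙 ⊕ φ) ⊗ (𝟙 ⊕ φ)) h ∷ conj (𝟙 ⊕ φ) ∷ pow (φ ⊗ (φ ⊕ conj φ ⊕ 𝟚)) h ∷ pow (φ ⊕ conj φ ⊕ 𝟚) h ∷ pow (φ ⊕ conj φ ⊕ 𝟚) j ∷ conj 𝟙 ∷ []) (λ φ c ph u v w z y x o → (φ :+ c :+ # 2) :* (ph :* x) := (φ :+ c :+ # 2) :* # 1 ⊣ # 1 ∙ v := u :* u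
      ⊞ # 1 ∙ u :* u := (# 1 :+ φ) :* w ⊞ φ :+ # 1 ∙ w := o :+ c ⊞ φ :+ # 1 ∙ o := # 1 ⊞ :- # 1 ∙ v := z ⊞ :- # 1 ∙ z := ph :* y
      ⊞ :- ph ∙ y := (φ :+ c :+ # 2) :* x ⊞ # 1 ∙ φ :* c := # 1 ⊞ []) (pow-⊗ (𝟙 ⊕ φ) (𝟙 ⊕ φ) h , pow-h² (𝟙 ⊕ φ) , conj-⊕ 𝟙 φ , conj-𝟙 , cong (λ t → pow t h) (linear (φ ∷ conj φ ∷ []) (λ φ c → (# 1 :+ φ) :* (# 1 :+ φ) := φ :* (φ :+ c :+ # 2) ⊣ :- # 1 ∙ φ :* c := # 1 ⊞ []) (nm , tt) refl) , pow-⊗ φ (φ ⊕ conj φ ⊕ 𝟚) h , pow-h (φ ⊕ conj φ ⊕ 𝟚) , nm , tt) refl)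

  fibre : A → ℤ
  fibre T = ∑ Φ (λ φ → indicator (tr φ ≟ T))

  -- For ψ(T + 2) = -1 the fibre is {T/2 + sδ : s² = (T² - 4)/(4δ²)}.
  fibre-nonresidue : ∀ {T} → InFq T → pow (T ⊕ 𝟚) j ≡ ⊖ 𝟙 → fibre T ≡ + 1 ℤ.+ ℤ.- ψ (T ⊗ T ⊕ ⊖ (𝟚 ⊗ 𝟚))
  fibre-nonresidue {T} a x = begin
    fibre T                                                    ≡⟨ sym (length-filter _ Φ) ⟩
    + length (filter (λ φ → tr φ ≟ T) Φ)                       ≡⟨ cong +_ (bijection⇒length (filter-unique _ Φ-unique) (filter-unique _ Fq-unique) back to from) ⟩
    + length (filter (λ s → s ⊗ s ≟ w) Fq)                     ≡⟨ length-filter _ Fq ⟩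
    ∑ Fq (λ s → indicator (s ⊗ s ≟ w))                         ≡⟨ roots-count Fq-w ⟩
    + 1 ℤ.+ ψ w                                                ≡⟨ cong (λ z → + 1 ℤ.+ z) (sym (trans (cong ℤ.-_ ψw) (trans (cong ℤ.-_ (ℤ.-1*i≡-i (ψ w))) (ℤ.neg-involutive (ψ w))))) ⟩
    + 1 ℤ.+ ℤ.- ψ (T ⊗ T ⊕ ⊖ (𝟚 ⊗ 𝟚))                          ∎
    where
    open ≡-Reasoning
    d = inv δ
    dδ : d ⊗ δ ≡ 𝟙
    dδ = inverseˡ δ δ≢𝟘
    Fq-dd : InFq (d ⊗ d)
    Fq-dd = trans (conj-⊗ d d) (trans (cong₂ _⊗_ conj-inv-δ conj-inv-δ) (solve 1 (λ d → :- d :* :- d := d :* d) refl d))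
    w : A
    w = (T ⊗ T ⊕ ⊖ (𝟚 ⊗ 𝟚)) ⊗ (half ⊗ half ⊗ (d ⊗ d))
    Fq-T²-4 : InFq (T ⊗ T ⊕ ⊖ (𝟚 ⊗ 𝟚))
    Fq-T²-4 = Fq-⊕ (Fq-⊗ a a) (Fq-⊖ (Fq-⊗ Fq-𝟚 Fq-𝟚))
    Fq-w : InFq w
    Fq-w = Fq-⊗ Fq-T²-4 (Fq-⊗ (Fq-⊗ Fq-half Fq-half) Fq-dd)
    ψw : ψ (T ⊗ T ⊕ ⊖ (𝟚 ⊗ 𝟚)) ≡ -[1+ 0 ] ℤ.* ψ w
    ψw = begin
      ψ (T ⊗ T ⊕ ⊖ (𝟚 ⊗ 𝟚))               ≡⟨ cong ψ (linear (T ∷ d ∷ half ∷ δ ∷ []) (λ T d f δ → T :* T :- # 2 :* # 2 := δ :* δ :* (# 2 :* # 2 :* ((T :* T :- # 2 :* # 2) :* (f :* f :* (d :* d)))) ⊣ :- (# 2 :* T :* T :* d :* d :* f :* δ :* δ) :- (T :* T :* d :* d :* δ :* δ) :+ # 8 :* d :* d :* f :* δ :* δ :+ # 4 :* d :* d :* δ :* δ ∙ # 2 :* f := # 1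
          ⊞ :- (T :* T :* d :* δ) :- (T :* T) :+ # 4 :* d :* δ :+ # 4 ∙ d :* δ := # 1 ⊞ []) (2half , dδ , tt) refl) ⟩
      ψ (δ ⊗ δ ⊗ (𝟚 ⊗ 𝟚 ⊗ w))             ≡⟨ ψ-⊗ (subst InFq (sym δ²) Fq-g) (Fq-⊗ (Fq-⊗ Fq-𝟚 Fq-𝟚) Fq-w) ⟩
      ψ (δ ⊗ δ) ℤ.* ψ (𝟚 ⊗ 𝟚 ⊗ w)         ≡⟨ cong₂ ℤ._*_ (ψ-nonresidue (trans (cong (λ z → pow z j) δ²) character-g)) (ψ-⊗ (Fq-⊗ Fq-𝟚 Fq-𝟚) Fq-w) ⟩
      -[1+ 0 ] ℤ.* (ψ (𝟚 ⊗ 𝟚) ℤ.* ψ w)    ≡⟨ cong (λ z → -[1+ 0 ] ℤ.* (z ℤ.* ψ w)) (ψ-residue (character-of-square Fq-𝟚 𝟚≢𝟘)) ⟩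
      -[1+ 0 ] ℤ.* (+ 1 ℤ.* ψ w)          ≡⟨ cong (-[1+ 0 ] ℤ.*_) (ℤ.*-identityˡ (ψ w)) ⟩
      -[1+ 0 ] ℤ.* ψ w                    ∎
    forth back : A → A
    forth φ = half ⊗ d ⊗ (φ ⊕ ⊖ conj φ)
    back s = half ⊗ T ⊕ s ⊗ δ
    to : ∀ {φ} → φ ∈ filter (λ φ → tr φ ≟ T) Φ → forth φ ∈ filter (λ s → s ⊗ s ≟ w) Fq × back (forth φ) ≡ φ
    to {φ} m with ∈-filter⁻ (λ φ → tr φ ≟ T) {xs = Φ} m
    ... | mΦ , eq = ∈-filter⁺ _ (∈Fq (Fq-imaginary φ))
          (linear (φ ∷ d ∷ T ∷ half ∷ conj φ ∷ []) (λ φ d T f c → f :* d :* (φ :- c) :* (f :* d :* (φ :- c)) := (T :* T :- # 2 :* # 2) :* (f :* f :* (d :* d)) ⊣ φ :* d :* d :* f :* f :+ d :* d :* T :* f :* f :+ d :* d :* f :* f :* c ∙ φ :+ c := T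
              ⊞ :- (# 4 :* d :* d :* f :* f) ∙ φ :* c := # 1 ⊞ []) (eq , Φ-norm (Φ∋ mΦ) , tt) refl)
        , linear (φ ∷ d ∷ T ∷ half ∷ conj φ ∷ δ ∷ []) (λ φ d T f c δ → f :* T :+ f :* d :* (φ :- c) :* δ := φ ⊣ d :* f :* δ :- # 1 ∙ φ :+ c := T
            ⊞ T :* f :- (# 2 :* f :* c) ∙ d :* δ := # 1 ⊞ T :- c ∙ # 2 :* f := # 1 ⊞ []) (eq , dδ , 2half , tt) refl
    from : ∀ {s} → s ∈ filter (λ s → s ⊗ s ≟ w) Fq → back s ∈ filter (λ φ → tr φ ≟ T) Φ × forth (back s) ≡ s
    from {s} m with ∈-filter⁻ (λ s → s ⊗ s ≟ w) {xs = Fq} m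
    ... | ms , eq = ∈-filter⁺ _ (∈Φ in-Φ) trace
        , linear (s ∷ T ∷ d ∷ half ∷ δ ∷ conj (back s) ∷ []) (λ s T d f δ c → f :* d :* (f :* T :+ s :* δ :- c) := s ⊣ d :* f :- d ∙ c := f :* T :- s :* δ
            ⊞ s ∙ d :* δ := # 1 ⊞ T :* d :* f :- (d :* c) ∙ # 2 :* f := # 1 ⊞ []) (c-back , dδ , 2half , tt) refl
      where
      c-back : conj (back s) ≡ half ⊗ T ⊕ ⊖ (s ⊗ δ)
      c-back = trans (conj-⊕ (half ⊗ T) (s ⊗ δ)) (trans (cong₂ _⊕_ (Fq-⊗ Fq-half a) (trans (conj-⊗ s δ) (cong₂ _⊗_ (Fq∋ ms) conj-δ)))
        (solve 4 (λ f T s d → f :* T :+ s :* :- d := f :* T :- s :* d) refl half T s δ))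
      trace : tr (back s) ≡ T
      trace = linear (s ∷ T ∷ half ∷ δ ∷ conj (back s) ∷ []) (λ s T f δ c → f :* T :+ s :* δ :+ c := T ⊣ # 1 ∙ c := f :* T :- s :* δ
          ⊞ T ∙ # 2 :* f := # 1 ⊞ []) (c-back , 2half , tt) refl
      norm : back s ⊗ conj (back s) ≡ 𝟙
      norm = linear (s ∷ T ∷ d ∷ half ∷ δ ∷ conj (back s) ∷ []) (λ s T d f δ c → (f :* T :+ s :* δ) :* c := # 1 ⊣ T :* f :+ s :* δ ∙ c := f :* T :- s :* δ
          ⊞ :- (δ :* δ) ∙ s :* s := (T :* T :- # 2 :* # 2) :* (f :* f :* (d :* d))
          ⊞ :- (T :* T :* d :* f :* f :* δ) :- (T :* T :* f :* f) :+ # 4 :* d :* f :* f :* δ :+ # 1 ∙ d :* δ := # 1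
          ⊞ # 2 :* d :* f :* δ :+ d :* δ ∙ # 2 :* f := # 1 ⊞ []) (c-back , eq , dδ , 2half , tt) refl
      T+2≢ : tr (back s) ⊕ 𝟚 ≢ 𝟘
      T+2≢ z = ⊖𝟙≢𝟘 (trans (sym x) (pow-zero j≢0 (trans (cong (_⊕ 𝟚) (sym trace)) z)))
      in-Φ : pow (back s) h ≡ ⊖ 𝟙
      in-Φ = linear (pow (back s) h ∷ pow (tr (back s) ⊕ 𝟚) j ∷ pow (T ⊕ 𝟚) j ∷ []) (λ a b c → a := :- # 1 ⊣ :- # 1 ∙ a :* b := # 1 ⊞ a ∙ b := c
          ⊞ a ∙ c := :- # 1 ⊞ []) (norm-one-character norm T+2≢ , cong (λ t → pow (t ⊕ 𝟚) j) trace , x , tt) refl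

  character-4 : pow (𝟚 ⊗ 𝟚) j ≡ 𝟙
  character-4 = character-of-square Fq-𝟚 𝟚≢𝟘

  Fq-T-2 : ∀ {T} → InFq T → InFq (T ⊕ ⊖ 𝟚)
  Fq-T-2 a = Fq-⊕ a (Fq-⊖ Fq-𝟚)

  ψ-cubic : ∀ {T} → InFq T → ψ (T ⊗ T ⊗ T ⊕ ⊖ (𝟚 ⊗ 𝟚 ⊗ T)) ≡ ψ T ℤ.* ψ (T ⊕ ⊖ 𝟚) ℤ.* ψ (T ⊕ 𝟚)
  ψ-cubic {T} a = trans (cong ψ (solve 1 (λ T → T :* T :* T :- # 2 :* # 2 :* T := T :* (T :- # 2) :* (T :+ # 2)) refl T))
    (trans (ψ-⊗ (Fq-⊗ a (Fq-T-2 a)) (Fq-⊕ a Fq-𝟚)) (cong (ℤ._* ψ (T ⊕ 𝟚)) (ψ-⊗ a (Fq-T-2 a))))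

  -- The correction terms at T = -2, where the fibre is {-1}, cancel.
  fibre-weight : ∀ {T} → InFq T → + 2 ℤ.* (ψ T ℤ.* fibre T) ≡
    (ψ T ℤ.- ψ (T ⊗ (T ⊕ 𝟚))) ℤ.+ (ψ (T ⊗ (T ⊕ ⊖ 𝟚)) ℤ.- ψ (T ⊗ T ⊗ T ⊕ ⊖ (𝟚 ⊗ 𝟚 ⊗ T)))
  -- The right-hand side is ψ(T) (1 - ψ(T + 2)) (1 + ψ(T - 2)) multiplied out; the last two factors
  -- together are twice the size of the fibre.
  fibre-weight {T} a = go (character-view (Fq-⊕ a Fq-𝟚))
    where
    go : CharacterView (T ⊕ 𝟚) → + 2 ℤ.* (ψ T ℤ.* fibre T) ≡
      (ψ T ℤ.- ψ (T ⊗ (T ⊕ 𝟚))) ℤ.+ (ψ (T ⊗ (T ⊕ ⊖ 𝟚)) ℤ.- ψ (T ⊗ T ⊗ T ⊕ ⊖ (𝟚 ⊗ 𝟚 ⊗ T)))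
    go (is-zero z _) = trans (cong₂ (λ u v → + 2 ℤ.* (u ℤ.* v)) ψT fibre≡1)
          (sym (cong₂ ℤ._+_ (cong₂ ℤ._-_ ψT (ψ-zero (trans (cong (T ⊗_) z) (zeroʳ T))))
               (cong₂ ℤ._-_ ψT[T-2] (ψ-zero (linear (T ∷ []) (λ T → T :* T :* T :- # 2 :* # 2 :* T := # 0 ⊣ T :* T :- (# 2 :* T) ∙ T :+ # 2 := # 0 ⊞ []) (z , tt) refl)))))
        where
        T≡ : T ≡ ⊖ 𝟚
        T≡ = linear (T ∷ []) (λ T → T := :- # 2 ⊣ # 1 ∙ T :+ # 2 := # 0 ⊞ []) (z , tt) refl
        ψT : ψ T ≡ + 1
        ψT = ψ-residue (trans (cong (λ t → pow t j) T≡) (trans (character-⊖ 𝟚) character-𝟚))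
        ψT[T-2] : ψ (T ⊗ (T ⊕ ⊖ 𝟚)) ≡ + 1
        ψT[T-2] = ψ-residue (trans (cong (λ t → pow t j) (linear (T ∷ []) (λ T → T :* (T :- # 2) := # 2 :* (# 2 :* # 2) ⊣ T :- # 4 ∙ T := :- # 2 ⊞ []) (T≡ , tt) refl))
          (trans (pow-⊗ 𝟚 (𝟚 ⊗ 𝟚) j) (trans (cong₂ _⊗_ character-𝟚 character-4) (*-identityˡ 𝟙))))
        fibre≡1 : fibre T ≡ + 1
        fibre≡1 = trans (∑-single Φ-unique (∈Φ (trans (pow-h-⊖ 𝟙) (cong ⊖_ pow-h-𝟙))) (λ {φ} m n → indicator-no (tr φ ≟ T) (λ eq → n (only m eq))))
          (indicator-yes (tr (⊖ 𝟙) ≟ T) (trans (cong (⊖ 𝟙 ⊕_) (trans (conj-⊖ 𝟙) (cong ⊖_ conj-𝟙))) (linear (T ∷ []) (λ T → :- # 1 :+ :- # 1 := T ⊣ :- # 1 ∙ T := :- # 2 ⊞ []) (T≡ , tt) refl)))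
          where
          only : ∀ {φ} → φ ∈ Φ → tr φ ≡ T → φ ≡ ⊖ 𝟙
          only {φ} m eq = difference-zero (square-zero (linear (φ ∷ T ∷ conj φ ∷ []) (λ φ T c → (φ :- :- # 1) :* (φ :- :- # 1) := # 0 ⊣ φ :+ T :+ # 2 ∙ φ :+ c := T
              ⊞ :- # 1 ∙ φ :* c := # 1 ⊞ T :- c ∙ T := :- # 2 ⊞ []) (eq , Φ-norm (Φ∋ m) , T≡ , tt) refl))
    go (is-residue n x e) = trans (cong (λ v → + 2 ℤ.* (ψ T ℤ.* v)) fibre≡0) (trans (lemma (ψ T) (ψ (T ⊕ ⊖ 𝟚)))
          (sym (cong₂ ℤ._+_ (cong (λ z → ψ T ℤ.- z) (trans (ψ-⊗ a (Fq-⊕ a Fq-𝟚)) (cong (ψ T ℤ.*_) e)))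
                            (cong₂ ℤ._-_ (ψ-⊗ a (Fq-T-2 a)) (trans (ψ-cubic a) (cong (λ z → ψ T ℤ.* ψ (T ⊕ ⊖ 𝟚) ℤ.* z) e))))))
        where
        fibre≡0 : fibre T ≡ + 0
        fibre≡0 = ∑-zero Φ (λ {φ} m → indicator-no (tr φ ≟ T) (λ { refl →
          ⊖𝟙≢𝟙 (linear (pow φ h ∷ pow (tr φ ⊕ 𝟚) j ∷ []) (λ ph x → :- # 1 := # 1 ⊣ :- x ∙ ph := :- # 1 ⊞ # 1 ∙ x := # 1 ⊞ # 1 ∙ ph :* x := # 1 ⊞ []) (Φ∋ m , x , norm-one-character (Φ-norm (Φ∋ m)) n , tt) refl) }))
        lemma : ∀ t s → + 2 ℤ.* (t ℤ.* + 0) ≡ (t ℤ.- t ℤ.* + 1) ℤ.+ (t ℤ.* s ℤ.- t ℤ.* s ℤ.* + 1)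
        lemma = solve-∀
    go (is-nonresidue n x e) = trans (cong (λ v → + 2 ℤ.* (ψ T ℤ.* v)) (trans (fibre-nonresidue a x) (cong (λ z → + 1 ℤ.+ ℤ.- z) ψ-square)))
          (trans (lemma (ψ T) (ψ (T ⊕ ⊖ 𝟚)))
          (sym (cong₂ ℤ._+_ (cong (λ z → ψ T ℤ.- z) (trans (ψ-⊗ a (Fq-⊕ a Fq-𝟚)) (cong (ψ T ℤ.*_) e)))
                            (cong₂ ℤ._-_ (ψ-⊗ a (Fq-T-2 a)) (trans (ψ-cubic a) (cong (λ z → ψ T ℤ.* ψ (T ⊕ ⊖ 𝟚) ℤ.* z) e))))))
        where
        ψ-square : ψ (T ⊗ T ⊕ ⊖ (𝟚 ⊗ 𝟚)) ≡ ψ (T ⊕ ⊖ 𝟚) ℤ.* -[1+ 0 ]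
        ψ-square = trans (cong ψ (solve 1 (λ T → T :* T :- # 2 :* # 2 := (T :- # 2) :* (T :+ # 2)) refl T)) (trans (ψ-⊗ (Fq-T-2 a) (Fq-⊕ a Fq-𝟚)) (cong (ψ (T ⊕ ⊖ 𝟚) ℤ.*_) e))
        lemma : ∀ t s → + 2 ℤ.* (t ℤ.* (+ 1 ℤ.+ ℤ.- (s ℤ.* -[1+ 0 ]))) ≡ (t ℤ.- t ℤ.* -[1+ 0 ]) ℤ.+ (t ℤ.* s ℤ.- t ℤ.* s ℤ.* -[1+ 0 ])
        lemma = solve-∀

  -- The sum over Φ and the number of points of the elliptic curve

  ellipticSum : ℤ
  ellipticSum = ∑ Fq (λ x → ψ (x ⊗ x ⊗ x ⊕ ⊖ x))

  -- Group the φ by their trace and insert `fibre-weight`: the linear sum is 0, the two quadratic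
  -- sums are both -1 and cancel, and the cubic one survives.
  ∑Φψ : + 2 ℤ.* ∑ Φ (λ φ → ψ (tr φ)) ≡ ℤ.- ellipticSum
  ∑Φψ = begin
    + 2 ℤ.* ∑ Φ (λ φ → ψ (tr φ))
      ≡⟨ cong (+ 2 ℤ.*_) (∑-cong Φ (λ {φ} m → sym (trans (∑-single Fq-unique (∈Fq (Fq-trace φ))
           (λ {T} _ n → trans (cong (ψ T ℤ.*_) (indicator-no (tr φ ≟ T) (n ∘ sym))) (ℤ.*-zeroʳ (ψ T))))
           (trans (cong (ψ (tr φ) ℤ.*_) (indicator-yes (tr φ ≟ tr φ) refl)) (ℤ.*-identityʳ _))))) ⟩
    + 2 ℤ.* ∑ Φ (λ φ → ∑ Fq (λ T → ψ T ℤ.* indicator (tr φ ≟ T)))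
      ≡⟨ cong (+ 2 ℤ.*_) (∑-swap (λ φ T → ψ T ℤ.* indicator (tr φ ≟ T)) Φ Fq) ⟩
    + 2 ℤ.* ∑ Fq (λ T → ∑ Φ (λ φ → ψ T ℤ.* indicator (tr φ ≟ T)))
      ≡⟨ cong (+ 2 ℤ.*_) (∑-cong Fq (λ {T} _ → ∑-* (ψ T) (λ φ → indicator (tr φ ≟ T)) Φ)) ⟩
    + 2 ℤ.* ∑ Fq (λ T → ψ T ℤ.* fibre T)
      ≡⟨ sym (∑-* (+ 2) (λ T → ψ T ℤ.* fibre T) Fq) ⟩
    ∑ Fq (λ T → + 2 ℤ.* (ψ T ℤ.* fibre T))
      ≡⟨ ∑-cong Fq (λ m → fibre-weight (Fq∋ m)) ⟩
    ∑ Fq (λ T → (ψ T ℤ.- ψ (T ⊗ (T ⊕ 𝟚))) ℤ.+ (ψ (T ⊗ (T ⊕ ⊖ 𝟚)) ℤ.- ψ (T ⊗ T ⊗ T ⊕ ⊖ (𝟚 ⊗ 𝟚 ⊗ T))))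
      ≡⟨ trans (∑-+ _ _ Fq) (cong₂ ℤ._+_ (∑-difference _ _) (∑-difference _ _)) ⟩
    (∑ Fq ψ ℤ.- ∑ Fq (λ T → ψ (T ⊗ (T ⊕ 𝟚)))) ℤ.+ (∑ Fq (λ T → ψ (T ⊗ (T ⊕ ⊖ 𝟚))) ℤ.- ∑ Fq (λ T → ψ (T ⊗ T ⊗ T ⊕ ⊖ (𝟚 ⊗ 𝟚 ⊗ T))))
      ≡⟨ cong₂ ℤ._+_ (cong₂ ℤ._-_ ∑ψ (∑ψ-quadratic Fq-𝟚 𝟚≢𝟘)) (cong₂ ℤ._-_ (∑ψ-quadratic (Fq-⊖ Fq-𝟚) (⊖-nonzero 𝟚≢𝟘)) rescale) ⟩
    + 1 ℤ.+ (-[1+ 0 ] ℤ.- ellipticSum)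
      ≡⟨ lemma ellipticSum ⟩
    ℤ.- ellipticSum ∎
    where
    open ≡-Reasoning
    ∑-difference : ∀ (f f′ : A → ℤ) → ∑ Fq (λ x → f x ℤ.- f′ x) ≡ ∑ Fq f ℤ.- ∑ Fq f′
    ∑-difference f f′ = trans (∑-+ f (λ x → ℤ.- f′ x) Fq) (cong (λ z → ∑ Fq f ℤ.+ z)
      (trans (∑-cong Fq (λ {x} _ → sym (ℤ.-1*i≡-i (f′ x)))) (trans (∑-* -[1+ 0 ] f′ Fq) (ℤ.-1*i≡-i _))))
    lemma : ∀ s → + 1 ℤ.+ (-[1+ 0 ] ℤ.- s) ≡ ℤ.- s
    lemma = solve-∀
    -- T = 2x turns T³ - 4T into 8(x³ - x), and 8 is a square because 2 is.
    rescale : ∑ Fq (λ T → ψ (T ⊗ T ⊗ T ⊕ ⊖ (𝟚 ⊗ 𝟚 ⊗ T))) ≡ ellipticSum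
    rescale = trans (sym (Fq-bijection (𝟚 ⊗_) (half ⊗_)
        (λ {x} a → Fq-⊗ Fq-𝟚 a , linear (x ∷ half ∷ []) (λ x f → f :* (# 2 :* x) := x ⊣ x ∙ # 2 :* f := # 1 ⊞ []) (2half , tt) refl)
        (λ {x} a → Fq-⊗ Fq-half a , linear (x ∷ half ∷ []) (λ x f → # 2 :* (f :* x) := x ⊣ x ∙ # 2 :* f := # 1 ⊞ []) (2half , tt) refl) (λ T → ψ (T ⊗ T ⊗ T ⊕ ⊖ (𝟚 ⊗ 𝟚 ⊗ T)))))
      (∑-cong Fq (λ {x} m → trans (cong ψ (solve 1 (λ x → # 2 :* x :* (# 2 :* x) :* (# 2 :* x) :- # 2 :* # 2 :* (# 2 :* x) := # 2 :* (# 2 :* # 2) :* (x :* x :* x :- x)) refl x))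
        (trans (ψ-⊗ (Fq-⊗ Fq-𝟚 (Fq-⊗ Fq-𝟚 Fq-𝟚)) (Fq-⊕ (Fq-⊗ (Fq-⊗ (Fq∋ m) (Fq∋ m)) (Fq∋ m)) (Fq-⊖ (Fq∋ m))))
        (trans (cong (ℤ._* ψ (x ⊗ x ⊗ x ⊕ ⊖ x)) (ψ-residue (trans (pow-⊗ 𝟚 (𝟚 ⊗ 𝟚) j) (trans (cong₂ _⊗_ character-𝟚 character-4) (*-identityˡ 𝟙)))))
          (ℤ.*-identityˡ _)))))

  C₊ C₋ : ℕ
  C₊ = length (filter (λ φ → pow (tr φ) j ≟ 𝟙) Φ)
  C₋ = length (filter (λ φ → pow (tr φ) j ≟ ⊖ 𝟙) Φ)

  C₊-C₋ : + C₊ ≡ ∑ Φ (λ φ → ψ (tr φ)) ℤ.+ + C₋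
  C₊-C₋ = trans (length-filter _ Φ) (trans (∑-cong Φ (λ {φ} _ → pointwise (Fq-trace φ))) (trans (∑-+ _ _ Φ) (cong (λ z → ∑ Φ (λ φ → ψ (tr φ)) ℤ.+ z) (sym (length-filter _ Φ)))))
    where
    pointwise : ∀ {c} → InFq c → indicator (pow c j ≟ 𝟙) ≡ ψ c ℤ.+ indicator (pow c j ≟ ⊖ 𝟙)
    pointwise {c} a with character-view a
    ... | is-zero z e = trans (indicator-no _ (λ x → 𝟘≢𝟙 (trans (sym (pow-zero j≢0 z)) x)))
            (sym (cong₂ ℤ._+_ e (indicator-no _ (λ x → ⊖𝟙≢𝟘 (trans (sym x) (pow-zero j≢0 z))))))
    ... | is-residue _ x e = trans (indicator-yes _ x) (sym (cong₂ ℤ._+_ e (indicator-no _ (λ y → ⊖𝟙≢𝟙 (trans (sym y) x)))))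
    ... | is-nonresidue _ x e = trans (indicator-no _ (λ y → ⊖𝟙≢𝟙 (trans (sym x) y))) (sym (cong₂ ℤ._+_ e (indicator-yes _ x)))

  Elliptic? : (z : A × A) → Dec (proj₂ z ⊗ proj₂ z ≡ proj₁ z ⊗ proj₁ z ⊗ proj₁ z ⊕ ⊖ proj₁ z)
  Elliptic? (x , y) = y ⊗ y ≟ x ⊗ x ⊗ x ⊕ ⊖ x

  ellipticPoints : List (A × A)
  ellipticPoints = filter Elliptic? (cartesianProduct Fq Fq)

  ellipticPoints-length : + length ellipticPoints ≡ + q ℤ.+ ellipticSum
  ellipticPoints-length = begin
    + length ellipticPoints                                              ≡⟨ length-filter _ (cartesianProduct Fq Fq) ⟩
    ∑ (cartesianProduct Fq Fq) (λ z → indicator (Elliptic? z))           ≡⟨ ∑-cartesianProduct _ Fq Fq ⟩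
    ∑ Fq (λ x → ∑ Fq (λ y → indicator (y ⊗ y ≟ x ⊗ x ⊗ x ⊕ ⊖ x)))        ≡⟨ ∑-cong Fq (λ m → roots-count (Fq-⊕ (Fq-⊗ (Fq-⊗ (Fq∋ m) (Fq∋ m)) (Fq∋ m)) (Fq-⊖ (Fq∋ m)))) ⟩
    ∑ Fq (λ x → + 1 ℤ.+ ψ (x ⊗ x ⊗ x ⊕ ⊖ x))                             ≡⟨ ∑-+ (λ _ → + 1) _ Fq ⟩
    ∑ Fq (λ _ → + 1) ℤ.+ ellipticSum                                     ≡⟨ cong (ℤ._+ ellipticSum) (trans (∑-one Fq) (cong +_ Fq-order)) ⟩
    + q ℤ.+ ellipticSum                                                  ∎
    where open ≡-Reasoning

  -- With n the number of affine points, this is n - q = -2 (C₊ - C₋) in a form free of subtraction.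
  elliptic-count : length ellipticPoints ℕ.+ (C₊ ℕ.+ C₊) ≡ q ℕ.+ (C₋ ℕ.+ C₋)
  elliptic-count = ℤ.+-injective (assemble (+ length ellipticPoints) (+ C₊) (+ q) (+ C₋) (∑ Φ (λ φ → ψ (tr φ))) ellipticSum
    ellipticPoints-length C₊-C₋ ∑Φψ)
    where
    lemma : ∀ q s c e → (q ℤ.+ e) ℤ.+ ((s ℤ.+ c) ℤ.+ (s ℤ.+ c)) ≡ (q ℤ.+ (c ℤ.+ c)) ℤ.+ (+ 2 ℤ.* s ℤ.+ e)
    lemma = solve-∀
    assemble : ∀ n c₊ q c₋ s e → n ≡ q ℤ.+ e → c₊ ≡ s ℤ.+ c₋ → + 2 ℤ.* s ≡ ℤ.- e → n ℤ.+ (c₊ ℤ.+ c₊) ≡ q ℤ.+ (c₋ ℤ.+ c₋)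
    assemble n c₊ q c₋ s e refl refl eq = trans (lemma q s c₋ e) (trans (cong (λ z → (q ℤ.+ (c₋ ℤ.+ c₋)) ℤ.+ (z ℤ.+ e)) eq)
      (trans (cong (λ z → (q ℤ.+ (c₋ ℤ.+ c₋)) ℤ.+ z) (ℤ.+-inverseˡ e)) (ℤ.+-identityʳ _)))

  -- Lines and the Hermitian form

  all4 : {P : Fin 4 → Set} → P zero → P (suc zero) → P (suc (suc zero)) → P (suc (suc (suc zero))) → ∀ i → P i
  all4 a b c d zero = a
  all4 a b c d (suc zero) = b
  all4 a b c d (suc (suc zero)) = c
  all4 a b c d (suc (suc (suc zero))) = d

  comb : A → V → A → V → V
  comb a u b w i = a ⊗ u i ⊕ b ⊗ w i

  OnLine-resp : ∀ {v v′ ℓ} → (∀ i → v′ i ≡ v i) → OnLine v ℓ → OnLine v′ ℓ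
  OnLine-resp eq (a , b , f) = a , b , λ i → trans (eq i) (f i)

  OnLine-comb : ∀ {v w ℓ} a b → OnLine v ℓ → OnLine w ℓ → OnLine (comb a v b w) ℓ
  OnLine-comb {v} {w} {line u u′} a b (c , d , f) (c′ , d′ , f′) = a ⊗ c ⊕ b ⊗ c′ , a ⊗ d ⊕ b ⊗ d′ , λ i →
    linear (a ∷ b ∷ c ∷ d ∷ c′ ∷ d′ ∷ v i ∷ w i ∷ u i ∷ u′ i ∷ []) (λ a b c d c′ d′ vi wi x y → a :* vi :+ b :* wi := (a :* c :+ b :* c′) :* x :+ (a :* d :+ b :* d′) :* y ⊣ a ∙ vi := c :* x :+ d :* y
        ⊞ b ∙ wi := c′ :* x :+ d′ :* y ⊞ []) (f i , f′ i , tt) refl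

  OnLine-u : ∀ ℓ → OnLine (Line.u ℓ) ℓ
  OnLine-u (line u w) = 𝟙 , 𝟘 , λ i → solve 2 (λ x y → x := # 1 :* x :+ # 0 :* y) refl (u i) (w i)

  OnLine-w : ∀ ℓ → OnLine (Line.w ℓ) ℓ
  OnLine-w (line u w) = 𝟘 , 𝟙 , λ i → solve 2 (λ x y → y := # 0 :* x :+ # 1 :* y) refl (u i) (w i)

  OnLine-scale : ∀ {v w ℓ} c → (∀ i → w i ≡ c ⊗ v i) → OnLine v ℓ → OnLine w ℓ
  OnLine-scale {v} {w} c eq o = OnLine-resp (λ i → trans (eq i) (solve 2 (λ c x → c :* x := c :* x :+ # 0 :* x) refl c (v i))) (OnLine-comb c 𝟘 o o)

  ∼-sym : ∀ {v w} → v ∼ w → w ∼ v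
  ∼-sym {v} {w} (c , n , f) = inv c , inv-nonzero n , λ i → linear (inv c ∷ c ∷ v i ∷ w i ∷ []) (λ d c x y → y := d :* x ⊣ :- d ∙ x := c :* y
      ⊞ :- y ∙ c :* d := # 1 ⊞ []) (f i , inverseʳ c n , tt) refl

  OnLine-∼ : ∀ {v w ℓ} → v ∼ w → OnLine v ℓ → OnLine w ℓ
  OnLine-∼ r = let (c , _ , f) = ∼-sym r in OnLine-scale c f

  OnLine-mono : ∀ {v ℓ m} → OnLine (Line.u ℓ) m → OnLine (Line.w ℓ) m → OnLine v ℓ → OnLine v m
  OnLine-mono u w (a , b , f) = OnLine-resp f (OnLine-comb a b u w)

  ≈L⇒⊆ : ∀ {v ℓ m} → ℓ ≈L m → OnLine v ℓ → OnLine v m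
  ≈L⇒⊆ ((u , w) , _) = OnLine-mono u w

  ≈L-refl : ∀ {ℓ} → ℓ ≈L ℓ
  ≈L-refl {ℓ} = (OnLine-u ℓ , OnLine-w ℓ) , (OnLine-u ℓ , OnLine-w ℓ)

  ≈L-sym : ∀ {ℓ m} → ℓ ≈L m → m ≈L ℓ
  ≈L-sym (a , b) = b , a

  ≈L-trans : ∀ {ℓ m n} → ℓ ≈L m → m ≈L n → ℓ ≈L n
  ≈L-trans r@((a , b) , (a′ , b′)) s@((c , d) , (c′ , d′)) =
    (≈L⇒⊆ s a , ≈L⇒⊆ s b) , (≈L⇒⊆ (≈L-sym r) c′ , ≈L⇒⊆ (≈L-sym r) d′)

  -- Cramer's rule: D is the determinant of the coordinates of v and w with respect to the spanning
  -- points of ℓ. If it vanished, the adjugate would give relations between v and w, forcing v = 0.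
  line-through : ∀ {v w ℓ} → Independent (line v w) → OnLine v ℓ → OnLine w ℓ → ℓ ≈L line v w
  line-through {v} {w} {line u u′} ind ov@(α , β , f) ow@(γ , ε , f′) =
    ((inv D ⊗ ε , ⊖ (inv D ⊗ β) , λ i → linear (α ∷ β ∷ γ ∷ ε ∷ inv D ∷ u i ∷ u′ i ∷ v i ∷ w i ∷ []) (λ α β γ ε E x y a b → x := E :* ε :* a :+ :- (E :* β) :* b ⊣ :- (ε :* E) ∙ a := α :* x :+ β :* y
        ⊞ β :* E ∙ b := γ :* x :+ ε :* y ⊞ :- x ∙ (α :* ε :- β :* γ) :* E := # 1 ⊞ []) (f i , f′ i , inverseʳ D D≢ , tt) refl)
    , (⊖ (inv D ⊗ γ) , inv D ⊗ α , λ i → linear (α ∷ β ∷ γ ∷ ε ∷ inv D ∷ u i ∷ u′ i ∷ v i ∷ w i ∷ []) (λ α β γ ε E x y a b → y := :- (E :* γ) :* a :+ E :* α :* b ⊣ γ :* E ∙ a := α :* x :+ β :* y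
        ⊞ :- (α :* E) ∙ b := γ :* x :+ ε :* y ⊞ :- y ∙ (α :* ε :- β :* γ) :* E := # 1 ⊞ []) (f i , f′ i , inverseʳ D D≢ , tt) refl))
    , (ov , ow)
    where
    D = α ⊗ ε ⊕ ⊖ (β ⊗ γ)
    D≢ : D ≢ 𝟘
    D≢ z = 𝟘≢𝟙 (sym (proj₁ (ind 𝟙 𝟘 (λ i → linear (α ∷ β ∷ γ ∷ ε ∷ u i ∷ u′ i ∷ v i ∷ w i ∷ []) (λ α β γ ε x y a b → # 1 :* a :+ # 0 :* b := # 0 ⊣ # 1 ∙ a := α :* x :+ β :* y
        ⊞ x ∙ α := # 0 ⊞ y ∙ β := # 0 ⊞ []) (f i , α≡0 , β≡0 , tt) refl))))
      where
      r₁ = ind ε (⊖ β) (λ i → linear (α ∷ β ∷ γ ∷ ε ∷ u i ∷ u′ i ∷ v i ∷ w i ∷ []) (λ α β γ ε x y a b → ε :* a :+ :- β :* b := # 0 ⊣ ε ∙ a := α :* x :+ β :* y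
          ⊞ :- β ∙ b := γ :* x :+ ε :* y ⊞ x ∙ α :* ε :- β :* γ := # 0 ⊞ []) (f i , f′ i , z , tt) refl)
      r₂ = ind (⊖ γ) α (λ i → linear (α ∷ β ∷ γ ∷ ε ∷ u i ∷ u′ i ∷ v i ∷ w i ∷ []) (λ α β γ ε x y a b → :- γ :* a :+ α :* b := # 0 ⊣ :- γ ∙ a := α :* x :+ β :* y
          ⊞ α ∙ b := γ :* x :+ ε :* y ⊞ y ∙ α :* ε :- β :* γ := # 0 ⊞ []) (f i , f′ i , z , tt) refl)
      α≡0 = proj₂ r₂
      β≡0 : β ≡ 𝟘
      β≡0 = linear (β ∷ []) (λ β → β := # 0 ⊣ :- # 1 ∙ :- β := # 0 ⊞ []) (proj₂ r₁ , tt) refl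

  -- The combination of the spanning points that cancels coordinate i vanishes only if both have
  -- coordinate i equal to 0, and then so would v.
  hyperplane-point : ∀ {ℓ v} i → Independent ℓ → OnLine v ℓ → v i ≢ 𝟘 → Σ V λ w → OnLine w ℓ × w i ≡ 𝟘 × ¬ (∀ m → w m ≡ 𝟘)
  hyperplane-point {line u u′} {v} i ind (a , b , f) n = comb (u′ i) u (⊖ u i) u′
    , (u′ i , ⊖ u i , λ _ → refl) , solve 2 (λ x y → y :* x :+ :- x :* y := # 0) refl (u i) (u′ i)
    , λ z → let (y≡0 , -x≡0) = ind (u′ i) (⊖ u i) z in
        n (linear (a ∷ b ∷ u i ∷ u′ i ∷ v i ∷ []) (λ a b x y c → c := # 0 ⊣ # 1 ∙ c := a :* x :+ b :* y ⊞ b ∙ y := # 0 ⊞ :- a ∙ :- x := # 0 ⊞ []) (f i , y≡0 , -x≡0 , tt) refl)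

  independent-at : ∀ {v w} i → v i ≢ 𝟘 → w i ≡ 𝟘 → ¬ (∀ m → w m ≡ 𝟘) → Independent (line v w)
  independent-at {v} {w} i n z nz a b f = a≡0 , b≡0
    where
    a≡0 : a ≡ 𝟘
    a≡0 = integral {v i} (linear (a ∷ b ∷ v i ∷ w i ∷ []) (λ a b x y → x :* a := # 0 ⊣ # 1 ∙ a :* x :+ b :* y := # 0 ⊞ :- b ∙ y := # 0 ⊞ []) (f i , z , tt) refl) n
    b≡0 : b ≡ 𝟘
    b≡0 with b ≟ 𝟘
    ... | yes eq = eq
    ... | no b≢ = ⊥-elim (nz λ m → integral (linear (a ∷ b ∷ v m ∷ w m ∷ []) (λ a b x y → b :* y := # 0 ⊣ # 1 ∙ a :* x :+ b :* y := # 0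
        ⊞ :- x ∙ a := # 0 ⊞ []) (f m , a≡0 , tt) refl) b≢)

  scale-line : ∀ {u w u′ w′} c d → c ≢ 𝟘 → d ≢ 𝟘 → (∀ i → u′ i ≡ c ⊗ u i) → (∀ i → w′ i ≡ d ⊗ w i) → line u′ w′ ≈L line u w
  scale-line c d c≢ d≢ f f′ =
    (OnLine-scale c f (OnLine-u _) , OnLine-scale d f′ (OnLine-w _))
    , (OnLine-∼ (c , c≢ , f) (OnLine-u _) , OnLine-∼ (d , d≢ , f′) (OnLine-w _))

  H : V → V → A
  H u v = X1 u ⊗ conj (X1 v) ⊕ 𝟚 ⊗ X2 u ⊗ conj (X2 v) ⊕ ⊖ (X0 u ⊗ conj (X3 v)) ⊕ ⊖ (X3 u ⊗ conj (X0 v))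

  U3⇒H : ∀ v → U3 v → H v v ≡ 𝟘
  U3⇒H v eq = linear (X0 v ∷ X1 v ∷ X2 v ∷ X3 v ∷ conj (X0 v) ∷ conj (X1 v) ∷ conj (X2 v) ∷ conj (X3 v) ∷ pow (X1 v) (q ℕ.+ 1) ∷ pow (X2 v) (q ℕ.+ 1) ∷ []) (λ a b c d a' b' c' d' x y → b :* b' :+ # 2 :* c :* c' :- a :* d' :- d :* a' := # 0 ⊣ # 1 ∙ x :+ # 2 :* y := d' :* a :+ d :* a'
      ⊞ :- # 1 ∙ x := b :* b' ⊞ :- # 2 ∙ y := c :* c' ⊞ []) (eq , pow-q+1 (X1 v) , pow-q+1 (X2 v) , tt) refl

  H⇒U3 : ∀ v → H v v ≡ 𝟘 → U3 v
  H⇒U3 v eq = linear (X0 v ∷ X1 v ∷ X2 v ∷ X3 v ∷ conj (X0 v) ∷ conj (X1 v) ∷ conj (X2 v) ∷ conj (X3 v) ∷ pow (X1 v) (q ℕ.+ 1) ∷ pow (X2 v) (q ℕ.+ 1) ∷ []) (λ a b c d a' b' c' d' x y → x :+ # 2 :* y := d' :* a :+ d :* a' ⊣ # 1 ∙ b :* b' :+ # 2 :* c :* c' :- a :* d' :- d :* a' := # 0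
      ⊞ # 1 ∙ x := b :* b' ⊞ # 2 ∙ y := c :* c' ⊞ []) (eq , pow-q+1 (X1 v) , pow-q+1 (X2 v) , tt) refl

  conj-comb : ∀ a b x y → conj (a ⊗ x ⊕ b ⊗ y) ≡ conj a ⊗ conj x ⊕ conj b ⊗ conj y
  conj-comb a b x y = trans (conj-⊕ (a ⊗ x) (b ⊗ y)) (cong₂ _⊕_ (conj-⊗ a x) (conj-⊗ b y))

  H-combˡ : ∀ {v u w} a b z → (∀ i → v i ≡ a ⊗ u i ⊕ b ⊗ w i) → H v z ≡ a ⊗ H u z ⊕ b ⊗ H w z
  H-combˡ {v} {u} {w} a b z f = linear (a ∷ b ∷ conj (X0 z) ∷ conj (X1 z) ∷ conj (X2 z) ∷ conj (X3 z) ∷ X0 v ∷ X1 v ∷ X2 v ∷ X3 v ∷ X0 u ∷ X1 u ∷ X2 u ∷ X3 u ∷ X0 w ∷ X1 w ∷ X2 w ∷ X3 w ∷ []) (λ a b z0 z1 z2 z3 v0 v1 v2 v3 u0 u1 u2 u3 w0 w1 w2 w3 → v1 :* z1 :+ # 2 :* v2 :* z2 :- v0 :* z3 :- v3 :* z0 := a :* (u1 :* z1 :+ # 2 :* u2 :* z2 :- u0 :* z3 :- u3 :* z0) :+ b :* (w1 :* z1 :+ # 2 :* w2 :* z2 :- w0 :* z3 :- w3 :* z0) ⊣ :- z3 ∙ v0 := a :* u0 :+ b :* w0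
      ⊞ z1 ∙ v1 := a :* u1 :+ b :* w1 ⊞ # 2 :* z2 ∙ v2 := a :* u2 :+ b :* w2 ⊞ :- z0 ∙ v3 := a :* u3 :+ b :* w3 ⊞ []) (f zero , f (suc zero) , f (suc (suc zero)) , f (suc (suc (suc zero))) , tt) refl

  H-conj : ∀ u v → conj (H u v) ≡ H v u
  H-conj u v = trans (trans (conj-⊝ _ _) (cong₂ (λ x y → x ⊕ ⊖ y) (trans (conj-⊝ _ _) (cong₂ (λ x y → x ⊕ ⊖ y)
        (trans (conj-⊕ _ _) (cong₂ _⊕_ (flip (X1 u) (X1 v)) (trans (conj-⊗ (𝟚 ⊗ X2 u) (conj (X2 v))) (cong₂ _⊗_ (trans (conj-⊗ 𝟚 (X2 u)) (cong (_⊗ conj (X2 u)) Fq-𝟚)) (conj-conj (X2 v))))))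
        (flip (X0 u) (X3 v)))) (flip (X3 u) (X0 v))))
      (solve 8 (λ a b c d a' b' c' d' → b' :* b :+ # 2 :* c' :* c :- a' :* d :- d' :* a := b :* b' :+ # 2 :* c :* c' :- a :* d' :- d :* a') refl (X0 v) (X1 v) (X2 v) (X3 v) (conj (X0 u)) (conj (X1 u)) (conj (X2 u)) (conj (X3 u)))
    where
    flip : ∀ x y → conj (x ⊗ conj y) ≡ conj x ⊗ y
    flip x y = trans (conj-⊗ x (conj y)) (cong (conj x ⊗_) (conj-conj y))

  H-combʳ : ∀ {v u w} a b z → (∀ i → v i ≡ a ⊗ u i ⊕ b ⊗ w i) → H z v ≡ conj a ⊗ H z u ⊕ conj b ⊗ H z w
  H-combʳ {v} {u} {w} a b z f = trans (sym (H-conj v z)) (trans (cong conj (H-combˡ a b z f)) (trans (conj-comb a b (H u z) (H w z))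
    (cong₂ (λ x y → conj a ⊗ x ⊕ conj b ⊗ y) (H-conj u z) (H-conj w z))))

  Isotropic : Line → Set
  Isotropic (line u w) = H u u ≡ 𝟘 × H u w ≡ 𝟘 × H w w ≡ 𝟘

  isotropic-perp : ∀ {ℓ v w} → Isotropic ℓ → OnLine v ℓ → OnLine w ℓ → H v w ≡ 𝟘
  isotropic-perp {line u u′} {v} {w} (uu , uw , ww) (a , b , f) (c , d , f′) =
    linear (a ∷ b ∷ conj c ∷ conj d ∷ H v w ∷ H u w ∷ H u′ w ∷ H u u ∷ H u u′ ∷ H u′ u ∷ H u′ u′ ∷ conj 𝟘 ∷ conj (H u u′) ∷ []) (λ a b c' d' vw uv wv uu uw wu ww z k → vw := # 0 ⊣ # 1 ∙ vw := a :* uv :+ b :* wv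
        ⊞ a ∙ uv := c' :* uu :+ d' :* uw ⊞ b ∙ wv := c' :* wu :+ d' :* ww ⊞ a :* c' ∙ uu := # 0 ⊞ a :* d' ∙ uw := # 0 ⊞ b :* d' ∙ ww := # 0
        ⊞ :- (b :* c') ∙ k := wu ⊞ b :* c' ∙ k := z ⊞ b :* c' ∙ z := # 0 ⊞ []) (H-combˡ a b w f , H-combʳ c d u f′ , H-combʳ c d u′ f′ , uu , uw , ww , H-conj u u′ , cong conj uw , conj-𝟘 , tt) refl

  isotropic⇒generator : ∀ {ℓ} → Independent ℓ → Isotropic ℓ → Generator ℓ
  isotropic⇒generator ind iso = ind , λ v o → H⇒U3 v (isotropic-perp iso o o)

  -- Polarisation, using the scalars 1 and δ.
  generator-perp : ∀ {ℓ v w} → Generator ℓ → OnLine v ℓ → OnLine w ℓ → H v w ≡ 𝟘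
  generator-perp {ℓ} {v} {w} (_ , u3) ov ow = integral {𝟚} (integral {δ}
      (linear (H v w ∷ H w v ∷ δ ∷ []) (λ vw wv d → d :* (# 2 :* vw) := # 0 ⊣ d ∙ vw :+ wv := # 0 ⊞ :- # 1 ∙ :- d :* vw :+ d :* wv := # 0 ⊞ []) (real , imaginary , tt) refl) δ≢𝟘) 𝟚≢𝟘
    where
    value : ∀ c → conj c ⊗ H v w ⊕ c ⊗ H w v ≡ 𝟘
    value c = linear (H v w ∷ H w v ∷ H v v ∷ H w w ∷ c ∷ conj c ∷ conj 𝟙 ∷ H (comb 𝟙 v c w) (comb 𝟙 v c w) ∷ H v (comb 𝟙 v c w) ∷ H w (comb 𝟙 v c w) ∷ []) (λ vw wv vv ww c c' o s sv sw → c' :* vw :+ c :* wv := # 0 ⊣ # 1 ∙ s := # 0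
        ⊞ :- # 1 ∙ s := # 1 :* sv :+ c :* sw ⊞ :- # 1 ∙ sv := o :* vv :+ c' :* vw ⊞ :- c ∙ sw := o :* wv :+ c' :* ww ⊞ :- (wv :* c) :- vv ∙ o := # 1
        ⊞ :- # 1 ∙ vv := # 0 ⊞ :- (c :* c') ∙ ww := # 0 ⊞ []) (U3⇒H (comb 𝟙 v c w) (u3 _ (OnLine-comb 𝟙 c ov ow)) , H-combˡ {comb 𝟙 v c w} 𝟙 c (comb 𝟙 v c w) (λ _ → refl) , H-combʳ {comb 𝟙 v c w} 𝟙 c v (λ _ → refl) , H-combʳ {comb 𝟙 v c w} 𝟙 c w (λ _ → refl) , conj-𝟙 , U3⇒H v (u3 v ov) , U3⇒H w (u3 w ow) , tt) refl
    real : H v w ⊕ H w v ≡ 𝟘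
    real = trans (linear (H v w ∷ H w v ∷ conj 𝟙 ∷ []) (λ a b o → a :+ b := o :* a :+ # 1 :* b ⊣ :- a ∙ o := # 1 ⊞ []) (conj-𝟙 , tt) refl) (value 𝟙)
    imaginary : ⊖ δ ⊗ H v w ⊕ δ ⊗ H w v ≡ 𝟘
    imaginary = trans (cong (λ z → z ⊗ H v w ⊕ δ ⊗ H w v) (sym conj-δ)) (value δ)

  -- Points of the curve and the Hermitian form

  Q : A → A → V
  Q x y = v4 𝟙 x y (y ⊗ y)

  Q∞ : V
  Q∞ = v4 𝟘 𝟘 𝟘 𝟙

  Curve : A → A → Set
  Curve x y = conj y ⊕ ⊖ y ≡ pow x h

  -- On points (1,x,y,y²) the part of the form outside X1 is minus a perfect square; orthogonality
  -- thereby becomes a multiplicative equation, to which h-th powers and norms can be applied.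
  H-Q : ∀ x y x′ y′ → H (Q x y) (Q x′ y′) ≡ x ⊗ conj x′ ⊕ ⊖ ((conj y′ ⊕ ⊖ y) ⊗ (conj y′ ⊕ ⊖ y))
  H-Q x y x′ y′ = linear (x ∷ y ∷ conj x′ ∷ conj y′ ∷ conj (y′ ⊗ y′) ∷ conj 𝟙 ∷ []) (λ x y a b c o → x :* a :+ # 2 :* y :* b :- # 1 :* c :- y :* y :* o := x :* a :- (b :- y) :* (b :- y) ⊣ :- # 1 ∙ c := b :* b
      ⊞ :- (y :* y) ∙ o := # 1 ⊞ []) (conj-⊗ y′ y′ , conj-𝟙 , tt) refl

  H-Q∞ : ∀ v → H v Q∞ ≡ ⊖ X0 v
  H-Q∞ v = linear (X0 v ∷ X1 v ∷ X2 v ∷ X3 v ∷ conj 𝟘 ∷ conj 𝟙 ∷ []) (λ a b c d z o → b :* z :+ # 2 :* c :* z :- a :* o :- d :* z := :- a ⊣ b :+ # 2 :* c :- d ∙ z := # 0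
      ⊞ :- a ∙ o := # 1 ⊞ []) (conj-𝟘 , conj-𝟙 , tt) refl

  -- The square of the curve equation. By `H-Q` it says that the curve lies on the Hermitian
  -- surface.
  curve-norm : ∀ {x y} → Curve x y → x ⊗ conj x ≡ (conj y ⊕ ⊖ y) ⊗ (conj y ⊕ ⊖ y)
  curve-norm {x} {y} c = trans (sym (pow-h² x)) (sym (cong₂ _⊗_ c c))

  conj-imaginary : ∀ y → conj (conj y ⊕ ⊖ y) ≡ y ⊕ ⊖ conj y
  conj-imaginary y = trans (conj-⊝ (conj y) y) (cong (_⊕ ⊖ conj y) (conj-conj y))

  -- A generator contains at most one rational point of the curve: raising the orthogonality relation
  -- x x′^q = (y′^q - y)² to the power (q+1)/2 leaves (y - y′)(y - y′)^q = 0.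
  curve-point-unique : ∀ {x y x′ y′} → Curve x y → Curve x′ y′ → H (Q x y) (Q x′ y′) ≡ 𝟘 → x ≡ x′ × y ≡ y′
  curve-point-unique {x} {y} {x′} {y′} c c′ o = x≡ , y≡
    where
    polar : x ⊗ conj x′ ≡ (conj y′ ⊕ ⊖ y) ⊗ (conj y′ ⊕ ⊖ y)
    polar = difference-zero (trans (sym (H-Q x y x′ y′)) o)
    product : (y ⊕ ⊖ y′) ⊗ conj (y ⊕ ⊖ y′) ≡ 𝟘
    product = linear (y ∷ conj y ∷ y′ ∷ conj y′ ∷ conj (y ⊕ ⊖ y′) ∷ pow x h ∷ pow x′ h ∷ pow (conj x′) h ∷ conj (pow x′ h) ∷ conj (conj y′ ⊕ ⊖ y′) ∷ pow (x ⊗ conj x′) h ∷ pow ((conj y′ ⊕ ⊖ y) ⊗ (conj y′ ⊕ ⊖ y)) h ∷ pow (conj y′ ⊕ ⊖ y) h ∷ conj (conj y′ ⊕ ⊖ y) ∷ conj (conj y′) ∷ []) (λ y b y′ b′ k px px′ pc cpx cim l r s m cc → (y :- y′) :* k := # 0 ⊣ :- px :- m ∙ k := b :- b′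
        ⊞ :- k :- m ∙ b :- y := px ⊞ :- px ∙ cim := cpx ⊞ px ∙ cim := y′ :- b′ ⊞ :- px ∙ cpx := pc ⊞ # 1 ∙ l := px :* pc ⊞ :- # 1 ∙ l := r
        ⊞ :- # 1 ∙ r := s :* s ⊞ :- # 1 ∙ s :* s := (b′ :- y) :* m ⊞ k :- px ∙ m := cc :- b ⊞ k :- px ∙ cc := y′ ⊞ []) (conj-⊝ y y′ , c , cong conj c′ , conj-imaginary y′ , conj-pow x′ h , pow-⊗ x (conj x′) h , cong (λ z → pow z h) polar , pow-⊗ (conj y′ ⊕ ⊖ y) (conj y′ ⊕ ⊖ y) h , pow-h² (conj y′ ⊕ ⊖ y) , conj-⊝ (conj y′) y , conj-conj y′ , tt) refl
    y≡ : y ≡ y′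
    y≡ with y ≟ y′
    ... | yes eq = eq
    ... | no n = ⊥-elim (⊗-nonzero (difference-nonzero n) (conj-nonzero (difference-nonzero n)) product)
    x≡ : x ≡ x′
    x≡ with x ≟ 𝟘 | x′ ≟ 𝟘
    ... | no n | _ = conj-injective (⊗-cancelˡ n (trans (curve-norm c) (trans (cong (λ z → (conj z ⊕ ⊖ y) ⊗ (conj z ⊕ ⊖ y)) y≡) (sym polar))))
    ... | yes z | yes z′ = trans z (sym z′)
    ... | yes z | no n′ = ⊥-elim (pow-nonzero h n′ (trans (sym c′) (trans (cong (λ t → conj t ⊕ ⊖ t) (sym y≡)) (trans c
            (trans (pow-h x) (trans (cong (_⊗ pow x j) z) (zeroˡ _)))))))

  curve-𝟘 : ∀ {x y} → Curve x y → x ≡ 𝟘 → InFq y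
  curve-𝟘 {x} c z = difference-zero (trans c (trans (pow-h x) (trans (cong (_⊗ pow x j) z) (zeroˡ _))))

  Fq-curve : ∀ {y} → InFq y → Curve 𝟘 y
  Fq-curve {y} a = trans (cong (_⊕ ⊖ y) a) (trans (-‿inverseʳ y) (sym (trans (pow-h 𝟘) (zeroˡ _))))

  -- Invariants of the generators meeting the curve

  -- A generator through (1,x,y,y²) ∈ Δ⁺ is projected from X_∞ onto a line meeting the conic again at
  -- (1,z,z²), and t = (z - y)/(z - y^q) has norm 2.
  record D1 (ℓ : Line) (s : A) : Set where
    constructor d1
    field
      x y z x̃ t : A
      curve : Curve x y
      x≢𝟘 : x ≢ 𝟘
      z≢y : z ≢ y
      ratio : t ⊗ (z ⊕ ⊖ conj y) ≡ z ⊕ ⊖ y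
      t-norm : t ⊗ conj t ≡ 𝟚
      polar : x ⊗ conj x̃ ≡ (conj z ⊕ ⊖ y) ⊗ (conj z ⊕ ⊖ y)
      same : ℓ ≈L line (Q x y) (Q x̃ z)
      sign : s ≡ pow t h ⊗ pow (conj y ⊕ ⊖ y) j

  -- Homogeneous parameters (e : f) on the conic, under which the infinite point of Ω is no
  -- exception.
  W : A → A → V
  W e f = v4 (e ⊗ e) 𝟘 (e ⊗ f) (f ⊗ f)

  -- Outside X1 this is the polarisation of the quadratic map `W`, so the line joining it to
  -- `W e₁ f₁` projects onto the tangent of the conic there.
  W′ : A → A → A → A → A → V
  W′ e₁ f₁ e₂ f₂ a = v4 (𝟚 ⊗ e₁ ⊗ e₂) a (e₁ ⊗ f₂ ⊕ e₂ ⊗ f₁) (𝟚 ⊗ f₁ ⊗ f₂)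

  -- A generator through the point (e₁²,0,e₁f₁,f₁²) of Ω.
  record D2 (ℓ : Line) (s : A) : Set where
    constructor d2
    field
      e₁ f₁ e₂ f₂ a : A
      Fq-e₁ : InFq e₁
      Fq-f₁ : InFq f₁
      Fq-e₂ : InFq e₂
      Fq-f₂ : InFq f₂
      -- Negating `e₂`, `f₂` and `a` together keeps the line and `a-norm` but negates a^h; the fixed
      -- determinant excludes this.
      det : e₁ ⊗ f₂ ⊕ ⊖ (e₂ ⊗ f₁) ≡ 𝟙
      a-norm : a ⊗ conj a ≡ ⊖ 𝟚
      same : ℓ ≈L line (W e₁ f₁) (W′ e₁ f₁ e₂ f₂ a)
      sign : s ≡ pow a h

  D1-resp : ∀ {ℓ m s} → ℓ ≈L m → D1 m s → D1 ℓ s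
  D1-resp r (d1 x y z x̃ t c n n′ r′ tn po sm sg) = d1 x y z x̃ t c n n′ r′ tn po (≈L-trans r sm) sg

  D2-resp : ∀ {ℓ m s} → ℓ ≈L m → D2 m s → D2 ℓ s
  D2-resp r (d2 e₁ f₁ e₂ f₂ a i₁ i₂ i₃ i₄ dt an sm sg) = d2 e₁ f₁ e₂ f₂ a i₁ i₂ i₃ i₄ dt an (≈L-trans r sm) sg

  norm-2⇒nonzero : ∀ {a} → a ⊗ conj a ≡ ⊖ 𝟚 → a ≢ 𝟘
  norm-2⇒nonzero n = factorˡ (λ z → ⊖-nonzero 𝟚≢𝟘 (trans (sym n) z))

  D2-square : ∀ {ℓ s} → D2 ℓ s → s ⊗ s ≡ ⊖ 𝟚
  D2-square {s = s} D = trans (cong₂ _⊗_ sign sign) (trans (pow-h² a) a-norm)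
    where open D2 D

  imaginary-nonzero : ∀ {x y} → Curve x y → x ≢ 𝟘 → conj y ⊕ ⊖ y ≢ 𝟘
  imaginary-nonzero c n z = pow-nonzero h n (trans (sym c) z)

  -- Conjugation negates y^q - y, so its (q-1)-th power is -1.
  imaginary-character : ∀ y → conj y ⊕ ⊖ y ≢ 𝟘 → pow (conj y ⊕ ⊖ y) j ⊗ pow (conj y ⊕ ⊖ y) j ≡ ⊖ 𝟙
  imaginary-character y n = ⊗-cancelˡ n (linear (y ∷ conj y ∷ pow (conj y ⊕ ⊖ y) j ∷ conj (conj y ⊕ ⊖ y) ∷ []) (λ y b u c → (b :- y) :* (u :* u) := (b :- y) :* :- # 1 ⊣ :- # 1 ∙ c := (b :- y) :* (u :* u)
      ⊞ # 1 ∙ c := y :- b ⊞ []) (pow-q (conj y ⊕ ⊖ y) , conj-imaginary y , tt) refl)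

  D1-square : ∀ {ℓ s} → D1 ℓ s → s ⊗ s ≡ ⊖ 𝟚
  D1-square {s = s} D = linear (s ∷ pow t h ∷ pow (conj y ⊕ ⊖ y) j ∷ t ∷ conj t ∷ []) (λ s u v t t' → s :* s := :- # 2 ⊣ u :* v :+ s ∙ s := u :* v
      ⊞ v :* v ∙ u :* u := t :* t' ⊞ v :* v ∙ t :* t' := # 2 ⊞ # 2 ∙ v :* v := :- # 1 ⊞ []) (sign , pow-h² t , t-norm , imaginary-character y (imaginary-nonzero curve x≢𝟘) , tt) refl
    where open D1 D

  two-points-independent : ∀ {x y x̃ z} → z ≢ y → Independent (line (Q x y) (Q x̃ z))
  two-points-independent {x} {y} {x̃} {z} n a b f = linear (a ∷ b ∷ []) (λ a b → a := # 0 ⊣ # 1 ∙ a :* # 1 :+ b :* # 1 := # 0 ⊞ :- # 1 ∙ b := # 0 ⊞ []) (f zero , b≡0 , tt) refl , b≡0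
    where
    b≡0 : b ≡ 𝟘
    b≡0 = integral {z ⊕ ⊖ y} (linear (a ∷ b ∷ y ∷ z ∷ []) (λ a b y z → (z :- y) :* b := # 0 ⊣ :- y ∙ a :* # 1 :+ b :* # 1 := # 0
        ⊞ # 1 ∙ a :* y :+ b :* z := # 0 ⊞ []) (f zero , f (suc (suc zero)) , tt) refl) (difference-nonzero n)

  -- The cross-ratio of y, y^q, z, z^q is 2.
  D1-cross-ratio : ∀ {ℓ s} (D : D1 ℓ s) → let open D1 D in
    (z ⊕ ⊖ conj y) ⊗ (conj z ⊕ ⊖ y) ≡ (conj z ⊕ ⊖ z) ⊗ (conj y ⊕ ⊖ y)
  D1-cross-ratio D = linear (y ∷ conj y ∷ z ∷ conj z ∷ t ∷ conj t ∷ conj (t ⊗ (z ⊕ ⊖ conj y)) ∷ conj (z ⊕ ⊖ conj y) ∷ conj (z ⊕ ⊖ y) ∷ conj (conj y) ∷ []) (λ y y' z z' t t' l m r yy → (z :- y') :* (z' :- y) := (z' :- z) :* (y' :- y) ⊣ y' :+ z' :- (# 2 :* m) :+ # 2 :* r :- (# 2 :* yy) ∙ t :* (z :- y') := z :- y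
      ⊞ :- (z :* t) :+ t :* m :- (t :* r) :+ t :* yy ∙ l := t' :* m
      ⊞ :- (# 2 :* y' :* t) :+ # 2 :* z :* t :- (t :* r) :+ # 2 :* y' :- (# 4 :* z) :+ # 2 :* m :+ # 2 :* yy ∙ m := z' :- yy
      ⊞ # 2 :* z :- (# 2 :* m) :+ # 2 :* r :- (# 2 :* yy) ∙ yy := y ⊞ z :* t :- (t :* m) :+ t :* r :- (t :* yy) ∙ l := r
      ⊞ y' :* t :- (z :* t) :+ t :* r :+ # 2 :* z :- (# 2 :* m) :- (# 2 :* yy) ∙ r := z' :- y'
      ⊞ :- (z :* m) :+ m :* m :- (m :* r) :+ m :* yy ∙ t :* t' := # 2 ⊞ []) (ratio , conj-⊗ t (z ⊕ ⊖ conj y) , conj-⊝ z (conj y) , conj-conj y , cong conj ratio , conj-⊝ z y , t-norm , tt) refl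
    where open D1 D

  D1-isotropic : ∀ {ℓ s} (D : D1 ℓ s) → let open D1 D in Isotropic (line (Q x y) (Q x̃ z))
  D1-isotropic D = trans (H-Q x y x y) (equal⇒difference-zero (curve-norm curve))
    , trans (H-Q x y x̃ z) (equal⇒difference-zero polar)
    , trans (H-Q x̃ z x̃ z) (equal⇒difference-zero other)
    where
    open D1 D
    -- Multiply `polar` by its conjugate. The cross-ratio turns the right-hand side into (z^q - z)²
    -- (y^q - y)², and the norm of x is (y^q - y)².
    other : x̃ ⊗ conj x̃ ≡ (conj z ⊕ ⊖ z) ⊗ (conj z ⊕ ⊖ z)
    other = ⊗-cancelˡ (⊗-nonzero x≢𝟘 (conj-nonzero x≢𝟘)) (linear (x ∷ x̃ ∷ conj x ∷ conj x̃ ∷ y ∷ conj y ∷ z ∷ conj z ∷ conj (x ⊗ conj x̃) ∷ conj (conj x̃) ∷ conj ((conj z ⊕ ⊖ y) ⊗ (conj z ⊕ ⊖ y)) ∷ conj (conj z ⊕ ⊖ y) ∷ conj (conj z) ∷ []) (λ x x̃ x' u y y' z z' l uu r m zz → x :* x' :* (x̃ :* u) := x :* x' :* ((z' :- z) :* (z' :- z)) ⊣ x̃ :* x' ∙ x :* u := (z' :- y) :* (z' :- y)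
        ⊞ :- (z :* z) :+ # 2 :* z :* z' :- (z' :* z') ∙ x :* x' := (y' :- y) :* (y' :- y)
        ⊞ :- (y :* y) :+ # 2 :* y :* z' :- (z' :* z') ∙ l := x' :* uu ⊞ :- (x' :* y :* y) :+ # 2 :* x' :* y :* z' :- (x' :* z' :* z') ∙ uu := x̃
        ⊞ y :* y :- (# 2 :* y :* z') :+ z' :* z' ∙ l := r ⊞ y :* y :- (# 2 :* y :* z') :+ z' :* z' ∙ r := m :* m
        ⊞ # 2 :* y :* z :* z :- (y' :* z :* z) :+ y :* y :* z' :- (# 3 :* y :* z :* z') :+ # 2 :* y' :* z :* z' :- (y' :* z' :* z') :+ y :* y :* m :+ y :* z :* m :+ z :* z :* m :- (# 2 :* y :* z' :* m) :- (# 2 :* z :* z' :* m) :+ z' :* z' :* m :- (y :* y :* zz) :- (y :* z :* zz) :- (z :* z :* zz) :+ y :* z' :* zz :+ z :* z' :* zz :+ z' :* z' :* zz :- (y :* m :* zz) :- (z :* m :* zz) :+ # 2 :* z' :* m :* zz :+ y :* zz :* zz :+ z :* zz :* zz :- (# 2 :* z' :* zz :* zz) ∙ m := zz :- y'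
        ⊞ y :* y :* z :- (y :* z' :* z') :+ # 2 :* y :* y :* m :+ # 2 :* y :* z :* m :- (# 4 :* y :* z' :* m) :+ y :* m :* m :+ z :* m :* m :- (# 2 :* z' :* m :* m) :- (y :* y :* zz) :- (# 2 :* y :* z :* zz) :+ # 2 :* y :* z' :* zz :+ z' :* z' :* zz :- (# 2 :* y :* m :* zz) :- (# 2 :* z :* m :* zz) :+ # 4 :* z' :* m :* zz :+ y :* zz :* zz :+ z :* zz :* zz :- (# 2 :* z' :* zz :* zz) ∙ zz := z
        ⊞ :- (y :* z') :- (y :* m) :+ y :* zz :+ z' :* zz :+ m :* zz :- (zz :* zz) ∙ (z :- y') :* (z' :- y) := (z' :- z) :* (y' :- y) ⊞ []) (polar , curve-norm curve , conj-⊗ x (conj x̃) , conj-conj x̃ , cong conj polar , conj-⊗ (conj z ⊕ ⊖ y) (conj z ⊕ ⊖ y) , conj-⊝ (conj z) y , conj-conj z , D1-cross-ratio D , tt) refl)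

  -- The line contains a single rational point of the curve, which fixes y; its projection meets the
  -- conic in one further point, which fixes z; and t is the resulting ratio.
  D1-functional : ∀ {ℓ s s′} → D1 ℓ s → D1 ℓ s′ → s ≡ s′
  D1-functional {ℓ} {s} {s′} D D′ = trans D.sign (trans (cong₂ (λ a b → pow a h ⊗ pow (conj b ⊕ ⊖ b) j) t≡ y≡) (sym D′.sign))
    where
    module D = D1 D
    module D′ = D1 D′
    m = line (Q D.x D.y) (Q D.x̃ D.z)
    same-point : D.x ≡ D′.x × D.y ≡ D′.y
    same-point = curve-point-unique D.curve D′.curve (isotropic-perp (D1-isotropic D) (OnLine-u m) (≈L⇒⊆ D.same (≈L⇒⊆ (≈L-sym D′.same) (OnLine-u _))))
    y≡ = proj₂ same-point
    Z∈ : OnLine (Q D′.x̃ D′.z) m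
    Z∈ = ≈L⇒⊆ D.same (≈L⇒⊆ (≈L-sym D′.same) (OnLine-w _))
    z≡ : D.z ≡ D′.z
    z≡ = let (α , β , f) = Z∈ in difference-zero (integral {(D′.z ⊕ ⊖ D.y) ⊗ (D.z ⊕ ⊖ D.y)}
      (linear (α ∷ β ∷ D.y ∷ D.z ∷ D′.z ∷ []) (λ α β y z w → (w :- y) :* (z :- y) :* (z :- w) := # 0 ⊣ y :* y :* z :- (y :* z :* z) ∙ # 1 := α :* # 1 :+ β :* # 1
          ⊞ :- (y :* y) :+ z :* z ∙ w := α :* y :+ β :* z ⊞ y :- z ∙ w :* w := α :* (y :* y) :+ β :* (z :* z) ⊞ []) (f zero , f (suc (suc zero)) , f (suc (suc (suc zero))) , tt) refl)
      (⊗-nonzero (difference-nonzero (λ eq → D′.z≢y (trans eq y≡))) (difference-nonzero D.z≢y)))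
    z-ȳ≢ : D.z ⊕ ⊖ conj D.y ≢ 𝟘
    z-ȳ≢ = factorʳ {D.t} (λ eq → difference-nonzero D.z≢y (trans (sym D.ratio) eq))
    t≡ : D.t ≡ D′.t
    t≡ = ⊗-cancelˡ z-ȳ≢ (trans (*-comm _ _) (trans D.ratio (trans (cong₂ (λ a b → a ⊕ ⊖ b) z≡ y≡)
      (trans (sym D′.ratio) (trans (*-comm _ _) (cong₂ (λ a b → (a ⊕ ⊖ conj b) ⊗ D′.t) (sym z≡) (sym y≡)))))))

  -- Points of the line with X1 = 0 are multiples of `W`, so the pairs (e₁,f₁) of the two
  -- descriptions are proportional. The normalised determinants then force the coefficient of `W′`
  -- to be 1, and X1 yields the same `a`.
  D2-functional : ∀ {ℓ s s′} → D2 ℓ s → D2 ℓ s′ → s ≡ s′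
  D2-functional {ℓ} {s} {s′} D D′ = trans D.sign (trans (cong (λ a → pow a h) (sym a≡)) (sym D′.sign))
    where
    module D = D2 D
    module D′ = D2 D′
    v∈ = ≈L⇒⊆ D.same (≈L⇒⊆ (≈L-sym D′.same) (OnLine-u _))
    w∈ = ≈L⇒⊆ D.same (≈L⇒⊆ (≈L-sym D′.same) (OnLine-w _))
    α = proj₁ v∈
    β = proj₁ (proj₂ v∈)
    fv = proj₂ (proj₂ v∈)
    γ = proj₁ w∈
    ε = proj₁ (proj₂ w∈)
    fw = proj₂ (proj₂ w∈)
    β≡0 : β ≡ 𝟘
    β≡0 = integral {D.a} (linear (α ∷ β ∷ D.a ∷ []) (λ α β a → a :* β := # 0 ⊣ :- # 1 ∙ # 0 := α :* # 0 :+ β :* a ⊞ []) (fv (suc zero) , tt) refl) (norm-2⇒nonzero D.a-norm)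
    parallel : D′.e₁ ⊗ D.f₁ ⊕ ⊖ (D′.f₁ ⊗ D.e₁) ≡ 𝟘
    parallel = square-zero (linear (α ∷ β ∷ D.e₁ ∷ D.f₁ ∷ D′.e₁ ∷ D′.f₁ ∷ 𝟚 ⊗ D.e₁ ⊗ D.e₂ ∷ D.e₁ ⊗ D.f₂ ⊕ D.e₂ ⊗ D.f₁ ∷ 𝟚 ⊗ D.f₁ ⊗ D.f₂ ∷ []) (λ α β u v u' v' k l m → (u' :* v :- v' :* u) :* (u' :* v :- v' :* u) := # 0 ⊣ v :* v ∙ u' :* u' := α :* (u :* u) :+ β :* k
        ⊞ :- (# 2 :* u :* v) ∙ u' :* v' := α :* (u :* v) :+ β :* l ⊞ u :* u ∙ v' :* v' := α :* (v :* v) :+ β :* m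
        ⊞ v :* v :* k :- (# 2 :* u :* v :* l) :+ u :* u :* m ∙ β := # 0 ⊞ []) (fv zero , fv (suc (suc zero)) , fv (suc (suc (suc zero))) , β≡0 , tt) refl)
    ε≡1 : ε ≡ 𝟙
    ε≡1 = linear (γ ∷ ε ∷ D.e₁ ∷ D.f₁ ∷ D.e₂ ∷ D.f₂ ∷ D′.e₁ ∷ D′.f₁ ∷ D′.e₂ ∷ D′.f₂ ∷ []) (λ γ ε u v w t u' v' w' t' → ε := # 1 ⊣ v :* t ∙ # 2 :* u' :* w' := γ :* (u :* u) :+ ε :* (# 2 :* u :* w)
        ⊞ :- (v :* w) :- (u :* t) ∙ u' :* t' :+ w' :* v' := γ :* (u :* v) :+ ε :* (u :* t :+ w :* v)
        ⊞ u :* w ∙ # 2 :* v' :* t' := γ :* (v :* v) :+ ε :* (# 2 :* v :* t) ⊞ :- (# 2 :* t :* w') :+ # 2 :* w :* t' ∙ u' :* v :- v' :* u := # 0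
        ⊞ ε :* v :* w :- (ε :* u :* t) :- ε :+ # 1 ∙ u :* t :- w :* v := # 1 ⊞ :- (v :* w) :+ u :* t ∙ u' :* t' :- w' :* v' := # 1 ⊞ []) (fw zero , fw (suc (suc zero)) , fw (suc (suc (suc zero))) , parallel , D.det , D′.det , tt) refl
    a≡ : D′.a ≡ D.a
    a≡ = linear (γ ∷ ε ∷ D.a ∷ D′.a ∷ []) (λ γ ε a a' → a' := a ⊣ # 1 ∙ a' := γ :* # 0 :+ ε :* a ⊞ a ∙ ε := # 1 ⊞ []) (fw (suc zero) , ε≡1 , tt) refl

  -- Generators through a given point of the curve

  -- The plane X0 = 0 is tangent to the surface at `Q∞`. Its points with X2 = 1 serve both as
  -- coordinates of the generators through a point of the curve and as normal forms of the points of
  -- Case (III).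
  P∞ : A → A → V
  P∞ a b = v4 𝟘 a 𝟙 b

  -- The sign t^h (y^q - y)^j, with z = b - y substituted into t = (z - y)/(z - y^q).
  sgn : A → A → A
  sgn b y = pow ((b ⊕ ⊖ y ⊕ ⊖ y) ⊗ inv (b ⊕ ⊖ y ⊕ ⊖ conj y)) h ⊗ pow (conj y ⊕ ⊖ y) j

  -- `a-norm` says that `P∞ a b` is isotropic, and `polar-b` that it is orthogonal to `Q x y`.
  module AffineLine {a b x y : A} (a-norm : a ⊗ conj a ≡ ⊖ 𝟚) (curve : Curve x y) (x≢𝟘 : x ≢ 𝟘) (polar-b : conj b ≡ conj a ⊗ x ⊕ 𝟚 ⊗ y) where

    b≡ : b ≡ a ⊗ conj x ⊕ 𝟚 ⊗ conj y
    b≡ = trans (sym (conj-conj b)) (trans (cong conj polar-b) (trans (conj-comb (conj a) 𝟚 x y) (cong₂ (λ s t → s ⊗ conj x ⊕ t ⊗ conj y) (conj-conj a) Fq-𝟚)))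

    -- (1,z,z²) - (1,y,y²) is z - y times (0,1,z + y), so the line through (0,1,b) has b = z + y.
    z = b ⊕ ⊖ y
    x̃ = x ⊕ (z ⊕ ⊖ y) ⊗ a
    im = conj y ⊕ ⊖ y

    im² : x ⊗ conj x ≡ im ⊗ im
    im² = curve-norm curve

    z-y≢ : z ⊕ ⊖ y ≢ 𝟘
    z-y≢ eq = ⊗-nonzero 𝟚≢𝟘 (⊗-nonzero im≢ im≢) (linear (a ∷ b ∷ x ∷ y ∷ conj a ∷ conj x ∷ conj y ∷ conj b ∷ conj (b ⊕ ⊖ y ⊕ ⊖ y) ∷ conj (b ⊕ ⊖ y) ∷ conj 𝟘 ∷ []) (λ a b x y a' x' y' c w v o → # 2 :* ((y' :- y) :* (y' :- y)) := # 0 ⊣ x :* a' ∙ b :- y :- y := # 0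
        ⊞ # 2 :* x :* a' :+ # 6 :* y :- (# 4 :* y') :- (# 2 :* v) ∙ w := o ⊞ # 2 :* x :* a' :+ # 6 :* y :- (# 4 :* y') :- (# 2 :* v) ∙ o := # 0
        ⊞ :- (# 2 :* x :* a') :- (# 6 :* y) :+ # 4 :* y' :+ # 2 :* v ∙ w := v :- y' ⊞ :- (# 2 :* y) :+ # 2 :* v ∙ v := c :- y'
        ⊞ :- (x :* a') ∙ b := a :* x' :+ # 2 :* y' ⊞ :- (# 2 :* y) :+ # 2 :* v ∙ c := a' :* x :+ # 2 :* y ⊞ # 2 ∙ x :* x' := (y' :- y) :* (y' :- y)
        ⊞ :- (x :* x') ∙ a :* a' := :- # 2 ⊞ []) (eq , cong conj eq , conj-𝟘 , conj-⊝ (b ⊕ ⊖ y) y , conj-⊝ b y , b≡ , polar-b , im² , a-norm , tt) refl)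
      where im≢ = imaginary-nonzero curve x≢𝟘

    z-ȳ≢ : z ⊕ ⊖ conj y ≢ 𝟘
    z-ȳ≢ eq = ⊗-nonzero im≢ im≢ (linear (a ∷ b ∷ x ∷ y ∷ conj a ∷ conj x ∷ conj y ∷ conj b ∷ conj (b ⊕ ⊖ y ⊕ ⊖ conj y) ∷ conj (b ⊕ ⊖ y) ∷ conj 𝟘 ∷ conj (conj y) ∷ []) (λ a b x y a' x' y' c w v o yy → (y' :- y) :* (y' :- y) := # 0 ⊣ :- (x :* a') ∙ b :- y :- y' := # 0
        ⊞ :- (x :* a') :+ # 2 :* c :- v :- (# 3 :* yy) ∙ w := o ⊞ :- (x :* a') :+ # 2 :* c :- v :- (# 3 :* yy) ∙ o := # 0
        ⊞ x :* a' :- (# 2 :* c) :+ v :+ # 3 :* yy ∙ w := v :- yy ⊞ x :* a' :+ y :- (# 2 :* y') :+ # 2 :* c :- (# 3 :* yy) ∙ yy := y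
        ⊞ x :* a' :- y' :- c :+ v :+ # 2 :* yy ∙ v := c :- y' ⊞ x :* a' ∙ b := a :* x' :+ # 2 :* y' ⊞ :- c :+ # 2 :* yy ∙ c := a' :* x :+ # 2 :* y
        ⊞ :- # 2 ∙ x :* x' := (y' :- y) :* (y' :- y) ⊞ x :* x' ∙ a :* a' := :- # 2 ⊞ []) (eq , cong conj eq , conj-𝟘 , conj-⊝ (b ⊕ ⊖ y) (conj y) , conj-conj y , conj-⊝ b y , b≡ , polar-b , im² , a-norm , tt) refl)
      where im≢ = imaginary-nonzero curve x≢𝟘

    t = (z ⊕ ⊖ y) ⊗ inv (z ⊕ ⊖ conj y)

    ratio : t ⊗ (z ⊕ ⊖ conj y) ≡ z ⊕ ⊖ y
    ratio = linear (z ⊕ ⊖ y ∷ z ⊕ ⊖ conj y ∷ inv (z ⊕ ⊖ conj y) ∷ []) (λ u v w → u :* w :* v := u ⊣ u ∙ v :* w := # 1 ⊞ []) (inverseʳ (z ⊕ ⊖ conj y) z-ȳ≢ , tt) refl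

    conj-z : conj z ≡ conj b ⊕ ⊖ conj y
    conj-z = conj-⊝ b y

    -- Multiplying b - 2 y^q = a x^q by its conjugate gives (b - 2 y^q)(b^q - 2 y) = -2 (y^q - y)²,
    -- which rearranges to this equation. The factor 2 is that of the norm of `a`.
    norm-ratio : (z ⊕ ⊖ y) ⊗ (conj z ⊕ ⊖ conj y) ≡ 𝟚 ⊗ ((z ⊕ ⊖ conj y) ⊗ (conj z ⊕ ⊖ y))
    norm-ratio = linear (a ∷ b ∷ x ∷ y ∷ conj a ∷ conj x ∷ conj y ∷ conj b ∷ conj z ∷ []) (λ a b x y a' x' y' c z' → (b :- y :- y) :* (z' :- y') := # 2 :* ((b :- y :- y') :* (z' :- y)) ⊣ :- (# 2 :* x :* a') :- b :- (# 4 :* y) :+ # 2 :* y' :+ # 2 :* c ∙ z' := c :- y'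
        ⊞ :- (x :* a') ∙ b := a :* x' :+ # 2 :* y' ⊞ :- b :+ # 2 :* c :- (# 2 :* z') ∙ c := a' :* x :+ # 2 :* y
        ⊞ # 2 ∙ x :* x' := (y' :- y) :* (y' :- y) ⊞ :- (x :* x') ∙ a :* a' := :- # 2 ⊞ []) (conj-z , b≡ , polar-b , im² , a-norm , tt) refl

    t-norm : t ⊗ conj t ≡ 𝟚
    t-norm = ⊗-cancelˡ (⊗-nonzero z-ȳ≢ (conj-nonzero z-ȳ≢)) (linear (y ∷ z ∷ t ∷ conj y ∷ conj z ∷ conj t ∷ conj (t ⊗ (z ⊕ ⊖ conj y)) ∷ conj (z ⊕ ⊖ conj y) ∷ conj (z ⊕ ⊖ y) ∷ conj (conj y) ∷ []) (λ y z t y' z' t' l m r yy → (z :- y') :* m :* (t :* t') := (z :- y') :* m :* # 2 ⊣ y' :+ z' :- (# 2 :* m) :+ # 2 :* r :- (# 2 :* yy) ∙ t :* (z :- y') := z :- y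
        ⊞ :- (z :* t) :+ t :* y' ∙ l := t' :* m ⊞ # 2 :* z :* t :- (# 2 :* t :* y') :- (# 4 :* z) :+ # 2 :* y' :+ # 2 :* yy ∙ m := z' :- yy
        ⊞ # 2 :* z :- (# 2 :* m) :+ # 2 :* r :- (# 2 :* yy) ∙ yy := y ⊞ z :* t :- (t :* y') ∙ l := r
        ⊞ :- (z :* t) :+ t :* y' :+ # 2 :* z :- (# 2 :* yy) ∙ r := z' :- y' ⊞ # 1 ∙ (z :- y) :* (z' :- y') := # 2 :* ((z :- y') :* (z' :- y)) ⊞ []) (ratio , conj-⊗ t (z ⊕ ⊖ conj y) , conj-⊝ z (conj y) , conj-conj y , cong conj ratio , conj-⊝ z y , norm-ratio , tt) refl)

    polar : x ⊗ conj x̃ ≡ (conj z ⊕ ⊖ y) ⊗ (conj z ⊕ ⊖ y)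
    polar = linear (a ∷ b ∷ x ∷ y ∷ conj a ∷ conj x ∷ conj y ∷ conj b ∷ conj z ∷ conj x̃ ∷ conj ((z ⊕ ⊖ y) ⊗ a) ∷ conj (z ⊕ ⊖ y) ∷ []) (λ a b x y a' x' y' c z' w v u → x :* w := (z' :- y) :* (z' :- y) ⊣ x ∙ w := x' :+ v
        ⊞ x ∙ v := u :* a' ⊞ :- (# 2 :* y) :+ y' :+ z' ∙ u := z' :- y' ⊞ :- u ∙ z' := c :- y' ⊞ :- u ∙ c := a' :* x :+ # 2 :* y
        ⊞ # 1 ∙ x :* x' := (y' :- y) :* (y' :- y) ⊞ []) (conj-⊕ x ((z ⊕ ⊖ y) ⊗ a) , conj-⊗ (z ⊕ ⊖ y) a , conj-⊝ z y , conj-z , polar-b , im² , tt) refl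

    same : line (P∞ a b) (Q x y) ≈L line (Q x y) (Q x̃ z)
    same = line-through (two-points-independent (λ eq → z-y≢ (equal⇒difference-zero eq))) (OnLine-w _)
      (z ⊕ ⊖ y , 𝟙 , all4 (solve 2 (λ z y → # 1 := (z :- y) :* # 0 :+ # 1 :* # 1) refl z y) (solve 4 (λ z y a x → x :+ (z :- y) :* a := (z :- y) :* a :+ # 1 :* x) refl z y a x)
        (solve 2 (λ z y → z := (z :- y) :* # 1 :+ # 1 :* y) refl z y) (solve 2 (λ b y → (b :- y) :* (b :- y) := (b :- y :- y) :* b :+ # 1 :* (y :* y)) refl b y))

    D1-line : D1 (line (P∞ a b) (Q x y)) (sgn b y)
    D1-line = d1 x y z x̃ t curve x≢𝟘 (λ eq → z-y≢ (equal⇒difference-zero eq)) ratio t-norm polar same refl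

  open AffineLine using (D1-line) public

  norm-from-form : ∀ {u v} → u ⊗ conj u ⊕ 𝟚 ⊗ (v ⊗ conj v) ≡ 𝟘 → v ≢ 𝟘 → (u ⊗ inv v) ⊗ conj (u ⊗ inv v) ≡ ⊖ 𝟚
  norm-from-form {u} {v} eq n = linear (u ∷ v ∷ conj u ∷ conj v ∷ inv v ∷ conj (inv v) ∷ conj (u ⊗ inv v) ∷ []) (λ u v u' v' w w' c → u :* w :* c := :- # 2 ⊣ u :* w ∙ c := u' :* w'
      ⊞ :- # 2 ∙ v :* w := # 1 ⊞ :- (# 2 :* v :* w) ∙ v' :* w' := # 1 ⊞ w :* w' ∙ u :* u' :+ # 2 :* (v :* v') := # 0 ⊞ []) (conj-⊗ u (inv v) , inverseʳ v n , conj-inv n , eq , tt) refl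

  anisotropic : ∀ {u} → u ⊗ conj u ≡ 𝟘 → u ≡ 𝟘
  anisotropic {u} eq with u ≟ 𝟘
  ... | yes z = z
  ... | no n = ⊥-elim (⊗-nonzero n (conj-nonzero n) eq)

  -- (0,a,1,b) is the intersection with the plane X0 = 0. Its X2-coordinate cannot vanish: isotropy
  -- would then kill X1, and orthogonality to the given point would kill X3.
  affine-classification : ∀ {ℓ x y} → Generator ℓ → OnLine (Q x y) ℓ →
    Σ A λ a → Σ A λ b → a ⊗ conj a ≡ ⊖ 𝟚 × conj b ≡ conj a ⊗ x ⊕ 𝟚 ⊗ y × OnLine (P∞ a b) ℓ
  affine-classification {ℓ} {x} {y} gen oQ = X1 w ⊗ u , X3 w ⊗ u , norm-from-form ww w2≢
      , linear (x ∷ y ∷ conj (X1 w) ∷ conj (X2 w) ∷ conj (X3 w) ∷ conj u ∷ conj (X3 w ⊗ u) ∷ conj (X1 w ⊗ u) ∷ []) (λ x y w1' w2' w3' u' c a' → c := a' :* x :+ # 2 :* y ⊣ # 1 ∙ c := w3' :* u'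
          ⊞ :- x ∙ a' := w1' :* u' ⊞ u' ∙ w3' := x :* w1' :+ # 2 :* y :* w2' ⊞ # 2 :* y ∙ w2' :* u' := # 1 ⊞ []) (conj-⊗ (X3 w) u , conj-⊗ (X1 w) u , Qw , conj-inv w2≢ , tt) refl
      , OnLine-scale u coordinates ow
    where
    point = hyperplane-point {ℓ} {Q x y} zero (proj₁ gen) oQ (𝟘≢𝟙 ∘ sym)
    w : V
    w = proj₁ point
    ow : OnLine w ℓ
    ow = proj₁ (proj₂ point)
    w0 : X0 w ≡ 𝟘
    w0 = proj₁ (proj₂ (proj₂ point))
    u = inv (X2 w)
    conj-w0 : conj (X0 w) ≡ 𝟘
    conj-w0 = trans (cong conj w0) conj-𝟘
    ww : X1 w ⊗ conj (X1 w) ⊕ 𝟚 ⊗ (X2 w ⊗ conj (X2 w)) ≡ 𝟘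
    ww = linear (X0 w ∷ X1 w ∷ X2 w ∷ X3 w ∷ conj (X0 w) ∷ conj (X1 w) ∷ conj (X2 w) ∷ conj (X3 w) ∷ []) (λ a b c d a' b' c' d' → b :* b' :+ # 2 :* (c :* c') := # 0 ⊣ # 1 ∙ b :* b' :+ # 2 :* c :* c' :- a :* d' :- d :* a' := # 0
        ⊞ d' ∙ a := # 0 ⊞ d ∙ a' := # 0 ⊞ []) (generator-perp gen ow ow , w0 , conj-w0 , tt) refl
    Qw : conj (X3 w) ≡ x ⊗ conj (X1 w) ⊕ 𝟚 ⊗ y ⊗ conj (X2 w)
    Qw = linear (x ∷ y ∷ conj (X0 w) ∷ conj (X1 w) ∷ conj (X2 w) ∷ conj (X3 w) ∷ []) (λ x y a' b' c' d' → d' := x :* b' :+ # 2 :* y :* c' ⊣ :- # 1 ∙ x :* b' :+ # 2 :* y :* c' :- # 1 :* d' :- y :* y :* a' := # 0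
        ⊞ :- (y :* y) ∙ a' := # 0 ⊞ []) (generator-perp gen oQ ow , conj-w0 , tt) refl
    w2≢ : X2 w ≢ 𝟘
    w2≢ z = proj₂ (proj₂ (proj₂ point)) (all4 w0 w1 z (conj-injective (trans (linear (x ∷ y ∷ conj (X1 w) ∷ conj (X2 w) ∷ conj (X3 w) ∷ []) (λ x y b' c' d' → d' := # 0 ⊣ # 1 ∙ d' := x :* b' :+ # 2 :* y :* c'
        ⊞ x ∙ b' := # 0 ⊞ # 2 :* y ∙ c' := # 0 ⊞ []) (Qw , trans (cong conj w1) conj-𝟘 , trans (cong conj z) conj-𝟘 , tt) refl) (sym conj-𝟘))))
      where
      w1 : X1 w ≡ 𝟘
      w1 = anisotropic (linear (X1 w ∷ X2 w ∷ conj (X1 w) ∷ conj (X2 w) ∷ []) (λ b c b' c' → b :* b' := # 0 ⊣ # 1 ∙ b :* b' :+ # 2 :* (c :* c') := # 0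
          ⊞ :- (# 2 :* c') ∙ c := # 0 ⊞ []) (ww , z , tt) refl)

    coordinates : ∀ i → P∞ (X1 w ⊗ u) (X3 w ⊗ u) i ≡ u ⊗ w i
    coordinates = all4 (trans (sym (zeroʳ u)) (cong (u ⊗_) (sym w0))) (*-comm _ _) (sym (inverseˡ (X2 w) w2≢)) (*-comm _ _)

  P∞-Q-independent : ∀ {a b x y} → Independent (line (P∞ a b) (Q x y))
  P∞-Q-independent {a} {b} {x} {y} c d f = linear (c ∷ d ∷ y ∷ []) (λ c d y → c := # 0 ⊣ # 1 ∙ c :* # 1 :+ d :* y := # 0 ⊞ :- y ∙ d := # 0 ⊞ []) (f (suc (suc zero)) , d≡0 , tt) refl , d≡0
    where
    d≡0 : d ≡ 𝟘
    d≡0 = linear (c ∷ d ∷ []) (λ c d → d := # 0 ⊣ # 1 ∙ c :* # 0 :+ d :* # 1 := # 0 ⊞ []) (f zero , tt) refl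

  P∞-Q∞-independent : ∀ {a b} → Independent (line (P∞ a b) Q∞)
  P∞-Q∞-independent {a} {b} c d f = c≡0 , linear (c ∷ d ∷ b ∷ []) (λ c d b → d := # 0 ⊣ # 1 ∙ c :* b :+ d :* # 1 := # 0 ⊞ :- b ∙ c := # 0 ⊞ []) (f (suc (suc (suc zero))) , c≡0 , tt) refl
    where
    c≡0 : c ≡ 𝟘
    c≡0 = linear (c ∷ d ∷ []) (λ c d → c := # 0 ⊣ # 1 ∙ c :* # 1 :+ d :* # 0 := # 0 ⊞ []) (f (suc (suc zero)) , tt) refl

  Fq-⊖𝟙 : InFq (⊖ 𝟙)
  Fq-⊖𝟙 = Fq-⊖ Fq-𝟙

  norm-⊖ : ∀ {a} → a ⊗ conj a ≡ ⊖ 𝟚 → ⊖ a ⊗ conj (⊖ a) ≡ ⊖ 𝟚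
  norm-⊖ {a} n = linear (a ∷ conj a ∷ conj (⊖ a) ∷ []) (λ a a' c → :- a :* c := :- # 2 ⊣ :- a ∙ c := :- a' ⊞ # 1 ∙ a :* a' := :- # 2 ⊞ []) (conj-⊖ a , n , tt) refl

  D2-line∞ : ∀ {a b} → a ⊗ conj a ≡ ⊖ 𝟚 → D2 (line (P∞ a b) Q∞) (pow (⊖ a) h)
  -- For (e₁,f₁) = (0,1) the determinant forces e₂ = -1, which reverses the point and makes its
  -- X1-coordinate -a.
  D2-line∞ {a} {b} n = d2 𝟘 𝟙 (⊖ 𝟙) 𝟘 (⊖ a) Fq-𝟘 Fq-𝟙 Fq-⊖𝟙 Fq-𝟘 (solve 1 (λ o → # 0 :* # 0 :- :- # 1 :* # 1 := # 1) refl 𝟙) (norm-⊖ n)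
    (line-through (independent-at (suc (suc (suc zero))) (λ z → 𝟘≢𝟙 (linear (𝟙 ∷ []) (λ o → # 0 := # 1 ⊣ :- # 1 ∙ # 1 :* # 1 := # 0 ⊞ []) (z , tt) refl)) (solve 1 (λ o → # 2 :* # 1 :* # 0 := # 0) refl 𝟙)
        (λ z → ⊖-nonzero (norm-2⇒nonzero n) (z (suc zero))))
      (𝟘 , 𝟙 , all4 (solve 1 (λ o → # 0 :* # 0 := # 0 :* # 0 :+ # 1 :* # 0) refl 𝟙) (solve 1 (λ a → # 0 := # 0 :* a :+ # 1 :* # 0) refl a) (solve 1 (λ o → # 0 :* # 1 := # 0 :* # 1 :+ # 1 :* # 0) refl 𝟙) (solve 1 (λ b → # 1 :* # 1 := # 0 :* b :+ # 1 :* # 1) refl b))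
      (⊖ 𝟙 , b , all4 (solve 1 (λ b → # 2 :* # 0 :* :- # 1 := :- # 1 :* # 0 :+ b :* # 0) refl b) (solve 2 (λ a b → :- a := :- # 1 :* a :+ b :* # 0) refl a b) (solve 1 (λ b → # 0 :* # 0 :+ :- # 1 :* # 1 := :- # 1 :* # 1 :+ b :* # 0) refl b) (solve 1 (λ b → # 2 :* # 1 :* # 0 := :- # 1 :* b :+ b :* # 1) refl b)))
    refl

  Δ⁺-point : ∀ {v} → Δ⁺ v → Σ A λ x → Σ A λ y → Curve x y × x ≢ 𝟘 × v ∼ Q x y
  Δ⁺-point (inj₁ (x , y , c , r) , n) = x , y , c , (λ { refl → n (inj₁ (y , curve-𝟘 c refl , r)) }) , r
  Δ⁺-point (inj₂ r , n) = ⊥-elim (n (inj₂ r))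

  D1-exists : ∀ {ℓ} → 𝒢₁ ℓ → Σ A (D1 ℓ)
  D1-exists {ℓ} (gen , v , Δ , o) = let
      (x , y , c , n , r) = Δ⁺-point Δ
      oQ = OnLine-∼ {v} {Q x y} {ℓ} r o
      (a , b , an , pb , oP) = affine-classification gen oQ
    in sgn b y , D1-resp (line-through (P∞-Q-independent {a} {b} {x} {y}) oP oQ) (D1-line {a} {b} {x} {y} an c n pb)

  D2-affine : ∀ {ℓ a b y} → InFq y → OnLine (Q 𝟘 y) ℓ → a ⊗ conj a ≡ ⊖ 𝟚 → conj b ≡ conj a ⊗ 𝟘 ⊕ 𝟚 ⊗ y → OnLine (P∞ a b) ℓ → D2 ℓ (pow a h)
  D2-affine {ℓ} {a} {b} {y} iy oQ an pb oP = d2 𝟙 y 𝟘 𝟙 a Fq-𝟙 iy Fq-𝟘 Fq-𝟙 (solve 1 (λ y → # 1 :* # 1 :- # 0 :* y := # 1) refl y) an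
    (line-through {W 𝟙 y} {W′ 𝟙 y 𝟘 𝟙 a} (independent-at {W 𝟙 y} {W′ 𝟙 y 𝟘 𝟙 a} zero (λ z → 𝟘≢𝟙 (linear (𝟙 ∷ []) (λ o → # 0 := # 1 ⊣ :- # 1 ∙ # 1 :* # 1 := # 0 ⊞ []) (z , tt) refl)) (solve 1 (λ o → # 2 :* # 1 :* # 0 := # 0) refl 𝟙) (λ z → norm-2⇒nonzero an (z (suc zero))))
      (OnLine-resp {Q 𝟘 y} (all4 (solve 1 (λ o → # 1 :* # 1 := # 1) refl 𝟙) refl (solve 1 (λ y → # 1 :* y := y) refl y) refl) oQ)
      (OnLine-resp {P∞ a b} (all4 (solve 1 (λ o → # 2 :* # 1 :* # 0 := # 0) refl 𝟙) refl (solve 1 (λ y → # 1 :* # 1 :+ # 0 :* y := # 1) refl y) (linear (y ∷ b ∷ []) (λ y b → # 2 :* y :* # 1 := b ⊣ :- # 1 ∙ b := # 2 :* y ⊞ []) (b≡ , tt) refl)) oP))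
    refl
    where
    b≡ : b ≡ 𝟚 ⊗ y
    b≡ = conj-injective (linear (y ∷ conj b ∷ conj a ∷ conj (𝟚 ⊗ y) ∷ []) (λ y b' a' c → b' := c ⊣ # 1 ∙ b' := a' :* # 0 :+ # 2 :* y
        ⊞ :- # 1 ∙ c := # 2 :* y ⊞ []) (pb , Fq-⊗ Fq-𝟚 iy , tt) refl)

  D2-infinite : ∀ {ℓ} → Generator ℓ → OnLine Q∞ ℓ → Σ A (D2 ℓ)
  D2-infinite {ℓ} gen oQ = pow (⊖ a) h , D2-resp (line-through (P∞-Q∞-independent {a} {𝟘}) (OnLine-scale u coordinates ow) oQ) (D2-line∞ {a} {𝟘} (norm-from-form ww w2≢))
    where
    point = hyperplane-point {ℓ} {Q∞} (suc (suc (suc zero))) (proj₁ gen) oQ (𝟘≢𝟙 ∘ sym)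
    w : V
    w = proj₁ point
    ow : OnLine w ℓ
    ow = proj₁ (proj₂ point)
    w3 : X3 w ≡ 𝟘
    w3 = proj₁ (proj₂ (proj₂ point))
    u = inv (X2 w)
    a = X1 w ⊗ u
    w0 : X0 w ≡ 𝟘
    w0 = linear (X0 w ∷ H w Q∞ ∷ []) (λ x y → x := # 0 ⊣ # 1 ∙ y := :- x ⊞ :- # 1 ∙ y := # 0 ⊞ []) (H-Q∞ w , generator-perp gen ow oQ , tt) refl
    ww : X1 w ⊗ conj (X1 w) ⊕ 𝟚 ⊗ (X2 w ⊗ conj (X2 w)) ≡ 𝟘
    ww = linear (X0 w ∷ X1 w ∷ X2 w ∷ X3 w ∷ conj (X0 w) ∷ conj (X1 w) ∷ conj (X2 w) ∷ conj (X3 w) ∷ []) (λ a b c d a' b' c' d' → b :* b' :+ # 2 :* (c :* c') := # 0 ⊣ # 1 ∙ b :* b' :+ # 2 :* c :* c' :- a :* d' :- d :* a' := # 0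
        ⊞ d' ∙ a := # 0 ⊞ a' ∙ d := # 0 ⊞ []) (generator-perp gen ow ow , w0 , w3 , tt) refl
    w2≢ : X2 w ≢ 𝟘
    w2≢ z = proj₂ (proj₂ (proj₂ point)) (all4 w0 (anisotropic (linear (X1 w ∷ X2 w ∷ conj (X1 w) ∷ conj (X2 w) ∷ []) (λ b c b' c' → b :* b' := # 0 ⊣ # 1 ∙ b :* b' :+ # 2 :* (c :* c') := # 0
        ⊞ :- (# 2 :* c') ∙ c := # 0 ⊞ []) (ww , z , tt) refl)) z w3)
    coordinates : ∀ i → P∞ a 𝟘 i ≡ u ⊗ w i
    coordinates = all4 (trans (sym (zeroʳ u)) (cong (u ⊗_) (sym w0))) (*-comm _ _) (sym (inverseˡ (X2 w) w2≢)) (trans (sym (zeroʳ u)) (cong (u ⊗_) (sym w3)))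

  D2-exists : ∀ {ℓ} → 𝒢₂ ℓ → Σ A (D2 ℓ)
  D2-exists {ℓ} (gen , v , inj₁ (y , iy , r) , o) = let
      oQ = OnLine-∼ {v} {Q 𝟘 y} {ℓ} r o
      (a , b , an , pb , oP) = affine-classification gen oQ
    in pow a h , D2-affine {ℓ} {a} {b} {y} iy oQ an pb oP
  D2-exists {ℓ} (gen , v , inj₂ r , o) = D2-infinite gen (OnLine-∼ {v} {Q∞} {ℓ} r o)

  -- The groups 𝔊 and 𝔥

  Linear : (V → V) → Set
  Linear f = ∀ {a b u w v} → (∀ i → v i ≡ a ⊗ u i ⊕ b ⊗ w i) → ∀ i → f v i ≡ a ⊗ f u i ⊕ b ⊗ f w i

  mapL : (V → V) → Line → Line
  mapL f (line u w) = line (f u) (f w)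

  OnLine-map : ∀ {f} → Linear f → ∀ {v ℓ} → OnLine v ℓ → OnLine (f v) (mapL f ℓ)
  OnLine-map lin (a , b , eq) = a , b , lin eq

  mapL-≈ : ∀ {f} → Linear f → ∀ {ℓ m} → ℓ ≈L m → mapL f ℓ ≈L mapL f m
  mapL-≈ lin ((a , b) , (c , d)) = (OnLine-map lin a , OnLine-map lin b) , (OnLine-map lin c , OnLine-map lin d)

  mapL-cong : ∀ {f f′ : V → V} → (∀ v i → f v i ≡ f′ v i) → ∀ ℓ → mapL f ℓ ≈L mapL f′ ℓ
  mapL-cong {f} {f′} eq (line u w) =
    (OnLine-resp {f′ u} (eq u) (OnLine-u _) , OnLine-resp {f′ w} (eq w) (OnLine-w _))
    , (OnLine-resp {f u} (λ i → sym (eq u i)) (OnLine-u _) , OnLine-resp {f w} (λ i → sym (eq w i)) (OnLine-w _))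

  mapL-scale : ∀ {f f′ : V → V} c → c ≢ 𝟘 → (∀ v i → f v i ≡ c ⊗ f′ v i) → ∀ ℓ → mapL f ℓ ≈L mapL f′ ℓ
  mapL-scale c n eq (line u w) = scale-line c c n n (eq u) (eq w)

  apply-linear : ∀ M → Linear (apply M)
  apply-linear M {a} {b} {u} {w} {v} eq i = linear (a ∷ b ∷ M i zero ∷ M i (suc zero) ∷ M i (suc (suc zero)) ∷ M i (suc (suc (suc zero))) ∷ X0 v ∷ X1 v ∷ X2 v ∷ X3 v ∷ X0 u ∷ X1 u ∷ X2 u ∷ X3 u ∷ X0 w ∷ X1 w ∷ X2 w ∷ X3 w ∷ []) (λ a b m0 m1 m2 m3 v0 v1 v2 v3 u0 u1 u2 u3 w0 w1 w2 w3 → m0 :* v0 :+ m1 :* v1 :+ m2 :* v2 :+ m3 :* v3 := a :* (m0 :* u0 :+ m1 :* u1 :+ m2 :* u2 :+ m3 :* u3) :+ b :* (m0 :* w0 :+ m1 :* w1 :+ m2 :* w2 :+ m3 :* w3) ⊣ m0 ∙ v0 := a :* u0 :+ b :* w0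
      ⊞ m1 ∙ v1 := a :* u1 :+ b :* w1 ⊞ m2 ∙ v2 := a :* u2 :+ b :* w2 ⊞ m3 ∙ v3 := a :* u3 :+ b :* w3 ⊞ []) (eq zero , eq (suc zero) , eq (suc (suc zero)) , eq (suc (suc (suc zero))) , tt) refl

  apply-cong : ∀ M {v w} → (∀ i → v i ≡ w i) → ∀ i → apply M v i ≡ apply M w i
  apply-cong M eq i = cong₂ _⊕_ (cong₂ _⊕_ (cong₂ _⊕_ (cong (M i zero ⊗_) (eq zero)) (cong (M i (suc zero) ⊗_) (eq (suc zero))))
    (cong (M i (suc (suc zero)) ⊗_) (eq (suc (suc zero))))) (cong (M i (suc (suc (suc zero))) ⊗_) (eq (suc (suc (suc zero)))))

  private
    sum4-swap : ∀ (f : Fin 4 → Fin 4 → A) → sum4 (λ j → sum4 (λ k → f k j)) ≡ sum4 (λ k → sum4 (f k))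
    sum4-swap f = interchange (f zero) (f (suc zero)) (f (suc (suc zero))) (f (suc (suc (suc zero))))
      where
      interchange : ∀ (a b c d : V) → sum4 (λ j → a j ⊕ b j ⊕ c j ⊕ d j) ≡ sum4 a ⊕ sum4 b ⊕ sum4 c ⊕ sum4 d
      interchange a b c d = solve 16 (λ a0 a1 a2 a3 b0 b1 b2 b3 c0 c1 c2 c3 d0 d1 d2 d3 → a0 :+ b0 :+ c0 :+ d0 :+ (a1 :+ b1 :+ c1 :+ d1) :+ (a2 :+ b2 :+ c2 :+ d2) :+ (a3 :+ b3 :+ c3 :+ d3) := a0 :+ a1 :+ a2 :+ a3 :+ (b0 :+ b1 :+ b2 :+ b3) :+ (c0 :+ c1 :+ c2 :+ c3) :+ (d0 :+ d1 :+ d2 :+ d3)) refl (X0 a) (X1 a) (X2 a) (X3 a) (X0 b) (X1 b) (X2 b) (X3 b) (X0 c) (X1 c) (X2 c) (X3 c) (X0 d) (X1 d) (X2 d) (X3 d)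

    sum4-cong : ∀ {f f′ : V} → (∀ i → f i ≡ f′ i) → sum4 f ≡ sum4 f′
    sum4-cong eq = cong₂ _⊕_ (cong₂ _⊕_ (cong₂ _⊕_ (eq zero) (eq (suc zero))) (eq (suc (suc zero)))) (eq (suc (suc (suc zero))))

    sum4-*ʳ : ∀ (f : V) c → sum4 f ⊗ c ≡ sum4 (λ i → f i ⊗ c)
    sum4-*ʳ f c = solve 5 (λ a b d e c → (a :+ b :+ d :+ e) :* c := a :* c :+ b :* c :+ d :* c :+ e :* c) refl (X0 f) (X1 f) (X2 f) (X3 f) c

    sum4-*ˡ : ∀ (f : V) c → c ⊗ sum4 f ≡ sum4 (λ i → c ⊗ f i)
    sum4-*ˡ f c = solve 5 (λ a b d e c → c :* (a :+ b :+ d :+ e) := c :* a :+ c :* b :+ c :* d :+ c :* e) refl (X0 f) (X1 f) (X2 f) (X3 f) c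

  apply-· : ∀ M N v i → apply (M · N) v i ≡ apply M (apply N v) i
  apply-· M N v i = begin
    sum4 (λ j → sum4 (λ k → M i k ⊗ N k j) ⊗ v j)     ≡⟨ sum4-cong (λ j → sum4-*ʳ (λ k → M i k ⊗ N k j) (v j)) ⟩
    sum4 (λ j → sum4 (λ k → M i k ⊗ N k j ⊗ v j))     ≡⟨ sum4-swap (λ k j → M i k ⊗ N k j ⊗ v j) ⟩
    sum4 (λ k → sum4 (λ j → M i k ⊗ N k j ⊗ v j))     ≡⟨ sum4-cong (λ k → sum4-cong (λ j → *-assoc (M i k) (N k j) (v j))) ⟩
    sum4 (λ k → sum4 (λ j → M i k ⊗ (N k j ⊗ v j)))   ≡⟨ sum4-cong (λ k → sym (sum4-*ˡ (λ j → N k j ⊗ v j) (M i k))) ⟩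
    sum4 (λ k → M i k ⊗ sum4 (λ j → N k j ⊗ v j))     ∎
    where open ≡-Reasoning

  apply-I : ∀ v i → apply I v i ≡ v i
  apply-I v = all4
    (solve 4 (λ a b c d → # 1 :* a :+ # 0 :* b :+ # 0 :* c :+ # 0 :* d := a) refl (X0 v) (X1 v) (X2 v) (X3 v)) (solve 4 (λ a b c d → # 0 :* a :+ # 1 :* b :+ # 0 :* c :+ # 0 :* d := b) refl (X0 v) (X1 v) (X2 v) (X3 v))
    (solve 4 (λ a b c d → # 0 :* a :+ # 0 :* b :+ # 1 :* c :+ # 0 :* d := c) refl (X0 v) (X1 v) (X2 v) (X3 v)) (solve 4 (λ a b c d → # 0 :* a :+ # 0 :* b :+ # 0 :* c :+ # 1 :* d := d) refl (X0 v) (X1 v) (X2 v) (X3 v))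

  actL-· : ∀ M N ℓ → actL (M · N) ℓ ≈L actL M (actL N ℓ)
  actL-· M N ℓ = mapL-cong {apply (M · N)} {λ v → apply M (apply N v)} (apply-· M N) ℓ

  actL-I : ∀ ℓ → actL I ℓ ≈L ℓ
  actL-I ℓ = mapL-cong {apply I} {λ v → v} apply-I ℓ

  -- The symmetric square of the matrix (A B; C D) on (X0,X2,X3), acting on (1,y,y²) as y ↦ (Ay+B)/(Cy+D),
  -- and multiplication by m on X1.
  act : A → A → A → A → A → V → V
  act A B C D m v = v4 (D ⊗ D ⊗ X0 v ⊕ 𝟚 ⊗ C ⊗ D ⊗ X2 v ⊕ C ⊗ C ⊗ X3 v) (m ⊗ X1 v)
    (B ⊗ D ⊗ X0 v ⊕ (A ⊗ D ⊕ B ⊗ C) ⊗ X2 v ⊕ A ⊗ C ⊗ X3 v) (B ⊗ B ⊗ X0 v ⊕ 𝟚 ⊗ A ⊗ B ⊗ X2 v ⊕ A ⊗ A ⊗ X3 v)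

  act-linear : ∀ A B C D m → Linear (act A B C D m)
  act-linear A B C D m {a} {b} {u} {w} {v} eq = all4 (row (D ⊗ D) (𝟚 ⊗ C ⊗ D) (C ⊗ C))
      (linear (a ∷ b ∷ m ∷ X1 v ∷ X1 u ∷ X1 w ∷ []) (λ a b m v1 u1 w1 → m :* v1 := a :* (m :* u1) :+ b :* (m :* w1) ⊣ m ∙ v1 := a :* u1 :+ b :* w1 ⊞ []) (eq (suc zero) , tt) refl)
      (row (B ⊗ D) (A ⊗ D ⊕ B ⊗ C) (A ⊗ C)) (row (B ⊗ B) (𝟚 ⊗ A ⊗ B) (A ⊗ A))
    where
    row : ∀ k l n → k ⊗ X0 v ⊕ l ⊗ X2 v ⊕ n ⊗ X3 v ≡ a ⊗ (k ⊗ X0 u ⊕ l ⊗ X2 u ⊕ n ⊗ X3 u) ⊕ b ⊗ (k ⊗ X0 w ⊕ l ⊗ X2 w ⊕ n ⊗ X3 w)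
    row k l n = linear (k ∷ l ∷ n ∷ a ∷ b ∷ X0 v ∷ X2 v ∷ X3 v ∷ X0 u ∷ X2 u ∷ X3 u ∷ X0 w ∷ X2 w ∷ X3 w ∷ []) (λ k l n a b v0 v2 v3 u0 u2 u3 w0 w2 w3 → k :* v0 :+ l :* v2 :+ n :* v3 := a :* (k :* u0 :+ l :* u2 :+ n :* u3) :+ b :* (k :* w0 :+ l :* w2 :+ n :* w3) ⊣ k ∙ v0 := a :* u0 :+ b :* w0
        ⊞ l ∙ v2 := a :* u2 :+ b :* w2 ⊞ n ∙ v3 := a :* u3 :+ b :* w3 ⊞ []) (eq zero , eq (suc (suc zero)) , eq (suc (suc (suc zero))) , tt) refl

  act-∘ : ∀ A B C D m A′ B′ C′ D′ m′ v i → act A B C D m (act A′ B′ C′ D′ m′ v) i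
    ≡ act (A ⊗ A′ ⊕ B ⊗ C′) (A ⊗ B′ ⊕ B ⊗ D′) (C ⊗ A′ ⊕ D ⊗ C′) (C ⊗ B′ ⊕ D ⊗ D′) (m ⊗ m′) v i
  act-∘ A B C D m A′ B′ C′ D′ m′ v = all4
    (solve 11 (λ A B C D A′ B′ C′ D′ a b c → D :* D :* (D′ :* D′ :* a :+ # 2 :* C′ :* D′ :* b :+ C′ :* C′ :* c) :+ # 2 :* C :* D :* (B′ :* D′ :* a :+ (A′ :* D′ :+ B′ :* C′) :* b :+ A′ :* C′ :* c) :+ C :* C :* (B′ :* B′ :* a :+ # 2 :* A′ :* B′ :* b :+ A′ :* A′ :* c) := (C :* B′ :+ D :* D′) :* (C :* B′ :+ D :* D′) :* a :+ # 2 :* (C :* A′ :+ D :* C′) :* (C :* B′ :+ D :* D′) :* b :+ (C :* A′ :+ D :* C′) :* (C :* A′ :+ D :* C′) :* c) refl A B C D A′ B′ C′ D′ (X0 v) (X2 v) (X3 v))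
    (sym (*-assoc m m′ (X1 v)))
    (solve 11 (λ A B C D A′ B′ C′ D′ a b c → B :* D :* (D′ :* D′ :* a :+ # 2 :* C′ :* D′ :* b :+ C′ :* C′ :* c) :+ (A :* D :+ B :* C) :* (B′ :* D′ :* a :+ (A′ :* D′ :+ B′ :* C′) :* b :+ A′ :* C′ :* c) :+ A :* C :* (B′ :* B′ :* a :+ # 2 :* A′ :* B′ :* b :+ A′ :* A′ :* c) := (A :* B′ :+ B :* D′) :* (C :* B′ :+ D :* D′) :* a :+ ((A :* A′ :+ B :* C′) :* (C :* B′ :+ D :* D′) :+ (A :* B′ :+ B :* D′) :* (C :* A′ :+ D :* C′)) :* b :+ (A :* A′ :+ B :* C′) :* (C :* A′ :+ D :* C′) :* c) refl A B C D A′ B′ C′ D′ (X0 v) (X2 v) (X3 v))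
    (solve 11 (λ A B C D A′ B′ C′ D′ a b c → B :* B :* (D′ :* D′ :* a :+ # 2 :* C′ :* D′ :* b :+ C′ :* C′ :* c) :+ # 2 :* A :* B :* (B′ :* D′ :* a :+ (A′ :* D′ :+ B′ :* C′) :* b :+ A′ :* C′ :* c) :+ A :* A :* (B′ :* B′ :* a :+ # 2 :* A′ :* B′ :* b :+ A′ :* A′ :* c) := (A :* B′ :+ B :* D′) :* (A :* B′ :+ B :* D′) :* a :+ # 2 :* (A :* A′ :+ B :* C′) :* (A :* B′ :+ B :* D′) :* b :+ (A :* A′ :+ B :* C′) :* (A :* A′ :+ B :* C′) :* c) refl A B C D A′ B′ C′ D′ (X0 v) (X2 v) (X3 v))

  act-≡ : ∀ {A B C D m A′ B′ C′ D′ m′} → A ≡ A′ → B ≡ B′ → C ≡ C′ → D ≡ D′ → m ≡ m′ → ∀ v i → act A B C D m v i ≡ act A′ B′ C′ D′ m′ v i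
  act-≡ refl refl refl refl refl v i = refl

  -- Under y ↦ (Ay + B)/(Cy + D) the quantity y^q - y is multiplied by Det / N(Cy + D), and x^h by
  -- m^h / N(Cy + D), N being the norm; `m-power` is thus the condition that the curve equation is
  -- preserved.
  record Transformation : Set where
    constructor transformation
    field
      A′ B′ C′ D′ m : A
      Fq-A : InFq A′
      Fq-B : InFq B′
      Fq-C : InFq C′
      Fq-D : InFq D′
    Det : A
    Det = A′ ⊗ D′ ⊕ ⊖ (B′ ⊗ C′)
    field
      Det≢𝟘 : Det ≢ 𝟘
      m-power : pow m h ≡ Det
    action : V → V
    action = act A′ B′ C′ D′ m
    Fq-Det : InFq Det
    Fq-Det = Fq-⊕ (Fq-⊗ Fq-A Fq-D) (Fq-⊖ (Fq-⊗ Fq-B Fq-C))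

  module _ (T : Transformation) where
    open Transformation T renaming (A′ to a; B′ to b; C′ to c; D′ to d)

    private
      -- As y is not in F_q, a vanishing denominator would make both C and D zero.
      denominator≢ : ∀ y → conj y ⊕ ⊖ y ≢ 𝟘 → c ⊗ y ⊕ d ≢ 𝟘
      denominator≢ y n eq = Det≢𝟘 (linear (a ∷ b ∷ c ∷ d ∷ y ∷ []) (λ a b c d y → a :* d :- b :* c := # 0 ⊣ a ∙ c :* y :+ d := # 0
          ⊞ :- (a :* y) :- b ∙ c := # 0 ⊞ []) (eq , c≡0 , tt) refl)
        where
        c≡0 : c ≡ 𝟘
        c≡0 = integral (linear (c ∷ d ∷ y ∷ conj y ∷ conj (c ⊗ y ⊕ d) ∷ conj 𝟘 ∷ []) (λ c d y y' k z → (y' :- y) :* c := # 0 ⊣ :- # 1 ∙ c :* y :+ d := # 0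
            ⊞ # 1 ∙ k := z ⊞ # 1 ∙ z := # 0 ⊞ :- # 1 ∙ k := c :* y' :+ d ⊞ []) (eq , cong conj eq , conj-𝟘 , conj-affine Fq-C Fq-D y , tt) refl) n

      action-Q : ∀ x y n → (c ⊗ y ⊕ d) ⊗ n ≡ 𝟙 → ∀ i →
        action (Q x y) i ≡ (c ⊗ y ⊕ d) ⊗ (c ⊗ y ⊕ d) ⊗ Q (m ⊗ x ⊗ (n ⊗ n)) ((a ⊗ y ⊕ b) ⊗ n) i
      action-Q x y n eq = all4
        (solve 3 (λ c d y → d :* d :* # 1 :+ # 2 :* c :* d :* y :+ c :* c :* (y :* y) := (c :* y :+ d) :* (c :* y :+ d) :* # 1) refl c d y)
        (linear (c ∷ d ∷ y ∷ n ∷ m ∷ x ∷ []) (λ c d y n m x → m :* x := (c :* y :+ d) :* (c :* y :+ d) :* (m :* x :* (n :* n)) ⊣ :- (c :* y :* n :* m :* x) :- (d :* n :* m :* x) :- (m :* x) ∙ (c :* y :+ d) :* n := # 1 ⊞ []) (eq , tt) refl)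
        (linear (a ∷ b ∷ c ∷ d ∷ y ∷ n ∷ []) (λ a b c d y n → b :* d :* # 1 :+ (a :* d :+ b :* c) :* y :+ a :* c :* (y :* y) := (c :* y :+ d) :* (c :* y :+ d) :* ((a :* y :+ b) :* n) ⊣ :- (a :* c :* y :* y) :- (b :* c :* y) :- (a :* d :* y) :- (b :* d) ∙ (c :* y :+ d) :* n := # 1 ⊞ []) (eq , tt) refl)
        (linear (a ∷ b ∷ c ∷ d ∷ y ∷ n ∷ []) (λ a b c d y n → b :* b :* # 1 :+ # 2 :* a :* b :* y :+ a :* a :* (y :* y) := (c :* y :+ d) :* (c :* y :+ d) :* ((a :* y :+ b) :* n :* ((a :* y :+ b) :* n)) ⊣ :- (a :* a :* c :* y :* y :* y :* n) :- (# 2 :* a :* b :* c :* y :* y :* n) :- (a :* a :* d :* y :* y :* n) :- (b :* b :* c :* y :* n) :- (# 2 :* a :* b :* d :* y :* n) :- (a :* a :* y :* y) :- (b :* b :* d :* n) :- (# 2 :* a :* b :* y) :- (b :* b) ∙ (c :* y :+ d) :* n := # 1 ⊞ []) (eq , tt) refl)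

    -- With ν₁ = Cy + D, t is multiplied by ν₁^(q-1) and y^q - y by Det / N(ν₁). The contributions
    -- of ν₁ to the sign cancel, and the character of Det remains.
    D1-action : ∀ {ℓ s} → D1 ℓ s → D1 (mapL action ℓ) (pow Det j ⊗ s)
    D1-action {ℓ} {s} D = d1 x′ y′ z′ x̃′ t′ curve′ x′≢ z′≢y′ ratio′ t-norm′ polar′ same′ sign′
      where
      open D1 D
      im≢ : conj y ⊕ ⊖ y ≢ 𝟘
      im≢ = imaginary-nonzero curve x≢𝟘
      z-ȳ≢ : z ⊕ ⊖ conj y ≢ 𝟘
      z-ȳ≢ = factorʳ {t} (λ eq → difference-nonzero z≢y (trans (sym ratio) eq))
      z̄-y≢ : conj z ⊕ ⊖ y ≢ 𝟘
      z̄-y≢ eq = conj-nonzero z-ȳ≢ (trans (conj-⊝ z (conj y)) (trans (cong (λ w → conj z ⊕ ⊖ w) (conj-conj y)) eq))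
      imz≢ : conj z ⊕ ⊖ z ≢ 𝟘
      imz≢ = factorˡ (λ eq → ⊗-nonzero z-ȳ≢ z̄-y≢ (trans (D1-cross-ratio D) eq))
      ν₁ ν₂ n₁ n₂ x′ y′ z′ x̃′ t′ ν̄ n̄₁ n̄₂ : A
      ν₁ = c ⊗ y ⊕ d
      ν₂ = c ⊗ z ⊕ d
      n₁ = inv ν₁
      n₂ = inv ν₂
      ν̄ = conj ν₁
      n̄₁ = conj n₁
      n̄₂ = conj n₂
      x′ = m ⊗ x ⊗ (n₁ ⊗ n₁)
      y′ = (a ⊗ y ⊕ b) ⊗ n₁
      z′ = (a ⊗ z ⊕ b) ⊗ n₂
      x̃′ = m ⊗ x̃ ⊗ (n₂ ⊗ n₂)
      t′ = t ⊗ (n₁ ⊗ ν̄)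
      ν₁≢ : ν₁ ≢ 𝟘
      ν₁≢ = denominator≢ y im≢
      ν₂≢ : ν₂ ≢ 𝟘
      ν₂≢ = denominator≢ z imz≢
      e₁ : (c ⊗ y ⊕ d) ⊗ n₁ ≡ 𝟙
      e₁ = inverseʳ ν₁ ν₁≢
      e₂ : (c ⊗ z ⊕ d) ⊗ n₂ ≡ 𝟙
      e₂ = inverseʳ ν₂ ν₂≢
      ν̄≡ : ν̄ ≡ c ⊗ conj y ⊕ d
      ν̄≡ = conj-affine Fq-C Fq-D y
      ē₁ : (c ⊗ conj y ⊕ d) ⊗ n̄₁ ≡ 𝟙
      ē₁ = trans (cong (_⊗ n̄₁) (sym ν̄≡)) (conj-inv ν₁≢)
      ē₂ : (c ⊗ conj z ⊕ d) ⊗ n̄₂ ≡ 𝟙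
      ē₂ = trans (cong (_⊗ n̄₂) (sym (conj-affine Fq-C Fq-D z))) (conj-inv ν₂≢)
      ȳ′≡ : conj y′ ≡ (a ⊗ conj y ⊕ b) ⊗ n̄₁
      ȳ′≡ = trans (conj-⊗ (a ⊗ y ⊕ b) n₁) (cong (_⊗ n̄₁) (conj-affine Fq-A Fq-B y))
      z̄′≡ : conj z′ ≡ (a ⊗ conj z ⊕ b) ⊗ n̄₂
      z̄′≡ = trans (conj-⊗ (a ⊗ z ⊕ b) n₂) (cong (_⊗ n̄₂) (conj-affine Fq-A Fq-B z))
      difference : ∀ {u v k l} → (c ⊗ u ⊕ d) ⊗ k ≡ 𝟙 → (c ⊗ v ⊕ d) ⊗ l ≡ 𝟙 →
        (a ⊗ u ⊕ b) ⊗ k ⊕ ⊖ ((a ⊗ v ⊕ b) ⊗ l) ≡ Det ⊗ (u ⊕ ⊖ v) ⊗ (k ⊗ l)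
      difference {u} {v} {k} {l} ek el = linear (a ∷ b ∷ c ∷ d ∷ u ∷ v ∷ k ∷ l ∷ []) (λ a b c d u v k l → (a :* u :+ b) :* k :- (a :* v :+ b) :* l := (a :* d :- b :* c) :* (u :- v) :* (k :* l) ⊣ a :* v :* l :+ b :* l ∙ (c :* u :+ d) :* k := # 1
          ⊞ :- (a :* u :* k) :- (b :* k) ∙ (c :* v :+ d) :* l := # 1 ⊞ []) (ek , el , tt) refl
      im′ : conj y′ ⊕ ⊖ y′ ≡ Det ⊗ (conj y ⊕ ⊖ y) ⊗ (n̄₁ ⊗ n₁)
      im′ = trans (cong (_⊕ ⊖ y′) ȳ′≡) (difference ē₁ e₁)
      pow-square-h : ∀ w → pow (w ⊗ w) h ≡ w ⊗ conj w
      pow-square-h w = trans (pow-⊗ w w h) (pow-h² w)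
      curve′ : Curve x′ y′
      curve′ = trans im′ (sym (trans (pow-⊗ (m ⊗ x) (n₁ ⊗ n₁) h) (trans (cong₂ _⊗_ (trans (pow-⊗ m x h) (cong₂ _⊗_ m-power (sym curve))) (pow-square-h n₁))
        (cong (λ w → Det ⊗ (conj y ⊕ ⊖ y) ⊗ w) (*-comm n₁ n̄₁)))))
      m≢ : m ≢ 𝟘
      m≢ z = Det≢𝟘 (trans (sym m-power) (trans (pow-h m) (trans (cong (_⊗ pow m j) z) (zeroˡ _))))
      n₁≢ : n₁ ≢ 𝟘
      n₁≢ = inv-nonzero ν₁≢
      n₂≢ : n₂ ≢ 𝟘
      n₂≢ = inv-nonzero ν₂≢
      x′≢ : x′ ≢ 𝟘
      x′≢ = ⊗-nonzero (⊗-nonzero m≢ x≢𝟘) (⊗-nonzero n₁≢ n₁≢)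
      z′≢y′ : z′ ≢ y′
      z′≢y′ eq = ⊗-nonzero (⊗-nonzero Det≢𝟘 (difference-nonzero z≢y)) (⊗-nonzero n₂≢ n₁≢) (trans (sym (difference e₂ e₁)) (equal⇒difference-zero eq))
      ratio′ : t′ ⊗ (z′ ⊕ ⊖ conj y′) ≡ z′ ⊕ ⊖ y′
      ratio′ = trans (cong (λ w → t′ ⊗ w) (trans (cong (λ w → z′ ⊕ ⊖ w) ȳ′≡) (difference e₂ ē₁)))
        (trans (linear (t ∷ n₁ ∷ n₂ ∷ ν̄ ∷ n̄₁ ∷ Det ∷ y ∷ z ∷ conj y ∷ []) (λ t n₁ n₂ ν̄ n̄₁ D y z y' → t :* (n₁ :* ν̄) :* (D :* (z :- y') :* (n₂ :* n̄₁)) := D :* (z :- y) :* (n₂ :* n₁) ⊣ n₁ :* n₂ :* ν̄ :* n̄₁ :* D ∙ t :* (z :- y') := z :- y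
            ⊞ :- (n₁ :* n₂ :* D :* y) :+ n₁ :* n₂ :* D :* z ∙ ν̄ :* n̄₁ := # 1 ⊞ []) (ratio , conj-inv ν₁≢ , tt) refl) (sym (difference e₂ e₁)))
      t-norm′ : t′ ⊗ conj t′ ≡ 𝟚
      t-norm′ = linear (t ∷ n₁ ∷ ν₁ ∷ ν̄ ∷ n̄₁ ∷ conj t ∷ conj t′ ∷ conj (n₁ ⊗ ν̄) ∷ conj ν̄ ∷ []) (λ t n₁ ν₁ ν̄ n̄₁ t' k l νν → t :* (n₁ :* ν̄) :* k := # 2 ⊣ t :* n₁ :* ν̄ ∙ k := t' :* l
          ⊞ # 2 :* n₁ :* ν̄ ∙ l := n̄₁ :* νν ⊞ # 2 :* n₁ ∙ νν := ν₁ ⊞ n₁ :* ν̄ :* l ∙ t :* t' := # 2 ⊞ # 2 :* n₁ :* νν ∙ ν̄ :* n̄₁ := # 1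
          ⊞ # 2 ∙ ν₁ :* n₁ := # 1 ⊞ []) (conj-⊗ t (n₁ ⊗ ν̄) , conj-⊗ n₁ ν̄ , conj-conj ν₁ , t-norm , conj-inv ν₁≢ , inverseʳ ν₁ ν₁≢ , tt) refl
      m-norm : m ⊗ conj m ≡ Det ⊗ Det
      m-norm = trans (sym (pow-h² m)) (cong₂ _⊗_ m-power m-power)
      polar′ : x′ ⊗ conj x̃′ ≡ (conj z′ ⊕ ⊖ y′) ⊗ (conj z′ ⊕ ⊖ y′)
      polar′ = trans (linear (m ∷ x ∷ n₁ ∷ n₂ ∷ n̄₂ ∷ conj m ∷ conj x̃ ∷ conj x̃′ ∷ conj (m ⊗ x̃) ∷ conj (n₂ ⊗ n₂) ∷ Det ∷ y ∷ conj z ∷ []) (λ m x n₁ n₂ n̄₂ m' u k l r D y z' → m :* x :* (n₁ :* n₁) :* k := D :* (z' :- y) :* (n̄₂ :* n₁) :* (D :* (z' :- y) :* (n̄₂ :* n₁)) ⊣ m :* x :* n₁ :* n₁ ∙ k := l :* r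
          ⊞ m :* x :* n₁ :* n₁ :* r ∙ l := m' :* u
          ⊞ n₁ :* n₁ :* D :* D :* y :* y :- (# 2 :* n₁ :* n₁ :* D :* D :* y :* z') :+ n₁ :* n₁ :* D :* D :* z' :* z' ∙ r := n̄₂ :* n̄₂
          ⊞ x :* n₁ :* n₁ :* u :* r ∙ m :* m' := D :* D ⊞ n₁ :* n₁ :* r :* D :* D ∙ x :* u := (z' :- y) :* (z' :- y) ⊞ []) (conj-⊗ (m ⊗ x̃) (n₂ ⊗ n₂) , conj-⊗ m x̃ , conj-⊗ n₂ n₂ , m-norm , polar , tt) refl)
        (sym (cong (λ w → w ⊗ w) (trans (cong (_⊕ ⊖ y′) z̄′≡) (difference ē₂ e₁))))
      same′ : mapL action ℓ ≈L line (Q x′ y′) (Q x̃′ z′)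
      same′ = ≈L-trans (mapL-≈ (act-linear a b c d m) same)
        (scale-line (ν₁ ⊗ ν₁) (ν₂ ⊗ ν₂) (⊗-nonzero ν₁≢ ν₁≢) (⊗-nonzero ν₂≢ ν₂≢) (action-Q x y n₁ e₁) (action-Q x̃ z n₂ e₂))
      -- The factors are the powers of ν₁ with exponents (q² - 1)/2 and -(q² - 1)/2.
      cocycle : pow (n₁ ⊗ ν̄) h ⊗ pow (n̄₁ ⊗ n₁) j ≡ 𝟙
      cocycle = linear (n₁ ∷ ν̄ ∷ n̄₁ ∷ pow (n₁ ⊗ ν̄) h ∷ pow (n̄₁ ⊗ n₁) j ∷ pow (n₁ ⊗ ν̄) j ∷ pow n₁ j ∷ pow ν̄ j ∷ pow n̄₁ j ∷ pow (ν̄ ⊗ n̄₁) j ∷ pow 𝟙 j ∷ []) (λ n₁ ν̄ n̄₁ A B C D E G K L → A :* B := # 1 ⊣ ν̄ :* n̄₁ :* D :* G ∙ A := n₁ :* ν̄ :* C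
          ⊞ n₁ :* ν̄ :* D :* G ∙ C := D :* E ⊞ A ∙ B := G :* D ⊞ :- (ν̄ :* E :* G) ∙ n̄₁ := n₁ :* (D :* D)
          ⊞ n₁ :* ν̄ :* C :* D :* G :- (A :* D :* G) :+ E :* G ∙ ν̄ :* n̄₁ := # 1 ⊞ :- # 1 ∙ K := E :* G ⊞ # 1 ∙ K := L ⊞ # 1 ∙ L := # 1 ⊞ []) (pow-h (n₁ ⊗ ν̄) , pow-⊗ n₁ ν̄ j , pow-⊗ n̄₁ n₁ j , pow-q n₁ , conj-inv ν₁≢ , pow-⊗ ν̄ n̄₁ j , cong (λ w → pow w j) (conj-inv ν₁≢) , pow-𝟙 j , tt) refl
      sign′ : pow Det j ⊗ s ≡ pow t′ h ⊗ pow (conj y′ ⊕ ⊖ y′) j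
      sign′ = linear (s ∷ pow Det j ∷ pow t h ∷ pow (conj y ⊕ ⊖ y) j ∷ pow (n₁ ⊗ ν̄) h ∷ pow (n̄₁ ⊗ n₁) j ∷ pow t′ h ∷ pow (conj y′ ⊕ ⊖ y′) j ∷ pow (Det ⊗ (conj y ⊕ ⊖ y) ⊗ (n̄₁ ⊗ n₁)) j ∷ pow (Det ⊗ (conj y ⊕ ⊖ y)) j ∷ []) (λ s D t E G K t' E' L M → D :* s := t' :* E' ⊣ D ∙ s := t :* E
          ⊞ :- (K :* M) ∙ t' := t :* G ⊞ :- t' ∙ E' := L ⊞ :- t' ∙ L := M :* K ⊞ :- t ∙ M := D :* E ⊞ :- (t :* M) ∙ G :* K := # 1 ⊞ []) (sign , pow-⊗ t (n₁ ⊗ ν̄) h , cong (λ w → pow w j) im′ , pow-⊗ (Det ⊗ (conj y ⊕ ⊖ y)) (n̄₁ ⊗ n₁) j , pow-⊗ Det (conj y ⊕ ⊖ y) j , cocycle , tt) refl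

    -- To keep the determinant 1, the image of (e₂,f₂) is divided by Det. Hence `a` becomes m a /
    -- Det, and (m / Det)^h = Det^(1-h) is the character of Det.
    D2-action : ∀ {ℓ s} → D2 ℓ s → D2 (mapL action ℓ) (pow Det j ⊗ s)
    D2-action {ℓ} {s} D = d2 E₁ F₁ (E₂ ⊗ κ) (F₂ ⊗ κ) a′ (Fq-⊕ (Fq-⊗ Fq-C Fq-f₁) (Fq-⊗ Fq-D Fq-e₁)) (Fq-⊕ (Fq-⊗ Fq-A Fq-f₁) (Fq-⊗ Fq-B Fq-e₁))
        (Fq-⊗ (Fq-⊕ (Fq-⊗ Fq-C Fq-f₂) (Fq-⊗ Fq-D Fq-e₂)) Fq-κ) (Fq-⊗ (Fq-⊕ (Fq-⊗ Fq-A Fq-f₂) (Fq-⊗ Fq-B Fq-e₂)) Fq-κ) det′ norm′ same′ sign′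
      where
      open D2 D renaming (a to a₀)
      κ E₁ F₁ E₂ F₂ a′ : A
      κ = inv Det
      Detκ : (a ⊗ d ⊕ ⊖ (b ⊗ c)) ⊗ κ ≡ 𝟙
      Detκ = inverseʳ Det Det≢𝟘
      Fq-κ : InFq κ
      Fq-κ = Fq-inv Det≢𝟘 Fq-Det
      E₁ = c ⊗ f₁ ⊕ d ⊗ e₁
      F₁ = a ⊗ f₁ ⊕ b ⊗ e₁
      E₂ = c ⊗ f₂ ⊕ d ⊗ e₂
      F₂ = a ⊗ f₂ ⊕ b ⊗ e₂
      a′ = m ⊗ a₀ ⊗ κ
      det′ : E₁ ⊗ (F₂ ⊗ κ) ⊕ ⊖ (E₂ ⊗ κ ⊗ F₁) ≡ 𝟙
      det′ = linear (a ∷ b ∷ c ∷ d ∷ κ ∷ e₁ ∷ f₁ ∷ e₂ ∷ f₂ ∷ []) (λ a b c d κ e₁ f₁ e₂ f₂ → (c :* f₁ :+ d :* e₁) :* ((a :* f₂ :+ b :* e₂) :* κ) :- (c :* f₂ :+ d :* e₂) :* κ :* (a :* f₁ :+ b :* e₁) := # 1 ⊣ :- (b :* c :* κ) :+ a :* d :* κ ∙ e₁ :* f₂ :- e₂ :* f₁ := # 1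
          ⊞ # 1 ∙ (a :* d :- b :* c) :* κ := # 1 ⊞ []) (det , Detκ , tt) refl
      norm′ : a′ ⊗ conj a′ ≡ ⊖ 𝟚
      norm′ = linear (m ∷ κ ∷ conj m ∷ conj κ ∷ a₀ ∷ conj a₀ ∷ conj a′ ∷ conj (m ⊗ a₀) ∷ Det ∷ []) (λ m κ m' κ' A A' l r D → m :* A :* κ :* l := :- # 2 ⊣ m :* κ' :* A ∙ l := r :* κ'
          ⊞ m :* κ' :* κ' :* A ∙ r := m' :* A' ⊞ κ' :* A :* A' :* D :* D :- (m :* A :* l) :- (# 2 :* D) ∙ κ' := κ ⊞ κ' :* D ∙ A :* A' := :- # 2
          ⊞ κ' :* κ' :* A :* A' ∙ m :* m' := D :* D ⊞ κ' :* A :* A' :* D :- # 2 ∙ D :* κ := # 1 ⊞ []) (conj-⊗ (m ⊗ a₀) κ , conj-⊗ m a₀ , Fq-κ , a-norm , trans (sym (pow-h² m)) (cong₂ _⊗_ m-power m-power) , inverseʳ Det Det≢𝟘 , tt) refl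
      first : ∀ i → action (W e₁ f₁) i ≡ 𝟙 ⊗ W E₁ F₁ i
      first = all4
        (solve 4 (λ c d e₁ f₁ → d :* d :* (e₁ :* e₁) :+ # 2 :* c :* d :* (e₁ :* f₁) :+ c :* c :* (f₁ :* f₁) := # 1 :* ((c :* f₁ :+ d :* e₁) :* (c :* f₁ :+ d :* e₁))) refl c d e₁ f₁)
        (solve 1 (λ m → m :* # 0 := # 1 :* # 0) refl m)
        (solve 6 (λ a b c d e₁ f₁ → b :* d :* (e₁ :* e₁) :+ (a :* d :+ b :* c) :* (e₁ :* f₁) :+ a :* c :* (f₁ :* f₁) := # 1 :* ((c :* f₁ :+ d :* e₁) :* (a :* f₁ :+ b :* e₁))) refl a b c d e₁ f₁)
        (solve 4 (λ a b e₁ f₁ → b :* b :* (e₁ :* e₁) :+ # 2 :* a :* b :* (e₁ :* f₁) :+ a :* a :* (f₁ :* f₁) := # 1 :* ((a :* f₁ :+ b :* e₁) :* (a :* f₁ :+ b :* e₁))) refl a b e₁ f₁)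
      second : ∀ i → action (W′ e₁ f₁ e₂ f₂ a₀) i ≡ Det ⊗ W′ E₁ F₁ (E₂ ⊗ κ) (F₂ ⊗ κ) a′ i
      second = all4
        (linear (c ∷ d ∷ κ ∷ e₁ ∷ f₁ ∷ e₂ ∷ f₂ ∷ Det ∷ []) (λ c d κ e₁ f₁ e₂ f₂ D → d :* d :* (# 2 :* e₁ :* e₂) :+ # 2 :* c :* d :* (e₁ :* f₂ :+ e₂ :* f₁) :+ c :* c :* (# 2 :* f₁ :* f₂) := D :* (# 2 :* (c :* f₁ :+ d :* e₁) :* ((c :* f₂ :+ d :* e₂) :* κ)) ⊣ :- (# 2 :* d :* d :* e₁ :* e₂) :- (# 2 :* c :* d :* f₁ :* e₂) :- (# 2 :* c :* d :* e₁ :* f₂) :- (# 2 :* c :* c :* f₁ :* f₂) ∙ D :* κ := # 1 ⊞ []) (inverseʳ Det Det≢𝟘 , tt) refl)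
        (linear (m ∷ κ ∷ a₀ ∷ Det ∷ []) (λ m κ A D → m :* A := D :* (m :* A :* κ) ⊣ :- (m :* A) ∙ D :* κ := # 1 ⊞ []) (inverseʳ Det Det≢𝟘 , tt) refl)
        (linear (a ∷ b ∷ c ∷ d ∷ κ ∷ e₁ ∷ f₁ ∷ e₂ ∷ f₂ ∷ Det ∷ []) (λ a b c d κ e₁ f₁ e₂ f₂ D → b :* d :* (# 2 :* e₁ :* e₂) :+ (a :* d :+ b :* c) :* (e₁ :* f₂ :+ e₂ :* f₁) :+ a :* c :* (# 2 :* f₁ :* f₂) := D :* ((c :* f₁ :+ d :* e₁) :* ((a :* f₂ :+ b :* e₂) :* κ) :+ (c :* f₂ :+ d :* e₂) :* κ :* (a :* f₁ :+ b :* e₁)) ⊣ :- (# 2 :* b :* d :* e₁ :* e₂) :- (b :* c :* f₁ :* e₂) :- (a :* d :* f₁ :* e₂) :- (b :* c :* e₁ :* f₂) :- (a :* d :* e₁ :* f₂) :- (# 2 :* a :* c :* f₁ :* f₂) ∙ D :* κ := # 1 ⊞ []) (inverseʳ Det Det≢𝟘 , tt) refl)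
        (linear (a ∷ b ∷ κ ∷ e₁ ∷ f₁ ∷ e₂ ∷ f₂ ∷ Det ∷ []) (λ a b κ e₁ f₁ e₂ f₂ D → b :* b :* (# 2 :* e₁ :* e₂) :+ # 2 :* a :* b :* (e₁ :* f₂ :+ e₂ :* f₁) :+ a :* a :* (# 2 :* f₁ :* f₂) := D :* (# 2 :* (a :* f₁ :+ b :* e₁) :* ((a :* f₂ :+ b :* e₂) :* κ)) ⊣ :- (# 2 :* b :* b :* e₁ :* e₂) :- (# 2 :* a :* b :* f₁ :* e₂) :- (# 2 :* a :* b :* e₁ :* f₂) :- (# 2 :* a :* a :* f₁ :* f₂) ∙ D :* κ := # 1 ⊞ []) (inverseʳ Det Det≢𝟘 , tt) refl)
      same′ : mapL action ℓ ≈L line (W E₁ F₁) (W′ E₁ F₁ (E₂ ⊗ κ) (F₂ ⊗ κ) a′)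
      same′ = ≈L-trans (mapL-≈ (act-linear a b c d m) same) (scale-line 𝟙 Det (𝟘≢𝟙 ∘ sym) Det≢𝟘 first second)
      sign′ : pow Det j ⊗ s ≡ pow a′ h
      sign′ = linear (s ∷ κ ∷ Det ∷ pow Det j ∷ pow m h ∷ pow a₀ h ∷ pow κ h ∷ pow κ j ∷ pow a′ h ∷ pow (m ⊗ a₀) h ∷ pow (Det ⊗ κ) j ∷ pow 𝟙 j ∷ []) (λ s κ D P M A K J l r Z O → P :* s := l ⊣ :- (P :* J) ∙ l := r :* K
          ⊞ :- (κ :* J) ∙ r := M :* A ⊞ P ∙ s := A ⊞ :- (κ :* A :* J) ∙ M := D ⊞ :- (P :* J :* r) ∙ K := κ :* J ⊞ :- (A :* J) ∙ D :* κ := # 1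
          ⊞ κ :* J :* r :+ P :* A :- l ∙ Z := P :* J ⊞ :- (κ :* J :* r) :- (P :* A) :+ l ∙ Z := O ⊞ :- (κ :* J :* r) :- (P :* A) :+ l ∙ O := # 1
          ⊞ A :* J ∙ P :* P := # 1 ⊞ []) (pow-⊗ (m ⊗ a₀) κ h , pow-⊗ m a₀ h , sign , m-power , pow-h κ , inverseʳ Det Det≢𝟘 , pow-⊗ Det κ j , cong (λ w → pow w j) (inverseʳ Det Det≢𝟘) , pow-𝟙 j , character-square Fq-Det Det≢𝟘 , tt) refl

  Represents : Mat → Transformation → Set
  Represents M T = Σ A λ c → c ≢ 𝟘 × (∀ v i → apply M v i ≡ c ⊗ Transformation.action T v i)

  GenG-represented : ∀ {M} → GenG M → Σ Transformation (Represents M)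
  GenG-represented (genT α i) = transformation 𝟙 α 𝟘 𝟙 𝟙 Fq-𝟙 i Fq-𝟘 Fq-𝟙 (λ z → 𝟘≢𝟙 (linear (α ∷ []) (λ α → # 0 := # 1 ⊣ :- # 1 ∙ # 1 :* # 1 :- α :* # 0 := # 0 ⊞ []) (z , tt) refl)) (trans pow-h-𝟙 (solve 1 (λ α → # 1 := # 1 :* # 1 :- α :* # 0) refl α))
    , 𝟙 , 𝟘≢𝟙 ∘ sym , λ v → all4
      (solve 4 (λ a b c d → # 1 :* a :+ # 0 :* b :+ # 0 :* c :+ # 0 :* d := # 1 :* (# 1 :* # 1 :* a :+ # 2 :* # 0 :* # 1 :* c :+ # 0 :* # 0 :* d)) refl (X0 v) (X1 v) (X2 v) (X3 v))
      (solve 4 (λ a b c d → # 0 :* a :+ # 1 :* b :+ # 0 :* c :+ # 0 :* d := # 1 :* (# 1 :* b)) refl (X0 v) (X1 v) (X2 v) (X3 v))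
      (solve 5 (λ α a b c d → α :* a :+ # 0 :* b :+ # 1 :* c :+ # 0 :* d := # 1 :* (α :* # 1 :* a :+ (# 1 :* # 1 :+ α :* # 0) :* c :+ # 1 :* # 0 :* d)) refl α (X0 v) (X1 v) (X2 v) (X3 v))
      (solve 5 (λ α a b c d → α :* α :* a :+ # 0 :* b :+ # 2 :* α :* c :+ # 1 :* d := # 1 :* (α :* α :* a :+ # 2 :* # 1 :* α :* c :+ # 1 :* # 1 :* d)) refl α (X0 v) (X1 v) (X2 v) (X3 v))
  -- ρ times the matrix acts as y ↦ ρ y with m = ρ, and ρ^h = ρ because ρ is a square.
  GenG-represented (genM ρ i ρ≢ (s , is , eq)) = transformation ρ 𝟘 𝟘 𝟙 ρ i Fq-𝟘 Fq-𝟘 Fq-𝟙 (λ z → ρ≢ (linear (ρ ∷ []) (λ ρ → ρ := # 0 ⊣ # 1 ∙ ρ :* # 1 :- # 0 :* # 0 := # 0 ⊞ []) (z , tt) refl))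
      (trans (pow-h ρ) (trans (cong (ρ ⊗_) (trans (cong (λ w → pow w j) eq) (character-of-square is s≢))) (solve 1 (λ ρ → ρ :* # 1 := ρ :* # 1 :- # 0 :* # 0) refl ρ)))
    , inv ρ , inv-nonzero ρ≢ , λ v → all4
      (solve 5 (λ w a b c d → w :* a :+ # 0 :* b :+ # 0 :* c :+ # 0 :* d := w :* (# 1 :* # 1 :* a :+ # 2 :* # 0 :* # 1 :* c :+ # 0 :* # 0 :* d)) refl (inv ρ) (X0 v) (X1 v) (X2 v) (X3 v))
      (linear (ρ ∷ inv ρ ∷ X0 v ∷ X1 v ∷ X2 v ∷ X3 v ∷ []) (λ ρ w a b c d → # 0 :* a :+ # 1 :* b :+ # 0 :* c :+ # 0 :* d := w :* (ρ :* b) ⊣ :- b ∙ ρ :* w := # 1 ⊞ []) (inverseʳ ρ ρ≢ , tt) refl)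
      (linear (ρ ∷ inv ρ ∷ X0 v ∷ X1 v ∷ X2 v ∷ X3 v ∷ []) (λ ρ w a b c d → # 0 :* a :+ # 0 :* b :+ # 1 :* c :+ # 0 :* d := w :* (# 0 :* # 1 :* a :+ (ρ :* # 1 :+ # 0 :* # 0) :* c :+ ρ :* # 0 :* d) ⊣ :- c ∙ ρ :* w := # 1 ⊞ []) (inverseʳ ρ ρ≢ , tt) refl)
      (linear (ρ ∷ inv ρ ∷ X0 v ∷ X1 v ∷ X2 v ∷ X3 v ∷ []) (λ ρ w a b c d → # 0 :* a :+ # 0 :* b :+ # 0 :* c :+ ρ :* d := w :* (# 0 :* # 0 :* a :+ # 2 :* ρ :* # 0 :* c :+ ρ :* ρ :* d) ⊣ :- (ρ :* d) ∙ ρ :* w := # 1 ⊞ []) (inverseʳ ρ ρ≢ , tt) refl)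
    where
    s≢ : s ≢ 𝟘
    s≢ = factorˡ (λ z → ρ≢ (trans eq z))
  GenG-represented (genL λ' eq) = transformation 𝟙 𝟘 𝟘 𝟙 λ' Fq-𝟙 Fq-𝟘 Fq-𝟘 Fq-𝟙 (λ z → 𝟘≢𝟙 (linear (𝟙 ∷ []) (λ o → # 0 := # 1 ⊣ :- # 1 ∙ # 1 :* # 1 :- # 0 :* # 0 := # 0 ⊞ []) (z , tt) refl)) (trans eq (solve 1 (λ o → # 1 := # 1 :* # 1 :- # 0 :* # 0) refl 𝟙))
    , 𝟙 , 𝟘≢𝟙 ∘ sym , λ v → all4
      (solve 4 (λ a b c d → # 1 :* a :+ # 0 :* b :+ # 0 :* c :+ # 0 :* d := # 1 :* (# 1 :* # 1 :* a :+ # 2 :* # 0 :* # 1 :* c :+ # 0 :* # 0 :* d)) refl (X0 v) (X1 v) (X2 v) (X3 v))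
      (solve 5 (λ l a b c d → # 0 :* a :+ l :* b :+ # 0 :* c :+ # 0 :* d := # 1 :* (l :* b)) refl λ' (X0 v) (X1 v) (X2 v) (X3 v))
      (solve 4 (λ a b c d → # 0 :* a :+ # 0 :* b :+ # 1 :* c :+ # 0 :* d := # 1 :* (# 0 :* # 1 :* a :+ (# 1 :* # 1 :+ # 0 :* # 0) :* c :+ # 1 :* # 0 :* d)) refl (X0 v) (X1 v) (X2 v) (X3 v))
      (solve 4 (λ a b c d → # 0 :* a :+ # 0 :* b :+ # 0 :* c :+ # 1 :* d := # 1 :* (# 0 :* # 0 :* a :+ # 2 :* # 1 :* # 0 :* c :+ # 1 :* # 1 :* d)) refl (X0 v) (X1 v) (X2 v) (X3 v))
  GenG-represented (genN σ eq) = transformation 𝟘 𝟙 𝟙 𝟘 σ Fq-𝟘 Fq-𝟙 Fq-𝟙 Fq-𝟘 (λ z → 𝟘≢𝟙 (linear (𝟙 ∷ []) (λ o → # 0 := # 1 ⊣ # 1 ∙ # 0 :* # 0 :- # 1 :* # 1 := # 0 ⊞ []) (z , tt) refl)) (trans eq (solve 1 (λ o → :- # 1 := # 0 :* # 0 :- # 1 :* # 1) refl 𝟙))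
    , 𝟙 , 𝟘≢𝟙 ∘ sym , λ v → all4
      (solve 4 (λ a b c d → # 0 :* a :+ # 0 :* b :+ # 0 :* c :+ # 1 :* d := # 1 :* (# 0 :* # 0 :* a :+ # 2 :* # 1 :* # 0 :* c :+ # 1 :* # 1 :* d)) refl (X0 v) (X1 v) (X2 v) (X3 v))
      (solve 5 (λ σ a b c d → # 0 :* a :+ σ :* b :+ # 0 :* c :+ # 0 :* d := # 1 :* (σ :* b)) refl σ (X0 v) (X1 v) (X2 v) (X3 v))
      (solve 4 (λ a b c d → # 0 :* a :+ # 0 :* b :+ # 1 :* c :+ # 0 :* d := # 1 :* (# 1 :* # 0 :* a :+ (# 0 :* # 0 :+ # 1 :* # 1) :* c :+ # 0 :* # 1 :* d)) refl (X0 v) (X1 v) (X2 v) (X3 v))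
      (solve 4 (λ a b c d → # 1 :* a :+ # 0 :* b :+ # 0 :* c :+ # 0 :* d := # 1 :* (# 1 :* # 1 :* a :+ # 2 :* # 0 :* # 1 :* c :+ # 0 :* # 0 :* d)) refl (X0 v) (X1 v) (X2 v) (X3 v))
  -- The determinant is -μ, and μ^h = -μ precisely because μ is a nonresidue.
  GenG-represented (genR μ i ns) = transformation 𝟘 μ 𝟙 𝟘 μ Fq-𝟘 i Fq-𝟙 Fq-𝟘 (λ z → μ≢ (linear (μ ∷ []) (λ μ → μ := # 0 ⊣ :- # 1 ∙ # 0 :* # 0 :- μ :* # 1 := # 0 ⊞ []) (z , tt) refl))
      (trans (pow-h μ) (trans (cong (μ ⊗_) nonresidue) (solve 1 (λ μ → μ :* :- # 1 := # 0 :* # 0 :- μ :* # 1) refl μ)))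
    , inv μ , inv-nonzero μ≢ , λ v → all4
      (solve 5 (λ w a b c d → # 0 :* a :+ # 0 :* b :+ # 0 :* c :+ w :* d := w :* (# 0 :* # 0 :* a :+ # 2 :* # 1 :* # 0 :* c :+ # 1 :* # 1 :* d)) refl (inv μ) (X0 v) (X1 v) (X2 v) (X3 v))
      (linear (μ ∷ inv μ ∷ X0 v ∷ X1 v ∷ X2 v ∷ X3 v ∷ []) (λ μ w a b c d → # 0 :* a :+ # 1 :* b :+ # 0 :* c :+ # 0 :* d := w :* (μ :* b) ⊣ :- b ∙ μ :* w := # 1 ⊞ []) (inverseʳ μ μ≢ , tt) refl)
      (linear (μ ∷ inv μ ∷ X0 v ∷ X1 v ∷ X2 v ∷ X3 v ∷ []) (λ μ w a b c d → # 0 :* a :+ # 0 :* b :+ # 1 :* c :+ # 0 :* d := w :* (μ :* # 0 :* a :+ (# 0 :* # 0 :+ μ :* # 1) :* c :+ # 0 :* # 1 :* d) ⊣ :- c ∙ μ :* w := # 1 ⊞ []) (inverseʳ μ μ≢ , tt) refl)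
      (linear (μ ∷ inv μ ∷ X0 v ∷ X1 v ∷ X2 v ∷ X3 v ∷ []) (λ μ w a b c d → μ :* a :+ # 0 :* b :+ # 0 :* c :+ # 0 :* d := w :* (μ :* μ :* a :+ # 2 :* # 0 :* μ :* c :+ # 0 :* # 0 :* d) ⊣ :- (μ :* a) ∙ μ :* w := # 1 ⊞ []) (inverseʳ μ μ≢ , tt) refl)
    where
    μ≢ : μ ≢ 𝟘
    μ≢ z = ns (𝟘 , Fq-𝟘 , trans z (sym (zeroˡ 𝟘)))
    nonresidue : pow μ j ≡ ⊖ 𝟙
    nonresidue = [ (λ r → let (s , is , eq) = residue⇒square i r in ⊥-elim (ns (s , is , sym eq))) , (λ r → r) ]′ (character-values i μ≢)

  -- 𝔊 acts on the invariants of both families through one and the same sign.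
  record ActsBy (M : Mat) (ε : A) : Set where
    field
      is-sign : ε ≡ 𝟙 ⊎ ε ≡ ⊖ 𝟙
      on-D1 : ∀ {ℓ s} → D1 ℓ s → D1 (actL M ℓ) (ε ⊗ s)
      on-D2 : ∀ {ℓ s} → D2 ℓ s → D2 (actL M ℓ) (ε ⊗ s)
  open ActsBy

  sign-product : ∀ {a b} → a ≡ 𝟙 ⊎ a ≡ ⊖ 𝟙 → b ≡ 𝟙 ⊎ b ≡ ⊖ 𝟙 → a ⊗ b ≡ 𝟙 ⊎ a ⊗ b ≡ ⊖ 𝟙
  sign-product (inj₁ refl) (inj₁ refl) = inj₁ (*-identityˡ 𝟙)
  sign-product (inj₁ refl) (inj₂ refl) = inj₂ (*-identityˡ (⊖ 𝟙))
  sign-product (inj₂ refl) (inj₁ refl) = inj₂ (*-identityʳ (⊖ 𝟙))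
  sign-product (inj₂ refl) (inj₂ refl) = inj₁ ⊖𝟙-square

  represented-ActsBy : ∀ {M} T → Represents M T → ActsBy M (pow (Transformation.Det T) j)
  represented-ActsBy {M} T (c , c≢ , eq) = record
    { is-sign = character-values (Transformation.Fq-Det T) (Transformation.Det≢𝟘 T)
    ; on-D1 = λ {ℓ} D → D1-resp (mapL-scale {apply M} {Transformation.action T} c c≢ eq ℓ) (D1-action T D)
    ; on-D2 = λ {ℓ} D → D2-resp (mapL-scale {apply M} {Transformation.action T} c c≢ eq ℓ) (D2-action T D) }

  ActsBy-I : ActsBy I 𝟙
  ActsBy-I = record
    { is-sign = inj₁ refl
    ; on-D1 = λ {ℓ} {s} D → D1-resp (actL-I ℓ) (subst (D1 ℓ) (sym (*-identityˡ s)) D)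
    ; on-D2 = λ {ℓ} {s} D → D2-resp (actL-I ℓ) (subst (D2 ℓ) (sym (*-identityˡ s)) D) }

  ActsBy-· : ∀ {M N a b} → ActsBy M a → ActsBy N b → ActsBy (M · N) (a ⊗ b)
  ActsBy-· {M} {N} {a} {b} m n = record
    { is-sign = sign-product (is-sign m) (is-sign n)
    ; on-D1 = λ {ℓ} {s} D → D1-resp (actL-· M N ℓ) (subst (D1 (actL M (actL N ℓ))) (sym (*-assoc a b s)) (on-D1 m (on-D1 n D)))
    ; on-D2 = λ {ℓ} {s} D → D2-resp (actL-· M N ℓ) (subst (D2 (actL M (actL N ℓ))) (sym (*-assoc a b s)) (on-D2 m (on-D2 n D))) }

  In𝔊-ActsBy : ∀ {M} → In𝔊 M → Σ A (ActsBy M)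
  In𝔊-ActsBy one = 𝟙 , ActsBy-I
  In𝔊-ActsBy (step {g₀} g M) = let (T , r) = GenG-represented g ; (ε , a) = In𝔊-ActsBy M in _ , ActsBy-· (represented-ActsBy {g₀} T r) a

  mpow-ActsBy : ∀ {M ε} n → ActsBy M ε → ActsBy (mpow M n) (pow ε n)
  mpow-ActsBy zero a = ActsBy-I
  mpow-ActsBy (suc n) a = ActsBy-· a (mpow-ActsBy n a)

  -- (-1)^p is a sign, and it is not 1, since (-1)^q = -1 and q is a power of p.
  ⊖𝟙-odd-power : ∀ k → pow (⊖ 𝟙) (p ℕ.^ k) ≡ ⊖ 𝟙
  ⊖𝟙-odd-power zero = pow-1 (⊖ 𝟙)
  ⊖𝟙-odd-power (suc k) = trans (pow-* (⊖ 𝟙) p (p ℕ.^ k)) (trans (cong (λ z → pow z (p ℕ.^ k)) odd) (⊖𝟙-odd-power k))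
    where
    values : pow (⊖ 𝟙) p ≡ 𝟙 ⊎ pow (⊖ 𝟙) p ≡ ⊖ 𝟙
    values = square-roots (trans (sym (pow-⊗ (⊖ 𝟙) (⊖ 𝟙) p)) (trans (cong (λ z → pow z p) ⊖𝟙-square) (trans (pow-𝟙 p) (sym (*-identityˡ 𝟙)))))
    odd : pow (⊖ 𝟙) p ≡ ⊖ 𝟙
    odd = [ (λ eq → ⊥-elim (⊖𝟙≢𝟙 (trans (sym (trans (conj-⊖ 𝟙) (cong ⊖_ conj-𝟙))) (trans (cong (pow (⊖ 𝟙)) q≡)
        (trans (pow-* (⊖ 𝟙) p (p ℕ.^ exponent)) (trans (cong (λ z → pow z (p ℕ.^ exponent)) eq) (pow-𝟙 (p ℕ.^ exponent)))))))) , (λ eq → eq) ]′ values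

  apply-scalar : ∀ {M} → M ≈P I → ∀ ℓ → ℓ ≈L actL M ℓ
  apply-scalar {M} (c , c≢ , eq) ℓ = ≈L-trans (≈L-sym (actL-I ℓ)) (≈L-sym (mapL-scale {apply M} {apply I} c c≢
    (λ v i → linear (c ∷ M i zero ∷ M i (suc zero) ∷ M i (suc (suc zero)) ∷ M i (suc (suc (suc zero))) ∷ I i zero ∷ I i (suc zero) ∷ I i (suc (suc zero)) ∷ I i (suc (suc (suc zero))) ∷ X0 v ∷ X1 v ∷ X2 v ∷ X3 v ∷ []) (λ c m0 m1 m2 m3 n0 n1 n2 n3 v0 v1 v2 v3 → m0 :* v0 :+ m1 :* v1 :+ m2 :* v2 :+ m3 :* v3 := c :* (n0 :* v0 :+ n1 :* v1 :+ n2 :* v2 :+ n3 :* v3) ⊣ v0 ∙ m0 := c :* n0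
        ⊞ v1 ∙ m1 := c :* n1 ⊞ v2 ∙ m2 := c :* n2 ⊞ v3 ∙ m3 := c :* n3 ⊞ []) (eq i zero , eq i (suc zero) , eq i (suc (suc zero)) , eq i (suc (suc (suc zero))) , tt) refl) ℓ))

  -- A sign equals its own p^k-th power, by `⊖𝟙-odd-power`.
  trivial-sign : ∀ {ε s} k → ε ≡ 𝟙 ⊎ ε ≡ ⊖ 𝟙 → s ⊗ s ≡ ⊖ 𝟚 → pow ε (p ℕ.^ k) ⊗ s ≡ s → ε ⊗ s ≡ s
  trivial-sign {ε} {s} k (inj₁ refl) _ _ = *-identityˡ s
  trivial-sign {ε} {s} k (inj₂ refl) s² eq = trans (cong (_⊗ s) (sym (⊖𝟙-odd-power k))) eq

  -- Some power M^(p^k) is scalar and fixes the line, hence by `D1-functional` its sign; as p^k is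
  -- odd, M multiplies the sign by the same factor as this power.
  Gen𝔥-D1 : ∀ {M ℓ s} → Gen𝔥 M → D1 ℓ s → D1 (actL M ℓ) s
  Gen𝔥-D1 {M} {ℓ} {s} (fromP g (k , r)) D = let (ε , a) = In𝔊-ActsBy g in
    subst (D1 (actL M ℓ)) (trivial-sign k (is-sign a) (D1-square D) (D1-functional (D1-resp (apply-scalar r ℓ) (on-D1 (mpow-ActsBy (p ℕ.^ k) a) D)) D)) (on-D1 a D)
  Gen𝔥-D1 {M} {ℓ} {s} (fromL λ' eq) D = let (T , r) = GenG-represented (genL λ' eq) in
    subst (D1 (actL M ℓ)) (trans (cong (λ z → pow z j ⊗ s) (solve 1 (λ o → # 1 :* # 1 :- # 0 :* # 0 := # 1) refl 𝟙)) (trans (cong (_⊗ s) (pow-𝟙 j)) (*-identityˡ s))) (on-D1 (represented-ActsBy {𝐋 λ'} T r) D)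

  Gen𝔥-D2 : ∀ {M ℓ s} → Gen𝔥 M → D2 ℓ s → D2 (actL M ℓ) s
  Gen𝔥-D2 {M} {ℓ} {s} (fromP g (k , r)) D = let (ε , a) = In𝔊-ActsBy g in
    subst (D2 (actL M ℓ)) (trivial-sign k (is-sign a) (D2-square D) (D2-functional (D2-resp (apply-scalar r ℓ) (on-D2 (mpow-ActsBy (p ℕ.^ k) a) D)) D)) (on-D2 a D)
  Gen𝔥-D2 {M} {ℓ} {s} (fromL λ' eq) D = let (T , r) = GenG-represented (genL λ' eq) in
    subst (D2 (actL M ℓ)) (trans (cong (λ z → pow z j ⊗ s) (solve 1 (λ o → # 1 :* # 1 :- # 0 :* # 0 := # 1) refl 𝟙)) (trans (cong (_⊗ s) (pow-𝟙 j)) (*-identityˡ s))) (on-D2 (represented-ActsBy {𝐋 λ'} T r) D)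

  In𝔥-D1 : ∀ {M ℓ s} → In𝔥 M → D1 ℓ s → D1 (actL M ℓ) s
  In𝔥-D1 {ℓ = ℓ} one D = D1-resp (actL-I ℓ) D
  In𝔥-D1 {ℓ = ℓ} (step {g₀} {M} g m) D = D1-resp (actL-· g₀ M ℓ) (Gen𝔥-D1 g (In𝔥-D1 m D))

  In𝔥-D2 : ∀ {M ℓ s} → In𝔥 M → D2 ℓ s → D2 (actL M ℓ) s
  In𝔥-D2 {ℓ = ℓ} one D = D2-resp (actL-I ℓ) D
  In𝔥-D2 {ℓ = ℓ} (step {g₀} {M} g m) D = D2-resp (actL-· g₀ M ℓ) (Gen𝔥-D2 g (In𝔥-D2 m D))

  -- Explicit elements of 𝔥

  -- Elements of 𝔥 are handled through the maps that they induce on vectors, so that products of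
  -- concrete matrices never have to be multiplied out.
  Hmap : (V → V) → Set
  Hmap f = Σ Mat λ M → In𝔥 M × (∀ v i → apply M v i ≡ f v i)

  In𝔥-· : ∀ {M N} → In𝔥 M → In𝔥 N → Σ Mat λ K → In𝔥 K × (∀ v i → apply K v i ≡ apply M (apply N v) i)
  In𝔥-· {N = N} one n = N , n , λ v i → sym (apply-I (apply N v) i)
  In𝔥-· {N = N} (step {g₀} {M} g m) n = let (K , inK , eq) = In𝔥-· m n in
    g₀ · K , step g inK , λ v i → trans (apply-· g₀ K v i) (trans (apply-cong g₀ (eq v) i) (sym (apply-· g₀ M (apply N v) i)))

  Hmap-∘ : ∀ {f f′} → Hmap f → Hmap f′ → Hmap (λ v → f (f′ v))
  Hmap-∘ {f} {f′} (M , m , eq) (N , n , eq′) = let (K , inK , eqK) = In𝔥-· m n in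
    K , inK , λ v i → trans (eqK v i) (trans (apply-cong M (eq′ v) i) (eq (f′ v) i))

  Hmap-resp : ∀ {f f′} → (∀ v i → f′ v i ≡ f v i) → Hmap f → Hmap f′
  Hmap-resp eq (M , m , eq′) = M , m , λ v i → trans (eq′ v i) (sym (eq v i))

  Hmap-Gen : ∀ {M} → Gen𝔥 M → Hmap (apply M)
  Hmap-Gen {M} g = M · I , step g one , λ v i → trans (apply-· M I v i) (apply-cong M (apply-I v) i)

  -- One-parameter groups consist of elements of order p.
  one-parameter : ∀ (f : A → V → V) → (∀ α β v i → f α (f β v) i ≡ f (α ⊕ β) v i) → (∀ v i → f 𝟘 v i ≡ v i) →
    ∀ {M α} → In𝔊 M → (∀ v i → apply M v i ≡ f α v i) → Hmap (f α)
  one-parameter f add zero′ {M} {α} g eq = Hmap-resp (λ v i → sym (eq v i)) (Hmap-Gen (fromP g (1 , 𝟙 , 𝟘≢𝟙 ∘ sym , power-identity)))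
    where
    power : ∀ n v i → apply (mpow M n) v i ≡ f (n ·ℕ α) v i
    power zero v i = trans (apply-I v i) (sym (zero′ v i))
    power (suc n) v i = trans (apply-· M (mpow M n) v i) (trans (apply-cong M (power n v) i) (trans (eq (f (n ·ℕ α) v) i) (add α (n ·ℕ α) v i)))
    identity : ∀ v i → apply (mpow M (p ℕ.^ 1)) v i ≡ v i
    identity v i = trans (power (p ℕ.^ 1) v i) (trans (cong (λ z → f z v i) (multiple-zero (divides 1 (ℕ.*-comm p 1)) α)) (zero′ v i))
    -- A matrix acting trivially on all vectors is the identity: its entries are read off from the
    -- images of the columns of `I`.
    entry : ∀ (N : Mat) i j → N i j ≡ apply N (λ k → I k j) i
    entry N i zero = solve 4 (λ a b c d → a := a :* # 1 :+ b :* # 0 :+ c :* # 0 :+ d :* # 0) refl (N i zero) (N i (suc zero)) (N i (suc (suc zero))) (N i (suc (suc (suc zero))))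
    entry N i (suc zero) = solve 4 (λ a b c d → b := a :* # 0 :+ b :* # 1 :+ c :* # 0 :+ d :* # 0) refl (N i zero) (N i (suc zero)) (N i (suc (suc zero))) (N i (suc (suc (suc zero))))
    entry N i (suc (suc zero)) = solve 4 (λ a b c d → c := a :* # 0 :+ b :* # 0 :+ c :* # 1 :+ d :* # 0) refl (N i zero) (N i (suc zero)) (N i (suc (suc zero))) (N i (suc (suc (suc zero))))
    entry N i (suc (suc (suc zero))) = solve 4 (λ a b c d → d := a :* # 0 :+ b :* # 0 :+ c :* # 0 :+ d :* # 1) refl (N i zero) (N i (suc zero)) (N i (suc (suc zero))) (N i (suc (suc (suc zero))))
    power-identity : ∀ i j → mpow M (p ℕ.^ 1) i j ≡ 𝟙 ⊗ I i j
    power-identity i j = trans (entry (mpow M (p ℕ.^ 1)) i j) (trans (identity (λ k → I k j) i) (sym (*-identityˡ _)))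

  act-identity : ∀ v i → act 𝟙 𝟘 𝟘 𝟙 𝟙 v i ≡ v i
  act-identity v = all4 (solve 3 (λ a b c → # 1 :* # 1 :* a :+ # 2 :* # 0 :* # 1 :* b :+ # 0 :* # 0 :* c := a) refl (X0 v) (X2 v) (X3 v)) (*-identityˡ _)
    (solve 3 (λ a b c → # 0 :* # 1 :* a :+ (# 1 :* # 1 :+ # 0 :* # 0) :* b :+ # 1 :* # 0 :* c := b) refl (X0 v) (X2 v) (X3 v)) (solve 3 (λ a b c → # 0 :* # 0 :* a :+ # 2 :* # 1 :* # 0 :* b :+ # 1 :* # 1 :* c := c) refl (X0 v) (X2 v) (X3 v))

  Hmap-upper : ∀ {α} → InFq α → Hmap (act 𝟙 α 𝟘 𝟙 𝟙)
  Hmap-upper {α} i = one-parameter (λ α → act 𝟙 α 𝟘 𝟙 𝟙)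
    (λ α β v i → trans (act-∘ 𝟙 α 𝟘 𝟙 𝟙 𝟙 β 𝟘 𝟙 𝟙 v i) (act-≡ (solve 1 (λ α → # 1 :* # 1 :+ α :* # 0 := # 1) refl α) (solve 2 (λ α β → # 1 :* β :+ α :* # 1 := α :+ β) refl α β) (solve 1 (λ α → # 0 :* # 1 :+ # 1 :* # 0 := # 0) refl α) (solve 1 (λ β → # 0 :* β :+ # 1 :* # 1 := # 1) refl β) (*-identityˡ 𝟙) v i))
    act-identity (step (genT α i) one)
    (λ v i′ → let (_ , _ , _ , eq) = GenG-represented (genT α i) in trans (apply-· (𝐓 α) I v i′) (trans (apply-cong (𝐓 α) (apply-I v) i′) (trans (eq v i′) (*-identityˡ _))))

  -- The conjugate of `𝐓 β` by `𝐍 (⊖ 𝟙)`, which inverts y. The conjugating element is admissible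
  -- because h is odd; it need only belong to 𝔊, since the conjugate itself has p-power order.
  Hmap-lower : ∀ {β} → InFq β → Hmap (act 𝟙 𝟘 β 𝟙 𝟙)
  Hmap-lower {β} i = one-parameter (λ β → act 𝟙 𝟘 β 𝟙 𝟙)
    (λ α β v i → trans (act-∘ 𝟙 𝟘 α 𝟙 𝟙 𝟙 𝟘 β 𝟙 𝟙 v i) (act-≡ (solve 1 (λ β → # 1 :* # 1 :+ # 0 :* β := # 1) refl β) (solve 1 (λ o → # 1 :* # 0 :+ # 0 :* # 1 := # 0) refl 𝟙) (solve 2 (λ α β → α :* # 1 :+ # 1 :* β := α :+ β) refl α β) (solve 1 (λ α → α :* # 0 :+ # 1 :* # 1 := # 1) refl α) (*-identityˡ 𝟙) v i))
    act-identity (step N (step (genT β i) (step N one)))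
    (λ v i′ → trans (apply-· (𝐍 (⊖ 𝟙)) (𝐓 β · (𝐍 (⊖ 𝟙) · I)) v i′) (trans (apply-cong (𝐍 (⊖ 𝟙)) (λ i₁ → trans (apply-· (𝐓 β) (𝐍 (⊖ 𝟙) · I) v i₁)
        (trans (apply-cong (𝐓 β) (λ i₂ → trans (apply-· (𝐍 (⊖ 𝟙)) I v i₂) (trans (apply-cong (𝐍 (⊖ 𝟙)) (apply-I v) i₂) (eqN v i₂))) i₁) (eqT (act 𝟘 𝟙 𝟙 𝟘 (⊖ 𝟙) v) i₁))) i′)
      (trans (eqN (act 𝟙 β 𝟘 𝟙 𝟙 (act 𝟘 𝟙 𝟙 𝟘 (⊖ 𝟙) v)) i′) (conjugate v i′))))
    where
    N : GenG (𝐍 (⊖ 𝟙))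
    N = genN (⊖ 𝟙) (trans (pow-h-⊖ 𝟙) (cong ⊖_ pow-h-𝟙))
    eqN : ∀ v i → apply (𝐍 (⊖ 𝟙)) v i ≡ act 𝟘 𝟙 𝟙 𝟘 (⊖ 𝟙) v i
    eqN v i = let (_ , _ , _ , eq) = GenG-represented N in trans (eq v i) (*-identityˡ _)
    eqT : ∀ v i → apply (𝐓 β) v i ≡ act 𝟙 β 𝟘 𝟙 𝟙 v i
    eqT v i′ = let (_ , _ , _ , eq) = GenG-represented (genT β i) in trans (eq v i′) (*-identityˡ _)
    conjugate : ∀ v i → act 𝟘 𝟙 𝟙 𝟘 (⊖ 𝟙) (act 𝟙 β 𝟘 𝟙 𝟙 (act 𝟘 𝟙 𝟙 𝟘 (⊖ 𝟙) v)) i ≡ act 𝟙 𝟘 β 𝟙 𝟙 v i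
    conjugate v = all4
      (solve 4 (λ β a b c → # 0 :* # 0 :* (# 1 :* # 1 :* (# 0 :* # 0 :* a :+ # 2 :* # 1 :* # 0 :* b :+ # 1 :* # 1 :* c) :+ # 2 :* # 0 :* # 1 :* (# 1 :* # 0 :* a :+ (# 0 :* # 0 :+ # 1 :* # 1) :* b :+ # 0 :* # 1 :* c) :+ # 0 :* # 0 :* (# 1 :* # 1 :* a :+ # 2 :* # 0 :* # 1 :* b :+ # 0 :* # 0 :* c)) :+ # 2 :* # 1 :* # 0 :* (β :* # 1 :* (# 0 :* # 0 :* a :+ # 2 :* # 1 :* # 0 :* b :+ # 1 :* # 1 :* c) :+ (# 1 :* # 1 :+ β :* # 0) :* (# 1 :* # 0 :* a :+ (# 0 :* # 0 :+ # 1 :* # 1) :* b :+ # 0 :* # 1 :* c) :+ # 1 :* # 0 :* (# 1 :* # 1 :* a :+ # 2 :* # 0 :* # 1 :* b :+ # 0 :* # 0 :* c)) :+ # 1 :* # 1 :* (β :* β :* (# 0 :* # 0 :* a :+ # 2 :* # 1 :* # 0 :* b :+ # 1 :* # 1 :* c) :+ # 2 :* # 1 :* β :* (# 1 :* # 0 :* a :+ (# 0 :* # 0 :+ # 1 :* # 1) :* b :+ # 0 :* # 1 :* c) :+ # 1 :* # 1 :* (# 1 :* # 1 :* a :+ # 2 :* # 0 :* # 1 :* b :+ # 0 :* # 0 :* c)) := # 1 :* # 1 :* a :+ # 2 :* β :* # 1 :* b :+ β :* β :* c) refl β (X0 v) (X2 v) (X3 v))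
      (solve 1 (λ a → :- # 1 :* (# 1 :* (:- # 1 :* a)) := # 1 :* a) refl (X1 v))
      (solve 4 (λ β a b c → # 1 :* # 0 :* (# 1 :* # 1 :* (# 0 :* # 0 :* a :+ # 2 :* # 1 :* # 0 :* b :+ # 1 :* # 1 :* c) :+ # 2 :* # 0 :* # 1 :* (# 1 :* # 0 :* a :+ (# 0 :* # 0 :+ # 1 :* # 1) :* b :+ # 0 :* # 1 :* c) :+ # 0 :* # 0 :* (# 1 :* # 1 :* a :+ # 2 :* # 0 :* # 1 :* b :+ # 0 :* # 0 :* c)) :+ (# 0 :* # 0 :+ # 1 :* # 1) :* (β :* # 1 :* (# 0 :* # 0 :* a :+ # 2 :* # 1 :* # 0 :* b :+ # 1 :* # 1 :* c) :+ (# 1 :* # 1 :+ β :* # 0) :* (# 1 :* # 0 :* a :+ (# 0 :* # 0 :+ # 1 :* # 1) :* b :+ # 0 :* # 1 :* c) :+ # 1 :* # 0 :* (# 1 :* # 1 :* a :+ # 2 :* # 0 :* # 1 :* b :+ # 0 :* # 0 :* c)) :+ # 0 :* # 1 :* (β :* β :* (# 0 :* # 0 :* a :+ # 2 :* # 1 :* # 0 :* b :+ # 1 :* # 1 :* c) :+ # 2 :* # 1 :* β :* (# 1 :* # 0 :* a :+ (# 0 :* # 0 :+ # 1 :* # 1) :* b :+ # 0 :* # 1 :* c) :+ # 1 :* # 1 :* (# 1 :* # 1 :* a :+ # 2 :* # 0 :* # 1 :* b :+ # 0 :* # 0 :* c)) := # 0 :* # 1 :* a :+ (# 1 :* # 1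 :+ # 0 :* β) :* b :+ # 1 :* β :* c) refl β (X0 v) (X2 v) (X3 v))
      (solve 4 (λ β a b c → # 1 :* # 1 :* (# 1 :* # 1 :* (# 0 :* # 0 :* a :+ # 2 :* # 1 :* # 0 :* b :+ # 1 :* # 1 :* c) :+ # 2 :* # 0 :* # 1 :* (# 1 :* # 0 :* a :+ (# 0 :* # 0 :+ # 1 :* # 1) :* b :+ # 0 :* # 1 :* c) :+ # 0 :* # 0 :* (# 1 :* # 1 :* a :+ # 2 :* # 0 :* # 1 :* b :+ # 0 :* # 0 :* c)) :+ # 2 :* # 0 :* # 1 :* (β :* # 1 :* (# 0 :* # 0 :* a :+ # 2 :* # 1 :* # 0 :* b :+ # 1 :* # 1 :* c) :+ (# 1 :* # 1 :+ β :* # 0) :* (# 1 :* # 0 :* a :+ (# 0 :* # 0 :+ # 1 :* # 1) :* b :+ # 0 :* # 1 :* c) :+ # 1 :* # 0 :* (# 1 :* # 1 :* a :+ # 2 :* # 0 :* # 1 :* b :+ # 0 :* # 0 :* c)) :+ # 0 :* # 0 :* (β :* β :* (# 0 :* # 0 :* a :+ # 2 :* # 1 :* # 0 :* b :+ # 1 :* # 1 :* c) :+ # 2 :* # 1 :* β :* (# 1 :* # 0 :* a :+ (# 0 :* # 0 :+ # 1 :* # 1) :* b :+ # 0 :* # 1 :* c) :+ # 1 :* # 1 :* (# 1 :* # 1 :* a :+ # 2 :* # 0 :* # 1 :* b :+ # 0 :* # 0 :* c)) := # 0 :* # 0 :* a :+ # 2 :* # 1 :* # 0 :* b :+ # 1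 :* # 1 :* c) refl β (X0 v) (X2 v) (X3 v))

  Hmap-L : ∀ {l} → pow l h ≡ 𝟙 → Hmap (act 𝟙 𝟘 𝟘 𝟙 l)
  Hmap-L {l} eq = Hmap-resp (λ v i → let (_ , _ , _ , eq′) = GenG-represented (genL l eq) in sym (trans (eq′ v i) (*-identityˡ _))) (Hmap-Gen (fromL l eq))

  -- SL(2,q) is generated by its unipotent triangular matrices.
  Hmap-SL-generic : ∀ {A B C D l} → InFq A → InFq B → InFq C → InFq D → C ≢ 𝟘 → A ⊗ D ⊕ ⊖ (B ⊗ C) ≡ 𝟙 → pow l h ≡ 𝟙 → Hmap (act A B C D l)
  Hmap-SL-generic {A} {B} {C} {D} {l} iA iB iC iD C≢ det eq = Hmap-resp factorise (Hmap-∘ (Hmap-upper Fq-α) (Hmap-∘ (Hmap-lower iC) (Hmap-∘ (Hmap-upper Fq-β) (Hmap-L eq))))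
    where
    K = inv C
    -- Read off from the product upper(α) lower(C) upper(β), whose diagonal entries are 1 + αC and 1
    -- + βC.
    α = (A ⊕ ⊖ 𝟙) ⊗ K
    β = (D ⊕ ⊖ 𝟙) ⊗ K
    CK : C ⊗ K ≡ 𝟙
    CK = inverseʳ C C≢
    Fq-α : InFq α
    Fq-α = Fq-⊗ (Fq-⊕ iA Fq-⊖𝟙) (Fq-inv C≢ iC)
    Fq-β : InFq β
    Fq-β = Fq-⊗ (Fq-⊕ iD Fq-⊖𝟙) (Fq-inv C≢ iC)
    cong-act : ∀ a b c d m {v w : V} → (∀ i → v i ≡ w i) → ∀ i → act a b c d m v i ≡ act a b c d m w i
    cong-act a b c d m eq = λ i → trans (act-linear a b c d m (λ i → trans (eq i) (solve 1 (λ x → x := # 1 :* x :+ # 0 :* x) refl _)) i) (solve 1 (λ x → # 1 :* x :+ # 0 :* x := x) refl _)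
    factorise : ∀ v i → act A B C D l v i ≡ act 𝟙 α 𝟘 𝟙 𝟙 (act 𝟙 𝟘 C 𝟙 𝟙 (act 𝟙 β 𝟘 𝟙 𝟙 (act 𝟙 𝟘 𝟘 𝟙 l v))) i
    factorise v i = sym (trans (cong-act 𝟙 α 𝟘 𝟙 𝟙 (λ i → trans (cong-act 𝟙 𝟘 C 𝟙 𝟙 (λ i → act-∘ 𝟙 β 𝟘 𝟙 𝟙 𝟙 𝟘 𝟘 𝟙 l v i) i) (act-∘ 𝟙 𝟘 C 𝟙 𝟙 _ _ _ _ _ v i)) i)
      (trans (act-∘ 𝟙 α 𝟘 𝟙 𝟙 _ _ _ _ _ v i) (act-≡
        (linear (A ∷ B ∷ C ∷ D ∷ K ∷ []) (λ A B C D K → # 1 :* (# 1 :* (# 1 :* # 1 :+ (D :- # 1) :* K :* # 0) :+ # 0 :* (# 0 :* # 1 :+ # 1 :* # 0)) :+ (A :- # 1) :* K :* (C :* (# 1 :* # 1 :+ (D :- # 1) :* K :* # 0) :+ # 1 :* (# 0 :* # 1 :+ # 1 :* # 0)) := A ⊣ A :- # 1 ∙ C :* K := # 1 ⊞ []) (CK , tt) refl)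
        (linear (A ∷ B ∷ C ∷ D ∷ K ∷ []) (λ A B C D K → # 1 :* (# 1 :* (# 1 :* # 0 :+ (D :- # 1) :* K :* # 1) :+ # 0 :* (# 0 :* # 0 :+ # 1 :* # 1)) :+ (A :- # 1) :* K :* (C :* (# 1 :* # 0 :+ (D :- # 1) :* K :* # 1) :+ # 1 :* (# 0 :* # 0 :+ # 1 :* # 1)) := B ⊣ A :* D :* K :- (A :* K) :- (D :* K) :+ B :+ K ∙ C :* K := # 1
            ⊞ K ∙ A :* D :- B :* C := # 1 ⊞ []) (CK , det , tt) refl)
        (solve 5 (λ A B C D K → # 0 :* (# 1 :* (# 1 :* # 1 :+ (D :- # 1) :* K :* # 0) :+ # 0 :* (# 0 :* # 1 :+ # 1 :* # 0)) :+ # 1 :* (C :* (# 1 :* # 1 :+ (D :- # 1) :* K :* # 0) :+ # 1 :* (# 0 :* # 1 :+ # 1 :* # 0)) := C) refl A B C D K)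
        (linear (A ∷ B ∷ C ∷ D ∷ K ∷ []) (λ A B C D K → # 0 :* (# 1 :* (# 1 :* # 0 :+ (D :- # 1) :* K :* # 1) :+ # 0 :* (# 0 :* # 0 :+ # 1 :* # 1)) :+ # 1 :* (C :* (# 1 :* # 0 :+ (D :- # 1) :* K :* # 1) :+ # 1 :* (# 0 :* # 0 :+ # 1 :* # 1)) := D ⊣ D :- # 1 ∙ C :* K := # 1 ⊞ []) (CK , tt) refl)
        (solve 1 (λ l → # 1 :* (# 1 :* (# 1 :* l)) := l) refl l) v i)))

  -- If C = 0, adding the first row to the second makes the lower left entry nonzero; the lower
  -- unipotent matrix with entry -1 undoes this.
  Hmap-SL : ∀ {A B C D l} → InFq A → InFq B → InFq C → InFq D → A ⊗ D ⊕ ⊖ (B ⊗ C) ≡ 𝟙 → pow l h ≡ 𝟙 → Hmap (act A B C D l)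
  Hmap-SL {A} {B} {C} {D} {l} iA iB iC iD det eq with C ≟ 𝟘
  ... | no C≢ = Hmap-SL-generic iA iB iC iD C≢ det eq
  ... | yes C≡0 = Hmap-resp factorise (Hmap-∘ (Hmap-lower Fq-⊖𝟙) (Hmap-SL-generic iA iB (Fq-⊕ iA iC) (Fq-⊕ iB iD) A+C≢ (linear (A ∷ B ∷ C ∷ D ∷ []) (λ A B C D → A :* (B :+ D) :- B :* (A :+ C) := # 1 ⊣ # 1 ∙ A :* D :- B :* C := # 1 ⊞ []) (det , tt) refl) eq))
    where
    A+C≢ : A ⊕ C ≢ 𝟘
    A+C≢ z = 𝟘≢𝟙 (linear (A ∷ B ∷ C ∷ D ∷ []) (λ A B C D → # 0 := # 1 ⊣ :- D ∙ A :+ C := # 0 ⊞ B :+ D ∙ C := # 0 ⊞ # 1 ∙ A :* D :- B :* C := # 1 ⊞ []) (z , C≡0 , det , tt) refl)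
    factorise : ∀ v i → act A B C D l v i ≡ act 𝟙 𝟘 (⊖ 𝟙) 𝟙 𝟙 (act A B (A ⊕ C) (B ⊕ D) l v) i
    factorise v i = sym (trans (act-∘ 𝟙 𝟘 (⊖ 𝟙) 𝟙 𝟙 A B (A ⊕ C) (B ⊕ D) l v i) (act-≡
      (solve 2 (λ A C → # 1 :* A :+ # 0 :* (A :+ C) := A) refl A C) (solve 2 (λ B D → # 1 :* B :+ # 0 :* (B :+ D) := B) refl B D) (solve 2 (λ A C → :- # 1 :* A :+ # 1 :* (A :+ C) := C) refl A C) (solve 2 (λ B D → :- # 1 :* B :+ # 1 :* (B :+ D) := D) refl B D) (*-identityˡ l) v i))

  Hmap⇒Orbit : ∀ {f ℓ₁ ℓ} → Hmap f → ℓ ≈L mapL f ℓ₁ → Orbit𝔥 ℓ₁ ℓ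
  Hmap⇒Orbit {f} {ℓ₁} (M , m , eq) r = M , m , ≈L-trans r (≈L-sym (mapL-cong {apply M} {f} eq ℓ₁))

  -- Transitivity of 𝔥 on the generators of a given sign

  -- t ≠ 1 because its norm is 2, so `ratio` can be solved for z; then `polar` determines x̃, as x ≠
  -- 0.
  D1-same : ∀ {ℓ ℓ′ s s′} (D : D1 ℓ s) (D′ : D1 ℓ′ s′) → D1.x D ≡ D1.x D′ → D1.y D ≡ D1.y D′ → D1.t D ≡ D1.t D′ → ℓ ≈L ℓ′
  D1-same {ℓ} {ℓ′} D D′ refl refl refl = ≈L-trans D.same (≈L-trans middle (≈L-sym D′.same))
    where
    module D = D1 D
    module D′ = D1 D′
    t≢1 : D.t ≢ 𝟙
    t≢1 eq = 𝟘≢𝟙 (linear (D.t ∷ conj D.t ∷ conj 𝟙 ∷ []) (λ t t' o → # 0 := # 1 ⊣ :- t' ∙ t := # 1 ⊞ # 1 ∙ t :* t' := # 2 ⊞ :- # 1 ∙ t' := o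
        ⊞ :- # 1 ∙ o := # 1 ⊞ []) (eq , D.t-norm , cong conj eq , conj-𝟙 , tt) refl)
    z≡ : D.z ≡ D′.z
    z≡ = ⊗-cancelˡ (difference-nonzero t≢1) (linear (D.t ∷ D.y ∷ conj D.y ∷ D.z ∷ D′.z ∷ []) (λ t y y' z w → (t :- # 1) :* z := (t :- # 1) :* w ⊣ # 1 ∙ t :* (z :- y') := z :- y
        ⊞ :- # 1 ∙ t :* (w :- y') := w :- y ⊞ []) (D.ratio , D′.ratio , tt) refl)
    x̃≡ : D.x̃ ≡ D′.x̃
    x̃≡ = conj-injective (⊗-cancelˡ D.x≢𝟘 (trans D.polar (trans (cong (λ z → (conj z ⊕ ⊖ D.y) ⊗ (conj z ⊕ ⊖ D.y)) z≡) (sym D′.polar))))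
    middle : line (Q D.x D.y) (Q D.x̃ D.z) ≈L line (Q D.x D.y) (Q D′.x̃ D′.z)
    middle = subst₂ (λ a b → line (Q D.x D.y) (Q D.x̃ D.z) ≈L line (Q D.x D.y) (Q a b)) x̃≡ z≡ ≈L-refl

  D2-same : ∀ {ℓ ℓ′ s s′} (D : D2 ℓ s) (D′ : D2 ℓ′ s′) → D2.e₁ D ≡ D2.e₁ D′ → D2.f₁ D ≡ D2.f₁ D′ → D2.e₂ D ≡ D2.e₂ D′ → D2.f₂ D ≡ D2.f₂ D′ → D2.a D ≡ D2.a D′ → ℓ ≈L ℓ′
  D2-same D D′ refl refl refl refl refl = ≈L-trans (D2.same D) (≈L-sym (D2.same D′))

  -- The quotient t′/t has norm 1. The explicit solution ν = t t′^q + 2 works unless it vanishes; in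
  -- that case t′ = -t, and δ, which conjugation negates, works.
  hilbert90 : ∀ {t t′} → t ⊗ conj t ≡ 𝟚 → t′ ⊗ conj t′ ≡ 𝟚 → Σ A λ ν → ν ≢ 𝟘 × t′ ⊗ ν ≡ t ⊗ conj ν
  hilbert90 {t} {t′} n n′ with t ⊗ conj t′ ⊕ 𝟚 ≟ 𝟘
  ... | no ≢ = t ⊗ conj t′ ⊕ 𝟚 , ≢ , linear (t ∷ t′ ∷ conj t ∷ conj t′ ∷ conj (t ⊗ conj t′ ⊕ 𝟚) ∷ conj (t ⊗ conj t′) ∷ conj (conj t′) ∷ conj 𝟚 ∷ []) (λ t t′ u u′ k l tt w → t′ :* (t :* u′ :+ # 2) := t :* k ⊣ :- t ∙ k := l :+ w
      ⊞ :- t ∙ w := # 2 ⊞ :- t ∙ l := u :* tt ⊞ :- # 2 ∙ tt := t′ ⊞ :- tt ∙ t :* u := # 2 ⊞ t ∙ t′ :* u′ := # 2 ⊞ []) (conj-⊕ (t ⊗ conj t′) 𝟚 , Fq-𝟚 , conj-⊗ t (conj t′) , conj-conj t′ , n , n′ , tt) refl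
  ... | yes z = δ , δ≢𝟘 , trans (cong (_⊗ δ) t′≡) (trans (solve 2 (λ t d → :- t :* d := t :* :- d) refl t δ) (cong (t ⊗_) (sym conj-δ)))
    where
    t′≡ : t′ ≡ ⊖ t
    t′≡ = ⊗-cancelˡ 𝟚≢𝟘 (linear (t ∷ t′ ∷ conj t′ ∷ []) (λ t t′ u′ → # 2 :* t′ := # 2 :* :- t ⊣ t′ ∙ t :* u′ :+ # 2 := # 0 ⊞ :- t ∙ t′ :* u′ := # 2 ⊞ []) (z , n′ , tt) refl)

  -- y is outside F_q, so y and 1 form a basis; comparing the equation with its conjugate gives r.
  Fq-coordinates : ∀ y → conj y ⊕ ⊖ y ≢ 𝟘 → ∀ w → Σ A λ r → Σ A λ s → InFq r × InFq s × r ⊗ y ⊕ s ≡ w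
  Fq-coordinates y n w = r , w ⊕ ⊖ (r ⊗ y) , Fq-r
      , linear (y ∷ w ∷ r ∷ conj y ∷ conj w ∷ conj (w ⊕ ⊖ (r ⊗ y)) ∷ conj (r ⊗ y) ∷ conj r ∷ []) (λ y w r y' w' k l r' → k := w :- r :* y ⊣ # 1 ∙ k := w' :- l
          ⊞ :- # 1 ∙ l := r' :* y' ⊞ :- y' ∙ r' := r ⊞ :- # 1 ∙ (y' :- y) :* r := w' :- w ⊞ []) (conj-⊝ w (r ⊗ y) , conj-⊗ r y , Fq-r , r-equation , tt) refl
      , solve 3 (λ y w r → r :* y :+ (w :- r :* y) := w) refl y w r
    where
    i = inv (conj y ⊕ ⊖ y)
    r = i ⊗ (conj w ⊕ ⊖ w)
    r-equation : (conj y ⊕ ⊖ y) ⊗ r ≡ conj w ⊕ ⊖ w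
    r-equation = linear (conj y ⊕ ⊖ y ∷ i ∷ conj w ⊕ ⊖ w ∷ []) (λ v i u → v :* (i :* u) := u ⊣ u ∙ v :* i := # 1 ⊞ []) (inverseʳ (conj y ⊕ ⊖ y) n , tt) refl
    Fq-r : InFq r
    Fq-r = ⊗-cancelˡ n (linear (r ∷ y ∷ conj y ∷ w ∷ conj w ∷ conj r ∷ conj ((conj y ⊕ ⊖ y) ⊗ r) ∷ conj (conj y ⊕ ⊖ y) ∷ conj (conj w ⊕ ⊖ w) ∷ []) (λ r y y' w w' r' k l m → (y' :- y) :* r' := (y' :- y) :* r ⊣ :- # 1 ∙ (y' :- y) :* r := w' :- w
        ⊞ # 1 ∙ k := l :* r' ⊞ r' ∙ l := y :- y' ⊞ :- # 1 ∙ k := m ⊞ :- # 1 ∙ m := w :- w' ⊞ []) (r-equation , conj-⊗ (conj y ⊕ ⊖ y) r , conj-imaginary y , cong conj r-equation , conj-imaginary w , tt) refl)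

  -- The element of PGL(2,q) taking y to y′ with denominator ω multiplies t by ω^(q-1); by Hilbert's Theorem 90
  -- it can be chosen to take t to t′, and equality of the signs says that its determinant is a square.
  D1-transitive : ∀ {ℓ₁ ℓ s} → D1 ℓ₁ s → D1 ℓ s → Orbit𝔥 ℓ₁ ℓ
  D1-transitive {ℓ₁} {ℓ} {s} D D′ = Hmap⇒Orbit {ℓ₁ = ℓ₁} (Hmap-SL iA iB iC iD det l-power) (≈L-sym (D1-same (D1-action T D) D′ x≡ y≡ t≡))
    where
    module D = D1 D
    module D′ = D1 D′
    y y′ im im′ : A
    y = D.y
    y′ = D′.y
    im = conj y ⊕ ⊖ y
    im′ = conj y′ ⊕ ⊖ y′
    im≢ : im ≢ 𝟘
    im≢ = imaginary-nonzero D.curve D.x≢𝟘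
    im′≢ : im′ ≢ 𝟘
    im′≢ = imaginary-nonzero D′.curve D′.x≢𝟘
    h90 = hilbert90 D.t-norm D′.t-norm
    ω ω̄ : A
    ω = proj₁ h90
    ω̄ = conj ω
    ω≢ : ω ≢ 𝟘
    ω≢ = proj₁ (proj₂ h90)
    tω : D′.t ⊗ ω ≡ D.t ⊗ ω̄
    tω = proj₂ (proj₂ h90)
    -- The rows are chosen so that the denominator at y is ω and the numerator is y′ ω.
    cd = Fq-coordinates y im≢ ω
    ab = Fq-coordinates y im≢ (y′ ⊗ ω)
    a b c d Δ : A
    a = proj₁ ab
    b = proj₁ (proj₂ ab)
    c = proj₁ cd
    d = proj₁ (proj₂ cd)
    ia : InFq a
    ia = proj₁ (proj₂ (proj₂ ab))
    ib : InFq b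
    ib = proj₁ (proj₂ (proj₂ (proj₂ ab)))
    ic : InFq c
    ic = proj₁ (proj₂ (proj₂ cd))
    id : InFq d
    id = proj₁ (proj₂ (proj₂ (proj₂ cd)))
    ab≡ : a ⊗ y ⊕ b ≡ y′ ⊗ ω
    ab≡ = proj₂ (proj₂ (proj₂ (proj₂ ab)))
    cd≡ : c ⊗ y ⊕ d ≡ ω
    cd≡ = proj₂ (proj₂ (proj₂ (proj₂ cd)))
    Δ = a ⊗ d ⊕ ⊖ (b ⊗ c)
    Δ-equation : Δ ⊗ im ≡ ω ⊗ ω̄ ⊗ im′
    Δ-equation = linear (a ∷ b ∷ c ∷ d ∷ y ∷ y′ ∷ ω ∷ ω̄ ∷ conj y ∷ conj y′ ∷ conj (a ⊗ y ⊕ b) ∷ conj (c ⊗ y ⊕ d) ∷ conj (y′ ⊗ ω) ∷ []) (λ a b c d y y′ ω ω̄ u u′ k l m → (a :* d :- b :* c) :* (u :- y) := ω :* ω̄ :* (u′ :- y′) ⊣ :- (c :* u) :- d ∙ a :* y :+ b := y′ :* ω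
        ⊞ a :* u :+ b ∙ c :* y :+ d := ω ⊞ :- ω ∙ k := a :* u :+ b ⊞ ω ∙ k := m ⊞ ω ∙ m := u′ :* ω̄ ⊞ y′ :* ω ∙ l := c :* u :+ d
        ⊞ :- (y′ :* ω) ∙ l := ω̄ ⊞ []) (ab≡ , cd≡ , conj-affine ia ib y , cong conj ab≡ , conj-⊗ y′ ω , conj-affine ic id y , cong conj cd≡ , tt) refl
    iΔ : InFq Δ
    iΔ = Fq-⊕ (Fq-⊗ ia id) (Fq-⊖ (Fq-⊗ ib ic))
    Δ≢ : Δ ≢ 𝟘
    Δ≢ = factorˡ (λ z → ⊗-nonzero (⊗-nonzero ω≢ (conj-nonzero ω≢)) im′≢ (trans (sym Δ-equation) z))
    Δ-character : pow Δ j ≡ 𝟙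
    Δ-character = ⊗-cancelˡ (⊗-nonzero (⊗-nonzero (pow-nonzero h t≢) (⊗-nonzero ω≢ (pow-nonzero j ω≢))) (pow-nonzero j im≢))
      (linear (s ∷ ω ∷ ω̄ ∷ pow im j ∷ pow im′ j ∷ pow Δ j ∷ pow (Δ ⊗ im) j ∷ pow (ω ⊗ ω̄ ⊗ im′) j ∷ pow (ω ⊗ ω̄) j ∷ pow ω j ∷ pow ω̄ j ∷ pow D.t h ∷ pow D′.t h ∷ pow (D′.t ⊗ ω) h ∷ pow (D.t ⊗ ω̄) h ∷ pow ω h ∷ pow ω̄ h ∷ []) (λ s ω ω̄ I I' Dj L R N P P' T T' S S' E E' → T :* (ω :* P) :* I :* Dj := T :* (ω :* P) :* I :* # 1 ⊣ :- (ω :* P :* T) ∙ L := Dj :* I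
          ⊞ ω :* P :* T ∙ L := R ⊞ T :* E ∙ R := N :* I' ⊞ I' :* T :* E ∙ N := P :* P' ⊞ I' ∙ S := T' :* E ⊞ :- I' ∙ S' := T :* E' ⊞ :- I' ∙ S := S'
          ⊞ I' :* P :* P' :* T :+ I :* T :- (R :* T) ∙ E := ω :* P ⊞ :- (I' :* T) ∙ E' := ω̄ :* P' ⊞ :- (I' :* P' :* T) ∙ ω̄ := ω :* (P :* P)
          ⊞ E ∙ s := T :* I ⊞ :- E ∙ s := T' :* I' ⊞ []) (pow-⊗ Δ im j , cong (λ w → pow w j) Δ-equation , pow-⊗ (ω ⊗ ω̄) im′ j , pow-⊗ ω ω̄ j , pow-⊗ D′.t ω h , pow-⊗ D.t ω̄ h , cong (λ w → pow w h) tω , pow-h ω , pow-h ω̄ , pow-q ω , D.sign , D′.sign , tt) refl)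
      where
      t≢ : D.t ≢ 𝟘
      t≢ = factorˡ (λ z → 𝟚≢𝟘 (trans (sym D.t-norm) z))
    -- Dividing the matrix by a square root of its determinant puts it into SL(2,q).
    root = residue⇒square iΔ Δ-character
    f w l : A
    f = proj₁ root
    if : InFq f
    if = proj₁ (proj₂ root)
    ff : f ⊗ f ≡ Δ
    ff = proj₂ (proj₂ root)
    f≢ : f ≢ 𝟘
    f≢ = factorˡ (λ z → Δ≢ (trans (sym ff) z))
    w = inv f
    iw : InFq w
    iw = Fq-inv f≢ if
    fw : f ⊗ w ≡ 𝟙
    fw = inverseʳ f f≢
    iA = Fq-⊗ ia iw
    iB = Fq-⊗ ib iw
    iC = Fq-⊗ ic iw
    iD = Fq-⊗ id iw
    det : a ⊗ w ⊗ (d ⊗ w) ⊕ ⊖ (b ⊗ w ⊗ (c ⊗ w)) ≡ 𝟙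
    det = linear (a ∷ b ∷ c ∷ d ∷ w ∷ f ∷ []) (λ a b c d w f → a :* w :* (d :* w) :- b :* w :* (c :* w) := # 1 ⊣ :- (w :* w) ∙ f :* f := a :* d :- b :* c
        ⊞ w :* f :+ # 1 ∙ f :* w := # 1 ⊞ []) (ff , fw , tt) refl
    v = inv D.x
    xv : D.x ⊗ v ≡ 𝟙
    xv = inverseʳ D.x D.x≢𝟘
    -- This scalar is forced by sending x to its target. That its h-th power is 1 follows from the
    -- curve equation at both points together with `Δ-equation`.
    l = D′.x ⊗ v ⊗ (ω ⊗ w ⊗ (ω ⊗ w))
    l-power : pow l h ≡ 𝟙
    l-power = ⊗-cancelˡ im≢ (linear (im ∷ im′ ∷ ω ∷ ω̄ ∷ w ∷ conj w ∷ f ∷ Δ ∷ pow D.x h ∷ pow D′.x h ∷ pow v h ∷ pow l h ∷ pow (D′.x ⊗ v) h ∷ pow (ω ⊗ w ⊗ (ω ⊗ w)) h ∷ pow (ω ⊗ w) h ∷ conj (ω ⊗ w) ∷ pow (D.x ⊗ v) h ∷ pow 𝟙 h ∷ []) (λ im im' ω ω̄ w w' f D X X' Y L K M N C O U → im :* L := im :* # 1 ⊣ im ∙ L := K :* M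
        ⊞ X :* N :* N ∙ K := X' :* Y ⊞ im :* K ∙ M := N :* N ⊞ w :* f :* X' ∙ N :* N := ω :* w :* C ⊞ im' :* ω :* w ∙ C := ω̄ :* w'
        ⊞ im :* w :* D ∙ w' := w ⊞ K :* N :* N :+ w :* f :- # 1 ∙ im := X ⊞ :- (ω :* w :* C) ∙ im' := X' ⊞ :- (X' :* N :* N) ∙ O := X :* Y
        ⊞ X' :* N :* N ∙ O := U ⊞ X' :* N :* N ∙ U := # 1 ⊞ :- (w :* w') ∙ D :* im := ω :* ω̄ :* im' ⊞ :- (im :* w :* w) ∙ f :* f := D
        ⊞ ω :* w :* X' :* C :+ im :* w :* f :- (X' :* N :* N) :+ X ∙ f :* w := # 1 ⊞ []) (pow-⊗ (D′.x ⊗ v) (ω ⊗ w ⊗ (ω ⊗ w)) h , pow-⊗ D′.x v h , pow-⊗ (ω ⊗ w) (ω ⊗ w) h , pow-h² (ω ⊗ w) , conj-⊗ ω w , iw , D.curve , D′.curve , pow-⊗ D.x v h , cong (λ z → pow z h) xv , pow-𝟙 h , Δ-equation , ff , fw , tt) refl)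
    T : Transformation
    T = transformation (a ⊗ w) (b ⊗ w) (c ⊗ w) (d ⊗ w) l iA iB iC iD (λ z → 𝟘≢𝟙 (trans (sym z) det)) (trans l-power (sym det))
    denominator : c ⊗ w ⊗ y ⊕ d ⊗ w ≡ ω ⊗ w
    denominator = linear (c ∷ d ∷ w ∷ y ∷ ω ∷ []) (λ c d w y ω → c :* w :* y :+ d :* w := ω :* w ⊣ w ∙ c :* y :+ d := ω ⊞ []) (cd≡ , tt) refl
    n = inv (c ⊗ w ⊗ y ⊕ d ⊗ w)
    ωwn : ω ⊗ w ⊗ n ≡ 𝟙
    ωwn = trans (cong (_⊗ n) (sym denominator)) (inverseʳ _ (λ z → ⊗-nonzero ω≢ (inv-nonzero f≢) (trans (sym denominator) z)))
    x≡ : l ⊗ D.x ⊗ (n ⊗ n) ≡ D′.x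
    x≡ = linear (ω ∷ w ∷ n ∷ v ∷ D.x ∷ D′.x ∷ []) (λ ω w n v x x' → x' :* v :* (ω :* w :* (ω :* w)) :* x :* (n :* n) := x' ⊣ ω :* w :* n :* v :* x :* x' :+ v :* x :* x' ∙ ω :* w :* n := # 1
        ⊞ x' ∙ x :* v := # 1 ⊞ []) (ωwn , xv , tt) refl
    y≡ : (a ⊗ w ⊗ y ⊕ b ⊗ w) ⊗ n ≡ y′
    y≡ = linear (a ∷ b ∷ w ∷ y ∷ n ∷ y′ ∷ ω ∷ []) (λ a b w y n y′ ω → (a :* w :* y :+ b :* w) :* n := y′ ⊣ w :* n ∙ a :* y :+ b := y′ :* ω
        ⊞ y′ ∙ ω :* w :* n := # 1 ⊞ []) (ab≡ , ωwn , tt) refl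
    t≡ : D.t ⊗ (n ⊗ conj (c ⊗ w ⊗ y ⊕ d ⊗ w)) ≡ D′.t
    t≡ = linear (ω ∷ ω̄ ∷ w ∷ n ∷ conj w ∷ D.t ∷ D′.t ∷ conj (c ⊗ w ⊗ y ⊕ d ⊗ w) ∷ conj (ω ⊗ w) ∷ []) (λ ω ω̄ w n w' t t' K L → t :* (n :* K) := t' ⊣ n :* t ∙ K := L
        ⊞ n :* t ∙ L := ω̄ :* w' ⊞ ω̄ :* n :* t ∙ w' := w ⊞ :- (w :* n) ∙ t' :* ω := t :* ω̄ ⊞ t' ∙ ω :* w :* n := # 1 ⊞ []) (cong conj denominator , conj-⊗ ω w , iw , tω , ωwn , tt) refl

  -- The matrix taking the basis (e₁,f₁), (e₂,f₂) to the corresponding one has determinant 1, as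
  -- both bases do. The multiplier of X1 is the quotient of the two values of `a`, and equal signs
  -- mean that its h-th power is 1.
  D2-transitive : ∀ {ℓ₁ ℓ s} → D2 ℓ₁ s → D2 ℓ s → Orbit𝔥 ℓ₁ ℓ
  D2-transitive {ℓ₁} {ℓ} {s} D D′ = Hmap⇒Orbit {ℓ₁ = ℓ₁} (Hmap-SL iA iB iC iD det l-power)
      (≈L-sym (D2-same (D2-action T D) D′ first-e first-f second-e second-f a≡))
    where
    module D = D2 D
    module D′ = D2 D′
    e₁ = D.e₁
    f₁ = D.f₁
    e₂ = D.e₂
    f₂ = D.f₂
    E₁ = D′.e₁
    F₁ = D′.f₁
    E₂ = D′.e₂
    F₂ = D′.f₂
    a b c d l : A
    a = F₂ ⊗ e₁ ⊕ ⊖ (F₁ ⊗ e₂)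
    b = F₁ ⊗ f₂ ⊕ ⊖ (F₂ ⊗ f₁)
    c = E₂ ⊗ e₁ ⊕ ⊖ (E₁ ⊗ e₂)
    d = E₁ ⊗ f₂ ⊕ ⊖ (E₂ ⊗ f₁)
    v = inv D.a
    l = D′.a ⊗ v
    av : D.a ⊗ v ≡ 𝟙
    av = inverseʳ D.a (norm-2⇒nonzero D.a-norm)
    iA = Fq-⊕ (Fq-⊗ D′.Fq-f₂ D.Fq-e₁) (Fq-⊖ (Fq-⊗ D′.Fq-f₁ D.Fq-e₂))
    iB = Fq-⊕ (Fq-⊗ D′.Fq-f₁ D.Fq-f₂) (Fq-⊖ (Fq-⊗ D′.Fq-f₂ D.Fq-f₁))
    iC = Fq-⊕ (Fq-⊗ D′.Fq-e₂ D.Fq-e₁) (Fq-⊖ (Fq-⊗ D′.Fq-e₁ D.Fq-e₂))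
    iD = Fq-⊕ (Fq-⊗ D′.Fq-e₁ D.Fq-f₂) (Fq-⊖ (Fq-⊗ D′.Fq-e₂ D.Fq-f₁))
    det : a ⊗ d ⊕ ⊖ (b ⊗ c) ≡ 𝟙
    det = linear (e₁ ∷ f₁ ∷ e₂ ∷ f₂ ∷ E₁ ∷ F₁ ∷ E₂ ∷ F₂ ∷ []) (λ e₁ f₁ e₂ f₂ E₁ F₁ E₂ F₂ → (F₂ :* e₁ :- F₁ :* e₂) :* (E₁ :* f₂ :- E₂ :* f₁) :- (F₁ :* f₂ :- F₂ :* f₁) :* (E₂ :* e₁ :- E₁ :* e₂) := # 1 ⊣ :- (F₁ :* E₂) :+ E₁ :* F₂ ∙ e₁ :* f₂ :- e₂ :* f₁ := # 1
        ⊞ # 1 ∙ E₁ :* F₂ :- E₂ :* F₁ := # 1 ⊞ []) (D.det , D′.det , tt) refl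
    l-power : pow l h ≡ 𝟙
    l-power = linear (s ∷ pow l h ∷ pow D.a h ∷ pow D′.a h ∷ pow v h ∷ pow (D.a ⊗ v) h ∷ pow 𝟙 h ∷ []) (λ s L A A' V O U → L := # 1 ⊣ # 1 ∙ L := A' :* V
        ⊞ V ∙ s := A ⊞ :- V ∙ s := A' ⊞ :- # 1 ∙ O := A :* V ⊞ # 1 ∙ O := U ⊞ # 1 ∙ U := # 1 ⊞ []) (pow-⊗ D′.a v h , D.sign , D′.sign , pow-⊗ D.a v h , cong (λ z → pow z h) av , pow-𝟙 h , tt) refl
    T : Transformation
    T = transformation a b c d l iA iB iC iD (λ z → 𝟘≢𝟙 (trans (sym z) det)) (trans l-power (sym det))
    κ = inv (a ⊗ d ⊕ ⊖ (b ⊗ c))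
    κ≡ : κ ≡ 𝟙
    κ≡ = trans (sym (*-identityˡ κ)) (trans (cong (_⊗ κ) (sym det)) (inverseʳ _ (λ z → 𝟘≢𝟙 (trans (sym z) det))))
    first-e : c ⊗ f₁ ⊕ d ⊗ e₁ ≡ E₁
    first-e = linear (e₁ ∷ f₁ ∷ e₂ ∷ f₂ ∷ E₁ ∷ E₂ ∷ []) (λ e₁ f₁ e₂ f₂ E₁ E₂ → (E₂ :* e₁ :- E₁ :* e₂) :* f₁ :+ (E₁ :* f₂ :- E₂ :* f₁) :* e₁ := E₁ ⊣ E₁ ∙ e₁ :* f₂ :- e₂ :* f₁ := # 1 ⊞ []) (D.det , tt) refl
    first-f : a ⊗ f₁ ⊕ b ⊗ e₁ ≡ F₁
    first-f = linear (e₁ ∷ f₁ ∷ e₂ ∷ f₂ ∷ F₁ ∷ F₂ ∷ []) (λ e₁ f₁ e₂ f₂ F₁ F₂ → (F₂ :* e₁ :- F₁ :* e₂) :* f₁ :+ (F₁ :* f₂ :- F₂ :* f₁) :* e₁ := F₁ ⊣ F₁ ∙ e₁ :* f₂ :- e₂ :* f₁ := # 1 ⊞ []) (D.det , tt) refl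
    second-e : (c ⊗ f₂ ⊕ d ⊗ e₂) ⊗ κ ≡ E₂
    second-e = linear (e₁ ∷ f₁ ∷ e₂ ∷ f₂ ∷ E₁ ∷ E₂ ∷ κ ∷ []) (λ e₁ f₁ e₂ f₂ E₁ E₂ κ → ((E₂ :* e₁ :- E₁ :* e₂) :* f₂ :+ (E₁ :* f₂ :- E₂ :* f₁) :* e₂) :* κ := E₂ ⊣ E₂ :* κ ∙ e₁ :* f₂ :- e₂ :* f₁ := # 1
        ⊞ E₂ ∙ κ := # 1 ⊞ []) (D.det , κ≡ , tt) refl
    second-f : (a ⊗ f₂ ⊕ b ⊗ e₂) ⊗ κ ≡ F₂
    second-f = linear (e₁ ∷ f₁ ∷ e₂ ∷ f₂ ∷ F₁ ∷ F₂ ∷ κ ∷ []) (λ e₁ f₁ e₂ f₂ F₁ F₂ κ → ((F₂ :* e₁ :- F₁ :* e₂) :* f₂ :+ (F₁ :* f₂ :- F₂ :* f₁) :* e₂) :* κ := F₂ ⊣ F₂ :* κ ∙ e₁ :* f₂ :- e₂ :* f₁ := # 1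
        ⊞ F₂ ∙ κ := # 1 ⊞ []) (D.det , κ≡ , tt) refl
    a≡ : l ⊗ D.a ⊗ κ ≡ D′.a
    a≡ = linear (v ∷ κ ∷ D.a ∷ D′.a ∷ []) (λ v κ A A' → A' :* v :* A :* κ := A' ⊣ κ :* A' ∙ A :* v := # 1 ⊞ A' ∙ κ := # 1 ⊞ []) (av , κ≡ , tt) refl

  Orbit⇒D1 : ∀ {ℓ₁ ℓ s} → D1 ℓ₁ s → Orbit𝔥 ℓ₁ ℓ → D1 ℓ s
  Orbit⇒D1 D (M , m , r) = D1-resp r (In𝔥-D1 m D)

  Orbit⇒D2 : ∀ {ℓ₁ ℓ s} → D2 ℓ₁ s → Orbit𝔥 ℓ₁ ℓ → D2 ℓ s
  Orbit⇒D2 D (M , m , r) = D2-resp r (In𝔥-D2 m D)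

  -- The generators through a point of Case (III)

  conj-ι⊗ : ∀ x → conj (ι ⊗ x) ≡ ι ⊗ conj x
  conj-ι⊗ x = trans (conj-⊗ ι x) (cong (_⊗ conj x) Fq-ι)

  pow-h-ι : pow ι h ≡ ι
  pow-h-ι = trans (pow-h ι) (trans (cong (ι ⊗_) character-ι) (*-identityʳ ι))

  ι≢𝟙 : ι ≢ 𝟙
  ι≢𝟙 eq = 1-ι≢𝟘 (trans (cong (λ z → 𝟙 ⊕ ⊖ z) eq) (-‿inverseʳ 𝟙))

  ι≢⊖𝟙 : ι ≢ ⊖ 𝟙
  ι≢⊖𝟙 eq = 1+ι≢𝟘 (trans (cong (𝟙 ⊕_) eq) (-‿inverseʳ 𝟙))

  module Pencil {a b : A} (a-norm : a ⊗ conj a ≡ ⊖ 𝟚) (b∉Fq : ¬ InFq b) where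

    private
      ā b̄ d w κ dⱼ κ′ : A
      ā = conj a
      b̄ = conj b
      d = b ⊕ ⊖ b̄
      w = inv d
      κ = pow a h
      dⱼ = pow d j
      κ′ = κ ⊗ dⱼ

      d≢ : d ≢ 𝟘
      d≢ z = b∉Fq (sym (difference-zero z))

      dw : d ⊗ w ≡ 𝟙
      dw = inverseʳ d d≢

      conj-d : conj d ≡ ⊖ d
      conj-d = trans (conj-⊝ b b̄) (trans (cong (λ z → b̄ ⊕ ⊖ z) (conj-conj b)) (solve 2 (λ b c → c :- b := :- (b :- c)) refl b b̄))

      dⱼ² : dⱼ ⊗ dⱼ ≡ ⊖ 𝟙
      dⱼ² = ⊗-cancelˡ d≢ (linear (d ∷ dⱼ ∷ conj d ∷ []) (λ d p c → d :* (p :* p) := d :* :- # 1 ⊣ :- # 1 ∙ c := d :* (p :* p) ⊞ # 1 ∙ c := :- d ⊞ []) (pow-q d , conj-d , tt) refl)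

      κ² : κ ⊗ κ ≡ ⊖ 𝟚
      κ² = trans (pow-h² a) a-norm

      κ′² : κ′ ⊗ κ′ ≡ 𝟚
      κ′² = linear (κ ∷ dⱼ ∷ []) (λ κ p → κ :* p :* (κ :* p) := # 2 ⊣ p :* p ∙ κ :* κ := :- # 2 ⊞ :- # 2 ∙ p :* p := :- # 1 ⊞ []) (κ² , dⱼ² , tt) refl

    -- `yof` solves the orthogonality relation b^q = a^q x + 2y. The other three are the successive
    -- coordinates U, η and φ = ι η² of the point `Q x (yof x)`; the inverse changes are `xη` and
    -- `ηφ`.
    yof Uof ηof φof : A → A
    yof x = half ⊗ (b̄ ⊕ ⊖ (ā ⊗ x))
    Uof x = ā ⊗ x ⊗ w
    ηof x = Uof x ⊕ ι ⊗ conj (Uof x) ⊕ 𝟙 ⊕ ι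
    φof x = ι ⊗ (ηof x ⊗ ηof x)

    polar-b : ∀ x → b̄ ≡ ā ⊗ x ⊕ 𝟚 ⊗ yof x
    polar-b x = linear (ā ∷ x ∷ b̄ ∷ half ∷ []) (λ ā x b̄ f → b̄ := ā :* x :+ # 2 :* (f :* (b̄ :- ā :* x)) ⊣ ā :* x :- b̄ ∙ # 2 :* f := # 1 ⊞ []) (2half , tt) refl

    X? : (x : A) → Dec (Curve x (yof x))
    X? x = conj (yof x) ⊕ ⊖ yof x ≟ pow x h

    X : List A
    X = filter X? elements

    private
      U≡ : ∀ x → d ⊗ Uof x ≡ ā ⊗ x
      U≡ x = linear (d ∷ w ∷ ā ∷ x ∷ []) (λ d w ā x → d :* (ā :* x :* w) := ā :* x ⊣ ā :* x ∙ d :* w := # 1 ⊞ []) (dw , tt) refl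

      2x≡ : ∀ x → 𝟚 ⊗ x ≡ ⊖ (a ⊗ d ⊗ Uof x)
      2x≡ x = linear (d ∷ Uof x ∷ ā ∷ a ∷ x ∷ []) (λ d U ā a x → # 2 :* x := :- (a :* d :* U) ⊣ a ∙ d :* U := ā :* x ⊞ x ∙ a :* ā := :- # 2 ⊞ []) (U≡ x , a-norm , tt) refl

      2y≡ : ∀ x → 𝟚 ⊗ yof x ≡ b̄ ⊕ ⊖ (d ⊗ Uof x)
      2y≡ x = linear (d ∷ Uof x ∷ ā ∷ x ∷ b̄ ∷ half ∷ []) (λ d U ā x b̄ f → # 2 :* (f :* (b̄ :- ā :* x)) := b̄ :- d :* U ⊣ # 1 ∙ d :* U := ā :* x
          ⊞ :- (ā :* x) :+ b̄ ∙ # 2 :* f := # 1 ⊞ []) (U≡ x , 2half , tt) refl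

      2ȳ≡ : ∀ x → 𝟚 ⊗ conj (yof x) ≡ b ⊕ d ⊗ conj (Uof x)
      2ȳ≡ x = linear (b ∷ d ∷ conj d ∷ conj (Uof x) ∷ conj (yof x) ∷ conj 𝟚 ∷ conj (𝟚 ⊗ yof x) ∷ conj (b̄ ⊕ ⊖ (d ⊗ Uof x)) ∷ conj b̄ ∷ conj (d ⊗ Uof x) ∷ []) (λ b d c U' y' t l r bb m → # 2 :* y' := b :+ d :* U' ⊣ :- # 1 ∙ l := t :* y'
          ⊞ :- y' ∙ t := # 2 ⊞ # 1 ∙ l := r ⊞ # 1 ∙ r := bb :- m ⊞ # 1 ∙ bb := b ⊞ :- # 1 ∙ m := c :* U' ⊞ :- U' ∙ c := :- d ⊞ []) (conj-⊗ 𝟚 (yof x) , Fq-𝟚 , cong conj (2y≡ x) , conj-⊝ b̄ (d ⊗ Uof x) , conj-conj b , conj-⊗ d (Uof x) , conj-d , tt) refl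

      2im≡ : ∀ x → 𝟚 ⊗ (conj (yof x) ⊕ ⊖ yof x) ≡ d ⊗ (𝟙 ⊕ Uof x ⊕ conj (Uof x))
      2im≡ x = linear (b ∷ b̄ ∷ yof x ∷ conj (yof x) ∷ Uof x ∷ conj (Uof x) ∷ []) (λ b b̄ y y' U U' → # 2 :* (y' :- y) := (b :- b̄) :* (# 1 :+ U :+ U') ⊣ :- # 1 ∙ # 2 :* y := b̄ :- (b :- b̄) :* U
          ⊞ # 1 ∙ # 2 :* y' := b :+ (b :- b̄) :* U' ⊞ []) (2y≡ x , 2ȳ≡ x , tt) refl

      2xʰ≡ : ∀ x → 𝟚 ⊗ pow x h ≡ ⊖ (κ′ ⊗ d ⊗ pow (Uof x) h)
      2xʰ≡ x = linear (κ ∷ dⱼ ∷ d ∷ pow 𝟚 h ∷ pow x h ∷ pow (𝟚 ⊗ x) h ∷ pow (⊖ (a ⊗ d ⊗ Uof x)) h ∷ pow (a ⊗ d ⊗ Uof x) h ∷ pow (a ⊗ d) h ∷ pow d h ∷ pow (Uof x) h ∷ []) (λ κ p d t X L R S M dh V → # 2 :* X := :- (κ :* p :* d :* V) ⊣ :- # 1 ∙ L := t :* X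
          ⊞ :- X ∙ t := # 2 ⊞ # 1 ∙ L := R ⊞ # 1 ∙ R := :- S ⊞ :- # 1 ∙ S := M :* V ⊞ :- V ∙ M := κ :* dh ⊞ :- (κ :* V) ∙ dh := d :* p ⊞ []) (pow-⊗ 𝟚 x h , pow-h-𝟚 , cong (λ z → pow z h) (2x≡ x) , pow-h-⊖ (a ⊗ d ⊗ Uof x) , pow-⊗ (a ⊗ d) (Uof x) h , pow-⊗ a d h , pow-h d , tt) refl

      -- The curve condition on x in the coordinate U = a^q x / (b - b^q).
      Conic : A → Set
      Conic U = 𝟙 ⊕ U ⊕ conj U ≡ ⊖ (κ′ ⊗ pow U h)

      curve⇒equation : ∀ x → Curve x (yof x) → Conic (Uof x)
      curve⇒equation x c = ⊗-cancelˡ d≢ (linear (d ∷ Uof x ∷ conj (Uof x) ∷ κ′ ∷ pow (Uof x) h ∷ conj (yof x) ⊕ ⊖ yof x ∷ pow x h ∷ []) (λ d U U' l V im X → d :* (# 1 :+ U :+ U') := d :* :- (l :* V) ⊣ :- # 1 ∙ # 2 :* im := d :* (# 1 :+ U :+ U')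
          ⊞ # 1 ∙ # 2 :* X := :- (l :* d :* V) ⊞ # 2 ∙ im := X ⊞ []) (2im≡ x , 2xʰ≡ x , c , tt) refl)

      equation⇒curve : ∀ x → Conic (Uof x) → Curve x (yof x)
      equation⇒curve x c = ⊗-cancelˡ 𝟚≢𝟘 (linear (d ∷ Uof x ∷ conj (Uof x) ∷ κ′ ∷ pow (Uof x) h ∷ conj (yof x) ⊕ ⊖ yof x ∷ pow x h ∷ []) (λ d U U' l V im X → # 2 :* im := # 2 :* X ⊣ # 1 ∙ # 2 :* im := d :* (# 1 :+ U :+ U')
          ⊞ :- # 1 ∙ # 2 :* X := :- (l :* d :* V) ⊞ d ∙ # 1 :+ U :+ U' := :- (l :* V) ⊞ []) (2im≡ x , 2xʰ≡ x , c , tt) refl)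

      -- On elements of norm ι conjugation is η ↦ ι/η, so relations between η and its conjugate
      -- become rational in η.
      module NormI {η} (norm : η ⊗ conj η ≡ ι) where

        η≢𝟘 : η ≢ 𝟘
        η≢𝟘 = factorˡ (λ z → ι≢𝟘 (trans (sym norm) z))

        η⁻¹ : A
        η⁻¹ = inv η

        ηη⁻¹ : η ⊗ η⁻¹ ≡ 𝟙
        ηη⁻¹ = inverseʳ η η≢𝟘

        conj-η : conj η ≡ ι ⊗ η⁻¹
        conj-η = linear (η ∷ conj η ∷ η⁻¹ ∷ ι ∷ []) (λ η c e i → c := i :* e ⊣ e ∙ η :* c := i ⊞ :- c ∙ η :* e := # 1 ⊞ []) (norm , ηη⁻¹ , tt) refl

        conj-η⁻¹ : conj η⁻¹ ≡ ⊖ (ι ⊗ η)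
        conj-η⁻¹ = linear (η ∷ conj η ∷ η⁻¹ ∷ conj η⁻¹ ∷ ι ∷ []) (λ η c e e' i → e' := :- (i :* η) ⊣ :- (η :* i) ∙ c :* e' := # 1
            ⊞ e' :* i ∙ η :* c := i ⊞ e' ∙ i :* i := :- # 1 ⊞ []) (conj-inv η≢𝟘 , norm , ι² , tt) refl

        power-inverse : pow η h ⊗ pow η⁻¹ h ≡ 𝟙
        power-inverse = trans (sym (pow-⊗ η η⁻¹ h)) (trans (cong (λ z → pow z h) ηη⁻¹) (pow-𝟙 h))

        η-1≢ : η ⊕ ⊖ 𝟙 ≢ 𝟘
        η-1≢ z = ι≢𝟙 (trans (sym norm) (trans (cong (λ t → t ⊗ conj t) (difference-zero z)) (trans (cong (𝟙 ⊗_) conj-𝟙) (*-identityˡ 𝟙))))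

        η-ι≢ : η ⊕ ⊖ ι ≢ 𝟘
        η-ι≢ z = ι≢⊖𝟙 (trans (sym norm) (trans (cong (λ t → t ⊗ conj t) (difference-zero z)) (trans (cong (ι ⊗_) Fq-ι) ι²)))

        η+1≢ : η ⊕ 𝟙 ≢ 𝟘
        η+1≢ z = ι≢𝟙 (trans (sym norm) (trans (cong (λ t → t ⊗ conj t) η≡) (trans (cong (⊖ 𝟙 ⊗_) (trans (conj-⊖ 𝟙) (cong ⊖_ conj-𝟙))) ⊖𝟙-square)))
          where
          η≡ : η ≡ ⊖ 𝟙
          η≡ = linear (η ∷ []) (λ η → η := :- # 1 ⊣ # 1 ∙ η :+ # 1 := # 0 ⊞ []) (z , tt) refl

        -- U = (η - 1)²/(2η) rationalises the conic underlying the equation.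
        Rational : A → Set
        Rational U = 𝟚 ⊗ U ≡ η ⊕ η⁻¹ ⊕ ⊖ 𝟚

        module _ {U} (r : Rational U) where

          rational-conj : 𝟚 ⊗ conj U ≡ ι ⊗ η⁻¹ ⊕ ⊖ (ι ⊗ η) ⊕ ⊖ 𝟚
          rational-conj = linear (η ∷ η⁻¹ ∷ ι ∷ conj U ∷ conj 𝟚 ∷ conj (𝟚 ⊗ U) ∷ conj (η ⊕ η⁻¹ ⊕ ⊖ 𝟚) ∷ conj (η ⊕ η⁻¹) ∷ conj η ∷ conj η⁻¹ ∷ []) (λ η e i U' t l m n c c' → # 2 :* U' := i :* e :- i :* η :- # 2 ⊣ :- # 1 ∙ l := t :* U'
              ⊞ :- U' :- # 1 ∙ t := # 2 ⊞ # 1 ∙ l := m ⊞ # 1 ∙ m := n :- t ⊞ # 1 ∙ n := c :+ c' ⊞ # 1 ∙ c := i :* e ⊞ # 1 ∙ c' := :- (i :* η) ⊞ []) (conj-⊗ 𝟚 U , Fq-𝟚 , cong conj r , conj-⊝ (η ⊕ η⁻¹) 𝟚 , conj-⊕ η η⁻¹ , conj-η , conj-η⁻¹ , tt) refl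

          -- Adding ι times the conjugate relation to 2U = η + 1/η - 2 eliminates 1/η, because ι² =
          -- -1. This is the origin of `ηof`.
          recover-η : U ⊕ ι ⊗ conj U ⊕ 𝟙 ⊕ ι ≡ η
          recover-η = ⊗-cancelˡ 𝟚≢𝟘 (linear (η ∷ η⁻¹ ∷ ι ∷ U ∷ conj U ∷ []) (λ η e i U U' → # 2 :* (U :+ i :* U' :+ # 1 :+ i) := # 2 :* η ⊣ # 1 ∙ # 2 :* U := η :+ e :- # 2
              ⊞ i ∙ # 2 :* U' := i :* e :- i :* η :- # 2 ⊞ :- η :+ e ∙ i :* i := :- # 1 ⊞ []) (r , rational-conj , ι² , tt) refl)

          trace-factor : 𝟚 ⊗ (𝟙 ⊕ U ⊕ conj U) ≡ (𝟙 ⊕ ⊖ ι) ⊗ ((η ⊕ ⊖ 𝟙) ⊗ (η ⊕ ⊖ ι) ⊗ η⁻¹)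
          trace-factor = linear (η ∷ η⁻¹ ∷ ι ∷ U ∷ conj U ∷ []) (λ η e i U U' → # 2 :* (# 1 :+ U :+ U') := (# 1 :- i) :* ((η :- # 1) :* (η :- i) :* e) ⊣ :- (η :* e :* i) :+ e :* i :* i :+ η :* e :+ e :+ i ∙ # 2 :* U := η :+ e :- # 2
              ⊞ # 1 ∙ # 2 :* U' := i :* e :- i :* η :- # 2 ⊞ e :* e :- (# 2 :* e :* U) :- e ∙ i :* i := :- # 1
              ⊞ :- (e :* i) :+ # 2 :* i :* U :+ e :+ # 2 :* i :- (# 2 :* U) ∙ η :* e := # 1 ⊞ []) (r , rational-conj , ι² , ηη⁻¹ , tt) refl

          conj-η-1 : (η ⊕ ⊖ 𝟙) ⊗ conj (η ⊕ ⊖ 𝟙) ≡ ⊖ ((η ⊕ ⊖ 𝟙) ⊗ (η ⊕ ⊖ ι) ⊗ η⁻¹)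
          conj-η-1 = linear (η ∷ η⁻¹ ∷ ι ∷ conj η ∷ conj (η ⊕ ⊖ 𝟙) ∷ conj 𝟙 ∷ []) (λ η e i c l o → (η :- # 1) :* l := :- ((η :- # 1) :* (η :- i) :* e) ⊣ η :- # 1 ∙ l := c :- o
              ⊞ :- η :+ # 1 ∙ o := # 1 ⊞ η :- # 1 ∙ c := i :* e ⊞ η :- # 1 ∙ η :* e := # 1 ⊞ []) (conj-⊝ η 𝟙 , conj-𝟙 , conj-η , ηη⁻¹ , tt) refl

          -- 2U = (η - 1)²/η, and the h-th power of (η - 1)² is the norm of η - 1. This produces the
          -- same factor (η - 1)(η - ι)/η as `trace-factor`; cancelling it reduces the curve
          -- condition to one on η^h.
          power-factor : 𝟚 ⊗ pow U h ≡ ⊖ ((η ⊕ ⊖ 𝟙) ⊗ (η ⊕ ⊖ ι) ⊗ η⁻¹ ⊗ pow η⁻¹ h)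
          power-factor = linear (pow U h ∷ pow 𝟚 h ∷ pow (𝟚 ⊗ U) h ∷ pow ((η ⊕ ⊖ 𝟙) ⊗ (η ⊕ ⊖ 𝟙) ⊗ η⁻¹) h ∷ pow ((η ⊕ ⊖ 𝟙) ⊗ (η ⊕ ⊖ 𝟙)) h ∷ pow (η ⊕ ⊖ 𝟙) h ∷ pow η⁻¹ h ∷ conj (η ⊕ ⊖ 𝟙) ∷ (η ⊕ ⊖ 𝟙) ∷ (η ⊕ ⊖ 𝟙) ⊗ (η ⊕ ⊖ ι) ⊗ η⁻¹ ∷ []) (λ V t L R M N K l m z → # 2 :* V := :- (z :* K) ⊣ :- # 1 ∙ L := t :* V
              ⊞ :- V ∙ t := # 2 ⊞ # 1 ∙ L := R ⊞ # 1 ∙ R := M :* K ⊞ K ∙ M := N :* N ⊞ K ∙ N :* N := m :* l ⊞ K ∙ m :* l := :- z ⊞ []) (pow-⊗ 𝟚 U h , pow-h-𝟚 , cong (λ s → pow s h) (linear (η ∷ η⁻¹ ∷ U ∷ []) (λ η e U → # 2 :* U := (η :- # 1) :* (η :- # 1) :* e ⊣ η :* e ∙ # 2 :* U := η :+ e :- # 2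
              ⊞ e :- (# 2 :* U) ∙ η :* e := # 1 ⊞ []) (r , ηη⁻¹ , tt) refl) , pow-⊗ ((η ⊕ ⊖ 𝟙) ⊗ (η ⊕ ⊖ 𝟙)) η⁻¹ h , pow-⊗ (η ⊕ ⊖ 𝟙) (η ⊕ ⊖ 𝟙) h , pow-h² (η ⊕ ⊖ 𝟙) , conj-η-1 , tt) refl

          rational⇒equation : (𝟙 ⊕ ⊖ ι) ⊗ pow η h ≡ κ′ → Conic U
          rational⇒equation half-power = ⊗-cancelˡ 𝟚≢𝟘 (linear (𝟙 ⊕ U ⊕ conj U ∷ pow U h ∷ κ′ ∷ ι ∷ pow η h ∷ pow η⁻¹ h ∷ (η ⊕ ⊖ 𝟙) ⊗ (η ⊕ ⊖ ι) ⊗ η⁻¹ ∷ []) (λ s V l i P K z → # 2 :* s := # 2 :* :- (l :* V) ⊣ # 1 ∙ # 2 :* s := (# 1 :- i) :* z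
              ⊞ l ∙ # 2 :* V := :- (z :* K) ⊞ K :* z ∙ (# 1 :- i) :* P := l ⊞ i :* z :- z ∙ P :* K := # 1 ⊞ []) (trace-factor , power-factor , half-power , power-inverse , tt) refl)

          equation⇒half-power : Conic U → (𝟙 ⊕ ⊖ ι) ⊗ pow η h ≡ κ′
          equation⇒half-power eq = ⊗-cancelˡ (⊗-nonzero (⊗-nonzero η-1≢ η-ι≢) (inv-nonzero η≢𝟘))
            (linear ((η ⊕ ⊖ 𝟙) ⊗ (η ⊕ ⊖ ι) ⊗ η⁻¹ ∷ ι ∷ pow η h ∷ pow η⁻¹ h ∷ κ′ ∷ 𝟙 ⊕ U ⊕ conj U ∷ pow U h ∷ []) (λ z i P K l s V → z :* ((# 1 :- i) :* P) := z :* l ⊣ :- P ∙ # 2 :* s := (# 1 :- i) :* z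
                ⊞ # 2 :* P ∙ s := :- (l :* V) ⊞ :- (P :* l) ∙ # 2 :* V := :- (z :* K) ⊞ z :* l ∙ P :* K := # 1 ⊞ []) (trace-factor , eq , power-factor , power-inverse , tt) refl)

      -- `norm` is the squared curve condition, and `half-power` restores the choice of square root
      -- that squaring forgets.
      record Good (η : A) : Set where
        field
          norm : η ⊗ conj η ≡ ι
          half-power : (𝟙 ⊕ ⊖ ι) ⊗ pow η h ≡ κ′
        open NormI norm public

      xη : A → A
      xη η = ⊖ (half ⊗ (a ⊗ d) ⊗ (half ⊗ (η ⊕ inv η ⊕ ⊖ 𝟚)))

      Uof-xη : ∀ η → Uof (xη η) ≡ half ⊗ (η ⊕ inv η ⊕ ⊖ 𝟚)
      Uof-xη η = linear (a ∷ ā ∷ d ∷ w ∷ half ∷ half ⊗ (η ⊕ inv η ⊕ ⊖ 𝟚) ∷ []) (λ a ā d w f U → ā :* :- (f :* (a :* d) :* U) :* w := U ⊣ :- (a :* ā :* f :* U) ∙ d :* w := # 1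
          ⊞ :- (f :* U) ∙ a :* ā := :- # 2 ⊞ U ∙ # 2 :* f := # 1 ⊞ []) (dw , a-norm , 2half , tt) refl

      good⇒rational : ∀ {η} (G : Good η) → Good.Rational G (Uof (xη η))
      good⇒rational {η} G = linear (half ∷ η ⊕ inv η ⊕ ⊖ 𝟚 ∷ Uof (xη η) ∷ []) (λ f v U → # 2 :* U := v ⊣ # 2 ∙ U := f :* v ⊞ v ∙ # 2 :* f := # 1 ⊞ []) (Uof-xη η , 2half , tt) refl

      good⇒curve : ∀ {η} → Good η → Curve (xη η) (yof (xη η)) × ηof (xη η) ≡ η
      good⇒curve {η} G = equation⇒curve (xη η) (Good.rational⇒equation G (good⇒rational G) (Good.half-power G)) , Good.recover-η G (good⇒rational G)

      module _ (x : A) (c : Curve x (yof x)) where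
        private
          U Ū η η* : A
          U = Uof x
          Ū = conj U
          η = ηof x
          -- The elimination that gives η, with -ι in place of ι, gives 1/η; that the product is 1
          -- is exactly the conic `eq²`.
          η* = U ⊕ ⊖ (ι ⊗ Ū) ⊕ 𝟙 ⊕ ⊖ ι

          eq : Conic U
          eq = curve⇒equation x c

          eq² : (𝟙 ⊕ U ⊕ Ū) ⊗ (𝟙 ⊕ U ⊕ Ū) ≡ 𝟚 ⊗ (U ⊗ Ū)
          eq² = linear (𝟙 ⊕ U ⊕ Ū ∷ κ′ ∷ pow U h ∷ U ∷ Ū ∷ []) (λ s l V U Ū → s :* s := # 2 :* (U :* Ū) ⊣ :- (l :* V) :+ s ∙ s := :- (l :* V)
              ⊞ V :* V ∙ l :* l := # 2 ⊞ # 2 ∙ V :* V := U :* Ū ⊞ []) (eq , κ′² , pow-h² U , tt) refl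

          ηη* : η ⊗ η* ≡ 𝟙
          ηη* = linear (U ∷ Ū ∷ ι ∷ []) (λ U Ū i → (U :+ i :* Ū :+ # 1 :+ i) :* (U :- i :* Ū :+ # 1 :- i) := # 1 ⊣ # 1 ∙ (# 1 :+ U :+ Ū) :* (# 1 :+ U :+ Ū) := # 2 :* (U :* Ū)
              ⊞ :- (Ū :* Ū) :- (# 2 :* Ū) :- # 1 ∙ i :* i := :- # 1 ⊞ []) (eq² , ι² , tt) refl

          conj-η : conj η ≡ ι ⊗ η*
          conj-η = linear (U ∷ Ū ∷ ι ∷ conj ι ∷ conj η ∷ conj (U ⊕ ι ⊗ Ū ⊕ 𝟙) ∷ conj (U ⊕ ι ⊗ Ū) ∷ conj (ι ⊗ Ū) ∷ conj Ū ∷ conj 𝟙 ∷ []) (λ U Ū i i' k l m n UU o → k := i :* (U :- i :* Ū :+ # 1 :- i) ⊣ :- (Ū :* i) :- (Ū :* k) :+ Ū :* l :+ i :* m :+ k :* m :- (l :* m) :- (i :* n) :- (k :* n) :+ l :* n :+ U :- UU :+ # 1 ∙ k := l :+ i'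
              ⊞ :- (Ū :* i) :- (Ū :* k) :+ Ū :* l :+ i :* m :+ k :* m :- (l :* m) :- (i :* n) :- (k :* n) :+ l :* n :+ U :+ # 1 ∙ i' := i
              ⊞ :- (# 2 :* Ū :* k) :+ Ū :* l :+ Ū :* m :+ # 2 :* k :* m :- (l :* m) :- (m :* m) :- (# 2 :* k :* n) :+ l :* n :+ m :* n :+ Ū :* o :- (m :* o) :+ n :* o :+ U :- UU :+ # 1 ∙ l := m :+ o
              ⊞ :- (# 2 :* Ū :* k) :+ # 2 :* Ū :* m :+ # 2 :* k :* m :- (# 2 :* m :* m) :- (# 2 :* k :* n) :+ # 2 :* m :* n :+ Ū :* o :- (m :* o) :+ n :* o :+ U :+ Ū :- m :+ n :- UU :+ # 1 ∙ o := # 1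
              ⊞ :- (k :* k) :+ # 2 :* k :* m :- (m :* m) :+ # 2 :* k :- (# 2 :* m) :- # 1 ∙ m := Ū :+ n ⊞ # 1 ∙ n := i' :* UU
              ⊞ k :- m :- # 1 ∙ UU := U ⊞ m :- n :+ # 1 ∙ i :* i := :- # 1 ⊞ []) (conj-⊕ (U ⊕ ι ⊗ Ū ⊕ 𝟙) ι , Fq-ι , conj-⊕ (U ⊕ ι ⊗ Ū) 𝟙 , conj-𝟙 , conj-⊕ U (ι ⊗ Ū) , conj-⊗ ι Ū , conj-conj U , ι² , tt) refl

          norm : η ⊗ conj η ≡ ι
          norm = linear (η ∷ η* ∷ ι ∷ conj η ∷ []) (λ η e i k → η :* k := i ⊣ η ∙ k := i :* e ⊞ i ∙ η :* e := # 1 ⊞ []) (conj-η , ηη* , tt) refl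

          open NormI norm using (Rational; η≢𝟘; equation⇒half-power)

          rational : Rational U
          rational = trans (solve 3 (λ U Ū i → # 2 :* U := U :+ i :* Ū :+ # 1 :+ i :+ (U :- i :* Ū :+ # 1 :- i) :- # 2) refl U Ū ι)
            (cong (λ z → η ⊕ z ⊕ ⊖ 𝟚) (⊗-cancelˡ η≢𝟘 (trans ηη* (sym (inverseʳ η η≢𝟘)))))

        curve⇒good : Good η
        curve⇒good = record { norm = norm ; half-power = equation⇒half-power rational eq }

        curve⇒rational : Good.Rational curve⇒good U
        curve⇒rational = rational

        xη-ηof : xη η ≡ x
        xη-ηof = ⊗-cancelˡ 𝟚≢𝟘 (linear (a ∷ d ∷ x ∷ half ∷ η ⊕ inv η ⊕ ⊖ 𝟚 ∷ U ∷ []) (λ a d x f v U → # 2 :* :- (f :* (a :* d) :* (f :* v)) := # 2 :* x ⊣ # 2 :* a :* d :* f :* f ∙ # 2 :* U := v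
            ⊞ :- (# 4 :* f :* f) ∙ # 2 :* x := :- (a :* d :* U) ⊞ # 4 :* x :* f :+ # 2 :* x ∙ # 2 :* f := # 1 ⊞ []) (rational , 2x≡ x , 2half , tt) refl)

      c₀ : A
      c₀ = κ′ ⊗ inv (𝟙 ⊕ ⊖ ι)

      c₀-equation : (𝟙 ⊕ ⊖ ι) ⊗ c₀ ≡ κ′
      c₀-equation = linear (κ′ ∷ 𝟙 ⊕ ⊖ ι ∷ inv (𝟙 ⊕ ⊖ ι) ∷ []) (λ l v u → v :* (l :* u) := l ⊣ l ∙ v :* u := # 1 ⊞ []) (inverseʳ (𝟙 ⊕ ⊖ ι) 1-ι≢𝟘 , tt) refl

      ηφ : A → A
      ηφ φ = c₀ ⊗ pow (ι ⊗ conj φ) k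

      -- η = η^h / (η²)^k with h = 2k + 1, so η is determined by φ = ιη² and η^h.
      good⇒Φ : ∀ {η} → Good η → pow (ι ⊗ (η ⊗ η)) h ≡ ⊖ 𝟙 × ηφ (ι ⊗ (η ⊗ η)) ≡ η
      good⇒Φ {η} G = linear (pow (ι ⊗ (η ⊗ η)) h ∷ pow ι h ∷ ι ∷ pow (η ⊗ η) h ∷ pow η h ∷ η ∷ conj η ∷ []) (λ L I i M P η c → L := :- # 1 ⊣ # 1 ∙ L := I :* M
          ⊞ M ∙ I := i ⊞ i ∙ M := P :* P ⊞ i ∙ P :* P := η :* c ⊞ i ∙ η :* c := i ⊞ # 1 ∙ i :* i := :- # 1 ⊞ []) (pow-⊗ ι (η ⊗ η) h , pow-h-ι , pow-⊗ η η h , pow-h² η , norm , ι² , tt) refl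
        , linear (c₀ ∷ pow (ι ⊗ conj (ι ⊗ (η ⊗ η))) k ∷ pow (η⁻¹ ⊗ η⁻¹) k ∷ pow η⁻¹ k ∷ pow η⁻¹ j ∷ pow η h ∷ pow η j ∷ pow (η ⊗ η⁻¹) j ∷ pow 𝟙 j ∷ η ∷ []) (λ c₀ K L Q R P S Z O η → c₀ :* K := η ⊣ c₀ ∙ K := L
            ⊞ c₀ ∙ L := Q :* Q ⊞ :- c₀ ∙ R := Q :* Q ⊞ R ∙ c₀ := P ⊞ R ∙ P := η :* S ⊞ :- η ∙ Z := S :* R ⊞ η ∙ Z := O ⊞ η ∙ O := # 1 ⊞ []) (cong (λ z → pow z k) argument , pow-⊗ η⁻¹ η⁻¹ k , pow-+ η⁻¹ k k , c₀≡ , pow-h η , pow-⊗ η η⁻¹ j , cong (λ z → pow z j) ηη⁻¹ , pow-𝟙 j , tt) refl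
        where
        open Good G
        argument : ι ⊗ conj (ι ⊗ (η ⊗ η)) ≡ η⁻¹ ⊗ η⁻¹
        argument = linear (ι ∷ η⁻¹ ∷ conj η ∷ conj (ι ⊗ (η ⊗ η)) ∷ conj (η ⊗ η) ∷ []) (λ i e c l m → i :* l := e :* e ⊣ i ∙ l := i :* m
            ⊞ :- # 1 ∙ m := c :* c ⊞ :- (i :* e) :- c ∙ c := i :* e ⊞ :- (e :* e) :+ m ∙ i :* i := :- # 1 ⊞ []) (conj-ι⊗ (η ⊗ η) , conj-⊗ η η , conj-η , ι² , tt) refl
        c₀≡ : c₀ ≡ pow η h
        c₀≡ = ⊗-cancelˡ 1-ι≢𝟘 (trans c₀-equation (sym half-power))

      Φ⇒good : ∀ {φ} → pow φ h ≡ ⊖ 𝟙 → Good (ηφ φ) × ι ⊗ (ηφ φ ⊗ ηφ φ) ≡ φ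
      Φ⇒good {φ} eq = record { norm = trans (sym (pow-h² η)) (trans (cong₂ _⊗_ ηʰ ηʰ) c₀²) ; half-power = trans (cong ((𝟙 ⊕ ⊖ ι) ⊗_) ηʰ) c₀-equation }
          , linear (ι ∷ η ⊗ η ∷ φ ∷ []) (λ i v φ → i :* v := φ ⊣ i ∙ v := :- (i :* φ) ⊞ :- φ ∙ i :* i := :- # 1 ⊞ []) (η² , ι² , tt) refl
        where
        η v φ̄ : A
        η = ηφ φ
        φ̄ = conj φ
        v = ι ⊗ φ̄
        φφ̄ : φ ⊗ φ̄ ≡ 𝟙
        φφ̄ = Φ-norm eq
        -- κ′² = 2 and (1 - ι)² = -2ι.
        c₀² : c₀ ⊗ c₀ ≡ ι
        c₀² = ⊗-cancelˡ (⊗-nonzero 1-ι≢𝟘 1-ι≢𝟘) (linear (c₀ ∷ ι ∷ κ′ ∷ []) (λ c₀ i l → (# 1 :- i) :* (# 1 :- i) :* (c₀ :* c₀) := (# 1 :- i) :* (# 1 :- i) :* i ⊣ :- (c₀ :* i) :+ c₀ :+ l ∙ (# 1 :- i) :* c₀ := l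
            ⊞ # 1 ∙ l :* l := # 2 ⊞ :- i :+ # 2 ∙ i :* i := :- # 1 ⊞ []) (c₀-equation , κ′² , ι² , tt) refl)
        -- v^h = ι (φ^q)^h = -ι, and v^j = v^h / v.
        vʲ : pow v j ≡ ⊖ φ
        vʲ = linear (ι ∷ pow ι h ∷ φ ∷ φ̄ ∷ pow v j ∷ pow v h ∷ pow φ̄ h ∷ conj (pow φ h) ∷ conj (⊖ 𝟙) ∷ []) (λ i I φ φ̄ V L M N O → V := :- φ ⊣ :- (φ :* L) ∙ L := i :* φ̄ :* V
            ⊞ :- (I :* φ) :- (I :* V) :+ φ :* L ∙ L := I :* M ⊞ i :* φ :+ I :* φ :+ i :* V :+ I :* V :+ V :* L ∙ I := i
            ⊞ I :* I :* φ :+ I :* I :* V :- (I :* φ :* L) ∙ N := M ⊞ :- (I :* I :* φ) :- (I :* I :* V) :+ I :* φ :* L ∙ N := O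
            ⊞ :- (I :* I :* φ) :- (I :* I :* V) :+ I :* φ :* L ∙ O := :- # 1 ⊞ :- (i :* V :* L) ∙ φ :* φ̄ := # 1 ⊞ φ :+ V ∙ i :* i := :- # 1 ⊞ []) (pow-h v , pow-⊗ ι φ̄ h , pow-h-ι , conj-pow φ h , cong conj eq , Fq-⊖𝟙 , φφ̄ , ι² , tt) refl
        η² : η ⊗ η ≡ ⊖ (ι ⊗ φ)
        η² = linear (c₀ ∷ pow v k ∷ pow v j ∷ φ ∷ ι ∷ []) (λ c₀ K V φ i → c₀ :* K :* (c₀ :* K) := :- (i :* φ) ⊣ :- (c₀ :* c₀) ∙ V := K :* K
            ⊞ V ∙ c₀ :* c₀ := i ⊞ i ∙ V := :- φ ⊞ []) (pow-+ v k k , c₀² , vʲ , tt) refl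
        -- η^h = η (η²)^k, where η = c₀ v^k and η² = -ιφ is the inverse of v.
        ηʰ : pow η h ≡ c₀
        ηʰ = linear (η ∷ c₀ ∷ pow v k ∷ pow η h ∷ pow η j ∷ pow η k ∷ pow (η ⊗ η) k ∷ pow (⊖ (ι ⊗ φ)) k ∷ pow (v ⊗ ⊖ (ι ⊗ φ)) k ∷ pow 𝟙 k ∷ []) (λ η c₀ K P J L M N R O → P := c₀ ⊣ # 1 ∙ P := η :* J
            ⊞ η ∙ J := L :* L ⊞ :- η ∙ M := L :* L ⊞ η ∙ M := N ⊞ N ∙ η := c₀ :* K ⊞ :- c₀ ∙ R := K :* N ⊞ c₀ ∙ R := O ⊞ c₀ ∙ O := # 1 ⊞ []) (pow-h η , pow-+ η k k , pow-⊗ η η k , cong (λ z → pow z k) η² , refl , pow-⊗ v (⊖ (ι ⊗ φ)) k , cong (λ z → pow z k) (linear (ι ∷ φ ∷ φ̄ ∷ []) (λ i φ φ̄ → i :* φ̄ :* :- (i :* φ) := # 1 ⊣ :- (i :* i) ∙ φ :* φ̄ := # 1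
            ⊞ :- # 1 ∙ i :* i := :- # 1 ⊞ []) (φφ̄ , ι² , tt) refl) , pow-𝟙 k , tt) refl

    module _ (x : A) (c : Curve x (yof x)) where
      private
        y η U : A
        y = yof x
        η = ηof x
        U = Uof x
        open Good (curve⇒good x c)
        r : Rational U
        r = curve⇒rational x c
        x-nonzero : x ≢ 𝟘
        x-nonzero z = b∉Fq (sym (trans (sym (conj-conj b)) (linear (b̄ ∷ conj b̄ ∷ ā ∷ x ∷ y ∷ conj y ∷ conj (𝟚 ⊗ y) ∷ []) (λ b̄ c ā x y y' m → c := b̄ ⊣ :- # 1 ∙ b̄ := ā :* x :+ # 2 :* y
            ⊞ :- ā ∙ x := # 0 ⊞ # 1 ∙ c := m ⊞ # 1 ∙ m := # 2 :* y ⊞ []) (polar-b x , z , cong conj (trans (polar-b x) (trans (cong (λ t → ā ⊗ t ⊕ 𝟚 ⊗ y) z) (trans (cong (_⊕ 𝟚 ⊗ y) (zeroʳ ā)) (+-identityˡ _)))) , Fq-⊗ Fq-𝟚 (curve-𝟘 c z) , tt) refl)))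
        open AffineLine {a} {b} {x} {y} a-norm c x-nonzero (polar-b x) using (t; ratio)
        m m̄ n : A
        m = η ⊕ 𝟙
        m̄ = conj m
        n = η ⊕ ⊖ 𝟙
        m̄≡ : η ⊗ m̄ ≡ η ⊕ ι
        m̄≡ = linear (η ∷ m̄ ∷ conj η ∷ conj 𝟙 ∷ ι ∷ []) (λ η k c o i → η :* k := η :+ i ⊣ η ∙ k := c :+ o ⊞ η ∙ o := # 1 ⊞ # 1 ∙ η :* c := i ⊞ []) (conj-⊕ η 𝟙 , conj-𝟙 , norm , tt) refl
        -- Numerator and denominator of t are both rational in η, and their quotient is (1 - ι) η
        -- m^(q-1) with m = η + 1.
        t-equation : t ⊗ m ≡ (𝟙 ⊕ ⊖ ι) ⊗ η ⊗ m̄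
        t-equation = ⊗-cancelˡ (⊗-nonzero d≢ (⊗-nonzero 1+ι≢𝟘 (⊗-nonzero η-ι≢ (inv-nonzero η≢𝟘))))
          (linear (t ∷ η ∷ η⁻¹ ∷ ι ∷ d ∷ b ⊕ ⊖ y ⊕ ⊖ y ∷ b ⊕ ⊖ y ⊕ ⊖ conj y ∷ m̄ ∷ []) (λ t η e i d B C m̄ → d :* ((# 1 :+ i) :* ((η :- i) :* e)) :* (t :* (η :+ # 1)) := d :* ((# 1 :+ i) :* ((η :- i) :* e)) :* ((# 1 :- i) :* η :* m̄) ⊣ # 4 ∙ t :* C := B
              ⊞ :- (η :* e :* i :* i :* m̄) :+ e :* e :* i :* i :* m̄ :+ e :* i :* i :* i :* m̄ :+ η :* e :* m̄ :+ e :* e :* m̄ :+ e :* i :* m̄ :- (# 2 :* e :* i) ∙ # 2 :* B := d :* (η :+ e)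
              ⊞ :- t ∙ # 2 :* # 2 :* C := d :* ((# 1 :+ i) :* ((η :+ # 1) :* (η :- i) :* e))
              ⊞ # 2 :* e :* i :* i :* B :+ # 2 :* e :* e :* d :+ # 2 :* e :* i :* d :- (# 2 :* e :* B) ∙ η :* m̄ := η :+ i
              ⊞ # 2 :* i :* i :* B :+ # 2 :* e :* d :- (# 2 :* B) ∙ η :* e := # 1
              ⊞ e :* e :* e :* d :* m̄ :+ e :* e :* i :* d :* m̄ :- (# 2 :* e :* e :* B :* m̄) :- (# 2 :* e :* i :* B :* m̄) :+ # 2 :* e :* i :* B :+ # 2 :* e :* d :+ # 2 :* B ∙ i :* i := :- # 1 ⊞ []) (ratio , numerator , denominator , m̄≡ , ηη⁻¹ , ι² , tt) refl)
          where
          numerator : 𝟚 ⊗ (b ⊕ ⊖ y ⊕ ⊖ y) ≡ d ⊗ (η ⊕ η⁻¹)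
          numerator = linear (η ∷ η⁻¹ ∷ b ∷ b̄ ∷ y ∷ U ∷ []) (λ η e b b̄ y U → # 2 :* (b :- y :- y) := (b :- b̄) :* (η :+ e) ⊣ :- # 2 ∙ # 2 :* y := b̄ :- (b :- b̄) :* U
              ⊞ b :- b̄ ∙ # 2 :* U := η :+ e :- # 2 ⊞ []) (2y≡ x , r , tt) refl
          denominator : (𝟚 ⊗ 𝟚) ⊗ (b ⊕ ⊖ y ⊕ ⊖ conj y) ≡ d ⊗ ((𝟙 ⊕ ι) ⊗ ((η ⊕ 𝟙) ⊗ (η ⊕ ⊖ ι) ⊗ η⁻¹))
          denominator = linear (η ∷ η⁻¹ ∷ ι ∷ b ∷ b̄ ∷ y ∷ conj y ∷ U ∷ conj U ∷ []) (λ η e i b b̄ y y' U U' → # 2 :* # 2 :* (b :- y :- y') := (b :- b̄) :* ((# 1 :+ i) :* ((η :+ # 1) :* (η :- i) :* e)) ⊣ :- (# 2 :* η :* e :* i) :+ # 2 :* e :* i :* i :- (# 2 :* η :* e) :- (# 2 :* e :* i) :+ # 2 :* i :* U :+ # 2 :* e :+ # 4 :* i :+ # 2 :* U' :+ # 2 ∙ # 2 :* y := b̄ :- (b :- b̄) :* U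
              ⊞ :- (# 2 :* i :* U') :- (# 2 :* e) :- (# 2 :* i) :+ # 2 :* U ∙ # 2 :* y' := b :+ (b :- b̄) :* U'
              ⊞ e :* i :* i :* i :* b :- (e :* i :* i :* i :* b̄) :+ i :* i :* i :* b :* U :- (i :* i :* i :* b̄ :* U) :+ η :* e :* i :* b :- (e :* i :* i :* b) :+ i :* i :* i :* b :- (η :* e :* i :* b̄) :+ e :* i :* i :* b̄ :- (i :* i :* i :* b̄) :- (i :* i :* b :* U') :+ i :* i :* b̄ :* U' :+ η :* e :* b :+ e :* i :* b :- (i :* i :* b) :- (η :* e :* b̄) :- (e :* i :* b̄) :+ i :* i :* b̄ :- (e :* b) :+ e :* b̄ :+ i :* b̄ :- (# 2 :* i :* y) :+ b̄ :- (# 2 :* y') ∙ # 2 :* U := η :+ e :- # 2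
              ⊞ i :* i :* i :* b :* U' :- (i :* i :* i :* b̄ :* U') :- (e :* i :* i :* b) :+ e :* i :* i :* b̄ :+ i :* i :* b :* U :- (i :* i :* b̄ :* U) :+ i :* i :* b :- (i :* i :* b̄) :- (e :* b) :- (i :* b) :+ e :* b̄ :+ # 2 :* i :* y' :+ b̄ :- (# 2 :* y) ∙ # 2 :* U' := i :* e :- i :* η :- # 2
              ⊞ # 2 :* i :* i :* i :* b :- (# 2 :* i :* i :* i :* b̄) :+ e :* i :* b :- (e :* i :* b̄) :+ e :* b :- (e :* b̄) :- (# 2 :* i :* b̄) :+ # 4 :* i :* y :- (# 4 :* b) :+ # 2 :* b̄ :+ # 4 :* y ∙ η :* e := # 1
              ⊞ :- (η :* i :* i :* b :* U') :+ e :* i :* i :* b :* U' :+ η :* i :* i :* b̄ :* U' :- (e :* i :* i :* b̄ :* U') :- (# 2 :* i :* b :* U :* U) :+ # 2 :* i :* b̄ :* U :* U :- (# 2 :* i :* b :* U' :* U') :+ # 2 :* i :* b̄ :* U' :* U' :- (e :* e :* b) :+ e :* e :* b̄ :- (# 4 :* i :* b :* U) :+ # 4 :* i :* b̄ :* U :- (# 2 :* i :* b :* U') :+ # 2 :* i :* b̄ :* U' :+ # 3 :* e :* b :+ η :* b̄ :- (# 2 :* e :* b̄) :- (# 4 :* e :* y) :- (# 2 :* η :* y') :+ # 2 :* e :* y' ∙ i :* i := :- # 1 ⊞ []) (2y≡ x , 2ȳ≡ x , r , rational-conj r , ηη⁻¹ , ι² , tt) refl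
        -- The h-th power of m^(q-1) has exponent (q² - 1)/2 and is therefore the j-th power of the
        -- norm of m.
        tʰ : pow t h ≡ pow (𝟙 ⊕ ⊖ ι) h ⊗ pow η h ⊗ pow (m ⊗ m̄) j
        tʰ = ⊗-cancelˡ (⊗-nonzero η+1≢ (pow-nonzero j η+1≢)) (linear (m ∷ m̄ ∷ pow m j ∷ pow m̄ j ∷ pow t h ∷ pow (𝟙 ⊕ ⊖ ι) h ∷ pow η h ∷ pow (t ⊗ m) h ∷ pow ((𝟙 ⊕ ⊖ ι) ⊗ η ⊗ m̄) h ∷ pow ((𝟙 ⊕ ⊖ ι) ⊗ η) h ∷ pow m h ∷ pow m̄ h ∷ pow (m ⊗ m̄) j ∷ []) (λ m m̄ M M' T I P L R S Mh Mh' N → m :* M :* T := m :* M :* (I :* P :* N) ⊣ :- # 1 ∙ L := T :* Mh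
            ⊞ # 1 ∙ L := R ⊞ # 1 ∙ R := S :* Mh' ⊞ m :* M :* N ∙ S := I :* P ⊞ :- (M :* M' :* S) :+ S :* N :- T ∙ Mh := m :* M ⊞ S ∙ Mh' := m̄ :* M'
            ⊞ M' :* S ∙ m̄ := m :* (M :* M) ⊞ :- (S :* Mh) ∙ N := M :* M' ⊞ []) (pow-⊗ t m h , cong (λ z → pow z h) t-equation , pow-⊗ ((𝟙 ⊕ ⊖ ι) ⊗ η) m̄ h , pow-⊗ (𝟙 ⊕ ⊖ ι) η h , pow-h m , pow-h m̄ , pow-q m , pow-⊗ m m̄ j , tt) refl)
        imʲ : pow (conj y ⊕ ⊖ y) j ≡ dⱼ ⊗ pow (𝟙 ⊕ ⊖ ι) j ⊗ pow (n ⊗ conj n) j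
        imʲ = linear (pow (𝟚 ⊗ 𝟚 ⊗ (conj y ⊕ ⊖ y)) j ∷ pow (𝟚 ⊗ 𝟚) j ∷ pow (conj y ⊕ ⊖ y) j ∷ pow (⊖ (d ⊗ (𝟙 ⊕ ⊖ ι) ⊗ (n ⊗ conj n))) j ∷ pow (d ⊗ (𝟙 ⊕ ⊖ ι) ⊗ (n ⊗ conj n)) j ∷ pow (d ⊗ (𝟙 ⊕ ⊖ ι)) j ∷ dⱼ ∷ pow (𝟙 ⊕ ⊖ ι) j ∷ pow (n ⊗ conj n) j ∷ []) (λ L F I R R' S D J N → I := D :* J :* N ⊣ :- # 1 ∙ L := F :* I
            ⊞ :- I ∙ F := # 1 ⊞ # 1 ∙ L := R ⊞ # 1 ∙ R := R' ⊞ # 1 ∙ R' := S :* N ⊞ N ∙ S := D :* J ⊞ []) (pow-⊗ (𝟚 ⊗ 𝟚) (conj y ⊕ ⊖ y) j , character-of-square Fq-𝟚 𝟚≢𝟘 , cong (λ z → pow z j) 4im , character-⊖ (d ⊗ (𝟙 ⊕ ⊖ ι) ⊗ (n ⊗ conj n)) , pow-⊗ (d ⊗ (𝟙 ⊕ ⊖ ι)) (n ⊗ conj n) j , pow-⊗ d (𝟙 ⊕ ⊖ ι) j , tt) refl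
          where
          4im : 𝟚 ⊗ 𝟚 ⊗ (conj y ⊕ ⊖ y) ≡ ⊖ (d ⊗ (𝟙 ⊕ ⊖ ι) ⊗ (n ⊗ conj n))
          4im = linear (conj y ⊕ ⊖ y ∷ d ∷ 𝟙 ⊕ U ⊕ conj U ∷ ι ∷ (η ⊕ ⊖ 𝟙) ⊗ (η ⊕ ⊖ ι) ⊗ η⁻¹ ∷ n ⊗ conj n ∷ []) (λ I d s i z N → # 2 :* # 2 :* I := :- (d :* (# 1 :- i) :* N) ⊣ # 2 ∙ # 2 :* I := d :* s
              ⊞ d ∙ # 2 :* s := (# 1 :- i) :* z ⊞ :- (d :* i) :+ d ∙ N := :- z ⊞ []) (2im≡ x , trace-factor r , conj-η-1 r , tt) refl
        -- The left side is the norm of η² - 1, which equals N(η)² + 1 - (η² + η^(2q)) with N(η)² =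
        -- ι² = -1.
        norms : m ⊗ m̄ ⊗ (n ⊗ conj n) ≡ ι ⊗ tr (φof x)
        norms = linear (η ∷ conj η ∷ conj 𝟙 ∷ m̄ ∷ conj n ∷ ι ∷ conj (ι ⊗ (η ⊗ η)) ∷ conj (η ⊗ η) ∷ []) (λ η c o m̄ n' i l k → (η :+ # 1) :* m̄ :* ((η :- # 1) :* n') := i :* (i :* (η :* η) :+ l) ⊣ η :* η :* c :- (η :* η :* o) :- c :+ o ∙ m̄ := c :+ o
            ⊞ η :* η :* m̄ :- m̄ ∙ n' := c :- o ⊞ :- (η :* η :* o) :- (η :* η) :+ o :+ # 1 ∙ o := # 1 ⊞ :- i ∙ l := i :* k ⊞ # 1 ∙ k := c :* c
            ⊞ η :* c :+ i ∙ η :* c := i ⊞ :- (η :* η) :- k :+ # 1 ∙ i :* i := :- # 1 ⊞ []) (conj-⊕ η 𝟙 , conj-⊝ η 𝟙 , conj-𝟙 , conj-ι⊗ (η ⊗ η) , conj-⊗ η η , norm , ι² , tt) refl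

      x≢𝟘 : x ≢ 𝟘
      x≢𝟘 = x-nonzero

      D1-pencil : D1 (line (P∞ a b) (Q x y)) (sgn b y)
      D1-pencil = D1-line {a} {b} {x} {y} a-norm c x-nonzero (polar-b x)

      -- The factors (1 - ι)^h and (1 - ι)^j combine to 1 - ι, and `half-power` turns (1 - ι) η^h
      -- into κ d^j. The second d^j, coming from y^q - y, makes this -κ. What is left is the
      -- character of ι times the trace, and ι is a square.
      sgn-character : sgn b y ≡ ⊖ (κ ⊗ pow (tr (φof x)) j)
      sgn-character = linear (pow t h ∷ pow (conj y ⊕ ⊖ y) j ∷ κ ∷ dⱼ ∷ ι ∷ conj (𝟙 ⊕ ⊖ ι) ∷ pow (𝟙 ⊕ ⊖ ι) j ∷ pow (𝟙 ⊕ ⊖ ι) h ∷ pow η h ∷ pow (m ⊗ m̄) j ∷ pow (n ⊗ conj n) j ∷ pow (m ⊗ m̄ ⊗ (n ⊗ conj n)) j ∷ pow (ι ⊗ tr (φof x)) j ∷ pow ι j ∷ pow (tr (φof x)) j ∷ []) (λ T I κ D i i' J Jh P M N L R Ij Z → T :* I := :- (κ :* Z) ⊣ I ∙ T := Jh :* P :* M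
          ⊞ Jh :* P :* M ∙ I := D :* J :* N ⊞ D :* J :* P :* Z ∙ Jh := (# 1 :- i) :* J ⊞ :- (D :* P :* Z) ∙ i' := (# 1 :- i) :* (J :* J)
          ⊞ D :* P :* Z ∙ i' := # 1 :- i ⊞ D :* Z ∙ (# 1 :- i) :* P := κ :* D ⊞ κ :* Z ∙ D :* D := :- # 1 ⊞ :- (D :* J :* Jh :* P) ∙ L := M :* N
          ⊞ D :* J :* Jh :* P ∙ L := R ⊞ D :* J :* Jh :* P ∙ R := Ij :* Z ⊞ D :* J :* Jh :* P :* Z ∙ Ij := # 1 ⊞ []) (tʰ , imʲ , pow-h (𝟙 ⊕ ⊖ ι) , pow-q (𝟙 ⊕ ⊖ ι) , Fq-⊕ Fq-𝟙 (Fq-⊖ Fq-ι) , half-power , dⱼ² , pow-⊗ (m ⊗ m̄) (n ⊗ conj n) j , cong (λ z → pow z j) norms , pow-⊗ ι (tr (φof x)) j , character-ι , tt) refl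

    sign-count : ∀ {σ ζ} → σ ≡ ⊖ (pow a h ⊗ ζ) → length (filter (λ x → sgn b (yof x) ≟ σ) X) ≡ length (filter (λ φ → pow (tr φ) j ≟ ζ) Φ)
    sign-count {σ} {ζ} σ≡ = bijection⇒length (filter-unique _ (filter-unique X? unique)) (filter-unique _ Φ-unique) (xη ∘ ηφ) to from
      where
      κ≢ : κ ≢ 𝟘
      κ≢ = pow-nonzero h (norm-2⇒nonzero a-norm)
      to : ∀ {x} → x ∈ filter (λ x → sgn b (yof x) ≟ σ) X → φof x ∈ filter (λ φ → pow (tr φ) j ≟ ζ) Φ × xη (ηφ (φof x)) ≡ x
      to {x} m = let
          (mX , s≡) = ∈-filter⁻ (λ x → sgn b (yof x) ≟ σ) {xs = X} m
          c = proj₂ (∈-filter⁻ X? {xs = elements} mX)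
          (inΦ , back) = good⇒Φ (curve⇒good x c)
        in ∈-filter⁺ (λ φ → pow (tr φ) j ≟ ζ) (∈Φ inΦ)
             (⊗-cancelˡ κ≢ (linear (κ ∷ pow (tr (φof x)) j ∷ ζ ∷ sgn b (yof x) ∷ σ ∷ []) (λ κ Z z s σ → κ :* Z := κ :* z ⊣ # 1 ∙ s := :- (κ :* Z)
                 ⊞ :- # 1 ∙ s := σ ⊞ :- # 1 ∙ σ := :- (κ :* z) ⊞ []) (sgn-character x c , s≡ , σ≡ , tt) refl))
           , trans (cong xη back) (xη-ηof x c)
      from : ∀ {φ} → φ ∈ filter (λ φ → pow (tr φ) j ≟ ζ) Φ → xη (ηφ φ) ∈ filter (λ x → sgn b (yof x) ≟ σ) X × φof (xη (ηφ φ)) ≡ φ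
      from {φ} m = let
          (mΦ , z≡) = ∈-filter⁻ (λ φ → pow (tr φ) j ≟ ζ) {xs = Φ} m
          (G , φ≡) = Φ⇒good (Φ∋ mΦ)
          (c , η≡) = good⇒curve G
          φof≡ = trans (cong (λ z → ι ⊗ (z ⊗ z)) η≡) φ≡
        in ∈-filter⁺ (λ x → sgn b (yof x) ≟ σ) (∈-filter⁺ X? (complete _) c)
             (trans (sgn-character _ c) (trans (cong (λ z → ⊖ (κ ⊗ z)) (trans (cong (λ z → pow (tr z) j) φof≡) z≡)) (sym σ≡)))
           , φof≡

    sgn-square : ∀ x → Curve x (yof x) → sgn b (yof x) ⊗ sgn b (yof x) ≡ ⊖ 𝟚
    sgn-square x c = D1-square (D1-pencil x c)

    count-⊖ : length (filter (λ x → sgn b (yof x) ≟ ⊖ pow a h) X) ≡ C₊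
    count-⊖ = sign-count (cong ⊖_ (sym (*-identityʳ _)))

    count-⊕ : length (filter (λ x → sgn b (yof x) ≟ pow a h) X) ≡ C₋
    count-⊕ = sign-count (solve 1 (λ k → k := :- (k :* :- # 1)) refl (pow a h))

    -- Every sign squares to -2, hence is one of κ and -κ.
    X-length : length X ≡ C₊ ℕ.+ C₋
    X-length = trans (length-partition (λ x → sgn b (yof x) ≟ ⊖ κ) (λ x → sgn b (yof x) ≟ κ) X either both) (cong₂ ℕ._+_ count-⊖ count-⊕)
      where
      either : ∀ {x} → x ∈ X → sgn b (yof x) ≡ ⊖ κ ⊎ sgn b (yof x) ≡ κ
      either {x} m = [ inj₂ , inj₁ ]′ (square-roots (trans (sgn-square x (proj₂ (∈-filter⁻ X? {xs = elements} m))) (sym κ²)))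
      both : ∀ {x} → sgn b (yof x) ≡ ⊖ κ → sgn b (yof x) ≡ κ → ⊥
      both eq eq′ = ⊗-nonzero 𝟚≢𝟘 (pow-nonzero h (norm-2⇒nonzero a-norm)) (linear (κ ∷ []) (λ κ → # 2 :* κ := # 0 ⊣ :- # 1 ∙ :- κ := κ ⊞ []) (trans (sym eq) eq′ , tt) refl)

    X-inhabited : Σ A λ x → Curve x (yof x)
    -- The parameter φ = -1 belongs to Φ because h is odd.
    X-inhabited = _ , proj₁ (good⇒curve (proj₁ (Φ⇒good (trans (pow-h-⊖ 𝟙) (cong ⊖_ pow-h-𝟙)))))

  -- Listing the generators through a point in normal form

  ≈L-join : ∀ {ℓ ℓ′ m} → ℓ ≈L m → ℓ′ ≈L m → ℓ ≈L ℓ′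
  ≈L-join r s = ≈L-trans r (≈L-sym s)

  𝓜 : Line → Line → Line → Set
  𝓜 ℓ₁ ℓ₂ ℓ = Orbit𝔥 ℓ₁ ℓ ⊎ Orbit𝔥 ℓ₂ ℓ

  ∼-refl : ∀ {v} → v ∼ v
  ∼-refl = 𝟙 , 𝟘≢𝟙 ∘ sym , λ i → sym (*-identityˡ _)

  Curve⇒XPlus : ∀ {x y} → Curve x y → XPlus (Q x y)
  Curve⇒XPlus {x} {y} c = inj₁ (x , y , c , ∼-refl)

  H-P∞ : ∀ {a b} → a ⊗ conj a ≡ ⊖ 𝟚 → H (P∞ a b) (P∞ a b) ≡ 𝟘
  H-P∞ {a} {b} n = linear (a ∷ b ∷ conj a ∷ conj b ∷ conj 𝟙 ∷ conj 𝟘 ∷ []) (λ a b a' b' o z → a :* a' :+ # 2 :* # 1 :* o :- # 0 :* b' :- b :* z := # 0 ⊣ # 1 ∙ a :* a' := :- # 2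
      ⊞ # 2 ∙ o := # 1 ⊞ :- b ∙ z := # 0 ⊞ []) (n , conj-𝟙 , conj-𝟘 , tt) refl

  H-Q∞-Q∞ : H Q∞ Q∞ ≡ 𝟘
  H-Q∞-Q∞ = trans (H-Q∞ Q∞) (solve 1 (λ o → :- # 0 := # 0) refl 𝟙)

  line∞-generator : ∀ {a b} → a ⊗ conj a ≡ ⊖ 𝟚 → Generator (line (P∞ a b) Q∞)
  line∞-generator {a} {b} n = isotropic⇒generator {line (P∞ a b) Q∞} (P∞-Q∞-independent {a} {b}) (H-P∞ {a} {b} n , trans (H-Q∞ (P∞ a b)) (solve 1 (λ o → :- # 0 := # 0) refl 𝟙) , H-Q∞-Q∞)

  module Through {a b : A} (a-norm : a ⊗ conj a ≡ ⊖ 𝟚) (b∉Fq : ¬ InFq b) where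
    open Pencil {a} {b} a-norm b∉Fq public

    P : V
    P = P∞ a b

    L∞ : Line
    L∞ = line P Q∞

    Lx : A → Line
    Lx x = line P (Q x (yof x))

    X∋ : ∀ {x} → x ∈ X → Curve x (yof x)
    X∋ m = proj₂ (∈-filter⁻ X? {xs = elements} m)

    Lx-isotropic : ∀ {x} → Curve x (yof x) → Isotropic (Lx x)
    Lx-isotropic {x} c = H-P∞ {a} {b} a-norm
      , linear (a ∷ b ∷ conj x ∷ conj (yof x) ∷ conj 𝟙 ∷ conj (yof x ⊗ yof x) ∷ []) (λ a b x' y' o s → a :* x' :+ # 2 :* # 1 :* y' :- # 0 :* s :- b :* o := # 0 ⊣ :- b ∙ o := # 1
          ⊞ :- # 1 ∙ b := a :* x' :+ # 2 :* y' ⊞ []) (conj-𝟙 , AffineLine.b≡ {a} {b} {x} {yof x} a-norm c (x≢𝟘 x c) (polar-b x) , tt) refl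
      , trans (H-Q x (yof x) x (yof x)) (equal⇒difference-zero (curve-norm c))

    Lx-generator : ∀ {x} → Curve x (yof x) → Generator (Lx x)
    Lx-generator {x} c = isotropic⇒generator {Lx x} (P∞-Q-independent {a} {b} {x} {yof x}) (Lx-isotropic {x} c)

    Q∞∉Lx : ∀ {x} → Curve x (yof x) → ¬ OnLine Q∞ (Lx x)
    Q∞∉Lx {x} c o = 𝟘≢𝟙 (linear (H (Q x (yof x)) Q∞ ∷ []) (λ v → # 0 := # 1 ⊣ :- # 1 ∙ v := :- # 1 ⊞ # 1 ∙ v := # 0 ⊞ []) (H-Q∞ (Q x (yof x)) , isotropic-perp {Lx x} {Q x (yof x)} {Q∞} (Lx-isotropic {x} c) (OnLine-w (Lx x)) o , tt) refl)

    Lx-injective : ∀ {x x′} → Curve x (yof x) → Curve x′ (yof x′) → Lx x ≈L Lx x′ → x ≡ x′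
    Lx-injective {x} {x′} c c′ r = sym (proj₁ (curve-point-unique c′ c (isotropic-perp {Lx x′} {Q x′ (yof x′)} {Q x (yof x)} (Lx-isotropic {x′} c′) (OnLine-w (Lx x′)) (≈L⇒⊆ {Q x (yof x)} {Lx x} {Lx x′} r (OnLine-w (Lx x))))))

    through-affine : ∀ {ℓ x y} → Generator ℓ → OnLine P ℓ → OnLine (Q x y) ℓ → Curve x y → x ∈ X × ℓ ≈L Lx x
    through-affine {ℓ} {x} {y} gen oP oQ c = ∈-filter⁺ X? (complete x) (subst (Curve x) y≡ c)
      , line-through (P∞-Q-independent {a} {b} {x} {yof x}) oP (subst (λ z → OnLine (Q x z) ℓ) y≡ oQ)
      where
      y≡ : y ≡ yof x
      y≡ = ⊗-cancelˡ 𝟚≢𝟘 (linear (x ∷ y ∷ yof x ∷ conj a ∷ conj b ∷ conj 𝟙 ∷ conj 𝟘 ∷ []) (λ x y Y a' b' o z → # 2 :* y := # 2 :* Y ⊣ # 1 ∙ x :* a' :+ # 2 :* y :* o :- # 1 :* b' :- y :* y :* z := # 0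
          ⊞ :- (# 2 :* y) ∙ o := # 1 ⊞ y :* y ∙ z := # 0 ⊞ # 1 ∙ b' := a' :* x :+ # 2 :* Y ⊞ []) (generator-perp {ℓ} {Q x y} {P} gen oQ oP , conj-𝟙 , conj-𝟘 , polar-b x , tt) refl)

    through-infinite : ∀ {ℓ} → OnLine P ℓ → OnLine Q∞ ℓ → ℓ ≈L L∞
    through-infinite oP oQ = line-through (P∞-Q∞-independent {a} {b}) oP oQ

    meeting-curve : CardUpTo _≈L_ (GensThroughPMeetingX P) (suc (length X))
    meeting-curve = L∞ ∷ map Lx X , cong suc (length-map Lx X)
      , ((line∞-generator {a} {b} a-norm , OnLine-u L∞ , Q∞ , inj₂ ∼-refl , OnLine-w L∞)
          ∷ All.map⁺ (All.tabulate λ {x} m → Lx-generator {x} (X∋ m) , OnLine-u (Lx x) , Q x (yof x) , Curve⇒XPlus (X∋ m) , OnLine-w (Lx x)))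
      , (All.map⁺ (All.tabulate λ {x} m r → Q∞∉Lx {x} (X∋ m) (≈L⇒⊆ {Q∞} {L∞} {Lx x} r (OnLine-w L∞)))
          ∷ allPairs-map Lx (λ {x} {x′} c c′ n r → n (Lx-injective {x} {x′} c c′ r)) (All.tabulate X∋) (filter-unique X? unique))
      , complete′
      where
      complete′ : ∀ ℓ → GensThroughPMeetingX P ℓ → Any (ℓ ≈L_) (L∞ ∷ map Lx X)
      complete′ ℓ (gen , oP , v , inj₁ (x , y , c , r) , ov) = let (m , s) = through-affine {ℓ} {x} {y} gen oP (OnLine-∼ {v} {Q x y} {ℓ} r ov) c in there (Any.map⁺ (lose m s))
      complete′ ℓ (gen , oP , v , inj₂ r , ov) = here (through-infinite {ℓ} oP (OnLine-∼ {v} {Q∞} {ℓ} r ov))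

    module _ {ℓ₁ ℓ₂ : Line} {σ₁ σ₂ : A} (d₁ : D1 ℓ₁ σ₁) (d₂ : D2 ℓ₂ σ₂) where

      private
        InM : Line → Set
        InM ℓ = 𝓜 ℓ₁ ℓ₂ ℓ × Generator ℓ × OnLine P ℓ

        X₁ : List A
        X₁ = filter (λ x → sgn b (yof x) ≟ σ₁) X

        X₁∋ : ∀ {x} → x ∈ X₁ → Curve x (yof x) × sgn b (yof x) ≡ σ₁
        X₁∋ m = let (mX , s) = ∈-filter⁻ (λ x → sgn b (yof x) ≟ σ₁) {xs = X} m in X∋ mX , s

        affine-members : All InM (map Lx X₁)
        affine-members = All.map⁺ (All.tabulate λ {x} m → let (c , s) = X₁∋ m in
          inj₁ (D1-transitive d₁ (subst (D1 (Lx x)) s (D1-pencil x c))) , Lx-generator {x} c , OnLine-u (Lx x))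

        affine-distinct : AllPairs (λ ℓ m → ¬ (ℓ ≈L m)) (map Lx X₁)
        affine-distinct = allPairs-map Lx (λ {x} {x′} c c′ n r → n (Lx-injective {x} {x′} c c′ r)) (All.tabulate (λ m → proj₁ (X₁∋ m))) (filter-unique _ (filter-unique X? unique))

        in-first : ∀ {ℓ} → D1 ℓ σ₁ → Generator ℓ → OnLine P ℓ → Any (ℓ ≈L_) (map Lx X₁)
        in-first {ℓ} D gen oP = let
            module D = D1 D
            (m , s) = through-affine {ℓ} {D.x} {D.y} gen oP (≈L⇒⊆ {Q D.x D.y} (≈L-sym D.same) (OnLine-u _)) D.curve
          in Any.map⁺ (lose (∈-filter⁺ (λ x → sgn b (yof x) ≟ σ₁) m (D1-functional (D1-pencil D.x (X∋ m)) (D1-resp (≈L-sym s) D))) s)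

        -- Orthogonality of P to (e₁²,0,e₁f₁,f₁²) reads e₁ (2 f₁ - e₁ b^q) = 0. A nonzero e₁ would
        -- put b into F_q, so the point of Ω on the line is `Q∞`.
        in-second : ∀ {ℓ} → D2 ℓ σ₂ → Generator ℓ → OnLine P ℓ → ℓ ≈L L∞ × σ₂ ≡ ⊖ pow a h
        in-second {ℓ} D gen oP = r , trans (D2-functional D (D2-resp r (D2-line∞ {a} {b} a-norm))) (pow-h-⊖ a)
          where
          module D = D2 D
          oW : OnLine (W D.e₁ D.f₁) ℓ
          oW = ≈L⇒⊆ {W D.e₁ D.f₁} (≈L-sym D.same) (OnLine-u _)
          perp : D.e₁ ⊗ (𝟚 ⊗ D.f₁ ⊕ ⊖ (D.e₁ ⊗ conj b)) ≡ 𝟘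
          perp = linear (D.e₁ ∷ D.f₁ ∷ conj a ∷ conj b ∷ conj 𝟙 ∷ conj 𝟘 ∷ []) (λ e f a' b' o z → e :* (# 2 :* f :- e :* b') := # 0 ⊣ # 1 ∙ # 0 :* a' :+ # 2 :* (e :* f) :* o :- e :* e :* b' :- f :* f :* z := # 0
              ⊞ :- (# 2 :* e :* f) ∙ o := # 1 ⊞ f :* f ∙ z := # 0 ⊞ []) (generator-perp {ℓ} {W D.e₁ D.f₁} {P} gen oW oP , conj-𝟙 , conj-𝟘 , tt) refl
          e₁≡0 : D.e₁ ≡ 𝟘
          e₁≡0 with D.e₁ ≟ 𝟘
          ... | yes z = z
          ... | no n = ⊥-elim (b∉Fq (trans b̄≡ (sym (trans (sym (conj-conj b)) (trans (cong conj b̄≡) (Fq-⊗ (Fq-⊗ Fq-𝟚 D.Fq-f₁) (Fq-inv n D.Fq-e₁)))))))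
            where
            b̄≡ : conj b ≡ 𝟚 ⊗ D.f₁ ⊗ inv D.e₁
            b̄≡ = linear (D.e₁ ∷ D.f₁ ∷ conj b ∷ inv D.e₁ ∷ []) (λ e f b' i → b' := # 2 :* f :* i ⊣ :- i ∙ # 2 :* f :- e :* b' := # 0
                ⊞ :- b' ∙ e :* i := # 1 ⊞ []) (integral perp n , inverseʳ D.e₁ n , tt) refl
          f₁≢0 : D.f₁ ≢ 𝟘
          f₁≢0 z = 𝟘≢𝟙 (linear (D.e₁ ∷ D.f₁ ∷ D.e₂ ∷ D.f₂ ∷ []) (λ e f u v → # 0 := # 1 ⊣ # 1 ∙ e :* v :- u :* f := # 1 ⊞ :- v ∙ e := # 0
              ⊞ u ∙ f := # 0 ⊞ []) (D.det , e₁≡0 , z , tt) refl)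
          W∼Q∞ : W D.e₁ D.f₁ ∼ Q∞
          W∼Q∞ = D.f₁ ⊗ D.f₁ , ⊗-nonzero f₁≢0 f₁≢0 , all4 (linear (D.e₁ ∷ D.f₁ ∷ []) (λ e f → e :* e := f :* f :* # 0 ⊣ e ∙ e := # 0 ⊞ []) (e₁≡0 , tt) refl) (solve 1 (λ f → # 0 := f :* f :* # 0) refl D.f₁)
            (linear (D.e₁ ∷ D.f₁ ∷ []) (λ e f → e :* f := f :* f :* # 0 ⊣ f ∙ e := # 0 ⊞ []) (e₁≡0 , tt) refl) (sym (*-identityʳ _))
          r : ℓ ≈L L∞
          r = through-infinite {ℓ} oP (OnLine-∼ {W D.e₁ D.f₁} {Q∞} {ℓ} W∼Q∞ oW)

      members-with : σ₂ ≡ ⊖ pow a h → CardUpTo _≈L_ InM (suc (length X₁))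
      members-with eq = L∞ ∷ map Lx X₁ , cong suc (length-map Lx X₁)
        , ((inj₂ (D2-transitive d₂ (subst (D2 L∞) (trans (pow-h-⊖ a) (sym eq)) (D2-line∞ {a} {b} a-norm))) , line∞-generator {a} {b} a-norm , OnLine-u L∞) ∷ affine-members)
        , (All.map⁺ (All.tabulate λ {x} m r → Q∞∉Lx {x} (proj₁ (X₁∋ m)) (≈L⇒⊆ {Q∞} {L∞} {Lx x} r (OnLine-w L∞))) ∷ affine-distinct)
        , λ { ℓ (inj₁ o , gen , oP) → there (in-first {ℓ} (Orbit⇒D1 d₁ o) gen oP) ; ℓ (inj₂ o , gen , oP) → here (proj₁ (in-second {ℓ} (Orbit⇒D2 d₂ o) gen oP)) }

      members-without : σ₂ ≢ ⊖ pow a h → CardUpTo _≈L_ InM (length X₁)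
      members-without ne = map Lx X₁ , length-map Lx X₁ , affine-members , affine-distinct
        , λ { ℓ (inj₁ o , gen , oP) → in-first {ℓ} (Orbit⇒D1 d₁ o) gen oP ; ℓ (inj₂ o , gen , oP) → ⊥-elim (ne (proj₂ (in-second {ℓ} (Orbit⇒D2 d₂ o) gen oP))) }

  -- Condition (B) as a relation between C₊ and C₋

  private
    arith₁ : ∀ u v → 2 ℕ.* suc u ≡ suc (u ℕ.+ v) → v ≡ suc u
    arith₁ u v eq = sym (ℕ.+-cancelˡ-≡ (suc u) (suc u) v (trans (expand u) eq))
      where
      expand : ∀ u → suc u ℕ.+ suc u ≡ 2 ℕ.* suc u
      expand = solve-∀ℕ
    arith₂ : ∀ u v → 2 ℕ.* v ≡ suc (u ℕ.+ v) → v ≡ suc u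
    arith₂ u v eq = ℕ.+-cancelʳ-≡ v v (suc u) (trans (expand v) eq)
      where
      expand : ∀ v → v ℕ.+ v ≡ 2 ℕ.* v
      expand = solve-∀ℕ
    arith₁⁻ : ∀ {u v} → v ≡ suc u → suc (u ℕ.+ v) ≡ 2 ℕ.* suc u
    arith₁⁻ {u} refl = expand u
      where
      expand : ∀ u → suc (u ℕ.+ suc u) ≡ 2 ℕ.* suc u
      expand = solve-∀ℕ
    arith₂⁻ : ∀ {u v} → v ≡ suc u → suc (u ℕ.+ v) ≡ 2 ℕ.* v
    arith₂⁻ {u} refl = expand u
      where
      expand : ∀ u → suc (u ℕ.+ suc u) ≡ 2 ℕ.* suc u
      expand = solve-∀ℕ

  -- With κ = a^h, the point carries C₊ lines of 𝒢₁ of sign -κ, C₋ of sign κ, and one line of 𝒢₂, of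
  -- sign -κ. Orbits of equal sign contribute 1 + C₊ or C₋, orbits of opposite sign C₊ or 1 + C₋.
  -- When each of these is half of the total does not depend on κ.
  Balanced : A → A → Set
  Balanced σ₁ σ₂ = (σ₁ ≡ σ₂ × C₋ ≡ suc C₊) ⊎ (σ₁ ≡ ⊖ σ₂ × C₊ ≡ suc C₋)

  module _ {a b : A} (a-norm : a ⊗ conj a ≡ ⊖ 𝟚) (b∉Fq : ¬ InFq b) {ℓ₁ ℓ₂ : Line} {σ₁ σ₂ : A} (d₁ : D1 ℓ₁ σ₁) (d₂ : D2 ℓ₂ σ₂) where
    open Through {a} {b} a-norm b∉Fq

    private
      κ : A
      κ = pow a h

      κ≢ : κ ≢ 𝟘
      κ≢ = pow-nonzero h (norm-2⇒nonzero a-norm)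

      κ² : κ ⊗ κ ≡ ⊖ 𝟚
      κ² = trans (pow-h² a) a-norm

      κ≢⊖κ : κ ≢ ⊖ κ
      κ≢⊖κ eq = ⊗-nonzero 𝟚≢𝟘 κ≢ (linear (κ ∷ []) (λ κ → # 2 :* κ := # 0 ⊣ # 1 ∙ κ := :- κ ⊞ []) (eq , tt) refl)

      ⊖⊖ : ∀ x → x ≡ ⊖ (⊖ x)
      ⊖⊖ x = solve 1 (λ x → x := :- (:- x)) refl x

    data Members (m : ℕ) : Set where
      equal₁ : σ₁ ≡ σ₂ → m ≡ suc C₊ → Members m
      equal₂ : σ₁ ≡ σ₂ → m ≡ C₋ → Members m
      opposite₁ : σ₁ ≡ ⊖ σ₂ → m ≡ C₊ → Members m
      opposite₂ : σ₁ ≡ ⊖ σ₂ → m ≡ suc C₋ → Members m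

    members : Σ ℕ λ m → Members m × CardUpTo _≈L_ (λ ℓ → 𝓜 ℓ₁ ℓ₂ ℓ × Generator ℓ × OnLine P ℓ) m
    members = choose (square-roots {σ₁} {κ} (trans (D1-square d₁) (sym κ²))) (square-roots {σ₂} {κ} (trans (D2-square d₂) (sym κ²)))
      where
      count : ∀ {σ} → σ₁ ≡ σ → length (filter (λ x → sgn b (yof x) ≟ σ₁) X) ≡ length (filter (λ x → sgn b (yof x) ≟ σ) X)
      count refl = refl
      choose : σ₁ ≡ κ ⊎ σ₁ ≡ ⊖ κ → σ₂ ≡ κ ⊎ σ₂ ≡ ⊖ κ → Σ ℕ λ m → Members m × CardUpTo _≈L_ (λ ℓ → 𝓜 ℓ₁ ℓ₂ ℓ × Generator ℓ × OnLine P ℓ) m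
      choose (inj₁ e₁) (inj₁ e₂) = _ , equal₂ (trans e₁ (sym e₂)) (trans (count e₁) count-⊕) , members-without d₁ d₂ (λ eq → κ≢⊖κ (trans (sym e₂) eq))
      choose (inj₁ e₁) (inj₂ e₂) = _ , opposite₂ (trans e₁ (trans (⊖⊖ κ) (cong ⊖_ (sym e₂)))) (cong suc (trans (count e₁) count-⊕)) , members-with d₁ d₂ e₂
      choose (inj₂ e₁) (inj₁ e₂) = _ , opposite₁ (trans e₁ (cong ⊖_ (sym e₂))) (trans (count e₁) count-⊖) , members-without d₁ d₂ (λ eq → κ≢⊖κ (trans (sym e₂) eq))
      choose (inj₂ e₁) (inj₂ e₂) = _ , equal₁ (trans e₁ (sym e₂)) (cong suc (trans (count e₁) count-⊖)) , members-with d₁ d₂ e₂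

    total : CardUpTo _≈L_ (GensThroughPMeetingX P) (suc (C₊ ℕ.+ C₋))
    total = subst (CardUpTo _≈L_ (GensThroughPMeetingX P)) (cong suc X-length) meeting-curve

    conditionB⇒ : ConditionB (𝓜 ℓ₁ ℓ₂) P → C₋ ≡ suc C₊ ⊎ C₊ ≡ suc C₋
    conditionB⇒ (m , cm , ct) = let (m′ , case , cm′) = members in
      decide case (CardUpTo-unique ≈L-join cm cm′) (CardUpTo-unique ≈L-join ct total)
      where
      decide : ∀ {m m′} → Members m′ → m ≡ m′ → 2 ℕ.* m ≡ suc (C₊ ℕ.+ C₋) → C₋ ≡ suc C₊ ⊎ C₊ ≡ suc C₋
      decide (equal₁ _ refl) refl eq = inj₁ (arith₁ C₊ C₋ eq)
      decide (equal₂ _ refl) refl eq = inj₁ (arith₂ C₊ C₋ eq)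
      decide (opposite₁ _ refl) refl eq = inj₂ (arith₂ C₋ C₊ (trans eq (cong suc (ℕ.+-comm C₊ C₋))))
      decide (opposite₂ _ refl) refl eq = inj₂ (arith₁ C₋ C₊ (trans eq (cong suc (ℕ.+-comm C₊ C₋))))

    ⇒conditionB : Balanced σ₁ σ₂ → ConditionB (𝓜 ℓ₁ ℓ₂) P
    ⇒conditionB bal = let (m , case , cm) = members in m , cm , subst (CardUpTo _≈L_ (GensThroughPMeetingX P)) (decide case bal) total
      where
      σ₂≢ : σ₂ ≢ ⊖ σ₂
      σ₂≢ eq = ⊗-nonzero 𝟚≢𝟘 (factorˡ {σ₂} {σ₂} (λ z → ⊖-nonzero 𝟚≢𝟘 (trans (sym (D2-square d₂)) z))) (linear (σ₂ ∷ []) (λ s → # 2 :* s := # 0 ⊣ # 1 ∙ s := :- s ⊞ []) (eq , tt) refl)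
      decide : ∀ {m} → Members m → Balanced σ₁ σ₂ → suc (C₊ ℕ.+ C₋) ≡ 2 ℕ.* m
      decide (equal₁ _ refl) (inj₁ (_ , eq)) = arith₁⁻ eq
      decide (equal₂ _ refl) (inj₁ (_ , eq)) = arith₂⁻ eq
      decide (opposite₁ _ refl) (inj₂ (_ , eq)) = trans (cong suc (ℕ.+-comm C₊ C₋)) (arith₂⁻ eq)
      decide (opposite₂ _ refl) (inj₂ (_ , eq)) = trans (cong suc (ℕ.+-comm C₊ C₋)) (arith₁⁻ eq)
      decide (equal₁ s _) (inj₂ (s′ , _)) = ⊥-elim (σ₂≢ (trans (sym s) s′))
      decide (equal₂ s _) (inj₂ (s′ , _)) = ⊥-elim (σ₂≢ (trans (sym s) s′))
      decide (opposite₁ s _) (inj₁ (s′ , _)) = ⊥-elim (σ₂≢ (trans (sym s′) s))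
      decide (opposite₂ s _) (inj₁ (s′ , _)) = ⊥-elim (σ₂≢ (trans (sym s′) s))

  -- Transport of Condition (B) by elements of 𝔥

  D2-isotropic : ∀ {ℓ s} (D : D2 ℓ s) → let open D2 D in Isotropic (line (W e₁ f₁) (W′ e₁ f₁ e₂ f₂ a))
  D2-isotropic D =
      (linear (e₁ ∷ f₁ ∷ conj 𝟘 ∷ conj (e₁ ⊗ e₁) ∷ conj (e₁ ⊗ f₁) ∷ conj (f₁ ⊗ f₁) ∷ []) (λ e f z A B C → # 0 :* z :+ # 2 :* (e :* f) :* B :- e :* e :* C :- f :* f :* A := # 0 ⊣ :- (# 2 :* f :* f) :+ C ∙ A := e :* e
          ⊞ # 2 :* e :* f ∙ B := e :* f ⊞ :- A ∙ C := f :* f ⊞ []) (Fq-⊗ Fq-e₁ Fq-e₁ , Fq-⊗ Fq-e₁ Fq-f₁ , Fq-⊗ Fq-f₁ Fq-f₁ , tt) refl)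
    , (linear (e₁ ∷ f₁ ∷ e₂ ∷ f₂ ∷ conj a ∷ conj (𝟚 ⊗ e₁ ⊗ e₂) ∷ conj (e₁ ⊗ f₂ ⊕ e₂ ⊗ f₁) ∷ conj (𝟚 ⊗ f₁ ⊗ f₂) ∷ []) (λ e f u v a' A B C → # 0 :* a' :+ # 2 :* (e :* f) :* B :- e :* e :* C :- f :* f :* A := # 0 ⊣ :- (f :* f) ∙ A := # 2 :* e :* u
        ⊞ # 2 :* e :* f ∙ B := e :* v :+ u :* f ⊞ :- (e :* e) ∙ C := # 2 :* f :* v ⊞ []) (FA , FB , FC , tt) refl)
    , (linear (e₁ ∷ f₁ ∷ e₂ ∷ f₂ ∷ a ∷ conj a ∷ conj (𝟚 ⊗ e₁ ⊗ e₂) ∷ conj (e₁ ⊗ f₂ ⊕ e₂ ⊗ f₁) ∷ conj (𝟚 ⊗ f₁ ⊗ f₂) ∷ []) (λ e f u v a a' A B C → a :* a' :+ # 2 :* (e :* v :+ u :* f) :* B :- # 2 :* e :* u :* C :- # 2 :* f :* v :* A := # 0 ⊣ :- C ∙ A := # 2 :* e :* u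
        ⊞ # 4 :* f :* u :+ # 2 ∙ B := e :* v :+ u :* f ⊞ :- (# 4 :* e :* u) :+ A ∙ C := # 2 :* f :* v ⊞ # 1 ∙ a :* a' := :- # 2
        ⊞ :- (# 4 :* f :* u) :+ # 2 :* B :+ # 2 ∙ e :* v :- u :* f := # 1 ⊞ []) (FA , FB , FC , a-norm , det , tt) refl)
    where
    open D2 D
    FA = Fq-⊗ (Fq-⊗ Fq-𝟚 Fq-e₁) Fq-e₂
    FB = Fq-⊕ (Fq-⊗ Fq-e₁ Fq-f₂) (Fq-⊗ Fq-e₂ Fq-f₁)
    FC = Fq-⊗ (Fq-⊗ Fq-𝟚 Fq-f₁) Fq-f₂

  -- For generators, carrying an invariant is the same as meeting the curve. As 𝔥 preserves the
  -- invariants, it moves generators meeting the curve to such generators, and the surface requires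
  -- no argument of its own.
  Typed : Line → Set
  Typed ℓ = Σ A λ s → D1 ℓ s ⊎ D2 ℓ s

  typed⇒generator : ∀ {ℓ} → Independent ℓ → Typed ℓ → Generator ℓ
  typed⇒generator {ℓ} ind (s , inj₁ D) = ind , λ v o → H⇒U3 v (let o′ = ≈L⇒⊆ {v} (D1.same D) o in isotropic-perp {v = v} {v} (D1-isotropic D) o′ o′)
  typed⇒generator {ℓ} ind (s , inj₂ D) = ind , λ v o → H⇒U3 v (let o′ = ≈L⇒⊆ {v} (D2.same D) o in isotropic-perp {v = v} {v} (D2-isotropic D) o′ o′)

  typed⇒meets : ∀ {ℓ} → Typed ℓ → Contains XPlus ℓ
  typed⇒meets {ℓ} (s , inj₁ D) = let open D1 D in Q x y , Curve⇒XPlus curve , ≈L⇒⊆ {Q x y} (≈L-sym same) (OnLine-u _)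
  typed⇒meets {ℓ} (s , inj₂ D) = W e₁ f₁ , onCurve , ≈L⇒⊆ {W e₁ f₁} (≈L-sym same) (OnLine-u _)
    where
    open D2 D
    onCurve : XPlus (W e₁ f₁)
    onCurve with e₁ ≟ 𝟘
    ... | no n = inj₁ (𝟘 , f₁ ⊗ inv e₁ , Fq-curve (Fq-⊗ Fq-f₁ (Fq-inv n Fq-e₁)) , e₁ ⊗ e₁ , ⊗-nonzero n n , all4 (sym (*-identityʳ _)) (sym (zeroʳ _))
          (linear (e₁ ∷ f₁ ∷ inv e₁ ∷ []) (λ e f i → e :* f := e :* e :* (f :* i) ⊣ :- (e :* f) ∙ e :* i := # 1 ⊞ []) (inverseʳ e₁ n , tt) refl) (linear (e₁ ∷ f₁ ∷ inv e₁ ∷ []) (λ e f i → f :* f := e :* e :* (f :* i :* (f :* i)) ⊣ :- (e :* f :* f :* i) :- (f :* f) ∙ e :* i := # 1 ⊞ []) (inverseʳ e₁ n , tt) refl))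
    ... | yes z = inj₂ (f₁ ⊗ f₁ , ⊗-nonzero f₁≢ f₁≢ , all4 (linear (e₁ ∷ f₁ ∷ []) (λ e f → e :* e := f :* f :* # 0 ⊣ e ∙ e := # 0 ⊞ []) (z , tt) refl) (sym (zeroʳ _)) (linear (e₁ ∷ f₁ ∷ []) (λ e f → e :* f := f :* f :* # 0 ⊣ f ∙ e := # 0 ⊞ []) (z , tt) refl) (sym (*-identityʳ _)))
      where
      f₁≢ : f₁ ≢ 𝟘
      f₁≢ z′ = 𝟘≢𝟙 (linear (e₁ ∷ f₁ ∷ e₂ ∷ f₂ ∷ []) (λ e f u v → # 0 := # 1 ⊣ # 1 ∙ e :* v :- u :* f := # 1 ⊞ :- v ∙ e := # 0 ⊞ u ∙ f := # 0 ⊞ []) (det , z , z′ , tt) refl)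

  affine-∉Ω : ∀ {v x y} → x ≢ 𝟘 → v ∼ Q x y → ¬ Ω v
  affine-∉Ω {v} {x} n (c , c≢ , eq) (inj₁ (_ , _ , c′ , _ , eq′)) = ⊗-nonzero c≢ n (trans (sym (eq (suc zero))) (trans (eq′ (suc zero)) (zeroʳ c′)))
  affine-∉Ω {v} {x} n (c , c≢ , eq) (inj₂ (c′ , _ , eq′)) = ⊗-nonzero c≢ n (trans (sym (eq (suc zero))) (trans (eq′ (suc zero)) (zeroʳ c′)))

  meets⇒typed : ∀ {ℓ} → Generator ℓ → Contains XPlus ℓ → Typed ℓ
  meets⇒typed {ℓ} gen (v , inj₂ r , o) = let (s , D) = D2-exists {ℓ} (gen , v , inj₂ r , o) in s , inj₂ D
  meets⇒typed {ℓ} gen (v , inj₁ (x , y , c , r) , o) = choose (x ≟ 𝟘)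
    where
    choose : Dec (x ≡ 𝟘) → Typed ℓ
    choose (no n) = let (s , D) = D1-exists {ℓ} (gen , v , (inj₁ (x , y , c , r) , affine-∉Ω {v} {x} {y} n r) , o) in s , inj₁ D
    choose (yes z) = let (s , D) = D2-exists {ℓ} (gen , v , inj₁ (y , curve-𝟘 c z , subst (λ t → v ∼ Q t y) z r) , o) in s , inj₂ D

  Hmap-linear : ∀ {f} → Hmap f → Linear f
  Hmap-linear (M , _ , eq) {a} {b} {u} {w} {v} f i = trans (sym (eq v i)) (trans (apply-linear M f i) (cong₂ (λ x y → a ⊗ x ⊕ b ⊗ y) (eq u i) (eq w i)))

  Hmap-Orbit : ∀ {f ℓ₁ ℓ} → Hmap f → Orbit𝔥 ℓ₁ ℓ → Orbit𝔥 ℓ₁ (mapL f ℓ)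
  Hmap-Orbit {f} {ℓ₁} {ℓ} hf@(M , m , eq) (N , n , r) = let (K , inK , eqK) = In𝔥-· m n in
    K , inK , ≈L-trans (mapL-≈ (Hmap-linear hf) r) (≈L-trans (≈L-sym (mapL-cong {apply M} {f} eq (actL N ℓ₁))) (≈L-sym (mapL-cong {apply K} {λ v → apply M (apply N v)} eqK ℓ₁)))

  Hmap-Typed : ∀ {f ℓ} → Hmap f → Typed ℓ → Typed (mapL f ℓ)
  Hmap-Typed {f} {ℓ} (M , m , eq) (s , inj₁ D) = s , inj₁ (D1-resp (≈L-sym (mapL-cong {apply M} {f} eq ℓ)) (In𝔥-D1 m D))
  Hmap-Typed {f} {ℓ} (M , m , eq) (s , inj₂ D) = s , inj₂ (D2-resp (≈L-sym (mapL-cong {apply M} {f} eq ℓ)) (In𝔥-D2 m D))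

  linear-independent : ∀ {f f′ : V → V} → Linear f′ → (∀ v i → f′ (f v) i ≡ v i) → ∀ {ℓ} → Independent ℓ → Independent (mapL f ℓ)
  linear-independent {f} {f′} lin′ inverse {line u w} ind a b eq = ind a b λ i →
    trans (sym (cong₂ (λ x y → a ⊗ x ⊕ b ⊗ y) (inverse u i) (inverse w i))) (trans (sym (lin′ {v = λ _ → 𝟘} (λ i → sym (eq i)) i)) (zero-image i))
    where
    zero-image : ∀ i → f′ (λ _ → 𝟘) i ≡ 𝟘
    zero-image i = trans (lin′ {𝟘} {𝟘} {λ _ → 𝟘} {λ _ → 𝟘} (λ _ → solve 1 (λ o → # 0 := # 0 :* # 0 :+ # 0 :* # 0) refl 𝟙) i) (solve 1 (λ z → # 0 :* z :+ # 0 :* z := # 0) refl (f′ (λ _ → 𝟘) i))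

  -- The inverse map is part of the data because `In𝔥` is built from products only, and a count is
  -- transported in both directions.
  record Normalisation (P : V) : Set where
    field
      f f′ : V → V
      hf : Hmap f
      hf′ : Hmap f′
      f′f : ∀ v i → f′ (f v) i ≡ v i
      ff′ : ∀ v i → f (f′ v) i ≡ v i
      a b : A
      a-norm : a ⊗ conj a ≡ ⊖ 𝟚
      b∉Fq : ¬ InFq b
      image : f P ∼ P∞ a b

  CardUpTo-transport : ∀ {S S′ : Line → Set} {g g′ : Line → Line} {n} → (∀ {ℓ m} → ℓ ≈L m → g ℓ ≈L g m) → (∀ {ℓ m} → ℓ ≈L m → g′ ℓ ≈L g′ m) →
    (∀ ℓ → g′ (g ℓ) ≈L ℓ) → (∀ ℓ → g (g′ ℓ) ≈L ℓ) → (∀ {ℓ} → S′ ℓ → S (g′ ℓ)) → (∀ {ℓ} → S ℓ → S′ (g ℓ)) → CardUpTo _≈L_ S′ n → CardUpTo _≈L_ S n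
  CardUpTo-transport {g = g} {g′} cg cg′ g′g gg′ to from (xs , l , s , ap , c) = map g′ xs , trans (length-map g′ xs) l , All.map⁺ (All.map to s)
    , distinct ap
    , λ ℓ sℓ → Any.map⁺ (Any.map (λ {m} r → ≈L-trans (≈L-sym (g′g ℓ)) (cg′ r)) (c (g ℓ) (from sℓ)))
    where
    distinct : ∀ {xs} → AllPairs (λ ℓ m → ¬ (ℓ ≈L m)) xs → AllPairs (λ ℓ m → ¬ (ℓ ≈L m)) (map g′ xs)
    distinct [] = []
    distinct (n ∷ ap) = All.map⁺ (All.map (λ {m} ne r → ne (≈L-trans (≈L-sym (gg′ _)) (≈L-trans (cg r) (gg′ m)))) n) ∷ distinct ap

  module _ {P : V} (N : Normalisation P) where
    open Normalisation N

    private
      forth back : Line → Line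
      forth = mapL f
      back = mapL f′
      lin = Hmap-linear hf
      lin′ = Hmap-linear hf′

      through⇒ : ∀ {ℓ} → OnLine P ℓ → OnLine (P∞ a b) (forth ℓ)
      through⇒ {ℓ} o = OnLine-∼ {f P} {P∞ a b} {forth ℓ} image (OnLine-map lin o)

      through⇐ : ∀ {ℓ} → OnLine (P∞ a b) ℓ → OnLine P (back ℓ)
      through⇐ {ℓ} o = OnLine-resp {f′ (f P)} (λ i → sym (f′f P i)) (OnLine-map lin′ (OnLine-∼ {P∞ a b} {f P} {ℓ} (∼-sym image) o))

      transport : ∀ {S S′ : Line → Set} {n} → (∀ {ℓ} → S′ ℓ → S (back ℓ)) → (∀ {ℓ} → S ℓ → S′ (forth ℓ)) → CardUpTo _≈L_ S′ n → CardUpTo _≈L_ S n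
      transport = CardUpTo-transport {g = forth} {back} (mapL-≈ lin) (mapL-≈ lin′) (mapL-cong {λ v → f′ (f v)} {λ v → v} f′f) (mapL-cong {λ v → f (f′ v)} {λ v → v} ff′)

    conditionB-transport : ∀ {ℓ₁ ℓ₂ σ₁ σ₂} → D1 ℓ₁ σ₁ → D2 ℓ₂ σ₂ → ConditionB (𝓜 ℓ₁ ℓ₂) (P∞ a b) → ConditionB (𝓜 ℓ₁ ℓ₂) P
    conditionB-transport {ℓ₁} {ℓ₂} d₁ d₂ (m , cm , ct) = m
      , transport {Member P} {Member (P∞ a b)} member⇐ member⇒ cm
      , transport {GensThroughPMeetingX P} {GensThroughPMeetingX (P∞ a b)} meeting⇐ meeting⇒ ct
      where
      Member : V → Line → Set
      Member R ℓ = 𝓜 ℓ₁ ℓ₂ ℓ × Generator ℓ × OnLine R ℓ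
      typed : ∀ {ℓ} → 𝓜 ℓ₁ ℓ₂ ℓ → Typed ℓ
      typed (inj₁ o) = _ , inj₁ (Orbit⇒D1 d₁ o)
      typed (inj₂ o) = _ , inj₂ (Orbit⇒D2 d₂ o)
      move : ∀ {f ℓ} → Hmap f → 𝓜 ℓ₁ ℓ₂ ℓ → 𝓜 ℓ₁ ℓ₂ (mapL f ℓ)
      move {f} {ℓ} hf (inj₁ o) = inj₁ (Hmap-Orbit {f} {ℓ₁} {ℓ} hf o)
      move {f} {ℓ} hf (inj₂ o) = inj₂ (Hmap-Orbit {f} {ℓ₂} {ℓ} hf o)
      generator⇐ : ∀ {ℓ} → Generator ℓ → Typed ℓ → Generator (back ℓ)
      generator⇐ {ℓ} (ind , _) t = typed⇒generator {back ℓ} (linear-independent {f′} {f} lin ff′ {ℓ} ind) (Hmap-Typed {f′} {ℓ} hf′ t)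
      generator⇒ : ∀ {ℓ} → Generator ℓ → Typed ℓ → Generator (forth ℓ)
      generator⇒ {ℓ} (ind , _) t = typed⇒generator {forth ℓ} (linear-independent {f} {f′} lin′ f′f {ℓ} ind) (Hmap-Typed {f} {ℓ} hf t)
      member⇐ : ∀ {ℓ} → Member (P∞ a b) ℓ → Member P (back ℓ)
      member⇐ {ℓ} (o , gen , oP) = move {f′} {ℓ} hf′ o , generator⇐ {ℓ} gen (typed o) , through⇐ {ℓ} oP
      member⇒ : ∀ {ℓ} → Member P ℓ → Member (P∞ a b) (forth ℓ)
      member⇒ {ℓ} (o , gen , oP) = move {f} {ℓ} hf o , generator⇒ {ℓ} gen (typed o) , through⇒ {ℓ} oP
      meeting⇐ : ∀ {ℓ} → GensThroughPMeetingX (P∞ a b) ℓ → GensThroughPMeetingX P (back ℓ)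
      meeting⇐ {ℓ} (gen , oP , c) = generator⇐ {ℓ} gen (meets⇒typed {ℓ} gen c) , through⇐ {ℓ} oP , typed⇒meets {back ℓ} (Hmap-Typed {f′} {ℓ} hf′ (meets⇒typed {ℓ} gen c))
      meeting⇒ : ∀ {ℓ} → GensThroughPMeetingX P ℓ → GensThroughPMeetingX (P∞ a b) (forth ℓ)
      meeting⇒ {ℓ} (gen , oP , c) = generator⇒ {ℓ} gen (meets⇒typed {ℓ} gen c) , through⇒ {ℓ} oP , typed⇒meets {forth ℓ} (Hmap-Typed {f} {ℓ} hf (meets⇒typed {ℓ} gen c))

  -- Moving a point of Case (III) to normal form

  all3 : {R : Fin 3 → Set} → R zero → R (suc zero) → R (suc (suc zero)) → ∀ i → R i
  all3 a b c zero = a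
  all3 a b c (suc zero) = b
  all3 a b c (suc (suc zero)) = c

  -- P already lies on the tangent at infinity, and only X2 has to be scaled to 1. If X2 were 0,
  -- isotropy would give X1 = 0, and the projection would be the tangency point, which lies in
  -- PG(2,q).
  normalise-infinite : ∀ {P} → NonZero P → U3 P → ¬ InPG2q (proj P) → X0 P ≡ 𝟘 → Normalisation P
  normalise-infinite {P} nz u3 n x0 = record
    { f = λ v → v ; f′ = λ v → v ; hf = I , one , apply-I ; hf′ = I , one , apply-I ; f′f = λ _ _ → refl ; ff′ = λ _ _ → refl
    ; a = X1 P ⊗ u ; b = X3 P ⊗ u ; a-norm = norm-from-form form x2≢
    ; b∉Fq = λ i → n (u , inv-nonzero x2≢ , all3 (subst InFq (sym (trans (cong (u ⊗_) x0) (zeroʳ u))) Fq-𝟘) (subst InFq (sym (inverseˡ (X2 P) x2≢)) Fq-𝟙) (subst InFq (*-comm (X3 P) u) i))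
    ; image = X2 P , x2≢ , all4 (trans x0 (sym (zeroʳ _))) (rescale (X1 P)) (sym (*-identityʳ _)) (rescale (X3 P)) }
    where
    u = inv (X2 P)
    x̄0 : conj (X0 P) ≡ 𝟘
    x̄0 = trans (cong conj x0) conj-𝟘
    form : X1 P ⊗ conj (X1 P) ⊕ 𝟚 ⊗ (X2 P ⊗ conj (X2 P)) ≡ 𝟘
    form = linear (X0 P ∷ X1 P ∷ X2 P ∷ X3 P ∷ conj (X0 P) ∷ conj (X1 P) ∷ conj (X2 P) ∷ conj (X3 P) ∷ []) (λ a b c d a' b' c' d' → b :* b' :+ # 2 :* (c :* c') := # 0 ⊣ # 1 ∙ b :* b' :+ # 2 :* c :* c' :- a :* d' :- d :* a' := # 0
        ⊞ d' ∙ a := # 0 ⊞ d ∙ a' := # 0 ⊞ []) (U3⇒H P u3 , x0 , x̄0 , tt) refl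
    x2≢ : X2 P ≢ 𝟘
    x2≢ z = n (inv (X3 P) , inv-nonzero x3≢ , all3 (zero-coordinate x0) (zero-coordinate z) (subst InFq (sym (inverseˡ (X3 P) x3≢)) Fq-𝟙))
      where
      zero-coordinate : ∀ {t} → t ≡ 𝟘 → InFq (inv (X3 P) ⊗ t)
      zero-coordinate eq = subst InFq (sym (trans (cong (inv (X3 P) ⊗_) eq) (zeroʳ _))) Fq-𝟘
      x1 : X1 P ≡ 𝟘
      x1 = anisotropic (linear (X1 P ∷ X2 P ∷ conj (X1 P) ∷ conj (X2 P) ∷ []) (λ b c b' c' → b :* b' := # 0 ⊣ # 1 ∙ b :* b' :+ # 2 :* (c :* c') := # 0
          ⊞ :- (# 2 :* c') ∙ c := # 0 ⊞ []) (form , z , tt) refl)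
      x3≢ : X3 P ≢ 𝟘
      x3≢ z′ = nz (all4 x0 x1 z z′)
    rescale : ∀ t → t ≡ X2 P ⊗ (t ⊗ u)
    rescale t = linear (t ∷ X2 P ∷ u ∷ []) (λ t x u → t := x :* (t :* u) ⊣ :- t ∙ x :* u := # 1 ⊞ []) (inverseʳ (X2 P) x2≢ , tt) refl

  -- y ↦ -1/(Y - y) moves the tangency point to infinity.
  normalise-affine : ∀ {P y} → U3 P → ¬ InPG2q (proj P) → InFq y → y ⊗ y ⊗ X0 P ⊕ ⊖ (𝟚 ⊗ y ⊗ X2 P) ⊕ X3 P ≡ 𝟘 → Normalisation P
  normalise-affine {P} {y} u3 n iy tangent = record
    { f = act 𝟘 (⊖ 𝟙) 𝟙 (⊖ y) 𝟙 ; f′ = act (⊖ y) 𝟙 (⊖ 𝟙) 𝟘 𝟙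
    ; hf = Hmap-SL Fq-𝟘 Fq-⊖𝟙 Fq-𝟙 (Fq-⊖ iy) (solve 1 (λ y → # 0 :* :- y :- :- # 1 :* # 1 := # 1) refl y) pow-h-𝟙
    ; hf′ = Hmap-SL (Fq-⊖ iy) Fq-𝟙 Fq-⊖𝟙 Fq-𝟘 (solve 1 (λ y → :- y :* # 0 :- # 1 :* :- # 1 := # 1) refl y) pow-h-𝟙
    ; f′f = λ v i → trans (act-∘ (⊖ y) 𝟙 (⊖ 𝟙) 𝟘 𝟙 𝟘 (⊖ 𝟙) 𝟙 (⊖ y) 𝟙 v i) (trans (act-≡ (solve 1 (λ y → :- y :* # 0 :+ # 1 :* # 1 := # 1) refl y) (solve 1 (λ y → :- y :* :- # 1 :+ # 1 :* :- y := # 0) refl y) (solve 1 (λ y → :- # 1 :* # 0 :+ # 0 :* # 1 := # 0) refl y) (solve 1 (λ y → :- # 1 :* :- # 1 :+ # 0 :* :- y := # 1) refl y) (*-identityˡ 𝟙) v i) (act-identity v i))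
    ; ff′ = λ v i → trans (act-∘ 𝟘 (⊖ 𝟙) 𝟙 (⊖ y) 𝟙 (⊖ y) 𝟙 (⊖ 𝟙) 𝟘 𝟙 v i) (trans (act-≡ (solve 1 (λ y → # 0 :* :- y :+ :- # 1 :* :- # 1 := # 1) refl y) (solve 1 (λ y → # 0 :* # 1 :+ :- # 1 :* # 0 := # 0) refl y) (solve 1 (λ y → # 1 :* :- y :+ :- y :* :- # 1 := # 0) refl y) (solve 1 (λ y → # 1 :* # 1 :+ :- y :* # 0 := # 1) refl y) (*-identityˡ 𝟙) v i) (act-identity v i))
    ; a = X1 P ⊗ u ; b = X0 P ⊗ u ; a-norm = norm-from-form form p≢ ; b∉Fq = b∉Fq
    ; image = p₂ , p≢ , all4
        (linear (y ∷ X0 P ∷ X2 P ∷ X3 P ∷ []) (λ y A C D → :- y :* :- y :* A :+ # 2 :* # 1 :* :- y :* C :+ # 1 :* # 1 :* D := (y :* A :- C) :* # 0 ⊣ # 1 ∙ y :* y :* A :- # 2 :* y :* C :+ D := # 0 ⊞ []) (tangent , tt) refl)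
        (linear (y ∷ X0 P ∷ X1 P ∷ X2 P ∷ u ∷ []) (λ y A B C u → # 1 :* B := (y :* A :- C) :* (B :* u) ⊣ :- B ∙ (y :* A :- C) :* u := # 1 ⊞ []) (pu , tt) refl)
        (solve 4 (λ y A C D → :- # 1 :* :- y :* A :+ (# 0 :* :- y :+ :- # 1 :* # 1) :* C :+ # 0 :* # 1 :* D := (y :* A :- C) :* # 1) refl y (X0 P) (X2 P) (X3 P))
        (linear (y ∷ X0 P ∷ X2 P ∷ X3 P ∷ u ∷ []) (λ y A C D u → :- # 1 :* :- # 1 :* A :+ # 2 :* # 0 :* :- # 1 :* C :+ # 0 :* # 0 :* D := (y :* A :- C) :* (A :* u) ⊣ :- A ∙ (y :* A :- C) :* u := # 1 ⊞ []) (pu , tt) refl) }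
    where
    p₂ u : A
    p₂ = y ⊗ X0 P ⊕ ⊖ X2 P
    u = inv p₂
    x3≡ : X3 P ≡ 𝟚 ⊗ y ⊗ X2 P ⊕ ⊖ (y ⊗ y ⊗ X0 P)
    x3≡ = linear (y ∷ X0 P ∷ X2 P ∷ X3 P ∷ []) (λ y A C D → D := # 2 :* y :* C :- y :* y :* A ⊣ # 1 ∙ y :* y :* A :- # 2 :* y :* C :+ D := # 0 ⊞ []) (tangent , tt) refl
    conj-Fq⊗ : ∀ {r} → InFq r → ∀ t → conj (r ⊗ t) ≡ r ⊗ conj t
    conj-Fq⊗ {r} ir t = trans (conj-⊗ r t) (cong (_⊗ conj t) ir)
    x̄3≡ : conj (X3 P) ≡ 𝟚 ⊗ y ⊗ conj (X2 P) ⊕ ⊖ (y ⊗ y ⊗ conj (X0 P))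
    x̄3≡ = trans (cong conj x3≡) (trans (conj-⊝ _ _) (cong₂ (λ s t → s ⊕ ⊖ t) (conj-Fq⊗ (Fq-⊗ Fq-𝟚 iy) (X2 P)) (conj-Fq⊗ (Fq-⊗ iy iy) (X0 P))))
    form : X1 P ⊗ conj (X1 P) ⊕ 𝟚 ⊗ (p₂ ⊗ conj p₂) ≡ 𝟘
    form = linear (y ∷ X0 P ∷ X1 P ∷ X2 P ∷ X3 P ∷ conj (X0 P) ∷ conj (X1 P) ∷ conj (X2 P) ∷ conj (X3 P) ∷ conj p₂ ∷ conj (y ⊗ X0 P) ∷ []) (λ y A B C D A' B' C' D' k l → B :* B' :+ # 2 :* ((y :* A :- C) :* k) := # 0 ⊣ # 1 ∙ B :* B' :+ # 2 :* C :* C' :- A :* D' :- D :* A' := # 0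
        ⊞ A' ∙ D := # 2 :* y :* C :- y :* y :* A ⊞ A ∙ D' := # 2 :* y :* C' :- y :* y :* A' ⊞ # 2 :* y :* A :- (# 2 :* C) ∙ k := l :- C'
        ⊞ # 2 :* y :* A :- (# 2 :* C) ∙ l := y :* A' ⊞ []) (U3⇒H P u3 , x3≡ , x̄3≡ , conj-⊝ (y ⊗ X0 P) (X2 P) , conj-Fq⊗ iy (X0 P) , tt) refl
    -- p₂ = 0 on the tangent makes the projection a multiple of the tangency point (1,y,y²),
    -- possibly zero, and `InPG2q` holds in either case.
    p≢ : p₂ ≢ 𝟘
    p≢ z = choose (X0 P ≟ 𝟘)
      where
      x2≡ : X2 P ≡ y ⊗ X0 P
      x2≡ = linear (y ∷ X0 P ∷ X2 P ∷ []) (λ y A C → C := y :* A ⊣ :- # 1 ∙ y :* A :- C := # 0 ⊞ []) (z , tt) refl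
      choose : Dec (X0 P ≡ 𝟘) → ⊥
      choose (yes x0) = n (𝟙 , 𝟘≢𝟙 ∘ sym , all3 (zero-coordinate x0) (zero-coordinate (trans x2≡ (trans (cong (y ⊗_) x0) (zeroʳ y))))
          (zero-coordinate (linear (y ∷ X0 P ∷ X2 P ∷ X3 P ∷ []) (λ y A C D → D := # 0 ⊣ # 1 ∙ D := # 2 :* y :* C :- y :* y :* A
              ⊞ # 2 :* y ∙ C := y :* A ⊞ y :* y ∙ A := # 0 ⊞ []) (x3≡ , x2≡ , x0 , tt) refl)))
        where
        zero-coordinate : ∀ {t} → t ≡ 𝟘 → InFq (𝟙 ⊗ t)
        zero-coordinate eq = subst InFq (sym (trans (*-identityˡ _) eq)) Fq-𝟘
      choose (no x0≢) = n (inv (X0 P) , inv-nonzero x0≢ , all3 (subst InFq (sym (inverseˡ (X0 P) x0≢)) Fq-𝟙)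
        (subst InFq (sym (linear (y ∷ X0 P ∷ X2 P ∷ inv (X0 P) ∷ []) (λ y A C i → i :* C := y ⊣ i ∙ C := y :* A ⊞ y ∙ A :* i := # 1 ⊞ []) (x2≡ , inverseʳ (X0 P) x0≢ , tt) refl)) iy)
        (subst InFq (sym (linear (y ∷ X0 P ∷ X2 P ∷ X3 P ∷ inv (X0 P) ∷ []) (λ y A C D i → i :* D := y :* y ⊣ i ∙ D := # 2 :* y :* C :- y :* y :* A
            ⊞ # 2 :* y :* i ∙ C := y :* A ⊞ y :* y ∙ A :* i := # 1 ⊞ []) (x3≡ , x2≡ , inverseʳ (X0 P) x0≢ , tt) refl)) (Fq-⊗ iy iy)))
    pu : p₂ ⊗ u ≡ 𝟙
    pu = inverseʳ p₂ p≢
    -- After division by p₂, X0 is b, X2 is y b - 1, and X3 follows from the tangent equation; all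
    -- would lie in F_q together with b.
    b∉Fq : ¬ InFq (X0 P ⊗ u)
    b∉Fq ib = n (u , inv-nonzero p≢ , all3 (subst InFq (*-comm (X0 P) u) ib)
      (subst InFq (linear (y ∷ X0 P ∷ X2 P ∷ u ∷ []) (λ y A C u → y :* (A :* u) :- # 1 := u :* C ⊣ # 1 ∙ (y :* A :- C) :* u := # 1 ⊞ []) (pu , tt) refl) (Fq-⊕ (Fq-⊗ iy ib) (Fq-⊖ Fq-𝟙)))
      (subst InFq (linear (y ∷ X0 P ∷ X2 P ∷ X3 P ∷ u ∷ []) (λ y A C D u → # 2 :* y :* (y :* (A :* u) :- # 1) :- y :* y :* (A :* u) := u :* D ⊣ # 2 :* y ∙ (y :* A :- C) :* u := # 1
          ⊞ :- u ∙ D := # 2 :* y :* C :- y :* y :* A ⊞ []) (pu , x3≡ , tt) refl)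
        (Fq-⊕ (Fq-⊗ (Fq-⊗ Fq-𝟚 iy) (Fq-⊕ (Fq-⊗ iy ib) (Fq-⊖ Fq-𝟙))) (Fq-⊖ (Fq-⊗ (Fq-⊗ iy iy) ib)))))

  normalisation : ∀ {P} → CaseIII P → Normalisation P
  -- The first existential of `Ωπ` ranges over the whole disjunction; the second alternative carries
  -- its own scalar inside.
  normalisation {P} (nz , u3 , n , R , (_ , inj₂ (c , c≢ , r0 , r1 , r2)) , tangent) = normalise-infinite nz u3 n (integral {c}
    (linear (c ∷ X0 P ∷ X2 P ∷ X3 P ∷ R zero ∷ R (suc zero) ∷ R (suc (suc zero)) ∷ []) (λ c A C D r s t → c :* A := # 0 ⊣ # 1 ∙ t :* A :- # 2 :* s :* C :+ r :* D := # 0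
        ⊞ :- D ∙ r := # 0 ⊞ # 2 :* C ∙ s := # 0 ⊞ :- A ∙ t := c ⊞ []) (tangent , r0 , r1 , r2 , tt) refl) c≢)
  normalisation {P} (nz , u3 , n , R , (c , inj₁ (c≢ , y , iy , r0 , r1 , r2)) , tangent) = normalise-affine {P} {y} u3 n iy (integral {c}
    (linear (c ∷ y ∷ X0 P ∷ X2 P ∷ X3 P ∷ R zero ∷ R (suc zero) ∷ R (suc (suc zero)) ∷ []) (λ c y A C D r s t → c :* (y :* y :* A :- # 2 :* y :* C :+ D) := # 0 ⊣ # 1 ∙ t :* A :- # 2 :* s :* C :+ r :* D := # 0
        ⊞ :- D ∙ r := c :* # 1 ⊞ # 2 :* C ∙ s := c :* y ⊞ :- A ∙ t := c :* (y :* y) ⊞ []) (tangent , r0 , r1 , r2 , tt) refl) c≢)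

  -- A point of Case (III), realisation of the signs, and the equivalence

  -- This square root of -2 lies in F_q, so its norm is its square; it is an admissible value of
  -- `a`.
  √-2 : A
  √-2 = ι ⊗ √2

  √-2-norm : √-2 ⊗ conj √-2 ≡ ⊖ 𝟚
  √-2-norm = linear (ι ∷ √2 ∷ conj (ι ⊗ √2) ∷ []) (λ i s c → i :* s :* c := :- # 2 ⊣ i :* s ∙ c := i :* s ⊞ :- (i :* i) ∙ # 2 := s :* s
      ⊞ # 2 ∙ i :* i := :- # 1 ⊞ []) (Fq-⊗ Fq-ι Fq-√2 , √2² , ι² , tt) refl

  δ∉Fq : ¬ InFq δ
  δ∉Fq i = ⊗-nonzero 𝟚≢𝟘 δ≢𝟘 (linear (δ ∷ conj δ ∷ []) (λ d c → # 2 :* d := # 0 ⊣ # 1 ∙ c := :- d ⊞ :- # 1 ∙ c := d ⊞ []) (conj-δ , i , tt) refl)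

  -- Case (III) is not empty, so statement (a) has content and yields the numerical criterion.
  δ-caseIII : CaseIII (P∞ √-2 δ)
  δ-caseIII = (λ z → 𝟘≢𝟙 (sym (z (suc (suc zero))))) , H⇒U3 (P∞ √-2 δ) (H-P∞ {√-2} {δ} √-2-norm)
    , (λ (c , c≢ , i) → δ∉Fq (⊗-cancelˡ c≢ (linear (c ∷ conj c ∷ δ ∷ conj δ ∷ conj (c ⊗ δ) ∷ conj (c ⊗ 𝟙) ∷ conj 𝟙 ∷ []) (λ c c' d d' k o l → c :* d' := c :* d ⊣ # 1 ∙ k := c :* d
        ⊞ :- # 1 ∙ k := c' :* d' ⊞ :- d' ∙ o := c :* # 1 ⊞ d' ∙ o := c' :* l ⊞ c' :* d' ∙ l := # 1 ⊞ []) (i (suc (suc zero)) , conj-⊗ c δ , i (suc zero) , conj-⊗ c 𝟙 , conj-𝟙 , tt) refl)))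
    , (λ { zero → 𝟘 ; (suc zero) → 𝟘 ; (suc (suc zero)) → 𝟙 }) , (𝟙 , inj₂ (𝟙 , 𝟘≢𝟙 ∘ sym , refl , refl , refl)) , solve 1 (λ d → # 1 :* # 0 :- # 2 :* # 0 :* # 1 :+ # 0 :* d := # 0) refl δ

  -- Replacing `a` by -a negates a^h because h is odd, so both square roots of -2 occur among the
  -- lines through `Q∞`.
  sign-realised : ∀ {τ} → τ ⊗ τ ≡ ⊖ 𝟚 → Σ Line λ ℓ → 𝒢₂ ℓ × D2 ℓ τ
  sign-realised {τ} eq = [ (λ e → realise (norm-⊖ √-2-norm) (trans e (cong (λ z → pow z h) (solve 1 (λ s → s := :- (:- s)) refl √-2))))
      , (λ e → realise √-2-norm (trans e (sym (pow-h-⊖ √-2)))) ]′ (square-roots (trans eq (sym (trans (pow-h² √-2) √-2-norm))))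
    where
    realise : ∀ {a} → a ⊗ conj a ≡ ⊖ 𝟚 → τ ≡ pow (⊖ a) h → Σ Line λ ℓ → 𝒢₂ ℓ × D2 ℓ τ
    realise {a} n e = line (P∞ a 𝟘) Q∞ , (line∞-generator {a} {𝟘} n , Q∞ , inj₂ ∼-refl , OnLine-w _) , subst (D2 (line (P∞ a 𝟘) Q∞)) (sym e) (D2-line∞ {a} {𝟘} n)

  𝒢₁-line : Σ Line λ ℓ → Σ A λ σ → 𝒢₁ ℓ × D1 ℓ σ
  𝒢₁-line = Lx x , sgn δ (yof x) , (Lx-generator {x} c , Q x (yof x) , (Curve⇒XPlus c , affine-∉Ω {Q x (yof x)} {x} {yof x} (x≢𝟘 x c) ∼-refl) , OnLine-w (Lx x)) , D1-pencil x c
    where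
    open Through {√-2} {δ} √-2-norm δ∉Fq
    x = proj₁ X-inhabited
    c = proj₂ X-inhabited

  balanced⇒StatementA : ∀ {ℓ₁ ℓ₂ σ₁ σ₂} → 𝒢₁ ℓ₁ → 𝒢₂ ℓ₂ → D1 ℓ₁ σ₁ → D2 ℓ₂ σ₂ → Balanced σ₁ σ₂ → StatementA
  balanced⇒StatementA {ℓ₁} {ℓ₂} g₁ g₂ d₁ d₂ bal = ℓ₁ , ℓ₂ , g₁ , g₂ , λ P c → at (normalisation c)
    where
    at : ∀ {P} → Normalisation P → ConditionB (𝓜 ℓ₁ ℓ₂) P
    at N = conditionB-transport N d₁ d₂ (⇒conditionB {N.a} {N.b} N.a-norm N.b∉Fq d₁ d₂ bal)
      where module N = Normalisation N

  StatementA⇒ : StatementA → C₋ ≡ suc C₊ ⊎ C₊ ≡ suc C₋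
  StatementA⇒ (ℓ₁ , ℓ₂ , g₁ , g₂ , cond) = let (σ₁ , d₁) = D1-exists {ℓ₁} g₁ ; (σ₂ , d₂) = D2-exists {ℓ₂} g₂ in
    conditionB⇒ {√-2} {δ} √-2-norm δ∉Fq d₁ d₂ (cond (P∞ √-2 δ) δ-caseIII)

  -- The criterion depends only on the relative sign of the two orbits: the first line may be
  -- arbitrary, and the second is taken with equal or opposite sign.
  choose-signs : ∀ {ℓ₁ σ₁} → 𝒢₁ ℓ₁ → D1 ℓ₁ σ₁ → C₋ ≡ suc C₊ ⊎ C₊ ≡ suc C₋ → StatementA
  choose-signs {ℓ₁} {σ₁} g₁ d₁ (inj₁ eq) = let (ℓ₂ , g₂ , d₂) = sign-realised (D1-square d₁) in balanced⇒StatementA g₁ g₂ d₁ d₂ (inj₁ (refl , eq))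
  choose-signs {ℓ₁} {σ₁} g₁ d₁ (inj₂ eq) = let (ℓ₂ , g₂ , d₂) = sign-realised negative in balanced⇒StatementA g₁ g₂ d₁ d₂ (inj₂ (solve 1 (λ s → s := :- (:- s)) refl σ₁ , eq))
    where
    negative : ⊖ σ₁ ⊗ ⊖ σ₁ ≡ ⊖ 𝟚
    negative = linear (σ₁ ∷ []) (λ s → :- s :* :- s := :- # 2 ⊣ # 1 ∙ s :* s := :- # 2 ⊞ []) (D1-square d₁ , tt) refl

  ⇒StatementA : C₋ ≡ suc C₊ ⊎ C₊ ≡ suc C₋ → StatementA
  ⇒StatementA = let (ℓ₁ , σ₁ , g₁ , d₁) = 𝒢₁-line in choose-signs g₁ d₁

  elliptic-card : CardUpTo _≡_ EllAff (length ellipticPoints)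
  elliptic-card = ellipticPoints , refl
    , All.tabulate (λ {z} m → let (mz , eq) = ∈-filter⁻ Elliptic? {xs = cartesianProduct Fq Fq} m ; (mx , my) = ∈-cartesianProduct⁻ Fq Fq mz in Fq∋ mx , Fq∋ my , eq)
    , filter-unique Elliptic? (cartesianProduct-unique Fq-unique Fq-unique)
    , λ (x , y) (ix , iy , eq) → ∈-filter⁺ Elliptic? (∈-cartesianProduct⁺ (∈Fq ix) (∈Fq iy)) eq

  private
    arith₋ : ∀ n r u v → n ℕ.+ (u ℕ.+ u) ≡ r ℕ.+ (v ℕ.+ v) → v ≡ suc u → n ≡ r ℕ.+ 2
    arith₋ n r u _ eq refl = ℕ.+-cancelʳ-≡ (u ℕ.+ u) n (r ℕ.+ 2) (trans eq (expand r u))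
      where
      expand : ∀ r u → r ℕ.+ (suc u ℕ.+ suc u) ≡ r ℕ.+ 2 ℕ.+ (u ℕ.+ u)
      expand = solve-∀ℕ

    double-injective : ∀ u v → u ℕ.+ u ≡ v ℕ.+ v → u ≡ v
    double-injective zero zero eq = refl
    double-injective (suc u) (suc v) eq = cong suc (double-injective u v (ℕ.suc-injective (ℕ.suc-injective (trans (cong suc (sym (ℕ.+-suc u u))) (trans eq (cong suc (ℕ.+-suc v v)))))))

    arith₋⁻ : ∀ n r u v → n ℕ.+ (u ℕ.+ u) ≡ r ℕ.+ (v ℕ.+ v) → n ≡ r ℕ.+ 2 → v ≡ suc u
    arith₋⁻ _ r u v eq refl = double-injective v (suc u) (ℕ.+-cancelˡ-≡ r (v ℕ.+ v) (suc u ℕ.+ suc u) (trans (sym eq) (expand r u)))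
      where
      expand : ∀ r u → r ℕ.+ 2 ℕ.+ (u ℕ.+ u) ≡ r ℕ.+ (suc u ℕ.+ suc u)
      expand = solve-∀ℕ

    q∸1+1 : q ≡ suc (q ℕ.∸ 1)
    q∸1+1 = trans q≡1+2j (cong (λ z → suc (z ℕ.∸ 1)) (sym q≡1+2j))

    q+3 : ∀ n → n ≡ q ℕ.+ 2 → n ℕ.+ 1 ≡ q ℕ.+ 3
    q+3 _ refl = ℕ.+-assoc q 2 1

    q+3⁻ : ∀ n → n ℕ.+ 1 ≡ q ℕ.+ 3 → n ≡ q ℕ.+ 2
    q+3⁻ n eq = ℕ.+-cancelʳ-≡ 1 n (q ℕ.+ 2) (trans eq (sym (ℕ.+-assoc q 2 1)))

    q-1 : ∀ n → q ≡ n ℕ.+ 2 → n ℕ.+ 1 ≡ q ℕ.∸ 1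
    q-1 n eq = ℕ.suc-injective (trans (sym (ℕ.+-suc n 1)) (trans (sym eq) q∸1+1))

    q-1⁻ : ∀ n → n ℕ.+ 1 ≡ q ℕ.∸ 1 → q ≡ n ℕ.+ 2
    q-1⁻ n eq = trans q∸1+1 (trans (cong suc (sym eq)) (sym (ℕ.+-suc n 1)))

  -- By `elliptic-count` there are q + 2 affine points in the first case and q - 2 in the second;
  -- the point at infinity adds one.
  ⇒StatementB : C₋ ≡ suc C₊ ⊎ C₊ ≡ suc C₋ → StatementB
  ⇒StatementB (inj₁ eq) = length ellipticPoints , elliptic-card , inj₂ (q+3 _ (arith₋ _ _ _ _ elliptic-count eq))
  ⇒StatementB (inj₂ eq) = length ellipticPoints , elliptic-card , inj₁ (q-1 _ (arith₋ _ _ _ _ (sym elliptic-count) eq))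

  StatementB⇒ : StatementB → C₋ ≡ suc C₊ ⊎ C₊ ≡ suc C₋
  StatementB⇒ (n , card , eq) = decide (CardUpTo-unique (λ a b → trans a (sym b)) card elliptic-card) eq
    where
    decide : ∀ {n} → n ≡ length ellipticPoints → (n ℕ.+ 1 ≡ q ℕ.∸ 1) ⊎ (n ℕ.+ 1 ≡ q ℕ.+ 3) → C₋ ≡ suc C₊ ⊎ C₊ ≡ suc C₋
    decide refl (inj₁ eq) = inj₂ (arith₋⁻ _ _ _ _ (sym elliptic-count) (q-1⁻ _ eq))
    decide refl (inj₂ eq) = inj₁ (arith₋⁻ _ _ _ _ elliptic-count (q+3⁻ _ eq))

  equivalence : StatementA ⇔ StatementB
  equivalence = mk⇔ (⇒StatementB ∘ StatementA⇒) (⇒StatementA ∘ StatementB⇒)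

theorem7p1 : (p e q : ℕ) → Prime p → q ≡ p ^ suc e → q % 4 ≡ 1
    → (F : FiniteField) → length (FiniteField.elements F) ≡ q * q
    → Geometry.SquareInFq F p q (Geometry.𝟚 F p q)
    → Geometry.StatementA F p q ⇔ Geometry.StatementB F p q
theorem7p1 p e q p-prime q≡ q%4 F order two-square = Setting.equivalence F p q record
  { exponent = e ; p-prime = p-prime ; q≡ = q≡ ; q%4 = q%4 ; order = order ; two-square = two-square }
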